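{- Let $H$ be a fixed graph, and let $\tau(H)$ denote the maximum number of edges in a connected component of $H$. In the $H$-minor game: (i) if $\tau(H)=1$, then $\frac{n^2}{2e(H)-2}$ is a sharp threshold both for the {\tt CleverMaker}–{\tt CleverBreaker} game and for the {\tt RandomMaker}–{\tt CleverBreaker} game; (ii) if $\tau(H)=2$, then $2n$ is a sharp threshold both for the {\tt CleverMaker}–{\tt CleverBreaker} game and for the {\tt RandomMaker}–{\tt CleverBreaker} game; (iii) if $H$ is a forest and $\tau(H)\geq 3$, then $n$ is a sharp threshold for the {\tt CleverMaker}–{\tt CleverBreaker} game, and $n$ is a threshold for the {\tt RandomMaker}–{\tt CleverBreaker} game; (iv) if $H$ is not a forest, then $\frac n2$ is a sharp threshold both for the {\tt CleverMaker}–{\tt CleverBreaker} game and for the {\tt RandomMaker}–{\tt CleverBreaker} game.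
   Context: A $(1:b)$ biased Maker–Breaker game on $K_n$ is played on the board $E(K_n)$: in each round Maker claims one unclaimed edge and then Breaker claims $b$ unclaimed edges (fewer if fewer remain), until all edges are claimed. $M$ denotes the graph of Maker's edges at the end. For a monotone increasing graph property $\mathcal P$, Maker wins if $M\in\mathcal P$, otherwise Breaker wins. In the $H$-minor game, Maker wins iff $H$ is a minor of $M$; $G$ has $H$ as a minor if there are pairwise disjoint non-empty sets $S_v\subseteq V(G)$, $v\in V(H)$, with each $G[S_v]$ connected and, for every $vw\in E(H)$, an edge of $G$ between $S_v$ and $S_w$. {\tt RandomMaker} chooses each of its edges uniformly at random among the currently unclaimed edges; {\tt CleverBreaker} (resp. {\tt CleverMaker}) follows a strategy maximizing its probability of winning against the opponent's strategy (against a clever opponent this means: the player with a winning strategy wins). For $X,Y\in\{\text{Random},\text{Clever}\}$, a function $f(n)$ is a threshold for the XMaker–YBreaker game if the probability that XMaker wins tends to $1$ as $n\to\infty$ whenever $b=o(f(n))$ and tends to $0$ whenever $b=\omega(f(n))$; $f(n)$ is a sharp threshold if for every fixed $\epsilon>0$ this probability tends to $1$ for $b=(1-\epsilon)f(n)$ and to $0$ for $b=(1+\epsilon)f(n)$.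
   Formalization: In (i) the formal statement assumes e(H) ≥ 2: if H has exactly one edge, then 2e(H)−2 = 0 and the claimed threshold n²/(2e(H)−2) is undefined (Maker then wins for every bias once n is at least the number of vertices of H). -}

module Defs where

open import Data.Bool using (Bool; true; false; T; _∧_; _∨_)
open import Data.Nat as ℕ using (ℕ; zero; suc; _<ᵇ_; _⊔_; _≤_)
open import Data.Fin using (Fin; toℕ; _≟_)
open import Data.Integer using (ℤ; +_)
open import Data.Rational as Q using (ℚ; _/_; 0ℚ; 1ℚ; floor)
open import Data.List using (List; []; _∷_; _++_; [_]; length; map; concatMap; allFin; filterᵇ; foldr)
open import Data.Bool.ListAction using (any)
open import Data.List.Membership.Propositional using (_∈_)
open import Data.List.Relation.Unary.Unique.Propositional using (Unique)
open import Data.List.Relation.Unary.Linked using (Linked)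
open import Data.List.Relation.Binary.Pointwise using (Pointwise)
open import Data.List.Relation.Binary.Permutation.Propositional using (_↭_)
open import Data.Product using (Σ; ∃; ∃-syntax; _×_; _,_)
open import Data.Sum using (_⊎_)
open import Relation.Binary.PropositionalEquality using (_≡_)
open import Relation.Nullary using (¬_; does)

record Graph (k : ℕ) : Set where
  field
    adj  : Fin k → Fin k → Bool
    symm : ∀ i j → adj i j ≡ adj j i
    irr  : ∀ i → adj i i ≡ false
open Graph public

countTrue : List Bool → ℕ
countTrue []           = 0
countTrue (true ∷ bs)  = suc (countTrue bs)
countTrue (false ∷ bs) = countTrue bs

pairs : (k : ℕ) → List (Fin k × Fin k)
pairs k = concatMap (λ i → map (λ j → (i , j)) (allFin k)) (allFin k)

eH : ∀ {k} → Graph k → ℕ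
eH {k} H = countTrue (map (λ p → (toℕ (Data.Product.proj₁ p) <ᵇ toℕ (Data.Product.proj₂ p))
                                  ∧ adj H (Data.Product.proj₁ p) (Data.Product.proj₂ p)) (pairs k))

reachB : ∀ {k} → Graph k → ℕ → Fin k → Fin k → Bool
reachB H zero    v w = does (v ≟ w)
reachB {k} H (suc m) v w = reachB H m v w ∨ any (λ u → reachB H m v u ∧ adj H u w) (allFin k)

compEdges : ∀ {k} → Graph k → Fin k → ℕ
compEdges {k} H v = countTrue (map (λ p → (toℕ (Data.Product.proj₁ p) <ᵇ toℕ (Data.Product.proj₂ p))
                                  ∧ adj H (Data.Product.proj₁ p) (Data.Product.proj₂ p)
                                  ∧ reachB H k v (Data.Product.proj₁ p)) (pairs k))

τ : ∀ {k} → Graph k → ℕ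
τ {k} H = foldr (λ v acc → compEdges H v ⊔ acc) 0 (allFin k)

IsForest : ∀ {k} → Graph k → Set
IsForest {k} H = ¬ (Σ (Fin k) λ x → Σ (List (Fin k)) λ ys →
                    (2 ≤ length ys) × Unique (x ∷ ys) ×
                    Linked (λ a b → T (adj H a b)) (x ∷ ys ++ [ x ]))

data WalkIn {n : ℕ} (G : Fin n → Fin n → Set) (P : Fin n → Set) : Fin n → Fin n → Set where
  here : ∀ {x} → WalkIn G P x x
  step : ∀ {x z y} → G x z → P z → WalkIn G P z y → WalkIn G P x y

HasMinor : ∀ {h n} → Graph h → (Fin n → Fin n → Set) → Set
HasMinor {h} {n} H G =
  Σ (Fin h → Fin n → Bool) λ S →
    (∀ v w x → T (S v x) → T (S w x) → v ≡ w) ×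
    (∀ v → ∃[ x ] T (S v x)) ×
    (∀ v x y → T (S v x) → T (S v y) → WalkIn G (λ z → T (S v z)) x y) ×
    (∀ v w → T (adj H v w) → ∃[ x ] ∃[ y ] (T (S v x) × T (S w y) × G x y))

Edge : ℕ → Set
Edge n = Fin n × Fin n

board : (n : ℕ) → List (Edge n)
board n = filterᵇ (λ p → toℕ (Data.Product.proj₁ p) <ᵇ toℕ (Data.Product.proj₂ p)) (pairs n)

graphOf : ∀ {n} → List (Edge n) → Fin n → Fin n → Set
graphOf M x y = ((x , y) ∈ M) ⊎ ((y , x) ∈ M)

bcount : ℕ → ℕ → ℕ
bcount b r = b ℕ.⊓ r

-- CleverMaker–CleverBreaker: MakerWins H b U M holds iff, with unclaimed edges U,
-- Maker's edges M and Maker to move, Maker has a winning strategy.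
data MakerWins {h n : ℕ} (H : Graph h) (b : ℕ) : List (Edge n) → List (Edge n) → Set where
  done : ∀ {M} → HasMinor H (graphOf M) → MakerWins H b [] M
  move : ∀ {U M} (e : Edge n) (U′ : List (Edge n)) → U ↭ e ∷ U′ →
         (∀ (B U″ : List (Edge n)) → U′ ↭ B ++ U″ → length B ≡ bcount b (length U′) →
            MakerWins H b U″ (e ∷ M)) →
         MakerWins H b U M

picks : ∀ {A : Set} → List A → List (A × List A)
picks []       = []
picks (x ∷ xs) = (x , xs) ∷ map (λ p → (Data.Product.proj₁ p , x ∷ Data.Product.proj₂ p)) (picks xs)

sumℚ : List ℚ → ℚ
sumℚ = foldr Q._+_ 0ℚ

ℕtoℚ : ℕ → ℚ
ℕtoℚ m = + m / 1

-- RandomMaker–CleverBreaker: RVal H b U M q  (Maker to move) and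
-- BVal H b U M q (Breaker to move) say that q is the probability that RandomMaker
-- wins from this position when Breaker plays optimally (minimizes this probability).
mutual
  data RVal {h n : ℕ} (H : Graph h) (b : ℕ) : List (Edge n) → List (Edge n) → ℚ → Set where
    endWin  : ∀ {M} → HasMinor H (graphOf M) → RVal H b [] M 1ℚ
    endLose : ∀ {M} → ¬ HasMinor H (graphOf M) → RVal H b [] M 0ℚ
    avg     : ∀ {e U M q} (vs : List ℚ) →
              Pointwise (λ p v → BVal H b (Data.Product.proj₂ p) (Data.Product.proj₁ p ∷ M) v)
                        (picks (e ∷ U)) vs →
              q Q.* ℕtoℚ (length (e ∷ U)) ≡ sumℚ vs →
              RVal H b (e ∷ U) M q

  data BVal {h n : ℕ} (H : Graph h) (b : ℕ) : List (Edge n) → List (Edge n) → ℚ → Set where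
    minimum : ∀ {U M q} (B₀ U₀ : List (Edge n)) →
              U ↭ B₀ ++ U₀ → length B₀ ≡ bcount b (length U) → RVal H b U₀ M q →
              (∀ (B U″ : List (Edge n)) → U ↭ B ++ U″ → length B ≡ bcount b (length U) →
                 ∃[ q′ ] (RVal H b U″ M q′ × q Q.≤ q′)) →
              BVal H b U M q

LittleO : (ℕ → ℕ) → (ℕ → ℚ) → Set
LittleO b f = ∀ (ε : ℚ) → 0ℚ Q.< ε → ∃[ N ] ∀ n → N ≤ n → ℕtoℚ (b n) Q.≤ ε Q.* f n

LittleOmega : (ℕ → ℕ) → (ℕ → ℚ) → Set
LittleOmega b f = ∀ (K : ℚ) → ∃[ N ] ∀ n → N ≤ n → K Q.* f n Q.≤ ℕtoℚ (b n)

-- ⌊x⌋ as a natural number (used for x ≥ 0)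
floorℕ : ℚ → ℕ
floorℕ x = Data.Integer.∣ floor x ∣

-- Clever–Clever: Maker's winning probability is 1 or 0
CleverTo1 CleverTo0 : ∀ {h} → Graph h → (ℕ → ℕ) → Set
CleverTo1 H b = ∃[ N ] ∀ n → N ≤ n → MakerWins H (b n) (board n) []
CleverTo0 H b = ∃[ N ] ∀ n → N ≤ n → ¬ MakerWins H (b n) (board n) []

RandomTo1 RandomTo0 : ∀ {h} → Graph h → (ℕ → ℕ) → Set
RandomTo1 H b = ∀ (ε : ℚ) → 0ℚ Q.< ε → ∃[ N ] ∀ n → N ≤ n →
                  ∃[ q ] (RVal H (b n) (board n) [] q × (1ℚ Q.- ε) Q.≤ q)
RandomTo0 H b = ∀ (ε : ℚ) → 0ℚ Q.< ε → ∃[ N ] ∀ n → N ≤ n →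
                  ∃[ q ] (RVal H (b n) (board n) [] q × q Q.≤ ε)

Threshold : ∀ {h} → (Graph h → (ℕ → ℕ) → Set) → (Graph h → (ℕ → ℕ) → Set) →
            Graph h → (ℕ → ℚ) → Set
Threshold To1 To0 H f = (∀ b → LittleO b f → To1 H b) × (∀ b → LittleOmega b f → To0 H b)

SharpThreshold : ∀ {h} → (Graph h → (ℕ → ℕ) → Set) → (Graph h → (ℕ → ℕ) → Set) →
                 Graph h → (ℕ → ℚ) → Set
SharpThreshold To1 To0 H f =
  (∀ (ε : ℚ) → 0ℚ Q.< ε → ε Q.< 1ℚ → To1 H (λ n → floorℕ ((1ℚ Q.- ε) Q.* f n))) ×
  (∀ (ε : ℚ) → 0ℚ Q.< ε → To0 H (λ n → floorℕ ((1ℚ Q.+ ε) Q.* f n)))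

BothSharp : ∀ {h} → Graph h → (ℕ → ℚ) → Set
BothSharp H f = SharpThreshold CleverTo1 CleverTo0 H f × SharpThreshold RandomTo1 RandomTo0 H f

-- Breaker's side is a set of pairing-like strategies, each keeping an invariant of Maker's graph: it
-- has few edges, is a matching, has maximum degree 2, is a union of stars, or is a forest.  The last
-- one, for b + 1 ≥ n/2, partitions the board into b + 1 double stars, ranks the components once for
-- each of them and cuts the descending edges of the component of larger rank.
--
-- A random Maker is analysed by potential functions, supermartingales bounding the probability of
-- failure: for matchings the risk of a repeated vertex, for cherries the number of cherries still
-- missing weighted against elapsed time, for cyclic H the expected number of short cycles among the
-- first (1 + δ)n edges.  Deleting an edge on each short cycle leaves (1 + δ′)n edges of large girth;
-- merging vertices into connected blobs of bounded radius keeps the surplus of edges over blobs, as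
-- the girth excludes multiple adjacencies, so that the contracted graph has large average degree and
-- Mader's induction yields a complete minor.  If the random Maker wins with positive probability then
-- a clever Maker has a winning strategy.
--
-- For a forest H and b ≤ (1 - ε)n, a clever Maker always attaches a vertex with nearly all its edges
-- free, which raises the number of free edges at the active vertices by about εn per round; hence
-- vertices can be grown into blobs carrying many vertices of linear free degree, and repeating this
-- gives a tree of blobs of large depth and arity, in which H is a minor.
module Submission where

open import Defs
open import Data.Bool using (Bool; true; false; T; _∧_; _∨_; not; if_then_else_)
open import Data.Nat using (ℕ; zero; suc; _+_; _*_; _∸_; _^_; _≤_; _<_; z≤n; s≤s; _<ᵇ_; _⊓_; _⊔_; _≤?_; _<?_; ⌊_/2⌋; ⌈_/2⌉)
open import Data.Nat.Properties
open import Data.Nat.Coprimality using (Coprime)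
open import Data.Fin using (Fin; toℕ; combine; quotient; remainder; inject≤)
import Data.Fin.Properties as FinP
open import Data.Integer using (ℤ; -[1+_])
import Data.Nat as Nat
import Data.Integer as Z
import Data.Integer.Properties as ZP
open import Data.Rational using (ℚ; 0ℚ; 1ℚ; _/_; mkℚ)
import Data.Rational as Q
import Data.Rational.Properties as QP
import Data.Rational.Unnormalised as QU
import Data.Rational.Unnormalised.Properties as QUP
open import Data.List using (List; []; _∷_; _++_; [_]; length; map; concatMap; concat; allFin; filter; foldr; upTo; take; drop; lookup)
open import Data.List.Properties using (length-++; length-tabulate; length-map; ++-assoc; filter-accept; filter-reject)
open import Data.List.Base using (cartesianProduct)
open import Data.List.Membership.Propositional using (_∈_; _∉_; find; lose)
open import Data.List.Membership.Propositional.Properties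
open import Data.List.Relation.Unary.Any using (Any; here; there; any?)
import Data.List.Relation.Unary.Any.Properties as AnyP
open import Data.List.Relation.Unary.All using (All; []; _∷_)
import Data.List.Relation.Unary.All as All
import Data.List.Relation.Unary.All.Properties as AllP
open import Data.List.Relation.Unary.AllPairs using (AllPairs; []; _∷_)
open import Data.List.Relation.Unary.Unique.Propositional using (Unique)
import Data.List.Relation.Unary.Unique.Propositional.Properties as UniqueP
open import Data.List.Relation.Unary.Linked using (Linked; []; [-]; _∷_)
open import Data.List.Relation.Binary.Pointwise using (Pointwise; []; _∷_)
open import Data.List.Relation.Binary.Permutation.Propositional using (_↭_; ↭-refl; ↭-sym; ↭-trans; ↭-reflexive; prep; swap)
import Data.List.Relation.Binary.Permutation.Propositional as Perm
import Data.List.Relation.Binary.Permutation.Propositional.Properties as PermP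
open import Data.Product using (Σ; ∃; ∃-syntax; ∃₂; _×_; _,_; proj₁; proj₂)
open import Data.Product.Properties using (≡-dec)
open import Data.Sum using (_⊎_; inj₁; inj₂)
open import Data.Empty using (⊥; ⊥-elim)
open import Data.Unit using (tt)
open import Data.Maybe using (Maybe; just; nothing)
open import Function using (_∘_; id; _$_; case_of_)
open import Relation.Nullary using (¬_; Dec; yes; no; does; _×-dec_; _⊎-dec_; _→-dec_; ¬?)
open import Relation.Nullary.Decidable using (map′; decidable-stable; T?)
open import Relation.Unary using (Decidable)
open import Relation.Binary.PropositionalEquality using (_≡_; _≢_; refl; sym; trans; cong; cong₂; subst; subst₂; module ≡-Reasoning)
open import Data.Nat.Tactic.RingSolver using (solve-∀)
open import Data.Rational.Solver using (module +-*-Solver)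
open import Relation.Binary.Definitions using (tri<; tri≈; tri>)

-- All arithmetic is in natural numbers: ε enters only through its denominator d + 1, and a bound 1
-- - φ / Z ≤ q on a probability is kept as Z ≤ Z q + φ. Breaker's strategies work from the threshold
-- itself on, so the slack ε is spent on Maker's side.
--
-- Contracting a sparse graph has two conflicting aims. Blobs must become large, so that a fixed
-- surplus of edges outnumbers them by the factor 2^h; their diameter must stay bounded, because the
-- girth is only a constant. Greedy absorption would let diameters grow, so small blobs are merged
-- with each other, and those that stay small then join blobs that were large at that moment.
--
-- The clever Maker cannot protect any single vertex, since Breaker may soon take all its free
-- edges. Only sums of free degrees over a set are under control, so every statement about vertices
-- of linear free degree is an average and costs a constant factor. This is affordable because the
-- whole construction takes a number of rounds depending on H and ε alone, during which Breaker can
-- spoil only boundedly many vertices.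

-- Indicators, sums and counts over lists

T→ : ∀ {P : Set} (d : Dec P) → T (does d) → P
T→ (yes p) _ = p

T← : ∀ {P : Set} (d : Dec P) → P → T (does d)
T← (yes _) _ = tt
T← (no ¬p) p = ⊥-elim (¬p p)

ind : ∀ {P : Set} → Dec P → ℕ
ind d = if does d then 1 else 0

ind-yes : ∀ {P : Set} (d : Dec P) → P → ind d ≡ 1
ind-yes (yes _) _ = refl
ind-yes (no ¬p) p = ⊥-elim (¬p p)

ind-no : ∀ {P : Set} (d : Dec P) → ¬ P → ind d ≡ 0
ind-no (yes p) ¬p = ⊥-elim (¬p p)
ind-no (no _) _ = refl

ind≤1 : ∀ {P : Set} (d : Dec P) → ind d ≤ 1
ind≤1 (yes _) = ≤-refl
ind≤1 (no _) = z≤n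

ind-mono : ∀ {P Q : Set} (d : Dec P) (d′ : Dec Q) → (P → Q) → ind d ≤ ind d′
ind-mono (yes p) d′ f = ≤-reflexive (sym (ind-yes d′ (f p)))
ind-mono (no _) _ _ = z≤n

ind-⊎ : ∀ {P Q R : Set} (d : Dec P) (d′ : Dec Q) (d″ : Dec R) → (P → Q ⊎ R) → ind d ≤ ind d′ + ind d″
ind-⊎ (no _) _ _ _ = z≤n
ind-⊎ (yes p) d′ d″ f with f p
... | inj₁ q = ≤-trans (≤-reflexive (sym (ind-yes d′ q))) (m≤m+n _ _)
... | inj₂ r = ≤-trans (≤-reflexive (sym (ind-yes d″ r))) (m≤n+m _ (ind d′))

sumf : ∀ {A : Set} → (A → ℕ) → List A → ℕ
sumf f []       = 0
sumf f (x ∷ xs) = f x + sumf f xs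

cnt : ∀ {A : Set} {P : A → Set} → Decidable P → List A → ℕ
cnt P? = sumf (λ x → ind (P? x))

module _ {A : Set} where

  sumf-mono : ∀ {f g : A → ℕ} xs → (∀ x → x ∈ xs → f x ≤ g x) → sumf f xs ≤ sumf g xs
  sumf-mono [] h = z≤n
  sumf-mono (x ∷ xs) h = +-mono-≤ (h x (here refl)) (sumf-mono xs (λ y m → h y (there m)))

  sumf-cong : ∀ {f g : A → ℕ} xs → (∀ x → x ∈ xs → f x ≡ g x) → sumf f xs ≡ sumf g xs
  sumf-cong xs h = ≤-antisym (sumf-mono xs (λ x m → ≤-reflexive (h x m))) (sumf-mono xs (λ x m → ≤-reflexive (sym (h x m))))

  sumf-+ : ∀ (f g : A → ℕ) xs → sumf (λ x → f x + g x) xs ≡ sumf f xs + sumf g xs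
  sumf-+ f g [] = refl
  sumf-+ f g (x ∷ xs) rewrite sumf-+ f g xs = lem (f x) (g x) (sumf f xs) (sumf g xs)
    where
    lem : ∀ a b c d → a + b + (c + d) ≡ a + c + (b + d)
    lem = solve-∀

  sumf-* : ∀ c (f : A → ℕ) xs → sumf (λ x → c * f x) xs ≡ c * sumf f xs
  sumf-* c f [] = sym (*-zeroʳ c)
  sumf-* c f (x ∷ xs) rewrite sumf-* c f xs = sym (*-distribˡ-+ c (f x) _)

  sumf-const : ∀ c (xs : List A) → sumf (λ _ → c) xs ≡ length xs * c
  sumf-const c [] = refl
  sumf-const c (x ∷ xs) = cong (c +_) (sumf-const c xs)

  sumf-bound : ∀ {f : A → ℕ} {c} xs → (∀ x → x ∈ xs → f x ≤ c) → sumf f xs ≤ length xs * c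
  sumf-bound xs h = ≤-trans (sumf-mono xs h) (≤-reflexive (sumf-const _ xs))

  sumf-++ : ∀ (f : A → ℕ) xs ys → sumf f (xs ++ ys) ≡ sumf f xs + sumf f ys
  sumf-++ f [] ys = refl
  sumf-++ f (x ∷ xs) ys rewrite sumf-++ f xs ys = sym (+-assoc (f x) _ _)

  sumf-↭ : ∀ (f : A → ℕ) {xs ys} → xs ↭ ys → sumf f xs ≡ sumf f ys
  sumf-↭ f Perm.refl = refl
  sumf-↭ f (prep x p) = cong (f x +_) (sumf-↭ f p)
  sumf-↭ f {_} {_ ∷ _ ∷ ys} (swap x y p) rewrite sumf-↭ f p = lem (f x) (f y) (sumf f ys)
    where
    lem : ∀ a b c → a + (b + c) ≡ b + (a + c)
    lem = solve-∀
  sumf-↭ f (Perm.trans p q) = trans (sumf-↭ f p) (sumf-↭ f q)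

module _ {A : Set} where

  sumf-swap : ∀ {B : Set} (f : A → B → ℕ) xs ys →
    sumf (λ x → sumf (f x) ys) xs ≡ sumf (λ y → sumf (λ x → f x y) xs) ys
  sumf-swap f [] ys = sym (trans (sumf-const 0 ys) (*-zeroʳ (length ys)))
  sumf-swap f (x ∷ xs) ys rewrite sumf-swap f xs ys = sym (sumf-+ (f x) (λ y → sumf (λ z → f z y) xs) ys)

  sumf-∈ : ∀ (f : A → ℕ) {xs x} → x ∈ xs → f x ≤ sumf f xs
  sumf-∈ f (here refl) = m≤m+n _ _
  sumf-∈ f {y ∷ _} (there m) = ≤-trans (sumf-∈ f m) (m≤n+m _ (f y))

  length-filter-cnt : ∀ {P : A → Set} (P? : Decidable P) xs → length (filter P? xs) ≡ cnt P? xs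
  length-filter-cnt P? [] = refl
  length-filter-cnt P? (x ∷ xs) with P? x
  ... | yes _ = cong suc (length-filter-cnt P? xs)
  ... | no _  = length-filter-cnt P? xs

  cnt≤length : ∀ {P : A → Set} (P? : Decidable P) xs → cnt P? xs ≤ length xs
  cnt≤length P? xs = ≤-trans (sumf-bound xs (λ x _ → ind≤1 (P? x))) (≤-reflexive (*-identityʳ _))

  cnt-mono : ∀ {P R : A → Set} (P? : Decidable P) (R? : Decidable R) xs →
    (∀ x → x ∈ xs → P x → R x) → cnt P? xs ≤ cnt R? xs
  cnt-mono P? R? xs h = sumf-mono xs (λ x m → ind-mono (P? x) (R? x) (h x m))

  cnt-⊎ : ∀ {P R S : A → Set} (P? : Decidable P) (R? : Decidable R) (S? : Decidable S) xs →
    (∀ x → x ∈ xs → P x → R x ⊎ S x) → cnt P? xs ≤ cnt R? xs + cnt S? xs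
  cnt-⊎ P? R? S? xs h = ≤-trans (sumf-mono xs (λ x m → ind-⊎ (P? x) (R? x) (S? x) (h x m)))
    (≤-reflexive (sumf-+ (λ x → ind (R? x)) (λ x → ind (S? x)) xs))

  cnt-0 : ∀ {P : A → Set} (P? : Decidable P) xs → cnt P? xs ≡ 0 → ∀ x → x ∈ xs → ¬ P x
  cnt-0 P? xs eq x m p = 1+n≰n (≤-trans (≤-reflexive (sym (ind-yes (P? x) p))) (≤-trans (sumf-∈ (λ y → ind (P? y)) m) (≤-reflexive eq)))

  cnt-none : ∀ {P : A → Set} (P? : Decidable P) xs → (∀ x → x ∈ xs → ¬ P x) → cnt P? xs ≡ 0
  cnt-none P? xs h = trans (sumf-cong xs (λ x m → ind-no (P? x) (h x m))) (trans (sumf-const 0 xs) (*-zeroʳ (length xs)))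

  cnt-pos : ∀ {P : A → Set} (P? : Decidable P) xs → 1 ≤ cnt P? xs → ∃[ x ] (x ∈ xs × P x)
  cnt-pos P? (x ∷ xs) h with P? x
  ... | yes p = x , here refl , p
  ... | no _ with cnt-pos P? xs h
  ... | y , m , p = y , there m , p

  ∈-split : ∀ {x : A} {xs} → x ∈ xs → ∃[ ys ] xs ↭ x ∷ ys
  ∈-split {x} m with ∈-∃++ m
  ... | as , bs , refl = as ++ bs , PermP.shift x as bs

  Unique-∷ : ∀ {x : A} {xs} → x ∉ xs → Unique xs → Unique (x ∷ xs)
  Unique-∷ n u = AllP.¬Any⇒All¬ _ n ∷ u

  Unique-head : ∀ {x : A} {xs} → Unique (x ∷ xs) → x ∉ xs
  Unique-head (a ∷ _) m = All.lookup a m refl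

  Unique-tail : ∀ {x : A} {xs} → Unique (x ∷ xs) → Unique xs
  Unique-tail (_ ∷ u) = u

  Unique-↭ : ∀ {xs ys : List A} → xs ↭ ys → Unique xs → Unique ys
  Unique-↭ Perm.refl u = u
  Unique-↭ (prep x p) u = Unique-∷ (λ m → Unique-head u (PermP.∈-resp-↭ (↭-sym p) m)) (Unique-↭ p (Unique-tail u))
  Unique-↭ (swap x y p) u = Unique-∷ (λ { (here refl) → Unique-head u (here refl) ; (there m) → Unique-head (Unique-tail u) (PermP.∈-resp-↭ (↭-sym p) m) })
    (Unique-∷ (λ m → Unique-head u (there (PermP.∈-resp-↭ (↭-sym p) m))) (Unique-↭ p (Unique-tail (Unique-tail u))))
  Unique-↭ (Perm.trans p q) u = Unique-↭ q (Unique-↭ p u)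

  Unique-++ˡ : ∀ (xs : List A) {ys} → Unique (xs ++ ys) → Unique xs
  Unique-++ˡ [] u = []
  Unique-++ˡ (x ∷ xs) (a ∷ u) = AllP.++⁻ˡ xs a ∷ Unique-++ˡ xs u

  Unique-++ʳ : ∀ (xs : List A) {ys} → Unique (xs ++ ys) → Unique ys
  Unique-++ʳ [] u = u
  Unique-++ʳ (x ∷ xs) (a ∷ u) = Unique-++ʳ xs u

  Unique-++-disj : ∀ (xs : List A) {ys} → Unique (xs ++ ys) → ∀ {x} → x ∈ xs → x ∉ ys
  Unique-++-disj (x ∷ xs) (a ∷ u) (here refl) m = All.lookup (AllP.++⁻ʳ xs a) m refl
  Unique-++-disj (x ∷ xs) (a ∷ u) (there k) m = Unique-++-disj xs u k m

  unique-⊆-length : ∀ {xs ys : List A} → Unique xs → (∀ {x} → x ∈ xs → x ∈ ys) → length xs ≤ length ys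
  unique-⊆-length {[]} u s = z≤n
  unique-⊆-length {x ∷ xs} {ys} u s with ∈-split (s (here refl))
  ... | zs , p = ≤-trans (s≤s (unique-⊆-length (Unique-tail u) sub)) (≤-reflexive (sym (PermP.↭-length p)))
    where
    sub : ∀ {y} → y ∈ xs → y ∈ zs
    sub m with PermP.∈-resp-↭ p (s (there m))
    ... | here refl = ⊥-elim (Unique-head u m)
    ... | there k = k

module _ {A : Set} where

  -- The standard way to bound a number of edges: map them injectively, mostly to their other ends.
  -- Injectivity is asked on the counted entries only.
  cnt-inj : ∀ {B : Set} {P : A → Set} (P? : Decidable P) (f : A → B) xs (ys : List B) → Unique xs →
    (∀ x → x ∈ xs → P x → f x ∈ ys) →
    (∀ x y → x ∈ xs → y ∈ xs → P x → P y → f x ≡ f y → x ≡ y) → cnt P? xs ≤ length ys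
  cnt-inj {B} {P} P? f xs ys u into inj =
    subst (_≤ length ys) (trans (length-map f (filter P? xs)) (length-filter-cnt P? xs))
      (unique-⊆-length (uniq (filter P? xs) (UniqueP.filter⁺ P? u) (λ m → ∈-filter⁻ P? m)) sub)
    where
    uniq : ∀ zs → Unique zs → (∀ {z} → z ∈ zs → z ∈ xs × P z) → Unique (map f zs)
    uniq [] _ _ = []
    uniq (z ∷ zs) u h = Unique-∷ notin (uniq zs (Unique-tail u) (h ∘ there))
      where
      notin : f z ∉ map f zs
      notin m with ∈-map⁻ f m
      ... | w , w∈ , eq with inj z w (proj₁ (h (here refl))) (proj₁ (h (there w∈))) (proj₂ (h (here refl))) (proj₂ (h (there w∈))) eq
      ... | refl = Unique-head u w∈
    sub : ∀ {y} → y ∈ map f (filter P? xs) → y ∈ ys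
    sub m with ∈-map⁻ f m
    ... | w , w∈ , refl = let (a , p) = ∈-filter⁻ P? w∈ in into w a p

  cnt≤1 : ∀ {P : A → Set} (P? : Decidable P) xs → Unique xs →
    (∀ x y → x ∈ xs → y ∈ xs → P x → P y → x ≡ y) → cnt P? xs ≤ 1
  cnt≤1 P? xs u h = cnt-inj P? (λ _ → tt) xs (tt ∷ []) u (λ _ _ _ → here refl) (λ x y a b p q _ → h x y a b p q)

  filter-split : ∀ {P : A → Set} (P? : Decidable P) xs → xs ↭ filter P? xs ++ filter (¬? ∘ P?) xs
  filter-split P? [] = ↭-refl
  filter-split P? (x ∷ xs) with P? x
  ... | yes _ = prep x (filter-split P? xs)
  ... | no _  = ↭-trans (prep x (filter-split P? xs)) (↭-sym (PermP.shift x (filter P? xs) _))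

  -- The elementary action of Breaker: the local strategies are sequences of such cuts, one for each
  -- kind of free edge that has become dangerous.
  trim : ∀ {P : A → Set} (P? : Decidable P) r c xs → cnt P? xs ≤ r + c →
    ∃₂ λ B ys → xs ↭ B ++ ys × length B ≤ r × cnt P? ys ≤ c
  trim P? zero c xs h = [] , xs , ↭-refl , z≤n , h
  trim P? (suc r) c xs h with cnt P? xs ≤? c
  ... | yes p = [] , xs , ↭-refl , z≤n , p
  ... | no ¬p with cnt-pos P? xs (≤-trans (s≤s z≤n) (≰⇒> ¬p))
  ... | x , m , px with ∈-split m
  ... | zs , perm with trim P? r c zs (≤-pred (≤-trans (≤-reflexive (trans (cong (_+ cnt P? zs) (sym (ind-yes (P? x) px))) (sym (sumf-↭ (λ y → ind (P? y)) perm)))) h))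
  ... | B , ys , p₂ , l , c′ = x ∷ B , ys , ↭-trans perm (prep x p₂) , s≤s l , c′

  take-more : ∀ r (xs : List A) → ∃₂ λ B ys → xs ≡ B ++ ys × length B ≡ r ⊓ length xs
  take-more zero xs = [] , xs , refl , refl
  take-more (suc r) [] = [] , [] , refl , refl
  take-more (suc r) (x ∷ xs) with take-more r xs
  ... | B , ys , refl , l = x ∷ B , ys , refl , cong suc l

  -- The rules demand exactly min(b, remaining) claims, while a strategy prescribes only some of
  -- them. Padding from the front of `ys` leaves free a suffix of what the strategy left free, so
  -- upper bounds on numbers of free edges survive.
  fill : ∀ b {xs B ys : List A} → xs ↭ B ++ ys → length B ≤ b →
    ∃₂ λ B′ B″ → ∃[ zs ] (xs ↭ B′ ++ zs × length B′ ≡ bcount b (length xs) × ys ≡ B″ ++ zs)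
  fill b {xs} {B} {ys} p l with take-more (b ∸ length B) ys
  ... | C , zs , refl , lc = B ++ C , C , zs , ↭-trans p (↭-reflexive (sym (++-assoc B C zs))) , eq , refl
    where
    open ≡-Reasoning
    eq : length (B ++ C) ≡ b ⊓ length xs
    eq = begin
      length (B ++ C) ≡⟨ length-++ B ⟩
      length B + length C ≡⟨ cong (length B +_) lc ⟩
      length B + ((b ∸ length B) ⊓ length (C ++ zs)) ≡⟨ +-distribˡ-⊓ (length B) _ _ ⟩
      (length B + (b ∸ length B)) ⊓ (length B + length (C ++ zs)) ≡⟨ cong₂ _⊓_ (m+[n∸m]≡n l) (sym (length-++ B)) ⟩
      b ⊓ length (B ++ C ++ zs) ≡⟨ cong (b ⊓_) (sym (PermP.↭-length p)) ⟩
      b ⊓ length xs ∎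

  ∈-ins : ∀ {x y : A} {xs ys} → xs ↭ y ∷ ys → x ∈ ys → x ∈ xs
  ∈-ins p m = PermP.∈-resp-↭ (↭-sym p) (there m)

unique-fin-length : ∀ {n} {xs : List (Fin n)} → Unique xs → length xs ≤ n
unique-fin-length {n} {xs} u = subst (length xs ≤_) (length-tabulate {n = n} id) (unique-⊆-length u (λ _ → ∈-allFin _))

-- Natural numbers inside the rationals

toℚᵘ-/ : ∀ i d → Q.toℚᵘ (i / suc d) QU.≃ QU.mkℚᵘ i d
toℚᵘ-/ i d = QP.toℚᵘ-fromℚᵘ (QU.mkℚᵘ i d)

toℚᵘ-ℕ : ∀ m → Q.toℚᵘ (ℕtoℚ m) QU.≃ QU.mkℚᵘ (Z.+ m) 0
toℚᵘ-ℕ m = toℚᵘ-/ (Z.+ m) 0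

ℕtoℚ-+ : ∀ m k → ℕtoℚ (m + k) ≡ ℕtoℚ m Q.+ ℕtoℚ k
ℕtoℚ-+ m k = QP.toℚᵘ-injective (QUP.≃-trans (toℚᵘ-ℕ (m + k)) (QUP.≃-trans lem (QUP.≃-sym (QUP.≃-trans (QP.toℚᵘ-homo-+ (ℕtoℚ m) (ℕtoℚ k)) (QUP.+-cong (toℚᵘ-ℕ m) (toℚᵘ-ℕ k))))))
  where
  lem : QU.mkℚᵘ (Z.+ (m + k)) 0 QU.≃ QU.mkℚᵘ (Z.+ m) 0 QU.+ QU.mkℚᵘ (Z.+ k) 0
  lem = QU.*≡* (cong (Z._* (Z.+ 1)) (trans (ZP.pos-+ m k) (sym (cong₂ Z._+_ (ZP.*-identityʳ (Z.+ m)) (ZP.*-identityʳ (Z.+ k))))))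

ℕtoℚ-* : ∀ m k → ℕtoℚ (m * k) ≡ ℕtoℚ m Q.* ℕtoℚ k
ℕtoℚ-* m k = QP.toℚᵘ-injective (QUP.≃-trans (toℚᵘ-ℕ (m * k)) (QUP.≃-trans lem (QUP.≃-sym (QUP.≃-trans (QP.toℚᵘ-homo-* (ℕtoℚ m) (ℕtoℚ k)) (QUP.*-cong (toℚᵘ-ℕ m) (toℚᵘ-ℕ k))))))
  where
  lem : QU.mkℚᵘ (Z.+ (m * k)) 0 QU.≃ QU.mkℚᵘ (Z.+ m) 0 QU.* QU.mkℚᵘ (Z.+ k) 0
  lem = QU.*≡* (cong (Z._* (Z.+ 1)) (ZP.pos-* m k))

ℕtoℚ-mono : ∀ {m k} → m ≤ k → ℕtoℚ m Q.≤ ℕtoℚ k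
ℕtoℚ-mono {m} {k} le = QP.toℚᵘ-cancel-≤ (QUP.≤-trans (QUP.≤-reflexive (toℚᵘ-ℕ m)) (QUP.≤-trans (QU.*≤* (ZP.*-monoʳ-≤-nonNeg (Z.+ 1) (Z.+≤+ le))) (QUP.≤-reflexive (QUP.≃-sym (toℚᵘ-ℕ k)))))

ℕtoℚ-pos : ∀ m → Q.Positive (ℕtoℚ (suc m))
ℕtoℚ-pos m = QP.normalize-pos (suc m) 1

ℕtoℚ-nonNeg : ∀ m → Q.NonNegative (ℕtoℚ m)
ℕtoℚ-nonNeg m = QP.normalize-nonNeg m 1

cancel-suc : ∀ k {p q} → p Q.* ℕtoℚ (suc k) Q.≤ q Q.* ℕtoℚ (suc k) → p Q.≤ q
cancel-suc k = QP.*-cancelʳ-≤-pos (ℕtoℚ (suc k)) {{ℕtoℚ-pos k}}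

inv-suc : ℕ → ℚ
inv-suc k = Q.1/_ (ℕtoℚ (suc k)) {{QP.pos⇒nonZero (ℕtoℚ (suc k)) {{ℕtoℚ-pos k}}}}

inv-suc-* : ∀ k s → s Q.* inv-suc k Q.* ℕtoℚ (suc k) ≡ s
inv-suc-* k s = trans (QP.*-assoc s (inv-suc k) (ℕtoℚ (suc k)))
  (trans (cong (s Q.*_) (QP.*-inverseˡ (ℕtoℚ (suc k)) {{QP.pos⇒nonZero (ℕtoℚ (suc k)) {{ℕtoℚ-pos k}}}})) (QP.*-identityʳ s))

-- Enumerating the moves of both players

module _ {A : Set} where

  insertions : A → List A → List (List A)
  insertions x []       = (x ∷ []) ∷ []
  insertions x (y ∷ ys) = (x ∷ y ∷ ys) ∷ map (y ∷_) (insertions x ys)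

  perms : List A → List (List A)
  perms []       = [] ∷ []
  perms (x ∷ xs) = concatMap (insertions x) (perms xs)

  insertions-complete : ∀ x as bs → as ++ x ∷ bs ∈ insertions x (as ++ bs)
  insertions-complete x [] []       = here refl
  insertions-complete x [] (_ ∷ _)  = here refl
  insertions-complete x (a ∷ as) bs = there (∈-map⁺ (a ∷_) (insertions-complete x as bs))

  insertions-sound : ∀ {x ys zs} → zs ∈ insertions x ys → x ∷ ys ↭ zs
  insertions-sound {ys = []} (here refl) = ↭-refl
  insertions-sound {ys = y ∷ ys} (here refl) = ↭-refl
  insertions-sound {x} {ys = y ∷ ys} (there m) with ∈-map⁻ (y ∷_) m
  ... | ws , m′ , refl = ↭-trans (swap x y ↭-refl) (prep y (insertions-sound m′))

  perms-complete : ∀ xs {ys} → xs ↭ ys → ys ∈ perms xs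
  perms-complete [] p with PermP.↭-empty-inv (↭-sym p)
  ... | refl = here refl
  perms-complete (x ∷ xs) {ys} p with ∈-∃++ (PermP.∈-resp-↭ p (here refl))
  ... | as , bs , refl = ∈-concatMap⁺ (insertions x) (lose (perms-complete xs (PermP.drop-mid [] as p)) (insertions-complete x as bs))

  perms-sound : ∀ xs {ys} → ys ∈ perms xs → xs ↭ ys
  perms-sound [] (here refl) = ↭-refl
  perms-sound (x ∷ xs) m with find (∈-concatMap⁻ (insertions x) {xs = perms xs} m)
  ... | zs , zm , ym = ↭-trans (prep x (perms-sound xs zm)) (insertions-sound ym)

  picks-↭ : ∀ xs {p : A × List A} → p ∈ picks xs → xs ↭ proj₁ p ∷ proj₂ p
  picks-↭ (x ∷ xs) (here refl) = ↭-refl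
  picks-↭ (x ∷ xs) (there m) with ∈-map⁻ (λ p → proj₁ p , x ∷ proj₂ p) m
  ... | (y , ys) , m′ , refl = ↭-trans (prep x (picks-↭ xs m′)) (swap x y ↭-refl)

  picks-length : ∀ (xs : List A) → length (picks xs) ≡ length xs
  picks-length [] = refl
  picks-length (x ∷ xs) = cong suc (trans (length-map _ (picks xs)) (picks-length xs))

  picks-proj₁ : ∀ (xs : List A) → map proj₁ (picks xs) ≡ xs
  picks-proj₁ [] = refl
  picks-proj₁ (x ∷ xs) = cong (x ∷_) (trans (sym (map-∘ (picks xs))) (picks-proj₁ xs))
    where open import Data.List.Properties using (map-∘)

  sumf-map : ∀ {B : Set} (g : B → A) (f : A → ℕ) xs → sumf f (map g xs) ≡ sumf (f ∘ g) xs
  sumf-map g f [] = refl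
  sumf-map g f (x ∷ xs) = cong (f (g x) +_) (sumf-map g f xs)

  argmin : ∀ (R : A → ℚ → Set) x xs → (∀ y → y ∈ x ∷ xs → ∃[ q ] R y q) →
    ∃₂ λ y q → y ∈ x ∷ xs × R y q × (∀ z → z ∈ x ∷ xs → ∃[ q′ ] (R z q′ × q Q.≤ q′))
  argmin R x [] v with v x (here refl)
  ... | q , r = x , q , here refl , r , λ { z (here refl) → q , r , QP.≤-refl }
  argmin R x (x′ ∷ xs) v with v x (here refl) | argmin R x′ xs (λ y m → v y (there m))
  ... | q , r | y , q₁ , m , r₁ , h with QP.≤-total q q₁
  ... | inj₁ le = x , q , here refl , r , λ { z (here refl) → q , r , QP.≤-refl ; z (there k) → let (q′ , r′ , le′) = h z k in q′ , r′ , QP.≤-trans le le′ }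
  ... | inj₂ ge = y , q₁ , there m , r₁ , λ { z (here refl) → q , r , ge ; z (there k) → h z k }

-- Walks, and deciding whether a minor exists

-- In contrast to `WalkIn`, the vertices are recorded, so that lengths, repetitions and membership
-- can be spoken of.
data Walk {n} (G : Fin n → Fin n → Set) : Fin n → Fin n → List (Fin n) → Set where
  stop : ∀ {x} → Walk G x x (x ∷ [])
  go   : ∀ {x z y vs} → G x z → Walk G z y vs → Walk G x y (x ∷ vs)

module _ {n : ℕ} where

  walk-start : ∀ {G : Fin n → Fin n → Set} {x y vs} → Walk G x y vs → x ∈ vs
  walk-start stop = here refl
  walk-start (go _ _) = here refl

  walk-map : ∀ {G G′ : Fin n → Fin n → Set} {x y vs} →
    (∀ a b → a ∈ vs → b ∈ vs → G a b → G′ a b) → Walk G x y vs → Walk G′ x y vs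
  walk-map f stop = stop
  walk-map f (go g w) = go (f _ _ (here refl) (there (walk-start w)) g) (walk-map (λ a b ma mb → f a b (there ma) (there mb)) w)

  walk-join : ∀ {G : Fin n → Fin n → Set} {x y z w vs us} → Walk G x y vs → G y z → Walk G z w us → Walk G x w (vs ++ us)
  walk-join stop e w = go e w
  walk-join (go g v) e w = go g (walk-join v e w)

  walk-suffix : ∀ {G : Fin n → Fin n → Set} {x y z us} → Walk G z y us → x ∈ us →
    ∃[ vs ] (Walk G x y vs × length vs ≤ length us × (∀ {u} → u ∈ vs → u ∈ us) × (Unique us → Unique vs))
  walk-suffix w@stop (here refl) = _ , w , ≤-refl , id , id
  walk-suffix w@(go _ _) (here refl) = _ , w , ≤-refl , id , id
  walk-suffix (go g w) (there m) with walk-suffix w m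
  ... | vs , w′ , le , s , u = vs , w′ , m≤n⇒m≤1+n le , there ∘ s , u ∘ Unique-tail

  loop-erase : ∀ {G : Fin n → Fin n → Set} {x y us} → Walk G x y us →
    ∃[ vs ] (Walk G x y vs × length vs ≤ length us × (∀ {u} → u ∈ vs → u ∈ us) × Unique vs)
  loop-erase stop = _ , stop , ≤-refl , id , ([] ∷ [])
  loop-erase {x = x} (go g w) with loop-erase w
  ... | vs , w′ , le , s , u with any? (x FinP.≟_) vs
  ... | yes m = let (zs , w″ , le′ , s′ , u′) = walk-suffix w′ m in zs , w″ , ≤-trans le′ (m≤n⇒m≤1+n le) , there ∘ s ∘ s′ , u′ u
  ... | no ¬m = x ∷ vs , go g w′ , s≤s le , (λ { (here refl) → here refl ; (there m) → there (s m) }) , Unique-∷ ¬m u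

  fromWalkIn : ∀ {G : Fin n → Fin n → Set} {P : Fin n → Set} {x y} → WalkIn G P x y →
    ∃[ vs ] Walk (λ a b → G a b × P b) x y vs
  fromWalkIn here = _ , stop
  fromWalkIn (step g p w) = let (_ , w′) = fromWalkIn w in _ , go (g , p) w′

  toWalkIn : ∀ {G : Fin n → Fin n → Set} {P : Fin n → Set} {x y vs} → Walk (λ a b → G a b × P b) x y vs → WalkIn G P x y
  toWalkIn stop = here
  toWalkIn (go (g , p) w) = step g p (toWalkIn w)

  WalkIn-map : ∀ {G G′ : Fin n → Fin n → Set} {P P′ : Fin n → Set} {x y} → (∀ {a b} → G a b → G′ a b) → (∀ {a} → P a → P′ a) →
    WalkIn G P x y → WalkIn G′ P′ x y
  WalkIn-map f g here = here
  WalkIn-map f g (step e p w) = step (f e) (g p) (WalkIn-map f g w)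

  shortWalk? : ∀ {G : Fin n → Fin n → Set} → (∀ a b → Dec (G a b)) → ∀ k x y →
    Dec (∃[ vs ] (Walk G x y vs × length vs ≤ suc k))
  shortWalk? G? k x y with x FinP.≟ y
  ... | yes refl = yes (_ , stop , s≤s z≤n)
  shortWalk? G? zero x y | no ne = no λ { (_ , stop , _) → ne refl ; (_ , go _ stop , s≤s ()) ; (_ , go _ (go _ _) , s≤s ()) }
  shortWalk? G? (suc k) x y | no ne with FinP.any? (λ z → G? x z ×-dec shortWalk? G? k z y)
  ... | yes (z , g , vs , w , le) = yes (_ , go g w , s≤s le)
  ... | no h = no λ { (_ , stop , _) → ne refl ; (_ , go g w , s≤s le) → h (_ , g , _ , w , le) }

  -- After erasing loops a walk has at most n vertices, so the search among walks of bounded length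
  -- is exhaustive.
  walkIn? : ∀ {G : Fin n → Fin n → Set} {P : Fin n → Set} → (∀ a b → Dec (G a b)) → (∀ a → Dec (P a)) → ∀ x y → Dec (WalkIn G P x y)
  walkIn? G? P? x y = map′ (λ { (_ , w , _) → toWalkIn w }) f (shortWalk? (λ a b → G? a b ×-dec P? b) n x y)
    where
    f : WalkIn _ _ x y → _
    f w with loop-erase (proj₂ (fromWalkIn w))
    ... | vs , w′ , _ , _ , u = vs , w′ , m≤n⇒m≤1+n (unique-fin-length u)

-- A search through tables reaches each function only up to pointwise equality; hence R has to
-- respect it.
any-Bool-fun? : ∀ n (R : (Fin n → Bool) → Set) → (∀ f g → (∀ i → f i ≡ g i) → R f → R g) → (∀ f → Dec (R f)) → Dec (∃ R)
any-Bool-fun? zero R resp R? = map′ (λ r → empty , r) (λ { (f , r) → resp f empty (λ ()) r }) (R? empty)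
  where
  empty : Fin 0 → Bool
  empty ()
any-Bool-fun? (suc n) R resp R? = map′ to from (try false ⊎-dec try true)
  where
  cons : Bool → (Fin n → Bool) → Fin (suc n) → Bool
  cons b f Fin.zero = b
  cons b f (Fin.suc i) = f i
  try : ∀ b → Dec (∃ λ f → R (cons b f))
  try b = any-Bool-fun? n (λ f → R (cons b f)) (λ f g eq → resp _ _ (λ { Fin.zero → refl ; (Fin.suc i) → eq i })) (λ f → R? (cons b f))
  to : (∃ λ f → R (cons false f)) ⊎ (∃ λ f → R (cons true f)) → ∃ R
  to (inj₁ (f , r)) = _ , r
  to (inj₂ (f , r)) = _ , r
  from : ∃ R → (∃ λ f → R (cons false f)) ⊎ (∃ λ f → R (cons true f))
  from (f , r) with f Fin.zero in eq
  ... | false = inj₁ (f ∘ Fin.suc , resp _ _ (λ { Fin.zero → eq ; (Fin.suc i) → refl }) r)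
  ... | true  = inj₂ (f ∘ Fin.suc , resp _ _ (λ { Fin.zero → eq ; (Fin.suc i) → refl }) r)

_≟ᴱ_ : ∀ {n} (e f : Edge n) → Dec (e ≡ f)
_≟ᴱ_ = ≡-dec FinP._≟_ FinP._≟_

_∈ᴱ?_ : ∀ {n} (e : Edge n) M → Dec (e ∈ M)
e ∈ᴱ? M = any? (e ≟ᴱ_) M

graphOf? : ∀ {n} (M : List (Edge n)) x y → Dec (graphOf M x y)
graphOf? M x y = ((x , y) ∈ᴱ? M) ⊎-dec ((y , x) ∈ᴱ? M)

-- Terminal positions have a value only if this is decided. A family of branch sets is searched for
-- as a single Boolean function on h · n points.
HasMinor? : ∀ {h n} (H : Graph h) (M : List (Edge n)) → Dec (HasMinor H (graphOf M))
HasMinor? {h} {n} H M = map′ (λ { (f , r) → (λ v x → f (combine v x)) , r })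
    (λ { (S , r) → (λ i → S (quotient n i) (remainder {h} n i)) , resp′ S _ (λ v x → cong₂ S (sym (cong proj₁ (FinP.remQuot-combine v x))) (sym (cong proj₂ (FinP.remQuot-combine v x)))) r })
    (any-Bool-fun? (h * n) (λ f → R (λ v x → f (combine v x))) (λ f g eq → resp′ _ _ (λ v x → eq _)) (λ f → R? _))
  where

  R : (Fin h → Fin n → Bool) → Set
  R S = (∀ v w x → T (S v x) → T (S w x) → v ≡ w) ×
    (∀ v → ∃[ x ] T (S v x)) ×
    (∀ v x y → T (S v x) → T (S v y) → WalkIn (graphOf M) (λ z → T (S v z)) x y) ×
    (∀ v w → T (adj H v w) → ∃[ x ] ∃[ y ] (T (S v x) × T (S w y) × graphOf M x y))
  resp′ : ∀ S S′ → (∀ v x → S v x ≡ S′ v x) → R S → R S′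
  resp′ S S′ eq (a , b , c , d) =
    (λ v w x p q → a v w x (bk p) (bk q)) ,
    (λ v → let (x , p) = b v in x , fw p) ,
    (λ v x y p q → WalkIn-map id fw (c v x y (bk p) (bk q))) ,
    (λ v w p → let (x , y , p , q , g) = d v w p in x , y , fw p , fw q , g)
    where
    fw : ∀ {v x} → T (S v x) → T (S′ v x)
    fw {v} {x} = subst T (eq v x)
    bk : ∀ {v x} → T (S′ v x) → T (S v x)
    bk {v} {x} = subst T (sym (eq v x))
  R? : ∀ S → Dec (R S)
  R? S = FinP.all? (λ v → FinP.all? λ w → FinP.all? λ x → T? (S v x) →-dec (T? (S w x) →-dec (v FinP.≟ w))) ×-dec
    FinP.all? (λ v → FinP.any? λ x → T? (S v x)) ×-dec
    FinP.all? (λ v → FinP.all? λ x → FinP.all? λ y → T? (S v x) →-dec (T? (S v y) →-dec walkIn? (graphOf? M) (λ z → T? (S v z)) x y)) ×-dec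
    FinP.all? (λ v → FinP.all? λ w → T? (adj H v w) →-dec FinP.any? λ x → FinP.any? λ y → T? (S v x) ×-dec T? (S w y) ×-dec graphOf? M x y)

HasMinor-map : ∀ {h n} {H : Graph h} {G G′ : Fin n → Fin n → Set} → (∀ {a b} → G a b → G′ a b) → HasMinor H G → HasMinor H G′
HasMinor-map f (S , a , b , c , d) = S , a , b , (λ v x y p q → WalkIn-map f id (c v x y p q)) , (λ v w p → let (x , y , p , q , g) = d v w p in x , y , p , q , f g)

graphOf-∷ : ∀ {n} {M : List (Edge n)} {e x y} → graphOf M x y → graphOf (e ∷ M) x y
graphOf-∷ (inj₁ m) = inj₁ (there m)
graphOf-∷ (inj₂ m) = inj₂ (there m)

-- Values of positions, strategies and potentials

module Game {h n : ℕ} (H : Graph h) (b : ℕ) where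

  Edges : Set
  Edges = List (Edge n)

  Reply : Edges → Edges → Edges → Set
  Reply U B U″ = U ↭ B ++ U″ × length B ≡ bcount b (length U)

  Reply-length : ∀ {U B U″} → Reply U B U″ → length U″ ≤ length U
  Reply-length {U} {B} {U″} (p , _) = ≤-trans (m≤n+m (length U″) (length B)) (≤-reflexive (trans (sym (length-++ B)) (sym (PermP.↭-length p))))

  mutual
    -- The number `k` bounds the free edges and serves as the recursion measure, since the positions
    -- after a round are rearrangements and not subterms of `U`.
    rval-exists : ∀ k (U M : Edges) → length U ≤ k → ∃[ q ] RVal H b U M q
    rval-exists k [] M le with HasMinor? H M
    ... | yes m = 1ℚ , endWin m
    ... | no ¬m = 0ℚ , endLose ¬m
    rval-exists (suc k) (e ∷ U) M (s≤s le) with vals (picks (e ∷ U)) (picks-↭ (e ∷ U))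
      where
      vals : ∀ ps → (∀ {p} → p ∈ ps → e ∷ U ↭ proj₁ p ∷ proj₂ p) →
        ∃[ vs ] Pointwise (λ p v → BVal H b (proj₂ p) (proj₁ p ∷ M) v) ps vs
      vals [] f = [] , []
      vals (p ∷ ps) f =
        let (v , r) = bval-exists k (proj₂ p) (proj₁ p ∷ M) (≤-trans (≤-reflexive (suc-injective (sym (PermP.↭-length (f (here refl)))))) le)
            (vs , rs) = vals ps (f ∘ there)
        in v ∷ vs , r ∷ rs
    ... | vs , pw = sumℚ vs Q.* inv-suc (length U) , avg vs pw (inv-suc-* (length U) (sumℚ vs))

    bval-exists : ∀ k (U M : Edges) → length U ≤ k → ∃[ q ] BVal H b U M q
    bval-exists k U M le with perms U in eq | perms-complete U ↭-refl
    ... | W ∷ Ws | _ with argmin (λ V q → RVal H b (drop c V) M q) W Ws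
                          (λ V m → rval-exists k (drop c V) M (≤-trans (length-drop′ c V) (≤-trans (≤-reflexive (sym (PermP.↭-length (sound m)))) le)))
      where
      c = bcount b (length U)
      sound : ∀ {V} → V ∈ W ∷ Ws → U ↭ V
      sound m = perms-sound U (subst (_ ∈_) (sym eq) m)
      length-drop′ : ∀ {A : Set} c (V : List A) → length (drop c V) ≤ length V
      length-drop′ zero V = ≤-refl
      length-drop′ (suc c) [] = z≤n
      length-drop′ (suc c) (x ∷ V) = m≤n⇒m≤1+n (length-drop′ c V)
    ... | V , q , m , r , h = q , minimum (take c V) (drop c V) (↭-trans (sound m) (↭-reflexive (sym (take++drop≡id c V))))
          (trans (length-take c V) (m≤n⇒m⊓n≡m (≤-trans (m⊓n≤n b _) (≤-reflexive (PermP.↭-length (sound m))))))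
          r opt
      where
      open import Data.List.Properties using (take++drop≡id; length-take)
      c = bcount b (length U)
      sound : ∀ {V} → V ∈ W ∷ Ws → U ↭ V
      sound m = perms-sound U (subst (_ ∈_) (sym eq) m)
      drop-++ : ∀ (B W : Edges) → drop (length B) (B ++ W) ≡ W
      drop-++ [] W = refl
      drop-++ (x ∷ B) W = drop-++ B W
      opt : ∀ B U″ → U ↭ B ++ U″ → length B ≡ bcount b (length U) → ∃[ q′ ] (RVal H b U″ M q′ × q Q.≤ q′)
      opt B U″ p l = subst (λ X → ∃[ q′ ] (RVal H b X M q′ × q Q.≤ q′)) (trans (cong (λ c → drop c (B ++ U″)) (sym l)) (drop-++ B U″))
        (h (B ++ U″) (subst (_ ∈_) eq (perms-complete U p)))

  value : ∀ U M → ∃[ q ] RVal H b U M q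
  value U M = rval-exists (length U) U M ≤-refl

  BVal′ : (Edges → Edges → ℚ → Set) → Edges → Edges → ℚ → Set
  BVal′ C U M q = (∃₂ λ B U″ → Reply U B U″ × C U″ M q) × (∀ B U″ → Reply U B U″ → ∃[ q′ ] (C U″ M q′ × q Q.≤ q′))

  -- Induction over whole rounds. The nested recursion through averages and minima is carried out
  -- here once; all later statements about values are instances.
  rval-ind : (C : Edges → Edges → ℚ → Set) →
    (∀ M → HasMinor H (graphOf M) → C [] M 1ℚ) → (∀ M → ¬ HasMinor H (graphOf M) → C [] M 0ℚ) →
    (∀ e U M q vs → Pointwise (λ p v → BVal′ C (proj₂ p) (proj₁ p ∷ M) v) (picks (e ∷ U)) vs →
      q Q.* ℕtoℚ (length (e ∷ U)) ≡ sumℚ vs → C (e ∷ U) M q) →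
    ∀ {U M q} → RVal H b U M q → C U M q
  rval-ind C w l s = R
    where
    mutual
      R : ∀ {U M q} → RVal H b U M q → C U M q
      R (endWin m) = w _ m
      R (endLose m) = l _ m
      R (avg vs pw eq) = s _ _ _ _ vs (PW pw) eq
      PW : ∀ {M ps vs} → Pointwise (λ p v → BVal H b (proj₂ p) (proj₁ p ∷ M) v) ps vs → Pointwise (λ p v → BVal′ C (proj₂ p) (proj₁ p ∷ M) v) ps vs
      PW [] = []
      PW (x ∷ xs) = BV x ∷ PW xs
      BV : ∀ {U M q} → BVal H b U M q → BVal′ C U M q
      BV (minimum B U₀ p l r f) = (B , U₀ , (p , l) , R r) , λ B U″ (p , l) → let (q′ , r′ , le) = f B U″ p l in q′ , R r′ , le

  -- Further edges cannot destroy a minor. Hence a potential argument may stop at the first minor,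
  -- long before the board is exhausted.
  won : ∀ {U M q} → RVal H b U M q → HasMinor H (graphOf M) → 1ℚ Q.≤ q
  won = rval-ind (λ U M q → HasMinor H (graphOf M) → 1ℚ Q.≤ q) (λ _ _ _ → QP.≤-refl) (λ _ ¬m m → ⊥-elim (¬m m))
    λ e U M q vs pw eq m → cancel-suc (length U)
      (subst₂ Q._≤_ (trans (cong ℕtoℚ (picks-length (e ∷ U))) (sym (QP.*-identityˡ (ℕtoℚ (suc (length U)))))) (sym eq) (sums m _ vs pw))
    where
    sums : ∀ {M} → HasMinor H (graphOf M) → ∀ ps vs → Pointwise (λ p v → BVal′ (λ U M q → HasMinor H (graphOf M) → 1ℚ Q.≤ q) (proj₂ p) (proj₁ p ∷ M) v) ps vs → ℕtoℚ (length ps) Q.≤ sumℚ vs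
    sums m [] [] [] = QP.≤-refl
    sums m (p ∷ ps) (v ∷ vs) (((_ , _ , _ , f) , _) ∷ pw) = QP.≤-trans (QP.≤-reflexive (ℕtoℚ-+ 1 (length ps))) (QP.+-mono-≤ {1ℚ} {v} {ℕtoℚ (length ps)} {sumℚ vs} (f (HasMinor-map {H = H} (λ {x} {y} → graphOf-∷ {e = proj₁ p} {x} {y}) m)) (sums m ps vs pw))

  nonneg : ∀ {U M q} → RVal H b U M q → 0ℚ Q.≤ q
  nonneg = rval-ind (λ _ _ q → 0ℚ Q.≤ q) (λ _ _ → QP.nonNegative⁻¹ 1ℚ) (λ _ _ → QP.≤-refl)
    λ e U M q vs pw eq → cancel-suc (length U)
      (subst₂ Q._≤_ (sym (QP.*-zeroˡ (ℕtoℚ (suc (length U))))) (sym eq) (sums M pw))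
    where
    sums : ∀ (M : Edges) {ps vs} → Pointwise (λ p v → BVal′ (λ _ _ q → 0ℚ Q.≤ q) (proj₂ p) (proj₁ p ∷ M) v) ps vs → 0ℚ Q.≤ sumℚ vs
    sums M [] = QP.≤-refl
    sums M {vs = v ∷ vs} (((_ , _ , _ , f) , _) ∷ pw) = QP.+-mono-≤ {0ℚ} {v} {0ℚ} {sumℚ vs} f (sums M pw)

  0<+ : ∀ p q → 0ℚ Q.< p Q.+ q → 0ℚ Q.< p ⊎ 0ℚ Q.< q
  0<+ p q lt with 0ℚ QP.<? p | 0ℚ QP.<? q
  ... | yes a | _ = inj₁ a
  ... | _ | yes a = inj₂ a
  ... | no a | no c = ⊥-elim (QP.<-irrefl refl (QP.<-≤-trans lt (QP.+-mono-≤ {p} {0ℚ} {q} {0ℚ} (QP.≮⇒≥ a) (QP.≮⇒≥ c))))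

  -- A positive average has a positive term, and a positive minimum over replies makes every reply
  -- positive. Always playing an edge of positive value therefore ends in a won position.
  random⇒clever : ∀ {U M q} → RVal H b U M q → 0ℚ Q.< q → MakerWins H b U M
  random⇒clever = rval-ind (λ U M q → 0ℚ Q.< q → MakerWins H b U M) (λ _ m _ → done m) (λ _ _ lt → ⊥-elim (QP.<-irrefl refl lt))
    λ e U M q vs pw eq lt → best (picks-↭ (e ∷ U)) pw (subst₂ Q._<_ (QP.*-zeroˡ (ℕtoℚ (suc (length U)))) eq (QP.*-monoˡ-<-pos (ℕtoℚ (suc (length U))) {{ℕtoℚ-pos (length U)}} lt))
    where
    best : ∀ {U M ps vs} → (∀ {p} → p ∈ ps → U ↭ proj₁ p ∷ proj₂ p) →
      Pointwise (λ p v → BVal′ (λ U M q → 0ℚ Q.< q → MakerWins H b U M) (proj₂ p) (proj₁ p ∷ M) v) ps vs → 0ℚ Q.< sumℚ vs → MakerWins H b U M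
    best f [] lt = ⊥-elim (QP.<-irrefl refl lt)
    best f (_∷_ {y = v} {ys = vs} (_ , g) pw) lt with 0<+ v (sumℚ vs) lt
    ... | inj₂ lt′ = best (f ∘ there) pw lt′
    ... | inj₁ lt′ = move _ _ (f (here refl)) (λ B U″ p l → let (q′ , w , le) = g B U″ (p , l) in w (QP.<-≤-trans lt′ le))

  -- An invariant that one reply restores after every Maker edge beats both Makers at once: against
  -- the random one, each term of the average is at most 0.
  module BreakerStrategy (I : Edges → Edges → Set)
      (end : ∀ M → I [] M → ¬ HasMinor H (graphOf M))
      (reply : ∀ U M e U′ → I U M → U ↭ e ∷ U′ → ∃₂ λ B U″ → Reply U′ B U″ × I U″ (e ∷ M)) where

    clever-loses : ∀ {U M} → I U M → ¬ MakerWins H b U M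
    clever-loses i (done m) = end _ i m
    clever-loses i (move e U′ p f) with reply _ _ e U′ i p
    ... | B , U″ , (p′ , l) , i′ = clever-loses i′ (f B U″ p′ l)

    random-loses : ∀ {U M q} → RVal H b U M q → I U M → q Q.≤ 0ℚ
    random-loses = rval-ind (λ U M q → I U M → q Q.≤ 0ℚ) (λ _ m i → ⊥-elim (end _ i m)) (λ _ _ _ → QP.≤-refl)
      λ e U M q vs pw eq i → cancel-suc (length U)
        (subst₂ Q._≤_ (sym eq) (sym (QP.*-zeroˡ (ℕtoℚ (suc (length U))))) (sums i (picks-↭ (e ∷ U)) pw))
      where
      sums : ∀ {U M ps vs} → I U M → (∀ {p} → p ∈ ps → U ↭ proj₁ p ∷ proj₂ p) →
        Pointwise (λ p v → BVal′ (λ U M q → I U M → q Q.≤ 0ℚ) (proj₂ p) (proj₁ p ∷ M) v) ps vs → sumℚ vs Q.≤ 0ℚ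
      sums i f [] = QP.≤-refl
      sums i f (_∷_ {y = v} (_ , g) pw) with reply _ _ _ _ i (f (here refl))
      ... | B , U″ , r , i′ = let (q′ , w , le) = g B U″ r in QP.+-mono-≤ {v} {0ℚ} {_} {0ℚ} (QP.≤-trans le (w i′)) (sums i (f ∘ there) pw)

  -- A position of potential φ, in the sense of I U M φ, is lost by RandomMaker with probability at most φ / Zc.
  module Potential (Zc : ℕ) (I : Edges → Edges → ℕ → Set)
      (progress : ∀ U M φ → I U M φ → HasMinor H (graphOf M) ⊎ (Zc ≤ φ) ⊎
        (1 ≤ length U × ∃ λ (ψ : Edge n → ℕ) → sumf ψ U ≤ length U * φ ×
          (∀ e U′ B U″ → U ↭ e ∷ U′ → Reply U′ B U″ → I U″ (e ∷ M) (ψ e)))) where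

    -- This is 1 - φ / Zc ≤ q without the division. The record keeps `q` and `φ` visible in the
    -- type.
    record Bound (q : ℚ) (φ : ℕ) : Set where
      constructor bounded
      field get : ℕtoℚ Zc Q.≤ ℕtoℚ Zc Q.* q Q.+ ℕtoℚ φ

    trivial-bound : ∀ {q φ} → Zc ≤ φ → 0ℚ Q.≤ q → Bound q φ
    trivial-bound {q} {φ} le nn = bounded $ subst (Q._≤ ℕtoℚ Zc Q.* q Q.+ ℕtoℚ φ) (QP.+-identityˡ (ℕtoℚ Zc))
      (QP.+-mono-≤ {0ℚ} {ℕtoℚ Zc Q.* q} (subst (Q._≤ ℕtoℚ Zc Q.* q) (QP.*-zeroʳ (ℕtoℚ Zc)) (QP.*-monoˡ-≤-nonNeg (ℕtoℚ Zc) {{ℕtoℚ-nonNeg Zc}} nn)) (ℕtoℚ-mono le))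

    won-bound : ∀ {q φ} → 1ℚ Q.≤ q → Bound q φ
    won-bound {q} {φ} le = bounded $ subst (Q._≤ ℕtoℚ Zc Q.* q Q.+ ℕtoℚ φ) (trans (QP.+-identityʳ (ℕtoℚ Zc Q.* 1ℚ)) (QP.*-identityʳ (ℕtoℚ Zc)))
      (QP.+-mono-≤ {ℕtoℚ Zc Q.* 1ℚ} {ℕtoℚ Zc Q.* q} {0ℚ} (QP.*-monoˡ-≤-nonNeg (ℕtoℚ Zc) {{ℕtoℚ-nonNeg Zc}} le) (ℕtoℚ-mono {0} {φ} z≤n))

    -- The value itself is carried through the induction, because positions that are already won or
    -- already given up are settled by `won` and `nonneg`.
    CC : Edges → Edges → ℚ → Set
    CC U M q = RVal H b U M q × (∀ φ → I U M φ → Bound q φ)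

    bound : ∀ {U M q φ} → RVal H b U M q → I U M φ → Bound q φ
    bound {φ = φ} r = rval-ind CC w l s r .proj₂ φ
      where
      w : ∀ M → HasMinor H (graphOf M) → CC [] M 1ℚ
      w M m = endWin m , λ φ _ → won-bound {φ = φ} QP.≤-refl
      l : ∀ M → ¬ HasMinor H (graphOf M) → CC [] M 0ℚ
      l M ¬m = endLose ¬m , λ φ i → case progress [] M φ i of λ
        { (inj₁ m) → ⊥-elim (¬m m) ; (inj₂ (inj₁ le)) → trivial-bound {φ = φ} le QP.≤-refl ; (inj₂ (inj₂ (() , _))) }
      s : ∀ e U M q vs → Pointwise (λ p v → BVal′ CC (proj₂ p) (proj₁ p ∷ M) v) (picks (e ∷ U)) vs →
        q Q.* ℕtoℚ (length (e ∷ U)) ≡ sumℚ vs → CC (e ∷ U) M q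
      s e U M q vs pw eq = rv , bd
        where
        bv : ∀ {U M v} → BVal′ CC U M v → BVal H b U M v
        bv ((B , U₀ , (p , l) , r , _) , f) = minimum B U₀ p l r (λ B U″ p l → let (q′ , (r′ , _) , le) = f B U″ (p , l) in q′ , r′ , le)
        pwmap : ∀ {ps vs} → Pointwise (λ p v → BVal′ CC (proj₂ p) (proj₁ p ∷ M) v) ps vs → Pointwise (λ p v → BVal H b (proj₂ p) (proj₁ p ∷ M) v) ps vs
        pwmap [] = []
        pwmap (x ∷ xs) = bv x ∷ pwmap xs
        rv = avg vs (pwmap pw) eq
        averaged : ∀ φ (ψ : Edge n → ℕ) → sumf ψ (e ∷ U) ≤ length (e ∷ U) * φ →
          (∀ f U′ B U″ → e ∷ U ↭ f ∷ U′ → Reply U′ B U″ → I U″ (f ∷ M) (ψ f)) → Bound q φ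
        averaged φ ψ sumle h = bounded $ cancel-suc (length U) (QP.≤-trans (QP.≤-trans (QP.≤-reflexive e₁) (sums (picks (e ∷ U)) vs (picks-↭ (e ∷ U)) pw)) (QP.≤-trans (QP.+-mono-≤ {ℕtoℚ Zc Q.* sumℚ vs} (QP.≤-reflexive refl) e₂) (QP.≤-reflexive e₃)))
          where
          N = ℕtoℚ (length (e ∷ U))
          F = ℕtoℚ φ
          sums : ∀ ps vs → (∀ {p} → p ∈ ps → e ∷ U ↭ proj₁ p ∷ proj₂ p) → Pointwise (λ p v → BVal′ CC (proj₂ p) (proj₁ p ∷ M) v) ps vs →
            ℕtoℚ Zc Q.* ℕtoℚ (length ps) Q.≤ ℕtoℚ Zc Q.* sumℚ vs Q.+ ℕtoℚ (sumf (ψ ∘ proj₁) ps)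
          sums [] [] f [] = QP.≤-reflexive (sym (QP.+-identityʳ _))
          sums (p ∷ ps) (v ∷ vs) f (((B , U₀ , rp , _ , b₀) , _) ∷ pw) =
            subst₂ Q._≤_ (trans (cong (Q._+ (ℕtoℚ Zc Q.* ℕtoℚ (length ps))) (sym (QP.*-identityʳ (ℕtoℚ Zc)))) (trans (sym (QP.*-distribˡ-+ (ℕtoℚ Zc) 1ℚ (ℕtoℚ (length ps)))) (cong (ℕtoℚ Zc Q.*_) (sym (ℕtoℚ-+ 1 (length ps))))))
              (trans (lem (ℕtoℚ Zc) v (ℕtoℚ (ψ (proj₁ p))) (sumℚ vs) (ℕtoℚ (sumf (ψ ∘ proj₁) ps))) (cong (ℕtoℚ Zc Q.* (v Q.+ sumℚ vs) Q.+_) (sym (ℕtoℚ-+ (ψ (proj₁ p)) _))))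
              (QP.+-mono-≤ here′ (sums ps vs (f ∘ there) pw))
            where
            here′ : ℕtoℚ Zc Q.≤ ℕtoℚ Zc Q.* v Q.+ ℕtoℚ (ψ (proj₁ p))
            here′ = Bound.get (b₀ (ψ (proj₁ p)) (h (proj₁ p) (proj₂ p) B U₀ (f (here refl)) rp))
            lem : ∀ z v p s t → (z Q.* v Q.+ p) Q.+ (z Q.* s Q.+ t) ≡ z Q.* (v Q.+ s) Q.+ (p Q.+ t)
            lem = solve 5 (λ z v p s t → ((z :* v :+ p) :+ (z :* s :+ t)) := (z :* (v :+ s) :+ (p :+ t))) refl
              where open +-*-Solver
          e₁ : ℕtoℚ Zc Q.* N ≡ ℕtoℚ Zc Q.* ℕtoℚ (length (picks (e ∷ U)))
          e₁ = cong (λ k → ℕtoℚ Zc Q.* ℕtoℚ k) (sym (picks-length (e ∷ U)))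
          e₂ : ℕtoℚ (sumf (ψ ∘ proj₁) (picks (e ∷ U))) Q.≤ N Q.* F
          e₂ = QP.≤-trans (ℕtoℚ-mono (≤-trans (≤-reflexive (trans (sym (sumf-map proj₁ ψ (picks (e ∷ U)))) (cong (sumf ψ) (picks-proj₁ (e ∷ U))))) sumle)) (QP.≤-reflexive (ℕtoℚ-* (length (e ∷ U)) φ))
          e₃ : ℕtoℚ Zc Q.* sumℚ vs Q.+ N Q.* F ≡ (ℕtoℚ Zc Q.* q Q.+ F) Q.* N
          e₃ = trans (cong (λ s → ℕtoℚ Zc Q.* s Q.+ N Q.* F) (sym eq)) (lem (ℕtoℚ Zc) q N F)
            where
            lem : ∀ z q n f → z Q.* (q Q.* n) Q.+ n Q.* f ≡ (z Q.* q Q.+ f) Q.* n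
            lem = solve 4 (λ z q n f → (z :* (q :* n) :+ n :* f) := ((z :* q :+ f) :* n)) refl
              where open +-*-Solver
        bd : ∀ φ → I (e ∷ U) M φ → Bound q φ
        bd φ i = cases (progress (e ∷ U) M φ i)
          where
          cases : HasMinor H (graphOf M) ⊎ (Zc ≤ φ) ⊎ _ → Bound q φ
          cases (inj₁ m) = won-bound {q} {φ} (won rv m)
          cases (inj₂ (inj₁ le)) = trivial-bound {q} {φ} le (nonneg rv)
          cases (inj₂ (inj₂ (_ , ψ , sumle , h))) = averaged φ ψ sumle h

-- Edges, degrees, the board and reachable positions

cnt-≥ : ∀ {A : Set} {P : A → Set} (P? : Decidable P) xs {ys} → Unique ys → (∀ {y} → y ∈ ys → y ∈ xs × P y) → length ys ≤ cnt P? xs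
cnt-≥ P? xs u h = ≤-trans (unique-⊆-length u (λ m → ∈-filter⁺ P? (proj₁ (h m)) (proj₂ (h m)))) (≤-reflexive (length-filter-cnt P? xs))

cnt-++ʳ : ∀ {A : Set} {P : A → Set} (P? : Decidable P) xs ys → cnt P? ys ≤ cnt P? (xs ++ ys)
cnt-++ʳ P? xs ys = ≤-trans (m≤n+m _ (cnt P? xs)) (≤-reflexive (sym (sumf-++ _ xs ys)))

cnt-↭-++ : ∀ {A : Set} {P : A → Set} (P? : Decidable P) {xs} B {ys} → xs ↭ B ++ ys → cnt P? ys ≤ cnt P? xs
cnt-↭-++ P? B {ys} p = ≤-trans (cnt-++ʳ P? B ys) (≤-reflexive (sym (sumf-↭ _ p)))

∈-↭-++ : ∀ {A : Set} {xs} (B : List A) {ys x} → xs ↭ B ++ ys → x ∈ ys → x ∈ xs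
∈-↭-++ B p m = PermP.∈-resp-↭ (↭-sym p) (∈-++⁺ʳ B m)

module _ {n : ℕ} where

  Ordered : Edge n → Set
  Ordered (x , y) = toℕ x < toℕ y

  Touches : Fin n → Edge n → Set
  Touches v (x , y) = v ≡ x ⊎ v ≡ y

  touches? : ∀ v → Decidable (Touches v)
  touches? v (x , y) = (v FinP.≟ x) ⊎-dec (v FinP.≟ y)

  deg : Fin n → List (Edge n) → ℕ
  deg v = cnt (touches? v)

  other : Fin n → Edge n → Fin n
  other v (x , y) = if does (v FinP.≟ x) then y else x

  other-left : ∀ v y → other v (v , y) ≡ y
  other-left v y with v FinP.≟ v
  ... | yes _ = refl
  ... | no ne = ⊥-elim (ne refl)

  other-right : ∀ v x → other v (x , v) ≡ x
  other-right v x with v FinP.≟ x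
  ... | yes e = e
  ... | no _ = refl

  Joins : Edge n → Fin n → Fin n → Set
  Joins e u v = e ≡ (u , v) ⊎ e ≡ (v , u)

  joins-other : ∀ {v e} → Touches v e → Joins e v (other v e)
  joins-other {v} {_ , y} (inj₁ refl) = inj₁ (cong (v ,_) (sym (other-left v y)))
  joins-other {v} {x , _} (inj₂ refl) = inj₂ (cong (_, v) (sym (other-right v x)))

  joins-touchesˡ : ∀ {e u v} → Joins e u v → Touches u e
  joins-touchesˡ (inj₁ refl) = inj₁ refl
  joins-touchesˡ (inj₂ refl) = inj₂ refl

  joins-touchesʳ : ∀ {e u v} → Joins e u v → Touches v e
  joins-touchesʳ (inj₁ refl) = inj₂ refl
  joins-touchesʳ (inj₂ refl) = inj₁ refl

  touches-joins : ∀ {e u v w} → Joins e u v → Touches w e → w ≡ u ⊎ w ≡ v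
  touches-joins (inj₁ refl) t = t
  touches-joins (inj₂ refl) (inj₁ t) = inj₂ t
  touches-joins (inj₂ refl) (inj₂ t) = inj₁ t

  ordered-≢ : ∀ {e u v} → Ordered e → Joins e u v → u ≢ v
  ordered-≢ o (inj₁ refl) refl = <-irrefl refl o
  ordered-≢ o (inj₂ refl) refl = <-irrefl refl o

  ordered-joins-unique : ∀ {e f u v} → Ordered e → Ordered f → Joins e u v → Joins f u v → e ≡ f
  ordered-joins-unique o p (inj₁ refl) (inj₁ refl) = refl
  ordered-joins-unique o p (inj₁ refl) (inj₂ refl) = ⊥-elim (<-asym o p)
  ordered-joins-unique o p (inj₂ refl) (inj₁ refl) = ⊥-elim (<-asym o p)
  ordered-joins-unique o p (inj₂ refl) (inj₂ refl) = refl

  other-injective : ∀ {v e f} → Ordered e → Ordered f → Touches v e → Touches v f → other v e ≡ other v f → e ≡ f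
  other-injective {v} {e} {f} o p t s eq = ordered-joins-unique o p (joins-other t) (subst (Joins f v) (sym eq) (joins-other s))

  graphOf-joins : ∀ {M : List (Edge n)} {x y} → graphOf M x y → ∃[ e ] (e ∈ M × Joins e x y)
  graphOf-joins (inj₁ m) = _ , m , inj₁ refl
  graphOf-joins (inj₂ m) = _ , m , inj₂ refl

  joins-graphOf : ∀ {M : List (Edge n)} {e x y} → e ∈ M → Joins e x y → graphOf M x y
  joins-graphOf m (inj₁ refl) = inj₁ m
  joins-graphOf m (inj₂ refl) = inj₂ m

  graphOf-sym : ∀ {M : List (Edge n)} {x y} → graphOf M x y → graphOf M y x
  graphOf-sym (inj₁ m) = inj₂ m
  graphOf-sym (inj₂ m) = inj₁ m

  -- The other ends of the free edges at `v` are distinct and none of them lies in `Xs`.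
  deg-bound : ∀ {U : List (Edge n)} v (Xs : List (Fin n)) → Unique U → (∀ {e} → e ∈ U → Ordered e) → Unique Xs →
    (∀ {e} → e ∈ U → Touches v e → other v e ∉ Xs) → deg v U + length Xs ≤ n
  deg-bound {U} v Xs uU oU uX h = subst (_≤ n) (trans (length-++ (map (other v) F)) (cong (_+ length Xs) (trans (length-map _ F) (length-filter-cnt (touches? v) U))))
      (unique-fin-length (UniqueP.++⁺ (uniq F (UniqueP.filter⁺ (touches? v) uU) (λ m → ∈-filter⁻ (touches? v) m)) uX
        (λ { (m , k) → let (e , e∈ , eq) = ∈-map⁻ (other v) m ; (eU , t) = ∈-filter⁻ (touches? v) {xs = U} e∈ in h eU t (subst (_∈ Xs) eq k) })))
    where
    F = filter (touches? v) U
    uniq : ∀ zs → Unique zs → (∀ {z} → z ∈ zs → z ∈ U × Touches v z) → Unique (map (other v) zs)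
    uniq [] _ _ = []
    uniq (z ∷ zs) u g = Unique-∷ (λ m → let (w , w∈ , eq) = ∈-map⁻ (other v) m in
        Unique-head u (subst (_∈ zs) (sym (other-injective (oU (proj₁ (g (here refl)))) (oU (proj₁ (g (there w∈)))) (proj₂ (g (here refl))) (proj₂ (g (there w∈))) eq)) w∈))
      (uniq zs (Unique-tail u) (g ∘ there))

  other-≢ : ∀ {v e} → Ordered e → Touches v e → other v e ≢ v
  other-≢ o t eq = ordered-≢ o (joins-other t) (sym eq)

  deg<n : ∀ {U : List (Edge n)} v → Unique U → (∀ {e} → e ∈ U → Ordered e) → deg v U + 1 ≤ n
  deg<n v u o = deg-bound v (v ∷ []) u o ([] ∷ []) (λ { m t (here eq) → other-≢ (o m) t eq })

pairs-cartesian : ∀ k → pairs k ≡ cartesianProduct (allFin k) (allFin k)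
pairs-cartesian k = go′ (allFin k)
  where
  go′ : ∀ xs → concatMap (λ i → map (λ j → (i , j)) (allFin k)) xs ≡ cartesianProduct xs (allFin k)
  go′ [] = refl
  go′ (x ∷ xs) = cong (map (x ,_) (allFin k) ++_) (go′ xs)

pairs-complete : ∀ {k} (i j : Fin k) → (i , j) ∈ pairs k
pairs-complete {k} i j = subst ((i , j) ∈_) (sym (pairs-cartesian k)) (∈-cartesianProduct⁺ (∈-allFin i) (∈-allFin j))

pairs-unique : ∀ k → Unique (pairs k)
pairs-unique k = subst Unique (sym (pairs-cartesian k)) (UniqueP.cartesianProduct⁺ (UniqueP.allFin⁺ k) (UniqueP.allFin⁺ k))

pairs-length : ∀ k → length (pairs k) ≡ k * k
pairs-length k = trans (go′ (allFin k)) (cong (_* k) (length-tabulate {n = k} id))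
  where
  go′ : ∀ xs → length (concatMap (λ i → map (λ j → (i , j)) (allFin k)) xs) ≡ length xs * k
  go′ [] = refl
  go′ (x ∷ xs) = trans (length-++ (map (x ,_) (allFin k))) (cong₂ _+_ (trans (length-map _ (allFin k)) (length-tabulate {n = k} id)) (go′ xs))

board-ordered : ∀ {n} {e : Edge n} → e ∈ board n → Ordered e
board-ordered {n} {x , y} m = <ᵇ⇒< (toℕ x) (toℕ y) (proj₂ (∈-filter⁻ (λ p → T? (toℕ (proj₁ p) <ᵇ toℕ (proj₂ p))) {xs = pairs n} m))

board-complete : ∀ {n} {e : Edge n} → Ordered e → e ∈ board n
board-complete {n} {x , y} o = ∈-filter⁺ (λ p → T? (toℕ (proj₁ p) <ᵇ toℕ (proj₂ p))) (pairs-complete x y) (<⇒<ᵇ o)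

board-unique : ∀ n → Unique (board n)
board-unique n = UniqueP.filter⁺ (λ p → T? (toℕ (proj₁ p) <ᵇ toℕ (proj₂ p))) (pairs-unique n)

private
  flip′ : ∀ {n} → Edge n → Edge n
  flip′ (x , y) = y , x

  flips-unique : ∀ {n} → Unique (map flip′ (board n))
  flips-unique {n} = UniqueP.map⁺ (λ { refl → refl }) (board-unique n)

-- The board and its reversal are disjoint among the n² ordered pairs. Together with the diagonal
-- they exhaust these pairs, which gives the lower bound that follows.
board-length-upper : ∀ n → 2 * length (board n) ≤ n * n
board-length-upper n = subst₂ _≤_ eq (pairs-length n) (unique-⊆-length (UniqueP.++⁺ (board-unique n) flips-unique disj) (λ _ → pairs-complete _ _))
  where
  eq : length (board n ++ map flip′ (board n)) ≡ 2 * length (board n)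
  eq = trans (length-++ (board n)) (cong (length (board n) +_) (trans (length-map flip′ (board n)) (sym (+-identityʳ _))))
  disj : ∀ {e} → ¬ (e ∈ board n × e ∈ map flip′ (board n))
  disj (m , k) with ∈-map⁻ flip′ k
  ... | f , f∈ , refl = <-asym (board-ordered f∈) (board-ordered m)

board-length-lower : ∀ n → n * n ≤ 2 * length (board n) + n
board-length-lower n = subst₂ _≤_ (pairs-length n) eq (unique-⊆-length (pairs-unique n) cover)
  where
  L = board n ++ map flip′ (board n) ++ map (λ x → x , x) (allFin n)
  eq : length L ≡ 2 * length (board n) + n
  eq = trans (length-++ (board n)) (trans (cong (length (board n) +_) (trans (length-++ (map flip′ (board n))) (cong₂ _+_ (length-map flip′ (board n)) (trans (length-map _ (allFin n)) (length-tabulate {n = n} id))))) (lem (length (board n)) n))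
    where
    lem : ∀ a b → a + (a + b) ≡ 2 * a + b
    lem = solve-∀
  cover : ∀ {e} → e ∈ pairs n → e ∈ L
  cover {x , y} _ with <-cmp (toℕ x) (toℕ y)
  ... | tri< lt _ _ = ∈-++⁺ˡ (board-complete lt)
  ... | tri≈ _ e _ with FinP.toℕ-injective e
  ... | refl = ∈-++⁺ʳ (board n) (∈-++⁺ʳ (map flip′ (board n)) (∈-map⁺ _ (∈-allFin x)))
  cover {x , y} _ | tri> _ _ gt = ∈-++⁺ʳ (board n) (∈-++⁺ˡ (∈-map⁺ flip′ (board-complete gt)))

-- What holds in every reachable position. The field `budget` says that a round removes at most b +
-- 1 edges from the board, so after few rounds many free edges are left.
record WF {n} (b : ℕ) (U M : List (Edge n)) : Set where
  constructor wf
  field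
    uniq    : Unique (M ++ U)
    ordered : ∀ {e} → e ∈ M ++ U → Ordered e
    budget  : length (board n) ≤ length U + suc b * length M

  uniqU : Unique U
  uniqU = Unique-++ʳ M uniq
  uniqM : Unique M
  uniqM = Unique-++ˡ M uniq
  ordU : ∀ {e} → e ∈ U → Ordered e
  ordU = ordered ∘ ∈-++⁺ʳ M
  ordM : ∀ {e} → e ∈ M → Ordered e
  ordM = ordered ∘ ∈-++⁺ˡ
open WF public

wf-start : ∀ {n b} → WF b (board n) []
wf-start {n} {b} = wf (board-unique n) board-ordered (m≤m+n _ _)

wf-step : ∀ {n b} {U M : List (Edge n)} {e U′ B U″} → WF b U M → U ↭ e ∷ U′ → U′ ↭ B ++ U″ → length B ≡ bcount b (length U′) → WF b U″ (e ∷ M)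
wf-step {n} {b} {U} {M} {e} {U′} {B} {U″} w p q l = wf (Unique-++ʳ B (Unique-↭ perm (uniq w))) (λ m → ordered w (PermP.∈-resp-↭ (↭-sym perm) (∈-++⁺ʳ B m)))
    (≤-trans (budget w) (subst (_≤ length U″ + suc b * suc (length M)) (cong (_+ suc b * length M) (sym lenU)) arith))
  where
  perm : M ++ U ↭ B ++ (e ∷ M ++ U″)
  perm = ↭-trans (PermP.++⁺ˡ M (↭-trans p (prep e q))) (↭-trans (PermP.shift e M (B ++ U″)) (↭-trans (prep e (PermP.shifts M B)) (↭-sym (PermP.shift e B (M ++ U″)))))
  lenU : length U ≡ suc (length B + length U″)
  lenU = trans (PermP.↭-length p) (cong suc (trans (PermP.↭-length q) (length-++ B)))
  arith : suc (length B + length U″) + suc b * length M ≤ length U″ + suc b * suc (length M)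
  arith = ≤-trans (+-monoˡ-≤ (suc b * length M) (s≤s (+-monoˡ-≤ (length U″) (≤-trans (≤-reflexive l) (m⊓n≤m b _))))) (≤-reflexive (lem b (length U″) (length M)))
    where
    lem : ∀ b u m → suc (b + u) + suc b * m ≡ u + suc b * suc m
    lem = solve-∀

module _ {n b : ℕ} where

  -- Turns a prescription of at most `b` claims into a legal reply. The conclusions say that
  -- anything true of all edges in `U₁` or `U`, and every upper bound on a count there, passes to
  -- the new free edges.
  reply-with : ∀ {U U′ M : List (Edge n)} {e} B {U₁} → WF b U M → U ↭ e ∷ U′ → U′ ↭ B ++ U₁ → length B ≤ b →
    ∃₂ λ B′ U″ → (U′ ↭ B′ ++ U″ × length B′ ≡ bcount b (length U′)) × WF b U″ (e ∷ M) ×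
      (∀ {f} → f ∈ U″ → f ∈ U₁) × (∀ {f} → f ∈ U″ → f ∈ U) × (∀ {P : Edge n → Set} (P? : Decidable P) → cnt P? U″ ≤ cnt P? U₁ × cnt P? U″ ≤ cnt P? U)
  reply-with {U} {U′} {M} {e} B {U₁} w p q l with fill b {ys = U₁} q l
  ... | B′ , B″ , U″ , p′ , l′ , refl = B′ , U″ , (p′ , l′) , wf-step w p p′ l′ , ∈-++⁺ʳ B″ , (λ m → ∈-ins p (∈-↭-++ B′ p′ m)) ,
    λ P? → cnt-++ʳ P? B″ U″ , ≤-trans (cnt-↭-++ P? B′ p′) (≤-trans (m≤n+m _ (ind (P? e))) (≤-reflexive (sym (sumf-↭ _ p))))

BreakerWins : ∀ {h} → Graph h → ℕ → ℕ → Set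
BreakerWins H b n = ¬ MakerWins H b (board n) [] × (∀ {q} → RVal H b (board n) [] q → q Q.≤ 0ℚ)

-- Strategies of Breaker

-- These are subgraphs, not necessarily induced: three edges at a vertex, two edges at a vertex, and
-- a path on four vertices.
Claw Cherry P₄ : ∀ {h} → Graph h → Set
Cherry {h} H = Σ (Fin h) λ v → Σ (Fin h) λ a → Σ (Fin h) λ c → a ≢ c × T (adj H v a) × T (adj H v c)
Claw {h} H = Σ (Fin h) λ v → Σ (Fin h) λ a → Σ (Fin h) λ c → Σ (Fin h) λ d →
  (a ≢ c × a ≢ d × c ≢ d) × T (adj H v a) × T (adj H v c) × T (adj H v d)
P₄ {h} H = Σ (Fin h) λ a → Σ (Fin h) λ v → Σ (Fin h) λ w → Σ (Fin h) λ d →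
  (a ≢ v × a ≢ w × a ≢ d × v ≢ w × v ≢ d × w ≢ d) × T (adj H a v) × T (adj H v w) × T (adj H w d)

adj-sym : ∀ {h} (H : Graph h) {i j} → T (adj H i j) → T (adj H j i)
adj-sym H {i} {j} = subst T (symm H i j)

adj-≢ : ∀ {h} (H : Graph h) {i j} → T (adj H i j) → i ≢ j
adj-≢ H {i} t refl = subst T (irr H i) t

hEdge? : ∀ {h} (H : Graph h) → Decidable (λ (p : Fin h × Fin h) → T ((toℕ (proj₁ p) <ᵇ toℕ (proj₂ p)) ∧ adj H (proj₁ p) (proj₂ p)))
hEdge? H p = T? _

countTrue-cnt : ∀ {A : Set} (f : A → Bool) xs → countTrue (map f xs) ≡ cnt (λ x → T? (f x)) xs
countTrue-cnt f [] = refl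
countTrue-cnt f (x ∷ xs) with f x
... | true = cong suc (countTrue-cnt f xs)
... | false = countTrue-cnt f xs

T-∧ : ∀ {a b} → T (a ∧ b) → T a × T b
T-∧ {true} t = tt , t

∧-T : ∀ {a b} → T a → T b → T (a ∧ b)
∧-T {true} _ t = t

-- Each edge of H picks an edge of M between its branch sets. As branch sets are disjoint, the
-- picked edge determines the two sets, and the order of the ends fixes the pair.
minor-edges : ∀ {h n} (H : Graph h) (M : List (Edge n)) → HasMinor H (graphOf M) → eH H ≤ length M
minor-edges {h} {n} H M (S , disj , _ , _ , cross) =
  subst (_≤ length M) (sym (countTrue-cnt _ (pairs h)))
    (subst (cnt (hEdge? H) (pairs h) ≤_) (length-map just M) (cnt-inj (hEdge? H) (λ p → img p (hEdge? H p)) (pairs h) (map just M) (pairs-unique h)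
      (λ p _ t → img-∈ p (hEdge? H p) t) (λ p r _ _ t s → img-inj p r (hEdge? H p) (hEdge? H r) t s)))
  where
  E : Fin h × Fin h → Set
  E p = T ((toℕ (proj₁ p) <ᵇ toℕ (proj₂ p)) ∧ adj H (proj₁ p) (proj₂ p))
  edge : ∀ p → E p → ∃[ e ] (e ∈ M × ∃[ x ] ∃[ y ] (T (S (proj₁ p) x) × T (S (proj₂ p) y) × Joins e x y))
  edge (v , w) t with cross v w (proj₂ (T-∧ {toℕ v <ᵇ toℕ w} t))
  ... | x , y , sx , sy , g with graphOf-joins g
  ... | e , m , j = e , m , x , y , sx , sy , j
  -- The value `nothing` makes the choice a total function on pairs; the count only looks at edges
  -- of H.
  img : ∀ p → Dec (E p) → Maybe (Edge n)
  img p (yes t) = just (proj₁ (edge p t))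
  img p (no _) = nothing
  img-∈ : ∀ p d → E p → img p d ∈ map just M
  img-∈ p (yes t) _ = ∈-map⁺ just (proj₁ (proj₂ (edge p t)))
  img-∈ p (no ¬t) t = ⊥-elim (¬t t)
  just-inj : ∀ {a b : Edge n} → just a ≡ just b → a ≡ b
  just-inj refl = refl
  img-inj : ∀ p r d d′ → E p → E r → img p d ≡ img r d′ → p ≡ r
  img-inj p r (no ¬t) _ t _ _ = ⊥-elim (¬t t)
  img-inj p r (yes _) (no ¬s) _ s _ = ⊥-elim (¬s s)
  img-inj p r (yes t) (yes s) _ _ eq = both (edge p t) (edge r s) (just-inj eq) (lt p t) (lt r s)
    where
    lt : ∀ p → E p → toℕ (proj₁ p) < toℕ (proj₂ p)
    lt (v , w) t = <ᵇ⇒< (toℕ v) (toℕ w) (proj₁ (T-∧ {toℕ v <ᵇ toℕ w} t))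
    Img : Fin h × Fin h → Set
    Img (v , w) = ∃[ e ] (e ∈ M × ∃[ x ] ∃[ y ] (T (S v x) × T (S w y) × Joins e x y))
    both : ∀ {p r} (a : Img p) (c : Img r) → proj₁ a ≡ proj₁ c → toℕ (proj₁ p) < toℕ (proj₂ p) → toℕ (proj₁ r) < toℕ (proj₂ r) → p ≡ r
    both {v , w} {v′ , w′} (e , _ , x , y , sx , sy , j) (_ , _ , x′ , y′ , sx′ , sy′ , j′) refl o o′ with touches-joins j (joins-touchesˡ j′) | touches-joins j (joins-touchesʳ j′)
    ... | inj₁ refl | inj₂ refl = cong₂ _,_ (disj v v′ _ sx sx′) (disj w w′ _ sy sy′)
    ... | inj₁ refl | inj₁ refl = ⊥-elim (<⇒≢ o′ (cong toℕ (disj v′ w′ _ sx′ sy′)))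
    ... | inj₂ refl | inj₂ refl = ⊥-elim (<⇒≢ o′ (cong toℕ (disj v′ w′ _ sx′ sy′)))
    ... | inj₂ refl | inj₁ refl with disj w v′ _ sy sx′ | disj v w′ _ sx sy′
    ... | refl | refl = ⊥-elim (<-asym o o′)

-- Breaker may play anything: a board of at most r (b + 1) edges lasts for at most r rounds. The
-- invariant counts the rounds `s` still to come.
breaker-exhausts : ∀ {h n b r} (H : Graph h) → length (board n) ≤ r * suc b → r < eH H → BreakerWins H b n
breaker-exhausts {h} {n} {b} {r} H le lt = BS.clever-loses start , λ v → BS.random-loses v start
  where
  open Game {h} {n} H b using (Edges; Reply; module BreakerStrategy)
  I : Edges → Edges → Set
  I U M = ∃[ s ] (s + length M ≡ r × length U ≤ s * suc b)
  start : I (board n) []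
  start = r , +-identityʳ r , le
  end : ∀ M → I [] M → ¬ HasMinor H (graphOf M)
  end M (s , eq , _) m = <⇒≱ lt (≤-trans (minor-edges H M m) (≤-trans (m≤n+m _ s) (≤-reflexive eq)))
  reply : ∀ U M e U′ → I U M → U ↭ e ∷ U′ → ∃₂ λ B U″ → Reply U′ B U″ × I U″ (e ∷ M)
  reply U M e U′ (s , eq , l) p with fill b {xs = U′} {B = []} ↭-refl z≤n
  ... | B , _ , U″ , q , lB , _ with s
  ... | zero = case subst (_≤ 0) (PermP.↭-length p) l of λ ()
  ... | suc s = B , U″ , (q , lB) , s , trans (+-suc s _) eq , bound
    where
    l′ : length U′ ≤ b + s * suc b
    l′ = ≤-pred (subst (_≤ suc (b + s * suc b)) (PermP.↭-length p) l)
    bound : length U″ ≤ s * suc b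
    bound with ≤-total b (length U′)
    ... | inj₁ b≤ = +-cancelˡ-≤ b _ _ (≤-trans (≤-reflexive (trans (cong (_+ length U″) (sym (trans lB (m≤n⇒m⊓n≡m b≤)))) (trans (sym (length-++ B)) (sym (PermP.↭-length q))))) l′)
    ... | inj₂ ≤b = ≤-trans (+-cancelˡ-≤ (length U′) _ _ (≤-reflexive (trans (cong (_+ length U″) (sym (trans lB (m≥n⇒m⊓n≡n ≤b)))) (trans (sym (length-++ B)) (trans (sym (PermP.↭-length q)) (sym (+-identityʳ _))))))) z≤n
  module BS = BreakerStrategy I end reply

module _ {n : ℕ} {G : Fin n → Fin n → Set} {h} {H : Graph h} where

  -- A walk inside the branch set from `s` to another vertex would begin with a neighbour of `s` in
  -- that set.
  singleton-branch : ((S , _) : HasMinor H G) → ∀ v s → T (S v s) → (∀ z → G s z → ¬ T (S v z)) → ∀ x → T (S v x) → x ≡ s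
  singleton-branch (S , _ , _ , conn , _) v s ts out x tx with conn v s x ts tx
  ... | here = refl
  ... | step g t _ = ⊥-elim (out _ g t)

  private
    apart : ((S , _) : HasMinor H G) → ∀ {v w} → v ≢ w → ∀ {x y} → T (S v x) → T (S w y) → x ≢ y
    apart (S , disj , _) ne tx ty refl = ne (disj _ _ _ tx ty)

  -- The vertex s of the branch set of v that meets the branch set of a has its only neighbour
  -- there, so the set is {s}; then s has no neighbour left for the branch set of c.
  cherry-free : (∀ v p q → G v p → G v q → p ≡ q) → Cherry H → ¬ HasMinor H G
  cherry-free leaf (v , a , c , ne , ea , ec) m@(S , disj , _ , _ , cross) with cross v a ea | cross v c ec
  ... | s , x , ts , tx , g | s′ , x′ , ts′ , tx′ , g′ with singleton-branch m v s ts (λ z gz tz → apart m (adj-≢ H ea) tz tx (leaf s z x gz g)) s′ ts′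
  ... | refl = apart m ne tx tx′ (leaf s x x′ g g′)

  -- The edge that realises the middle edge v w has an end of degree 1. Its branch set is that
  -- single vertex, which cannot also be adjacent to the branch set of the outer neighbour.
  P₄-free : (∀ {x y} → G x y → G y x) → (∀ x y → G x y → (∀ p q → G x p → G x q → p ≡ q) ⊎ (∀ p q → G y p → G y q → p ≡ q)) → P₄ H → ¬ HasMinor H G
  P₄-free gsym star (a , v , w , d , (_ , a≢w , _ , v≢w , v≢d , _) , ea , ev , ew) m@(S , disj , _ , _ , cross) with cross v w ev
  ... | x , y , tx , ty , g with star x y g
  ... | inj₁ leaf with cross a v ea
  ... | p , s , tp , ts , g′ with singleton-branch m v x tx (λ z gz tz → apart m v≢w tz ty (leaf z y gz g)) s ts
  ... | refl = apart m a≢w tp ty (leaf p y (gsym g′) g)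
  P₄-free gsym star (a , v , w , d , (_ , a≢w , _ , v≢w , v≢d , _) , ea , ev , ew) m@(S , disj , _ , _ , cross) | x , y , tx , ty , g | inj₂ leaf with cross w d ew
  ... | s , p , ts , tp , g′ with singleton-branch m w y ty (λ z gz tz → apart m v≢w tx tz (leaf x z (gsym g) gz)) s ts
  ... | refl = apart m v≢d tx tp (leaf x p (gsym g) g′)

  -- A path inside the branch set of v joins its contact with the set of a to its contact with the
  -- set of c. Along it all degrees are used up, so the branch set is this path and offers no third
  -- contact.
  claw-free : (∀ {x y} → G x y → G y x) → (∀ v p q r → G v p → G v q → G v r → p ≡ q ⊎ p ≡ r ⊎ q ≡ r) → Claw H → ¬ HasMinor H G
  claw-free gsym deg2 (v , a , c , d , (a≢c , a≢d , c≢d) , ea , ec , ed) m@(S , disj , _ , conn , cross) with cross v a ea | cross v c ec | cross v d ed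
  ... | sa , xa , tsa , txa , ga | sc , xc , tsc , txc , gc | sd , xd , tsd , txd , gd with loop-erase (proj₂ (fromWalkIn (conn v sa sc tsa tsc)))
  ... | vs , w , _ , _ , u = final (closed w u (λ m′ → out (adj-≢ H ea) txa (inside w tsa m′)) ga (λ eq → apart m a≢c txa txc eq) (λ m′ → out (adj-≢ H ec) txc (inside w tsa m′)) gc)
    where
    Sv : Fin n → Fin n → Set
    Sv p q = G p q × T (S v q)
    out : ∀ {w x} → v ≢ w → T (S w x) → ¬ T (S v x)
    out ne t t′ = ne (disj _ _ _ t′ t)
    inside : ∀ {p q us} → Walk Sv p q us → T (S v p) → ∀ {z} → z ∈ us → T (S v z)
    inside stop t (here refl) = t
    inside (go _ _) t (here refl) = t
    inside (go (_ , t′) w) t (there m′) = inside w t′ m′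
    -- Each vertex of the path already has two neighbours, namely its neighbours on the path with
    -- `x` and `y` added beyond the ends; in the induction `x` is the preceding vertex.
    closed : ∀ {p q us x y} → Walk Sv p q us → Unique us → x ∉ us → G p x → x ≢ y → y ∉ us → G q y → ∀ s z → s ∈ us → G s z → z ∈ us ⊎ z ≡ x ⊎ z ≡ y
    closed {p} {x = x} {y} stop u nx gx ne ny gy s z (here refl) gz with deg2 p x y z gx gy gz
    ... | inj₁ e = ⊥-elim (ne e)
    ... | inj₂ (inj₁ e) = inj₂ (inj₁ (sym e))
    ... | inj₂ (inj₂ e) = inj₂ (inj₂ (sym e))
    closed {p} {x = x} {y} (go (g , _) w) u nx gx ne ny gy s z (here refl) gz with deg2 p x _ z gx g gz
    ... | inj₁ refl = ⊥-elim (nx (there (walk-start w)))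
    ... | inj₂ (inj₁ e) = inj₂ (inj₁ (sym e))
    ... | inj₂ (inj₂ refl) = inj₁ (there (walk-start w))
    closed {p} {x = x} {y} (go (g , _) w) u nx gx ne ny gy s z (there m′) gz with closed w (Unique-tail u) (Unique-head u) (gsym g) (λ { refl → ny (here refl) }) (ny ∘ there) gy s z m′ gz
    ... | inj₁ k = inj₁ (there k)
    ... | inj₂ (inj₁ refl) = inj₁ (here refl)
    ... | inj₂ (inj₂ e) = inj₂ (inj₂ e)
    final : (∀ s z → s ∈ vs → G s z → z ∈ vs ⊎ z ≡ xa ⊎ z ≡ xc) → ⊥
    final cl = absurd (cl sd xd (stay (proj₂ (fromWalkIn (conn v sa sd tsa tsd))) (walk-start w)) gd)
      where
      stay : ∀ {p q us} → Walk Sv p q us → p ∈ vs → q ∈ vs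
      stay stop m′ = m′
      stay (go {z = z} (g , t) w′) m′ with cl _ z m′ g
      ... | inj₁ k = stay w′ k
      ... | inj₂ (inj₁ refl) = ⊥-elim (out (adj-≢ H ea) txa t)
      ... | inj₂ (inj₂ refl) = ⊥-elim (out (adj-≢ H ec) txc t)
      absurd : xd ∈ vs ⊎ xd ≡ xa ⊎ xd ≡ xc → ⊥
      absurd (inj₁ k) = out (adj-≢ H ed) txd (inside w tsa k)
      absurd (inj₂ (inj₁ e)) = apart m a≢d txa txd (sym e)
      absurd (inj₂ (inj₂ e)) = apart m c≢d txc txd (sym e)

-- After Maker's edge x y, Breaker claims all free edges at x and at y, fewer than n at each end. So
-- an edge taken by Maker never meets another edge that is free or taken by Maker.
breaker-matching : ∀ {h n b} (H : Graph h) → 2 * n ≤ b → Cherry H → BreakerWins H b n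
breaker-matching {h} {n} {b} H le ch = BS.clever-loses start , λ v → BS.random-loses v start
  where
  open Game {h} {n} H b using (Edges; Reply; module BreakerStrategy)
  I : Edges → Edges → Set
  I U M = WF b U M × (∀ e f v → e ∈ M → f ∈ M ⊎ f ∈ U → Touches v e → Touches v f → e ≡ f × f ∈ M)
  start : I (board n) []
  start = wf-start , λ _ _ _ ()
  end : ∀ M → I [] M → ¬ HasMinor H (graphOf M)
  end M (w , i) = cherry-free {G = graphOf M} {H = H} leaf ch
    where
    leaf : ∀ v p q → graphOf M v p → graphOf M v q → p ≡ q
    leaf v p q g g′ with graphOf-joins g | graphOf-joins g′
    ... | e , me , je | f , mf , jf with i e f v me (inj₁ mf) (joins-touchesˡ je) (joins-touchesˡ jf)
    ... | refl , _ with touches-joins jf (joins-touchesʳ je)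
    ... | inj₁ refl = ⊥-elim (ordered-≢ (ordM w me) je refl)
    ... | inj₂ eq = eq
  reply : ∀ U M e U′ → I U M → U ↭ e ∷ U′ → ∃₂ λ B U″ → Reply U′ B U″ × I U″ (e ∷ M)
  reply U M e@(x , y) U′ (w , i) p with trim (touches? x) n 0 U′ (≤-trans (degU′ x) (m≤m+n n 0))
    where
    degU′ : ∀ v → deg v U′ ≤ n
    degU′ v = ≤-trans (m≤n+m _ (ind (touches? v e))) (≤-trans (≤-reflexive (sym (sumf-↭ _ p))) (≤-trans (m≤m+n _ 1) (deg<n v (uniqU w) (ordU w))))
  ... | B₁ , U₁ , p₁ , l₁ , c₁ with trim (touches? y) n 0 U₁ (≤-trans (cnt-↭-++ (touches? y) B₁ p₁) (≤-trans (m≤n+m _ (ind (touches? y e))) (≤-trans (≤-reflexive (sym (sumf-↭ _ p))) (≤-trans (m≤m+n _ 1) (≤-trans (deg<n y (uniqU w) (ordU w)) (m≤m+n n 0))))))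
  ... | B₂ , U₂ , p₂ , l₂ , c₂ with reply-with (B₁ ++ B₂) {U₂} w p (↭-trans p₁ (↭-trans (PermP.++⁺ˡ B₁ p₂) (↭-reflexive (sym (++-assoc B₁ B₂ U₂)))))
         (≤-trans (≤-reflexive (length-++ B₁)) (≤-trans (+-mono-≤ l₁ l₂) (≤-trans (≤-reflexive (cong (n +_) (sym (+-identityʳ n)))) le)))
  ... | B , U″ , r , w″ , s₂ , sU , _ = B , U″ , r , w″ , inv
    where
    clear : ∀ f v → f ∈ U″ → Touches v e → ¬ Touches v f
    clear f v m (inj₁ refl) = cnt-0 (touches? x) U₁ (n≤0⇒n≡0 c₁) f (∈-↭-++ B₂ p₂ (s₂ m))
    clear f v m (inj₂ refl) = cnt-0 (touches? y) U₂ (n≤0⇒n≡0 c₂) f (s₂ m)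
    e∈U : e ∈ U
    e∈U = PermP.∈-resp-↭ (↭-sym p) (here refl)
    inv : ∀ f g v → f ∈ e ∷ M → g ∈ e ∷ M ⊎ g ∈ U″ → Touches v f → Touches v g → f ≡ g × g ∈ e ∷ M
    inv f g v (here refl) (inj₁ (here refl)) tf tg = refl , here refl
    inv f g v (here refl) (inj₁ (there m)) tf tg with i g e v m (inj₂ e∈U) tg tf
    ... | refl , _ = refl , here refl
    inv f g v (here refl) (inj₂ m) tf tg = ⊥-elim (clear g v m tf tg)
    inv f g v (there m) (inj₁ (here refl)) tf tg with i f e v m (inj₂ e∈U) tf tg
    ... | refl , k = refl , here refl
    inv f g v (there m) (inj₁ (there m′)) tf tg = let (eq , k) = i f g v m (inj₁ m′) tf tg in eq , there k
    inv f g v (there m) (inj₂ m′) tf tg = let (eq , k) = i f g v m (inj₂ (sU m′)) tf tg in eq , there k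
  module BS = BreakerStrategy I end reply

-- Breaker keeps the maximum degree of Maker's graph at most 2: he claims half of the edges at
-- a vertex when its degree becomes 1 and the rest when it becomes 2.
breaker-paths : ∀ {h n b} (H : Graph h) → n ≤ b → Claw H → BreakerWins H b n
breaker-paths {h} {n} {b} H le ch = BS.clever-loses start , λ v → BS.random-loses v start
  where
  open Game {h} {n} H b using (Edges; Reply; module BreakerStrategy)
  half = ⌊ n /2⌋
  State : Edges → Edges → Fin n → Set
  State U M v = deg v M ≡ 0 ⊎ (deg v M ≡ 1 × deg v U ≤ half) ⊎ (deg v M ≡ 2 × deg v U ≤ 0)
  I : Edges → Edges → Set
  I U M = WF b U M × ∀ v → State U M v
  start : I (board n) []
  start = wf-start , λ _ → inj₁ refl
  end : ∀ M → I [] M → ¬ HasMinor H (graphOf M)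
  end M (w , i) = claw-free {G = graphOf M} {H = H} (graphOf-sym {M = M}) deg2 ch
    where
    le2 : ∀ v → deg v M ≤ 2
    le2 v with i v
    ... | inj₁ e = ≤-trans (≤-reflexive e) z≤n
    ... | inj₂ (inj₁ (e , _)) = ≤-trans (≤-reflexive e) (s≤s z≤n)
    ... | inj₂ (inj₂ (e , _)) = ≤-reflexive e
    deg2 : ∀ v p q r → graphOf M v p → graphOf M v q → graphOf M v r → p ≡ q ⊎ p ≡ r ⊎ q ≡ r
    deg2 v p q r gp gq gr with graphOf-joins gp | graphOf-joins gq | graphOf-joins gr
    ... | e₁ , m₁ , j₁ | e₂ , m₂ , j₂ | e₃ , m₃ , j₃ with p FinP.≟ q | p FinP.≟ r | q FinP.≟ r
    ... | yes e | _ | _ = inj₁ e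
    ... | no _ | yes e | _ = inj₂ (inj₁ e)
    ... | no _ | no _ | yes e = inj₂ (inj₂ e)
    ... | no a | no c | no d = ⊥-elim (<⇒≱ (s≤s (le2 v)) (cnt-≥ (touches? v) M {e₁ ∷ e₂ ∷ e₃ ∷ []}
        ((ne j₁ j₂ m₁ a ∷ ne j₁ j₃ m₁ c ∷ []) ∷ (ne j₂ j₃ m₂ d ∷ []) ∷ [] ∷ [])
        λ { (here refl) → m₁ , joins-touchesˡ j₁ ; (there (here refl)) → m₂ , joins-touchesˡ j₂ ; (there (there (here refl))) → m₃ , joins-touchesˡ j₃ }))
      where
      ne : ∀ {e f a c} → Joins e v a → Joins f v c → e ∈ M → a ≢ c → e ≢ f
      ne j j′ m a≢c refl with touches-joins j′ (joins-touchesʳ j)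
      ... | inj₁ refl = ordered-≢ (ordM w m) j refl
      ... | inj₂ eq = a≢c eq
  -- A vertex has at most n - 1 ≤ 2 ⌊n/2⌋ free edges. Hence ⌊n/2⌋ claims at each end of Maker's edge
  -- suffice, both for a vertex reaching degree 1 and for one reaching degree 2, and the two ends
  -- together cost at most n ≤ b.
  n≤ : n ≤ suc (half + half)
  n≤ = ≤-trans (≤-reflexive (sym (⌊n/2⌋+⌈n/2⌉≡n n))) (≤-trans (+-monoʳ-≤ half (⌈n/2⌉≤ n)) (≤-reflexive (+-suc half half)))
    where
    ⌈n/2⌉≤ : ∀ m → ⌈ m /2⌉ ≤ suc ⌊ m /2⌋
    ⌈n/2⌉≤ zero = z≤n
    ⌈n/2⌉≤ (suc zero) = s≤s z≤n
    ⌈n/2⌉≤ (suc (suc m)) = s≤s (⌈n/2⌉≤ m)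
  -- the number of edges at v that may stay once v has received its next Maker edge
  keep : ∀ {U M} v {e} → WF b U M → State U M v → e ∈ U → Touches v e →
    ∃[ c ] (deg v U ≤ half + c × (∀ {U″ M″} → deg v M″ ≡ suc (deg v M) → deg v U″ ≤ c → State U″ M″ v))
  keep v w (inj₁ e) _ _ = half , ≤-pred (≤-trans (≤-reflexive (+-comm 1 _)) (≤-trans (deg<n v (uniqU w) (ordU w)) n≤)) , λ eq l → inj₂ (inj₁ (trans eq (cong suc e) , l))
  keep v w (inj₂ (inj₁ (e , l))) _ _ = 0 , ≤-trans l (m≤m+n _ _) , λ eq l′ → inj₂ (inj₂ (trans eq (cong suc e) , l′))
  keep {U} v w (inj₂ (inj₂ (e , l))) m t = ⊥-elim (cnt-0 (touches? v) U (n≤0⇒n≡0 l) _ m t)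
  reply : ∀ U M e U′ → I U M → U ↭ e ∷ U′ → ∃₂ λ B U″ → Reply U′ B U″ × I U″ (e ∷ M)
  reply U M e@(x , y) U′ (w , i) p with keep x w (i x) (PermP.∈-resp-↭ (↭-sym p) (here refl)) (inj₁ refl) | keep y w (i y) (PermP.∈-resp-↭ (↭-sym p) (here refl)) (inj₂ refl)
  ... | cx , lx , kx | cy , ly , ky with trim (touches? x) half cx U′ (≤-trans (shrink x) lx)
    where
    shrink : ∀ v → deg v U′ ≤ deg v U
    shrink v = ≤-trans (m≤n+m _ (ind (touches? v e))) (≤-reflexive (sym (sumf-↭ _ p)))
  ... | B₁ , U₁ , p₁ , l₁ , c₁ with trim (touches? y) half cy U₁ (≤-trans (cnt-↭-++ (touches? y) B₁ p₁) (≤-trans (m≤n+m _ (ind (touches? y e))) (≤-trans (≤-reflexive (sym (sumf-↭ _ p))) ly)))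
  ... | B₂ , U₂ , p₂ , l₂ , c₂ with reply-with (B₁ ++ B₂) {U₂} w p (↭-trans p₁ (↭-trans (PermP.++⁺ˡ B₁ p₂) (↭-reflexive (sym (++-assoc B₁ B₂ U₂)))))
         (≤-trans (≤-reflexive (length-++ B₁)) (≤-trans (+-mono-≤ l₁ l₂) (≤-trans (+-monoʳ-≤ half (⌊n/2⌋≤⌈n/2⌉ n)) (≤-trans (≤-reflexive (⌊n/2⌋+⌈n/2⌉≡n n)) le))))
  ... | B , U″ , r , w″ , s₂ , sU , cs = B , U″ , r , w″ , inv
    where
    inv : ∀ v → State U″ (e ∷ M) v
    inv v with touches? v e
    ... | yes (inj₁ refl) = kx {U″} {e ∷ M} (cong (_+ deg v M) (ind-yes (touches? x e) (inj₁ refl))) (≤-trans (proj₁ (cs (touches? x))) (≤-trans (cnt-↭-++ (touches? x) B₂ p₂) c₁))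
    ... | yes (inj₂ refl) = ky {U″} {e ∷ M} (cong (_+ deg v M) (ind-yes (touches? y e) (inj₂ refl))) (≤-trans (proj₁ (cs (touches? y))) c₂)
    ... | no ¬t with i v
    ... | inj₁ z = inj₁ (trans (cong (_+ deg v M) (ind-no (touches? v e) ¬t)) z)
    ... | inj₂ (inj₁ (z , l)) = inj₂ (inj₁ (trans (cong (_+ deg v M) (ind-no (touches? v e) ¬t)) z , ≤-trans (proj₂ (cs (touches? v))) l))
    ... | inj₂ (inj₂ (z , l)) = inj₂ (inj₂ (trans (cong (_+ deg v M) (ind-no (touches? v e) ¬t)) z , ≤-trans (proj₂ (cs (touches? v))) l))
  module BS = BreakerStrategy I end reply

-- Breaker keeps every component of Maker's graph a star: L lists the leaves, all of whose free
-- edges are claimed, and C the centres, between which no free edge is left.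
breaker-stars : ∀ {h n b} (H : Graph h) → n ≤ b → P₄ H → BreakerWins H b n
breaker-stars {h} {n} {b} H le p4 = BS.clever-loses start , λ v → BS.random-loses v start
  where
  open Game {h} {n} H b using (Edges; Reply; module BreakerStrategy)
  record I (U M : Edges) : Set where
    constructor st
    field
      well : WF b U M
      L C : List (Fin n)
      uL : Unique L
      C≤L : length C ≤ length L
      noL : ∀ f v → f ∈ U → Touches v f → v ∉ L
      noC : ∀ f u v → f ∈ U → Joins f u v → u ∈ C → v ∉ C
      star : ∀ f → f ∈ M → ∃₂ λ u v → Joins f u v × u ∈ L × v ∈ C
      leaf : ∀ f g v → f ∈ M → g ∈ M → v ∈ L → Touches v f → Touches v g → f ≡ g
  start : I (board n) []
  start = st wf-start [] [] [] z≤n (λ _ _ _ _ ()) (λ _ _ _ _ _ ()) (λ _ ()) (λ _ _ _ ())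
  end : ∀ M → I [] M → ¬ HasMinor H (graphOf M)
  end M i = P₄-free {G = graphOf M} {H = H} (graphOf-sym {M = M}) st′ p4
    where
    open I i
    leafy : ∀ v → v ∈ L → ∀ p q → graphOf M v p → graphOf M v q → p ≡ q
    leafy v m p q g g′ with graphOf-joins g | graphOf-joins g′
    ... | e , me , je | f , mf , jf with leaf e f v me mf m (joins-touchesˡ je) (joins-touchesˡ jf)
    ... | refl with touches-joins jf (joins-touchesʳ je)
    ... | inj₁ refl = ⊥-elim (ordered-≢ (ordM well me) je refl)
    ... | inj₂ eq = eq
    st′ : ∀ x y → graphOf M x y → (∀ p q → graphOf M x p → graphOf M x q → p ≡ q) ⊎ (∀ p q → graphOf M y p → graphOf M y q → p ≡ q)
    st′ x y g with graphOf-joins g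
    ... | e , me , je with star e me
    ... | u , v , j , uL , _ with touches-joins je (joins-touchesˡ j)
    ... | inj₁ refl = inj₁ (leafy x uL)
    ... | inj₂ refl = inj₂ (leafy y uL)
  -- u becomes a leaf attached to v; C′ is the new list of centres
  attach : ∀ {U M e U′} → (i : I U M) → U ↭ e ∷ U′ → ∀ u v C′ → Joins e u v → u ∉ I.C i → v ∈ C′ → length C′ ≤ suc (length (I.L i)) → (∀ {c} → c ∈ I.C i → c ∈ C′) →
    (∃₂ λ B U₁ → U′ ↭ B ++ U₁ × length B ≤ b × deg u U₁ ≤ 0 × (∀ f a c → f ∈ U₁ → f ∈ U → Joins f a c → a ∈ C′ → c ∉ C′)) →
    ∃₂ λ B U″ → Reply U′ B U″ × I U″ (e ∷ M)
  attach {U} {M} {e} {U′} i p u v C′ j u∉C v∈C′ lC sub (B₁ , U₁ , p₁ , l₁ , du , cc) with reply-with B₁ {U₁} (I.well i) p p₁ l₁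
  ... | B , U″ , r , w″ , s₁ , sU , _ = B , U″ , r , st w″ (u ∷ L) C′ (Unique-∷ u∉L uL) lC noL′ (λ f a c m → cc f a c (s₁ m) (sU m)) star′ leaf′
    where
    open I i
    e∈U : e ∈ U
    e∈U = PermP.∈-resp-↭ (↭-sym p) (here refl)
    u∉L : u ∉ L
    u∉L = noL e u e∈U (joins-touchesˡ j)
    v∉L : v ∉ L
    v∉L = noL e v e∈U (joins-touchesʳ j)
    noL′ : ∀ f w → f ∈ U″ → Touches w f → w ∉ u ∷ L
    noL′ f w m t (here refl) = cnt-0 (touches? u) U₁ (n≤0⇒n≡0 du) f (s₁ m) t
    noL′ f w m t (there k) = noL f w (sU m) t k
    star′ : ∀ f → f ∈ e ∷ M → ∃₂ λ a c → Joins f a c × a ∈ u ∷ L × c ∈ C′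
    star′ f (here refl) = u , v , j , here refl , v∈C′
    star′ f (there m) = let (a , c , jf , aL , cC) = star f m in a , c , jf , there aL , sub cC
    fresh : ∀ f → f ∈ M → ¬ Touches u f
    fresh f m t with star f m
    ... | a , c , jf , aL , cC with touches-joins jf t
    ... | inj₁ refl = u∉L aL
    ... | inj₂ refl = u∉C cC
    leafe : ∀ w → w ∈ L → ¬ Touches w e
    leafe w m t with touches-joins j t
    ... | inj₁ refl = u∉L m
    ... | inj₂ refl = v∉L m
    leaf′ : ∀ f g w → f ∈ e ∷ M → g ∈ e ∷ M → w ∈ u ∷ L → Touches w f → Touches w g → f ≡ g
    leaf′ f g w (here refl) (here refl) _ _ _ = refl
    leaf′ f g w (here refl) (there m) (here refl) _ t = ⊥-elim (fresh g m t)
    leaf′ f g w (here refl) (there m) (there k) t _ = ⊥-elim (leafe w k t)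
    leaf′ f g w (there m) _ (here refl) t _ = ⊥-elim (fresh f m t)
    leaf′ f g w (there m) (here refl) (there k) _ t = ⊥-elim (leafe w k t)
    leaf′ f g w (there m) (there m′) (there k) t t′ = leaf f g w m m′ k t t′
  shrink : ∀ {U e U′} {P : Edge n → Set} (P? : Decidable P) → U ↭ e ∷ U′ → cnt P? U′ ≤ cnt P? U
  shrink {e = e} P? p = ≤-trans (m≤n+m _ (ind (P? e))) (≤-reflexive (sym (sumf-↭ _ p)))
  grow : ∀ {U M e U′} (i : I U M) → U ↭ e ∷ U′ → ∀ u v → Joins e u v → u ∉ I.C i → v ∈ I.C i → ∃₂ λ B U″ → Reply U′ B U″ × I U″ (e ∷ M)
  grow {U} {M} {e} {U′} i p u v j u∉C v∈C with trim (touches? u) n 0 U′ (≤-trans (shrink (touches? u) p) (≤-trans (m≤m+n _ 1) (≤-trans (deg<n u (uniqU (I.well i)) (ordU (I.well i))) (m≤m+n n 0))))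
  ... | B₁ , U₁ , p₁ , l₁ , c₁ = attach i p u v (I.C i) j u∉C v∈C (m≤n⇒m≤1+n (I.C≤L i)) id
    (B₁ , U₁ , p₁ , ≤-trans l₁ le , c₁ , λ f a c _ m → I.noC i f a c m)
  -- The new leaf has at most n - |L| free edges, as none of them leads to an old leaf, and the new
  -- centre has at most |C| ≤ |L| free edges to old centres. The two costs add up to at most n.
  create : ∀ {U M e U′} (i : I U M) → U ↭ e ∷ U′ → ∀ u v → Joins e u v → u ∉ I.C i → v ∉ I.C i → ∃₂ λ B U″ → Reply U′ B U″ × I U″ (e ∷ M)
  create {U} {M} {e} {U′} i p u v j u∉C v∉C with trim (touches? u) (deg u U) 0 U′ (≤-trans (shrink (touches? u) p) (m≤m+n _ 0))
  ... | B₁ , U₁ , p₁ , l₁ , c₁ with trim toC? (length C) 0 U₁ (≤-trans (cnt-↭-++ toC? B₁ p₁) (≤-trans (shrink toC? p) (≤-trans bound (m≤m+n _ 0))))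
    where
    open I i
    toC? : Decidable (λ f → Touches v f × other v f ∈ C)
    toC? f = touches? v f ×-dec any? (other v f FinP.≟_) C
    bound : cnt toC? U ≤ length C
    bound = cnt-inj toC? (other v) U C (uniqU well) (λ _ _ → proj₂) (λ f g mf mg (tf , _) (tg , _) → other-injective (ordU well mf) (ordU well mg) tf tg)
  ... | B₂ , U₂ , p₂ , l₂ , c₂ = attach i p u v (v ∷ C) j u∉C (here refl) (s≤s C≤L) there
      (B₁ ++ B₂ , U₂ , ↭-trans p₁ (↭-trans (PermP.++⁺ˡ B₁ p₂) (↭-reflexive (sym (++-assoc B₁ B₂ U₂)))) ,
        ≤-trans (≤-reflexive (length-++ B₁)) (≤-trans (+-mono-≤ l₁ (≤-trans l₂ C≤L)) (≤-trans (deg-bound u L (uniqU well) (ordU well) uL (λ m t → noL _ _ m (joins-touchesʳ (joins-other t)))) le)) ,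
        ≤-trans (cnt-↭-++ (touches? u) B₂ p₂) c₁ , cc)
    where
    open I i
    toC? : Decidable (λ f → Touches v f × other v f ∈ C)
    toC? f = touches? v f ×-dec any? (other v f FinP.≟_) C
    hit : ∀ f c → f ∈ U → Joins f v c → c ∈ C → Touches v f × other v f ∈ C
    hit f c m jf cC with touches-joins (joins-other (joins-touchesˡ jf)) (joins-touchesʳ jf)
    ... | inj₁ refl = ⊥-elim (ordered-≢ (ordU well m) jf refl)
    ... | inj₂ refl = joins-touchesˡ jf , cC
    swapJ : ∀ {f : Edge n} {a c} → Joins f a c → Joins f c a
    swapJ (inj₁ x) = inj₂ x
    swapJ (inj₂ x) = inj₁ x
    cc : ∀ f a c → f ∈ U₂ → f ∈ U → Joins f a c → a ∈ v ∷ C → c ∉ v ∷ C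
    cc f a c m mU jf (here refl) (here refl) = ordered-≢ (ordU well mU) jf refl
    cc f a c m mU jf (here refl) (there k) = cnt-0 toC? U₂ (n≤0⇒n≡0 c₂) f m (hit f c mU jf k)
    cc f a c m mU jf (there k) (here refl) = cnt-0 toC? U₂ (n≤0⇒n≡0 c₂) f m (hit f a mU (swapJ jf) k)
    cc f a c m mU jf (there k) (there k′) = noC f a c mU jf k k′
  reply : ∀ U M e U′ → I U M → U ↭ e ∷ U′ → ∃₂ λ B U″ → Reply U′ B U″ × I U″ (e ∷ M)
  reply U M e@(x , y) U′ i p with any? (x FinP.≟_) (I.C i) | any? (y FinP.≟_) (I.C i)
  ... | no x∉ | no y∉ = create i p x y (inj₁ refl) x∉ y∉
  ... | no x∉ | yes y∈ = grow i p x y (inj₁ refl) x∉ y∈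
  ... | yes x∈ | no y∉ = grow i p y x (inj₂ refl) y∉ x∈
  ... | yes x∈ | yes y∈ = ⊥-elim (I.noC i e x y (PermP.∈-resp-↭ (↭-sym p) (here refl)) (inj₁ refl) x∈ y∈)
  module BS = BreakerStrategy I end reply

-- Every edge is a bridge, witnessed by a 2-colouring in which it is the only edge with differently
-- coloured ends. This form is easily updated when two components are joined, and no walks in M have
-- to be handled.
Acyclic : ∀ {n} → List (Edge n) → Set
Acyclic {n} M = ∀ e → e ∈ M → ∃ λ (χ : Fin n → Bool) → χ (proj₁ e) ≢ χ (proj₂ e) × (∀ f → f ∈ M → f ≢ e → χ (proj₁ f) ≡ χ (proj₂ f))

-- If H has a cycle through x y, take the edge e of M between these branch sets and its colouring.
-- Following the rest of the cycle from the set of y back to the set of x uses only edges other than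
-- e, so both ends of e get the same colour.
acyclic-minor : ∀ {h n} (H : Graph h) (M : List (Edge n)) → Acyclic M → HasMinor H (graphOf M) → IsForest H
acyclic-minor H M ac (S , disj , ne , conn , cross) (x , y ∷ y′ ∷ ys , s≤s (s≤s z≤n) , u , (exy ∷ lk)) with cross x y exy
... | p , q , sp , sq , g with graphOf-joins g
... | e , me , je with ac e me
... | χ , differ , same = splits je (sym (crossing y y′ q (proj₁ (ne y′)) sq (proj₂ (ne y′)) (head lk) (λ { (inj₁ (e , _)) → y≢x e ; (inj₂ (_ , e)) → y′≢x e })
      ⟨t⟩ along y′ ys (tail lk) (proj₁ (ne y′)) (proj₂ (ne y′)) (λ z m → (λ { refl → Unique-head u (there m) }) , (λ { refl → Unique-head (Unique-tail u) m }))))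
  where
  _⟨t⟩_ : ∀ {a b c : Bool} → a ≡ b → b ≡ c → a ≡ c
  _⟨t⟩_ = trans
  splits : Joins e p q → χ p ≡ χ q → ⊥
  splits (inj₁ refl) eq = differ eq
  splits (inj₂ refl) eq = differ (sym eq)
  y≢x : y ≢ x
  y≢x refl = Unique-head u (here refl)
  y′≢x : y′ ≢ x
  y′≢x refl = Unique-head u (there (here refl))
  head : ∀ {R : _ → _ → Set} {a c zs} → Linked R (a ∷ c ∷ zs) → R a c
  head (r ∷ _) = r
  tail : ∀ {R : _ → _ → Set} {a c zs} → Linked R (a ∷ c ∷ zs) → Linked R (c ∷ zs)
  tail (_ ∷ l) = l
  -- Since branch sets are disjoint, an edge that does not run between those of `x` and `y` cannot
  -- be `e`.
  edge-step : ∀ a c u v → graphOf M u v → T (S a u) → T (S c v) → ¬ (a ≡ x × c ≡ y ⊎ a ≡ y × c ≡ x) → χ u ≡ χ v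
  edge-step a c u v guv su sv np with graphOf-joins guv
  ... | f , mf , jf with f ≟ᴱ e
  ... | no f≢e = join jf
    where
    join : Joins f u v → χ u ≡ χ v
    join (inj₁ refl) = same f mf f≢e
    join (inj₂ refl) = sym (same f mf f≢e)
  ... | yes refl = ⊥-elim (contra (touches-joins je (joins-touchesˡ jf)) (touches-joins je (joins-touchesʳ jf)))
    where
    contra : u ≡ p ⊎ u ≡ q → v ≡ p ⊎ v ≡ q → ⊥
    contra (inj₁ refl) (inj₂ refl) = np (inj₁ (disj _ _ _ su sp , disj _ _ _ sv sq))
    contra (inj₂ refl) (inj₁ refl) = np (inj₂ (disj _ _ _ su sq , disj _ _ _ sv sp))
    contra (inj₁ refl) (inj₁ refl) with touches-joins jf (joins-touchesʳ je)
    ... | inj₁ refl = y≢x (disj _ _ _ sq sp)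
    ... | inj₂ refl = y≢x (disj _ _ _ sq sp)
    contra (inj₂ refl) (inj₂ refl) with touches-joins jf (joins-touchesˡ je)
    ... | inj₁ refl = y≢x (disj _ _ _ sq sp)
    ... | inj₂ refl = y≢x (disj _ _ _ sq sp)
  constant : ∀ a {u v} → WalkIn (graphOf M) (λ z → T (S a z)) u v → T (S a u) → χ u ≡ χ v
  constant a here _ = refl
  constant a (step guz sz w) su = trans (edge-step a a _ _ guz su sz (λ { (inj₁ (refl , refl)) → y≢x refl ; (inj₂ (refl , refl)) → y≢x refl })) (constant a w sz)
  crossing : ∀ a c u v → T (S a u) → T (S c v) → T (adj H a c) → ¬ (a ≡ x × c ≡ y ⊎ a ≡ y × c ≡ x) → χ u ≡ χ v
  crossing a c u v su sv eac np with cross a c eac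
  ... | u′ , v′ , su′ , sv′ , guv = trans (constant a (conn a u u′ su su′) su) (trans (edge-step a c u′ v′ guv su′ sv′ np) (constant c (conn c v′ v sv′ sv) sv′))
  along : ∀ a zs → Linked (λ a b → T (adj H a b)) (a ∷ zs ++ [ x ]) → ∀ u → T (S a u) → (∀ z → z ∈ a ∷ zs → z ≢ x × z ≢ y) → χ u ≡ χ p
  along a [] l u su h = crossing a x u p su sp (head l) (λ { (inj₁ (e , _)) → proj₁ (h a (here refl)) e ; (inj₂ (e , _)) → proj₂ (h a (here refl)) e })
  along a (c ∷ zs) l u su h = trans (crossing a c u (proj₁ (ne c)) su (proj₂ (ne c)) (head l) (λ { (inj₁ (e , _)) → proj₁ (h a (here refl)) e ; (inj₂ (e , _)) → proj₂ (h a (here refl)) e }))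
    (along c zs (tail l) (proj₁ (ne c)) (proj₂ (ne c)) (λ z m → h z (there m)))

if-yes : ∀ {A P : Set} (d : Dec P) {a c : A} → P → (if does d then a else c) ≡ a
if-yes (yes _) _ = refl
if-yes (no ne) p = ⊥-elim (ne p)

if-no : ∀ {A P : Set} (d : Dec P) {a c : A} → ¬ P → (if does d then a else c) ≡ c
if-no (yes p) ne = ⊥-elim (ne p)
if-no (no _) _ = refl

half-lt : ∀ {m} k → m < 2 * k → ⌊ m /2⌋ < k
half-lt {zero} (suc k) _ = s≤s z≤n
half-lt {suc zero} (suc k) _ = s≤s z≤n
half-lt {suc (suc m)} (suc k) lt = s≤s (half-lt k (≤-pred (≤-pred (≤-trans lt (≤-reflexive (lem k))))))
  where
  lem : ∀ k → 2 * suc k ≡ suc (suc (2 * k))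
  lem = solve-∀

parity : ℕ → Bool
parity zero = false
parity (suc m) = not (parity m)

half-parity : ∀ m k → ⌊ m /2⌋ ≡ ⌊ k /2⌋ → parity m ≡ parity k → m ≡ k
half-parity zero zero _ _ = refl
half-parity zero (suc zero) _ ()
half-parity (suc zero) zero _ ()
half-parity (suc zero) (suc zero) _ _ = refl
half-parity (suc zero) (suc (suc k)) () _
half-parity zero (suc (suc k)) () _
half-parity (suc (suc m)) zero () _
half-parity (suc (suc m)) (suc zero) () _
half-parity (suc (suc m)) (suc (suc k)) h p = cong (suc ∘ suc) (half-parity m k (suc-injective h) (trans (sym (not-involutive (parity m))) (trans p (not-involutive (parity k)))))
  where open import Data.Bool.Properties using (not-involutive)

-- The board is partitioned into double stars: class i has the two centres 2i and 2i+1, and each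
-- other vertex sends one edge of this class to one of them.
module _ {n : ℕ} where

  private
    hf : Fin n → ℕ
    hf x = ⌊ toℕ x /2⌋
    pr : Fin n → Bool
    pr x = parity (toℕ x)

    fin-≡ : ∀ {x y : Fin n} → hf x ≡ hf y → pr x ≡ pr y → x ≡ y
    fin-≡ h p = FinP.toℕ-injective (half-parity _ _ h p)

    _≟ᵇ_ : (a c : Bool) → Dec (a ≡ c)
    _≟ᵇ_ = Data.Bool._≟_
      where import Data.Bool

  -- For an ordered edge: ends of equal parity give the class of the smaller end, ends of different
  -- parity that of the larger one. So in class i a vertex beyond the pair 2i, 2i + 1 is joined to
  -- the centre of its own parity, and a vertex before the pair to the centre of the other parity.
  colour : Edge n → ℕ
  colour (x , y) = if does (pr x ≟ᵇ pr y) then hf x else hf y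

  -- Even centre 0, odd centre 1, all others 2. Within a class every vertex then has at most one
  -- descending edge: a leaf the one to its centre, the odd centre the one to the even centre.
  rank₀ : ℕ → Fin n → ℕ
  rank₀ i x = if does (hf x Nat.≟ i) then (if pr x then 1 else 0) else 2

  Down : (ℕ → Fin n → ℕ) → Edge n → Fin n → Fin n → Set
  Down ρ f v u = Joins f v u × ρ (colour f) u < ρ (colour f) v

  private
    rank-centre : ∀ i x → hf x ≡ i → rank₀ i x ≡ (if pr x then 1 else 0)
    rank-centre i x e = if-yes (hf x Nat.≟ i) e

    rank-leaf : ∀ i x → hf x ≢ i → rank₀ i x ≡ 2
    rank-leaf i x ne = if-no (hf x Nat.≟ i) ne

    bit≤1 : ∀ b → (if b then 1 else 0) ≤ 1
    bit≤1 true = ≤-refl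
    bit≤1 false = z≤n

    bit-inj : ∀ a b → (if a then 1 else 0) ≡ (if b then 1 else 0) → a ≡ b
    bit-inj true true _ = refl
    bit-inj false false _ = refl

    bits : ∀ a b → (if a then 1 else 0) < (if b then 1 else 0) → a ≢ b
    bits a b lt refl = <-irrefl refl lt

    ≢-not : ∀ {a b c : Bool} → a ≢ b → c ≢ b → a ≡ c
    ≢-not {true} {true} ne _ = ⊥-elim (ne refl)
    ≢-not {true} {false} {true} _ _ = refl
    ≢-not {true} {false} {false} _ ne = ⊥-elim (ne refl)
    ≢-not {false} {false} ne _ = ⊥-elim (ne refl)
    ≢-not {false} {true} {false} _ _ = refl
    ≢-not {false} {true} {true} _ ne = ⊥-elim (ne refl)

  colour-cases : ∀ x y → (pr x ≡ pr y × colour (x , y) ≡ hf x) ⊎ (pr x ≢ pr y × colour (x , y) ≡ hf y)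
  colour-cases x y with pr x ≟ᵇ pr y
  ... | yes e = inj₁ (e , refl)
  ... | no ne = inj₂ (ne , refl)

  colour-bound : ∀ k → n ≤ 2 * k → ∀ f → colour f < k
  colour-bound k le (x , y) with colour-cases x y
  ... | inj₁ (_ , e) = subst (_< k) (sym e) (half-lt k (<-≤-trans (FinP.toℕ<n x) le))
  ... | inj₂ (_ , e) = subst (_< k) (sym e) (half-lt k (<-≤-trans (FinP.toℕ<n y) le))

  rank₀-differ : ∀ f → Ordered f → rank₀ (colour f) (proj₁ f) ≢ rank₀ (colour f) (proj₂ f)
  rank₀-differ (x , y) o eq with colour-cases x y
  ... | inj₁ (p , c) rewrite c | rank-centre (hf x) x refl | rank-leaf (hf x) y (λ h → <⇒≢ o (cong toℕ (fin-≡ {x} {y} (sym h) p))) =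
    <⇒≱ (s≤s (bit≤1 (pr x))) (≤-reflexive (sym eq))
  ... | inj₂ (ne , c) rewrite c with hf x Nat.≟ hf y
  ... | yes h rewrite rank-centre (hf y) x h | rank-centre (hf y) y refl = ne (bit-inj _ _ eq)
  ... | no h rewrite rank-leaf (hf y) x h | rank-centre (hf y) y refl = <⇒≱ (s≤s (bit≤1 (pr y))) (≤-reflexive eq)

  down-end : ∀ f v u → Ordered f → Down rank₀ f v u → hf u ≡ colour f ×
    ((toℕ u < toℕ v × pr u ≡ pr v × hf v ≢ colour f) ⊎ (pr u ≢ pr v × (hf v ≡ colour f ⊎ toℕ v < toℕ u)))
  down-end (x , y) .x .y o (inj₁ refl , lt) with colour-cases x y
  ... | inj₁ (p , c) rewrite c | rank-centre (hf x) x refl | rank-leaf (hf x) y (λ h → <⇒≢ o (cong toℕ (fin-≡ {x} {y} (sym h) p))) = ⊥-elim (<⇒≱ (<-trans lt (s≤s (bit≤1 (pr x)))) ≤-refl)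
  ... | inj₂ (ne , c) rewrite c = refl , inj₂ ((λ e → ne (sym e)) , inj₂ o)
  down-end (x , y) .y .x o (inj₂ refl , lt) with colour-cases x y
  ... | inj₁ (p , c) rewrite c = refl , inj₁ (o , p , λ h → <⇒≢ o (cong toℕ (fin-≡ {x} {y} (sym h) p)))
  ... | inj₂ (ne , c) rewrite c with hf x Nat.≟ hf y
  ... | yes h = h , inj₂ (ne , inj₁ refl)
  ... | no h rewrite rank-leaf (hf y) x h | rank-centre (hf y) y refl = ⊥-elim (<⇒≱ (<-trans lt (s≤s (bit≤1 (pr y)))) ≤-refl)

  -- The lower end is a centre of the class, and its parity is determined by that of `v` and by the
  -- position of `v` before, in or beyond the pair of centres.
  down-unique : ∀ f g v u w → Ordered f → Ordered g → colour f ≡ colour g → Down rank₀ f v u → Down rank₀ g v w → f ≡ g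
  down-unique f g v u w of og cc df dg with down-end f v u of df | down-end g v w og dg
  ... | hu , cu | hw , cw = ordered-joins-unique of og (proj₁ df) (subst (Joins g v) (sym (same cu cw)) (proj₁ dg))
    where
    huw : hf u ≡ hf w
    huw = trans hu (trans cc (sym hw))
    hmono : ∀ {a c} → toℕ {n} a < toℕ {n} c → hf a ≤ hf c
    hmono lt = ⌊n/2⌋-mono (<⇒≤ lt)
    same : _ → _ → u ≡ w
    same (inj₁ (_ , p , _)) (inj₁ (_ , q , _)) = fin-≡ huw (trans p (sym q))
    same (inj₂ (p , _)) (inj₂ (q , _)) = fin-≡ huw (≢-not p q)
    same (inj₁ (_ , _ , ne)) (inj₂ (_ , inj₁ h)) = ⊥-elim (ne (trans h (sym cc)))
    same (inj₂ (_ , inj₁ h)) (inj₁ (_ , _ , ne)) = ⊥-elim (ne (trans h cc))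
    same (inj₁ (lt , _ , ne)) (inj₂ (_ , inj₂ gt)) = ⊥-elim (ne (trans (≤-antisym (≤-trans (hmono gt) (≤-reflexive (sym huw))) (hmono lt)) hu))
    same (inj₂ (_ , inj₂ gt)) (inj₁ (lt , _ , ne)) = ⊥-elim (ne (trans (≤-antisym (≤-trans (hmono gt) (≤-reflexive huw)) (hmono lt)) hw))

-- comp labels the components of Maker's graph. For each class i, ρ i is a rank function constant on
-- components such that every free edge of class i joins different ranks, and every component has at
-- most one free edge of class i leading down. After Maker joins two components, Breaker claims for
-- each class the down edge of the component of larger rank; for the class of Maker's own edge, this
-- is that very edge, so b claims suffice.
breaker-forest : ∀ {h n b} (H : Graph h) → n ≤ 2 * suc b → ¬ IsForest H → BreakerWins H b n
breaker-forest {h} {n} {b} H le nf = BS.clever-loses start , λ v → BS.random-loses v start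
  where
  open Game {h} {n} H b using (Edges; Reply; module BreakerStrategy)
  record I (U M : Edges) : Set where
    constructor st
    field
      well : WF b U M
      comp : Fin n → Fin n
      ρ : ℕ → Fin n → ℕ
      compM : ∀ f → f ∈ M → comp (proj₁ f) ≡ comp (proj₂ f)
      ρcomp : ∀ i u v → comp u ≡ comp v → ρ i u ≡ ρ i v
      differ : ∀ f → f ∈ U → ρ (colour f) (proj₁ f) ≢ ρ (colour f) (proj₂ f)
      unique : ∀ f g v u v′ u′ → f ∈ U → g ∈ U → colour f ≡ colour g → Down ρ f v u → Down ρ g v′ u′ → comp v ≡ comp v′ → f ≡ g
      acyclic : Acyclic M
  start : I (board n) []
  start = st wf-start id rank₀ (λ _ ()) (λ { i u .u refl → refl }) (λ f m → rank₀-differ f (board-ordered m))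
    (λ { f g v u .v u′ m m′ c d d′ refl → down-unique f g v u u′ (board-ordered m) (board-ordered m′) c d d′ }) (λ _ ())
  end : ∀ M → I [] M → ¬ HasMinor H (graphOf M)
  end M i m = nf (acyclic-minor H M (I.acyclic i) m)
  reply : ∀ U M e U′ → I U M → U ↭ e ∷ U′ → ∃₂ λ B U″ → Reply U′ B U″ × I U″ (e ∷ M)
  reply U M e@(x , y) U′ i p = result
    where
    open I i
    e∈U : e ∈ U
    e∈U = PermP.∈-resp-↭ (↭-sym p) (here refl)
    -- In classes other than that of `e` the two ranks may agree; the tie is broken arbitrarily,
    -- with y as the upper end.
    hi lo : ℕ → Fin n
    hi c = if does (ρ c y <? ρ c x) then x else y
    lo c = if does (ρ c y <? ρ c x) then y else x
    lohi : ∀ c → (hi c ≡ x × lo c ≡ y × ρ c y < ρ c x) ⊎ (hi c ≡ y × lo c ≡ x × ρ c x ≤ ρ c y)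
    lohi c = go′ (ρ c y <? ρ c x)
      where
      go′ : Dec (ρ c y < ρ c x) → _
      go′ (yes l) = inj₁ (if-yes (ρ c y <? ρ c x) l , if-yes (ρ c y <? ρ c x) l , l)
      go′ (no l) = inj₂ (if-no (ρ c y <? ρ c x) l , if-no (ρ c y <? ρ c x) l , ≮⇒≥ l)
    Kill : Edge n → Set
    Kill f = (comp (proj₁ f) ≡ comp (hi (colour f)) × ρ (colour f) (proj₂ f) < ρ (colour f) (proj₁ f)) ⊎ (comp (proj₂ f) ≡ comp (hi (colour f)) × ρ (colour f) (proj₁ f) < ρ (colour f) (proj₂ f))
    kill? : Decidable Kill
    kill? f = (comp (proj₁ f) FinP.≟ comp (hi (colour f)) ×-dec ρ (colour f) (proj₂ f) <? ρ (colour f) (proj₁ f)) ⊎-dec (comp (proj₂ f) FinP.≟ comp (hi (colour f)) ×-dec ρ (colour f) (proj₁ f) <? ρ (colour f) (proj₂ f))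
    kill-down : ∀ {f} → Kill f → ∃₂ λ v u → Down ρ f v u × comp v ≡ comp (hi (colour f))
    kill-down (inj₁ (c , lt)) = _ , _ , (inj₁ refl , lt) , c
    kill-down (inj₂ (c , lt)) = _ , _ , (inj₂ refl , lt) , c
    down-kill : ∀ {f v u} → Down ρ f v u → comp v ≡ comp (hi (colour f)) → Kill f
    down-kill (inj₁ refl , lt) c = inj₁ (c , lt)
    down-kill (inj₂ refl , lt) c = inj₂ (c , lt)
    kill-e : Kill e
    kill-e with lohi (colour e)
    ... | inj₁ (h , _ , lt) = inj₁ (cong comp (sym h) , lt)
    ... | inj₂ (h , _ , l) = inj₂ (cong comp (sym h) , ≤∧≢⇒< l (differ e e∈U))
    kill-count : cnt kill? U ≤ suc b
    kill-count = subst (cnt kill? U ≤_) (length-upTo (suc b)) (cnt-inj kill? colour U (upTo (suc b)) (uniqU well) (λ f _ _ → ∈-upTo⁺ (colour-bound (suc b) le f))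
      (λ f g mf mg kf kg cc → let (v , u , d , c) = kill-down kf ; (v′ , u′ , d′ , c′) = kill-down kg in unique f g v u v′ u′ mf mg cc d d′ (trans c (trans (cong (comp ∘ hi) cc) (sym c′)))))
      where open import Data.List.Properties using (length-upTo)
    count′ : cnt kill? U′ ≤ b + 0
    count′ = ≤-trans (≤-pred (≤-trans (≤-reflexive (trans (cong (_+ cnt kill? U′) (sym (ind-yes (kill? e) kill-e))) (sym (sumf-↭ _ p)))) kill-count)) (m≤m+n b 0)
    comp-xy : comp x ≢ comp y
    comp-xy c = differ e e∈U (ρcomp _ x y c)
    Merged : Fin n → Set
    Merged z = comp z ≡ comp x ⊎ comp z ≡ comp y
    merged? : Decidable Merged
    merged? z = (comp z FinP.≟ comp x) ⊎-dec (comp z FinP.≟ comp y)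
    comp′ : Fin n → Fin n
    comp′ z = if does (merged? z) then comp x else comp z
    ρ′ : ℕ → Fin n → ℕ
    ρ′ c z = if does (merged? z) then ρ c (lo c) else ρ c z
    comp-m : ∀ {z} → Merged z → comp′ z ≡ comp x
    comp-m {z} m = if-yes (merged? z) m
    comp-n : ∀ {z} → ¬ Merged z → comp′ z ≡ comp z
    comp-n {z} m = if-no (merged? z) m
    ρ-m : ∀ c {z} → Merged z → ρ′ c z ≡ ρ c (lo c)
    ρ-m c {z} m = if-yes (merged? z) m
    ρ-n : ∀ c {z} → ¬ Merged z → ρ′ c z ≡ ρ c z
    ρ-n c {z} m = if-no (merged? z) m
    comp′-≡ : ∀ u v → comp′ u ≡ comp′ v → (Merged u × Merged v) ⊎ (¬ Merged u × ¬ Merged v × comp u ≡ comp v)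
    comp′-≡ u v eq with merged? u | merged? v
    ... | yes a | yes c = inj₁ (a , c)
    ... | yes a | no c = ⊥-elim (c (inj₁ (trans (sym (comp-n c)) (trans (sym eq) (comp-m a)))))
    ... | no a | yes c = ⊥-elim (a (inj₁ (trans (sym (comp-n a)) (trans eq (comp-m c)))))
    ... | no a | no c = inj₂ (a , c , trans (sym (comp-n a)) (trans eq (comp-n c)))
    comp-mono : ∀ u v → comp u ≡ comp v → comp′ u ≡ comp′ v
    comp-mono u v eq with merged? u | merged? v
    ... | yes a | yes c = trans (comp-m a) (sym (comp-m c))
    ... | yes a | no c = ⊥-elim (c (subst (λ k → k ≡ comp x ⊎ k ≡ comp y) eq a))
    ... | no a | yes c = ⊥-elim (a (subst (λ k → k ≡ comp x ⊎ k ≡ comp y) (sym eq) c))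
    ... | no a | no c = trans (comp-n a) (trans eq (sym (comp-n c)))
    ρ′≤ρ : ∀ c z → ρ′ c z ≤ ρ c z
    ρ′≤ρ c z with merged? z
    ... | no nm = ≤-reflexive (ρ-n c nm)
    ... | yes m with lohi c | m
    ... | inj₁ (_ , l , lt) | inj₁ e = ≤-trans (≤-reflexive (trans (ρ-m c m) (cong (ρ c) l))) (≤-trans (<⇒≤ lt) (≤-reflexive (ρcomp c x z (sym e))))
    ... | inj₁ (_ , l , lt) | inj₂ e = ≤-trans (≤-reflexive (trans (ρ-m c m) (cong (ρ c) l))) (≤-reflexive (ρcomp c y z (sym e)))
    ... | inj₂ (_ , l , lt) | inj₁ e = ≤-trans (≤-reflexive (trans (ρ-m c m) (cong (ρ c) l))) (≤-reflexive (ρcomp c x z (sym e)))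
    ... | inj₂ (_ , l , lt) | inj₂ e = ≤-trans (≤-reflexive (trans (ρ-m c m) (cong (ρ c) l))) (≤-trans lt (≤-reflexive (ρcomp c y z (sym e))))
    to-lo : ∀ c z → Merged z → comp z ≢ comp (hi c) → comp z ≡ comp (lo c)
    to-lo c z m ne with lohi c | m
    ... | inj₁ (h , l , _) | inj₁ e = ⊥-elim (ne (trans e (cong comp (sym h))))
    ... | inj₁ (h , l , _) | inj₂ e = trans e (cong comp (sym l))
    ... | inj₂ (h , l , _) | inj₁ e = trans e (cong comp (sym l))
    ... | inj₂ (h , l , _) | inj₂ e = ⊥-elim (ne (trans e (cong comp (sym h))))
    -- Merging never raises a rank, and the upper end of a surviving edge keeps its own: either it
    -- is not merged, or it belongs to the component whose rank the union inherits. So surviving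
    -- edges keep their direction.
    down-step : ∀ f v u → ¬ Kill f → Down ρ f v u → Down ρ′ f v u
    down-step f v u nk d@(j , lt) = j , ≤-<-trans (ρ′≤ρ c u) (subst (ρ c u <_) (sym top) lt)
      where
      c = colour f
      top : ρ′ c v ≡ ρ c v
      top with merged? v
      ... | no nm = ρ-n c nm
      ... | yes m = trans (ρ-m c m) $ ρcomp c (lo c) v (sym (to-lo c v m (λ eq → nk (down-kill d eq))))
    orient : ∀ f → f ∈ U → ∃₂ λ v u → Down ρ f v u
    orient f m with <-cmp (ρ (colour f) (proj₁ f)) (ρ (colour f) (proj₂ f))
    ... | tri< lt _ _ = _ , _ , inj₂ refl , lt
    ... | tri≈ _ eq _ = ⊥-elim (differ f m eq)
    ... | tri> _ _ gt = _ , _ , inj₁ refl , gt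
    down-back : ∀ f v u → f ∈ U → ¬ Kill f → Down ρ′ f v u → Down ρ f v u
    down-back f v u m nk (j , lt) with orient f m
    ... | a , c , d@(j′ , _) with down-step f a c nk d
    ... | _ , lt′ with touches-joins j′ (joins-touchesˡ j) | touches-joins j′ (joins-touchesʳ j)
    ... | inj₁ refl | inj₂ refl = d
    ... | inj₁ refl | inj₁ refl = ⊥-elim (<-irrefl refl lt)
    ... | inj₂ refl | inj₂ refl = ⊥-elim (<-irrefl refl lt)
    ... | inj₂ refl | inj₁ refl = ⊥-elim (<-asym lt lt′)
    -- The component of `y` separates the new edge. An old colouring in which the new edge is not
    -- monochromatic is flipped on that component, which changes no old edge.
    acyclic′ : Acyclic (e ∷ M)
    acyclic′ f (here refl) = (λ z → does (comp z FinP.≟ comp y)) , (λ eq → comp-xy (T→ (comp x FinP.≟ comp y) (subst T (sym eq) (T← (comp y FinP.≟ comp y) refl)))) ,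
      λ { g (here refl) ne → ⊥-elim (ne refl) ; g (there m) _ → cong (λ k → does (k FinP.≟ comp y)) (compM g m) }
    acyclic′ f (there m) with acyclic f m
    ... | χ , d , s with Data.Bool._≟_ (χ x) (χ y)
      where import Data.Bool
    ... | yes eq = χ , d , λ { g (here refl) _ → eq ; g (there m′) ne → s g m′ ne }
    ... | no neq = χ′ , (λ eq → d (flip-inj (does (comp (proj₁ f) FinP.≟ comp y)) (trans eq (cong (λ k → if k then not (χ (proj₂ f)) else χ (proj₂ f)) (cong (λ k → does (k FinP.≟ comp y)) (sym (compM f m))))))) ,
      λ { g (here refl) _ → at-e ; g (there m′) ne → cong₂ (λ k c → if k then not c else c) (cong (λ k → does (k FinP.≟ comp y)) (compM g m′)) (s g m′ ne) }
      where
      χ′ : Fin n → Bool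
      χ′ z = if does (comp z FinP.≟ comp y) then not (χ z) else χ z
      flip-inj : ∀ k {a c} → (if k then not a else a) ≡ (if k then not c else c) → a ≡ c
      flip-inj true {true} {true} _ = refl
      flip-inj true {false} {false} _ = refl
      flip-inj false eq = eq
      neq-not : ∀ {a c} → a ≢ c → a ≡ not c
      neq-not {true} {true} ne = ⊥-elim (ne refl)
      neq-not {true} {false} _ = refl
      neq-not {false} {true} _ = refl
      neq-not {false} {false} ne = ⊥-elim (ne refl)
      at-e : χ′ x ≡ χ′ y
      at-e = trans (if-no (comp x FinP.≟ comp y) comp-xy) (trans (neq-not neq) (sym (if-yes (comp y FinP.≟ comp y) refl)))
    result : ∃₂ λ B U″ → Reply U′ B U″ × I U″ (e ∷ M)
    result with trim kill? b 0 U′ count′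
    ... | B₁ , U₁ , p₁ , l₁ , c₁ with reply-with B₁ {U₁} well p p₁ l₁
    ... | B , U″ , r , w″ , s₁ , sU , _ = B , U″ , r , st w″ comp′ ρ′ compM′ ρcomp′ differ′ unique′ acyclic′
      where
      live : ∀ f → f ∈ U″ → ¬ Kill f
      live f m = cnt-0 kill? U₁ (n≤0⇒n≡0 c₁) f (s₁ m)
      compM′ : ∀ f → f ∈ e ∷ M → comp′ (proj₁ f) ≡ comp′ (proj₂ f)
      compM′ f (here refl) = trans (comp-m {x} (inj₁ refl)) (sym (comp-m {y} (inj₂ refl)))
      compM′ f (there m) = comp-mono _ _ (compM f m)
      ρcomp′ : ∀ c u v → comp′ u ≡ comp′ v → ρ′ c u ≡ ρ′ c v
      ρcomp′ c u v eq with comp′-≡ u v eq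
      ... | inj₁ (mu , mv) = trans (ρ-m c mu) (sym (ρ-m c mv))
      ... | inj₂ (nu , nv , eq′) = trans (ρ-n c nu) (trans (ρcomp c u v eq′) (sym (ρ-n c nv)))
      differ′ : ∀ f → f ∈ U″ → ρ′ (colour f) (proj₁ f) ≢ ρ′ (colour f) (proj₂ f)
      differ′ f m eq with orient f (sU m)
      ... | v , u , d with down-step f v u (live f m) d
      ... | inj₁ refl , lt = <⇒≢ lt (sym eq)
      ... | inj₂ refl , lt = <⇒≢ lt eq
      unique′ : ∀ f g v u v′ u′ → f ∈ U″ → g ∈ U″ → colour f ≡ colour g → Down ρ′ f v u → Down ρ′ g v′ u′ → comp′ v ≡ comp′ v′ → f ≡ g
      unique′ f g v u v′ u′ mf mg cc df dg eq = unique f g v u v′ u′ (sU mf) (sU mg) cc df₀ dg₀ same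
        where
        df₀ = down-back f v u (sU mf) (live f mf) df
        dg₀ = down-back g v′ u′ (sU mg) (live g mg) dg
        same : comp v ≡ comp v′
        same with comp′-≡ v v′ eq
        ... | inj₂ (_ , _ , e) = e
        ... | inj₁ (mv , mv′) = trans (to-lo (colour f) v mv (λ e → live f mf (down-kill df₀ e)))
          (trans (cong (comp ∘ lo) cc) (sym (to-lo (colour g) v′ mv′ (λ e → live g mg (down-kill dg₀ e)))))
  module BS = BreakerStrategy I end reply

-- Subgraphs forced by the size of a component

T-∨ : ∀ {a b} → T (a ∨ b) → T a ⊎ T b
T-∨ {true} t = inj₁ t
T-∨ {false} t = inj₂ t

reach-ind : ∀ {k} (H : Graph k) {v} (P : Fin k → Set) → P v → (∀ u w → P u → T (adj H u w) → P w) → ∀ m w → T (reachB H m v w) → P w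
reach-ind H {v} P base stp zero w t with T→ (v FinP.≟ w) t
... | refl = base
reach-ind {k} H {v} P base stp (suc m) w t with T-∨ {reachB H m v w} t
... | inj₁ t′ = reach-ind H P base stp m w t′
... | inj₂ t′ with find (AnyP.any⁻ (λ u → reachB H m v u ∧ adj H u w) (allFin k) t′)
... | u , _ , t″ = stp u w (reach-ind H P base stp m u (proj₁ (T-∧ {reachB H m v u} t″))) (proj₂ (T-∧ {reachB H m v u} t″))

module _ {k : ℕ} (H : Graph k) where

  CompEdge : Fin k → Fin k × Fin k → Set
  CompEdge v p = T ((toℕ (proj₁ p) <ᵇ toℕ (proj₂ p)) ∧ adj H (proj₁ p) (proj₂ p) ∧ reachB H k v (proj₁ p))

  compEdge? : ∀ v → Decidable (CompEdge v)
  compEdge? v p = T? _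

  compEdges-cnt : ∀ v → compEdges H v ≡ cnt (compEdge? v) (pairs k)
  compEdges-cnt v = countTrue-cnt _ (pairs k)

  τ-witness : ∀ m → suc m ≤ τ H → ∃[ v ] suc m ≤ compEdges H v
  τ-witness m = search (allFin k)
    where
    search : ∀ vs → suc m ≤ foldr (λ v acc → compEdges H v ⊔ acc) 0 vs → ∃[ v ] suc m ≤ compEdges H v
    search (v ∷ vs) le with ⊔-sel (compEdges H v) (foldr (λ v acc → compEdges H v ⊔ acc) 0 vs)
    ... | inj₁ e = v , subst (suc m ≤_) e le
    ... | inj₂ e = search vs (subst (suc m ≤_) e le)

  compEdge-parts : ∀ {v i j} → CompEdge v (i , j) → toℕ i < toℕ j × T (adj H i j) × T (reachB H k v i)
  compEdge-parts {v} {i} {j} t = let (a , c) = T-∧ {toℕ i <ᵇ toℕ j} t ; (d , e) = T-∧ {adj H i j} c in <ᵇ⇒< (toℕ i) (toℕ j) a , d , e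

  cherry? : Dec (Cherry H)
  cherry? = FinP.any? λ v → FinP.any? λ a → FinP.any? λ c → ¬? (a FinP.≟ c) ×-dec T? (adj H v a) ×-dec T? (adj H v c)

  p₄? : Dec (P₄ H)
  p₄? = FinP.any? λ a → FinP.any? λ v → FinP.any? λ w → FinP.any? λ d →
    (¬? (a FinP.≟ v) ×-dec ¬? (a FinP.≟ w) ×-dec ¬? (a FinP.≟ d) ×-dec ¬? (v FinP.≟ w) ×-dec ¬? (v FinP.≟ d) ×-dec ¬? (w FinP.≟ d)) ×-dec T? (adj H a v) ×-dec T? (adj H v w) ×-dec T? (adj H w d)

  -- Without a cherry all degrees are at most 1, so from `v` only `v` and one neighbour are reached.
  τ≥2⇒cherry : 2 ≤ τ H → Cherry H
  τ≥2⇒cherry le with cherry?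
  ... | yes ch = ch
  ... | no ¬ch with τ-witness 1 le
  ... | v , le′ = ⊥-elim (<⇒≱ le′ (≤-trans (≤-reflexive (compEdges-cnt v)) (cnt≤1 (compEdge? v) (pairs k) (pairs-unique k)
          (λ { (i , j) (i′ , j′) _ _ t t′ → same (i , j) (i′ , j′) t t′ }))))
    where
    leaf : ∀ x p q → T (adj H x p) → T (adj H x q) → p ≡ q
    leaf x p q a c with p FinP.≟ q
    ... | yes e = e
    ... | no ne = ⊥-elim (¬ch (x , p , q , ne , a , c))
    near : ∀ i → T (reachB H k v i) → i ≡ v ⊎ T (adj H v i)
    near = reach-ind H (λ i → i ≡ v ⊎ T (adj H v i)) (inj₁ refl) (λ { u w (inj₁ refl) a → inj₂ a ; u w (inj₂ a) c → inj₁ (leaf u w v c (adj-sym H a)) }) k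
    form : ∀ p → CompEdge v p → ∃[ w ] (Joins p v w × T (adj H v w))
    form (i , j) t with compEdge-parts {v} {i} {j} t
    ... | _ , a , r with near i r
    ... | inj₁ refl = j , inj₁ refl , a
    ... | inj₂ c with leaf i j v a (adj-sym H c)
    ... | refl = i , inj₂ refl , c
    same : ∀ p q → CompEdge v p → CompEdge v q → p ≡ q
    same p q t t′ with form p t | form q t′
    ... | w , j , a | w′ , j′ , a′ with leaf v w w′ a a′
    ... | refl = ordered-joins-unique (proj₁ (compEdge-parts {v} t)) (proj₁ (compEdge-parts {v} t′)) j j′

  triangle-free : IsForest H → ∀ a c d → T (adj H a c) → T (adj H c d) → T (adj H d a) → ⊥
  triangle-free f a c d x y z = f (a , c ∷ d ∷ [] , s≤s (s≤s z≤n) , ((adj-≢ H x ∷ (λ e → adj-≢ H z (sym e)) ∷ []) ∷ (adj-≢ H y ∷ []) ∷ [] ∷ []) , x ∷ y ∷ z ∷ [-])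

  -- The centre is `v` if it has two neighbours, otherwise its only neighbour. A way of length 2 out
  -- of the centre would extend backwards to a path on four vertices.
  star-component : IsForest H → ¬ P₄ H → ∀ v → ∃[ c ] (∀ p → CompEdge v p → ∃[ w ] (Joins p c w × T (adj H c w)))
  star-component f ¬p v = pick (FinP.any? λ a → FinP.any? λ d → ¬? (a FinP.≟ d) ×-dec T? (adj H v a) ×-dec T? (adj H v d)) (FinP.any? λ a → T? (adj H v a))
    where
    -- The vertex `a` is the missing first vertex of the path a, c, u, w.
    Spare : Fin k → Set
    Spare c = ∀ u w → T (adj H c u) → T (adj H u w) → w ≢ c → ∃[ a ] (T (adj H c a) × a ≢ u × a ≢ w)
    from : ∀ c → v ≡ c ⊎ T (adj H c v) → Spare c → ∃[ c ] (∀ p → CompEdge v p → ∃[ w ] (Joins p c w × T (adj H c w)))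
    from c base spare = c , λ { (i , j) t → let (_ , a , r) = compEdge-parts {v} {i} {j} t in form i j a (reach-ind H (λ i → i ≡ c ⊎ T (adj H c i)) base reach-step k i r) }
      where
      no-exit : ∀ u w → T (adj H c u) → T (adj H u w) → w ≢ c → ⊥
      no-exit u w cu uw ne with spare u w cu uw ne
      ... | a , ca , a≢u , a≢w = ¬p (a , c , u , w , ((λ e → adj-≢ H ca (sym e)) , a≢u , a≢w , adj-≢ H cu , (λ e → ne (sym e)) , adj-≢ H uw) , adj-sym H ca , cu , uw)
      reach-step : ∀ u w → u ≡ c ⊎ T (adj H c u) → T (adj H u w) → w ≡ c ⊎ T (adj H c w)
      reach-step u w (inj₁ refl) a = inj₂ a
      reach-step u w (inj₂ cu) a with w FinP.≟ c
      ... | yes e = inj₁ e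
      ... | no ne = ⊥-elim (no-exit u w cu a ne)
      form : ∀ i j → T (adj H i j) → i ≡ c ⊎ T (adj H c i) → ∃[ w ] (Joins (i , j) c w × T (adj H c w))
      form i j a (inj₁ refl) = j , inj₁ refl , a
      form i j a (inj₂ ci) with j FinP.≟ c
      ... | yes refl = i , inj₂ refl , ci
      ... | no ne = ⊥-elim (no-exit i j ci a ne)
    pick : Dec (∃[ a ] ∃[ d ] (a ≢ d × T (adj H v a) × T (adj H v d))) → Dec (∃[ a ] T (adj H v a)) → ∃[ c ] (∀ p → CompEdge v p → ∃[ w ] (Joins p c w × T (adj H c w)))
    pick (yes (a , d , a≢d , va , vd)) _ = from v (inj₁ refl) spare
      where
      not-w : ∀ a u w → T (adj H v a) → T (adj H v u) → T (adj H u w) → a ≢ w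
      not-w a u .a va vu uw refl = triangle-free f v u a vu uw (adj-sym H va)
      spare : Spare v
      spare u w vu uw ne with a FinP.≟ u
      ... | no a≢u = a , va , a≢u , not-w a u w va vu uw
      ... | yes refl = d , vd , (λ e → a≢d (sym e)) , not-w d u w vd vu uw
    pick (no ¬two) (yes (c , vc)) = from c (inj₂ (adj-sym H vc)) spare
      where
      only : ∀ x → T (adj H v x) → x ≡ c
      only x vx with x FinP.≟ c
      ... | yes e = e
      ... | no ne = ⊥-elim (¬two (x , c , ne , vx , vc))
      spare : Spare c
      spare u w cu uw ne = v , adj-sym H vc , (λ { refl → ne (only w uw) }) , λ { refl → adj-≢ H cu (sym (only u (adj-sym H uw))) }
    pick (no _) (no ¬one) = from v (inj₁ refl) (λ u w vu _ _ → ⊥-elim (¬one (u , vu)))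

  -- In a star the edges correspond to the neighbours of the centre, so three edges give three
  -- neighbours.
  τ≥3⇒claw⊎p₄ : IsForest H → 3 ≤ τ H → Claw H ⊎ P₄ H
  τ≥3⇒claw⊎p₄ f le with p₄?
  ... | yes p = inj₂ p
  ... | no ¬p with τ-witness 2 le
  ... | v , le′ with star-component f ¬p v
  ... | c , star = claw (filter (λ w → T? (adj H c w)) (allFin k)) (UniqueP.filter⁺ _ (UniqueP.allFin⁺ k)) (λ m → proj₂ (∈-filter⁻ (λ w → T? (adj H c w)) {xs = allFin k} m))
        (≤-trans (≤-trans le′ (≤-reflexive (compEdges-cnt v))) (cnt-inj (compEdge? v) (other c) (pairs k) _ (pairs-unique k) into inj))
    where
    oth : ∀ p w → Joins p c w → toℕ (proj₁ p) < toℕ (proj₂ p) → other c p ≡ w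
    oth p w (inj₁ refl) _ = other-left c w
    oth p w (inj₂ refl) _ = other-right c w
    into : ∀ p → p ∈ pairs k → CompEdge v p → other c p ∈ filter (λ w → T? (adj H c w)) (allFin k)
    into p _ t with star p t
    ... | w , j , a = subst (_∈ filter (λ w → T? (adj H c w)) (allFin k)) (sym (oth p w j (proj₁ (compEdge-parts {v} t)))) (∈-filter⁺ (λ w → T? (adj H c w)) (∈-allFin w) a)
    inj : ∀ p q → p ∈ pairs k → q ∈ pairs k → CompEdge v p → CompEdge v q → other c p ≡ other c q → p ≡ q
    inj p q _ _ t t′ eq = other-injective (proj₁ (compEdge-parts {v} t)) (proj₁ (compEdge-parts {v} t′)) (joins-touchesˡ (proj₁ (proj₂ (star p t)))) (joins-touchesˡ (proj₁ (proj₂ (star q t′)))) eq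
    claw : ∀ N → Unique N → (∀ {w} → w ∈ N → T (adj H c w)) → 3 ≤ length N → Claw H ⊎ P₄ H
    claw (a ∷ d ∷ e ∷ _) ((ad ∷ ae ∷ _) ∷ (de ∷ _) ∷ _) h _ = inj₁ (c , a , d , e , (ad , ae , de) , h (here refl) , h (there (here refl)) , h (there (there (here refl))))
    claw (a ∷ d ∷ []) _ _ (s≤s (s≤s ()))
    claw (a ∷ []) _ _ (s≤s ())

-- Rounding and error bounds

ℕtoℚ-cancel : ∀ {m k} → ℕtoℚ m Q.≤ ℕtoℚ k → m ≤ k
ℕtoℚ-cancel {m} {k} le with QUP.≤-trans (QUP.≤-reflexive (QUP.≃-sym (toℚᵘ-ℕ m))) (QUP.≤-trans (QP.toℚᵘ-mono-≤ le) (QUP.≤-reflexive (toℚᵘ-ℕ k)))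
... | QU.*≤* h = ZP.drop‿+≤+ (subst₂ Z._≤_ (ZP.*-identityʳ (Z.+ m)) (ZP.*-identityʳ (Z.+ k)) h)

floorℕ-/ : ∀ a d .(c : Coprime a (suc d)) → floorℕ (mkℚ (Z.+ a) d c) ≡ a Nat./ suc d
floorℕ-/ a d c = cong Z.∣_∣ (div-pos-is-/ℕ (Z.+ a) (suc d))
  where open import Data.Integer.DivMod using (div-pos-is-/ℕ)

floorℕ-lower : ∀ x → 0ℚ Q.≤ x → ℕtoℚ (floorℕ x) Q.≤ x
floorℕ-lower x@(mkℚ (Z.+ a) d c) _ = QP.toℚᵘ-cancel-≤ (QUP.≤-trans (QUP.≤-reflexive (toℚᵘ-ℕ (floorℕ x)))
  (QU.*≤* (subst₂ Z._≤_ (ZP.pos-* (floorℕ x) (suc d)) (sym (ZP.*-identityʳ (Z.+ a))) (Z.+≤+ (≤-trans (≤-reflexive (cong (_* suc d) (floorℕ-/ a d c))) (m/n*n≤m a (suc d)))))))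
  where open import Data.Nat.DivMod using (m/n*n≤m)
floorℕ-lower (mkℚ -[1+ a ] d c) (Q.*≤* ())

floorℕ-upper : ∀ x → 0ℚ Q.≤ x → x Q.< ℕtoℚ (suc (floorℕ x))
floorℕ-upper x@(mkℚ (Z.+ a) d c) _ = QP.toℚᵘ-cancel-< (QUP.<-≤-trans
  (QU.*<* (subst₂ Z._<_ (sym (ZP.*-identityʳ (Z.+ a))) (ZP.pos-* (suc (floorℕ x)) (suc d)) (Z.+<+ lt))) (QUP.≤-reflexive (QUP.≃-sym (toℚᵘ-ℕ (suc (floorℕ x))))))
  where
  open import Data.Nat.DivMod using (m≡m%n+[m/n]*n; m%n<n)
  lt : a < suc (floorℕ x) * suc d
  lt = ≤-<-trans (≤-reflexive (trans (m≡m%n+[m/n]*n a (suc d)) (cong (λ k → a Nat.% suc d + k * suc d) (sym (floorℕ-/ a d c))))) (+-monoˡ-< (floorℕ x * suc d) (m%n<n a (suc d)))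
floorℕ-upper (mkℚ -[1+ a ] d c) (Q.*≤* ())

frac-nonneg : ∀ p q → 0ℚ Q.≤ (Z.+ p) / suc q
frac-nonneg p q = QP.nonNegative⁻¹ _ {{QP.normalize-nonNeg p (suc q)}}

-- Breaker's strategies ask for b + 1 > f(n), and rounding down (1 + ε) f(n) ≥ f(n) leaves this
-- true.
floor-above : ∀ ε → 0ℚ Q.< ε → ∀ p q → p < suc (floorℕ ((1ℚ Q.+ ε) Q.* ((Z.+ p) / suc q))) * suc q
floor-above ε ε>0 p q = clear (QUP.<-respˡ-≃ (toℚᵘ-/ (Z.+ p) q) (QUP.<-respʳ-≃ (toℚᵘ-ℕ (suc (floorℕ x))) (QP.toℚᵘ-mono-< (QP.≤-<-trans f≤x (floorℕ-upper x (QP.≤-trans (frac-nonneg p q) f≤x))))))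
  where
  f = (Z.+ p) / suc q
  x = (1ℚ Q.+ ε) Q.* f
  f≤x : f Q.≤ x
  f≤x = subst (Q._≤ x) (QP.*-identityˡ f) (QP.*-monoʳ-≤-nonNeg f {{Q.nonNegative (frac-nonneg p q)}} (subst (Q._≤ 1ℚ Q.+ ε) (QP.+-identityʳ 1ℚ) (QP.+-monoʳ-≤ 1ℚ (QP.<⇒≤ ε>0))))
  clear : QU.mkℚᵘ (Z.+ p) q QU.< QU.mkℚᵘ (Z.+ (suc (floorℕ x))) 0 → p < suc (floorℕ x) * suc q
  clear (QU.*<* h) = ZP.drop‿+<+ (subst₂ Z._<_ (ZP.*-identityʳ (Z.+ p)) (sym (ZP.pos-* (suc (floorℕ x)) (suc q))) h)

-- The denominator less one, as it is stored.
denominator : ℚ → ℕ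
denominator (mkℚ _ d _) = d

-- A positive numerator is at least 1. This is how ε is traded for a natural number.
1/den≤ : ∀ ε → 0ℚ Q.< ε → (Z.+ 1) / suc (denominator ε) Q.≤ ε
1/den≤ (mkℚ (Z.+ zero) d c) (Q.*<* h) = ⊥-elim (ZP.<-irrefl refl h)
1/den≤ (mkℚ -[1+ m ] d c) (Q.*<* ())
1/den≤ (mkℚ (Z.+ suc m) d c) _ = QP.toℚᵘ-cancel-≤ (QUP.≤-trans (QUP.≤-reflexive (toℚᵘ-/ (Z.+ 1) d)) (QU.*≤* (ZP.*-monoʳ-≤-nonNeg (Z.+ suc d) {Z.+ 1} {Z.+ suc m} (Z.+≤+ (s≤s z≤n)))))

-- b = ⌊(1-ε) p/q⌋ satisfies b ≤ (d/(d+1)) p/q where d+1 is the denominator of ε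
floor-below : ∀ ε → 0ℚ Q.< ε → ε Q.< 1ℚ → ∀ p q → suc (denominator ε) * (floorℕ ((1ℚ Q.- ε) Q.* ((Z.+ p) / suc q)) * suc q) ≤ denominator ε * p
floor-below ε ε>0 ε<1 p q = ℕtoℚ-cancel (begin
    ℕtoℚ (suc d * (b * suc q)) ≡⟨ trans (ℕtoℚ-* (suc d) (b * suc q)) (cong (ℕtoℚ (suc d) Q.*_) (ℕtoℚ-* b (suc q))) ⟩
    ℕtoℚ (suc d) Q.* (ℕtoℚ b Q.* ℕtoℚ (suc q)) ≤⟨ QP.*-monoˡ-≤-nonNeg (ℕtoℚ (suc d)) {{ℕtoℚ-nonNeg (suc d)}} (QP.*-monoʳ-≤-nonNeg (ℕtoℚ (suc q)) {{ℕtoℚ-nonNeg (suc q)}} (floorℕ-lower x x≥0)) ⟩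
    ℕtoℚ (suc d) Q.* ((1ℚ Q.- ε) Q.* f Q.* ℕtoℚ (suc q)) ≡⟨ cong (ℕtoℚ (suc d) Q.*_) (trans (QP.*-assoc (1ℚ Q.- ε) f (ℕtoℚ (suc q))) (cong ((1ℚ Q.- ε) Q.*_) (f-cancel p q))) ⟩
    ℕtoℚ (suc d) Q.* ((1ℚ Q.- ε) Q.* ℕtoℚ p) ≡⟨ sym (QP.*-assoc (ℕtoℚ (suc d)) (1ℚ Q.- ε) (ℕtoℚ p)) ⟩
    ℕtoℚ (suc d) Q.* (1ℚ Q.- ε) Q.* ℕtoℚ p ≤⟨ QP.*-monoʳ-≤-nonNeg (ℕtoℚ p) {{ℕtoℚ-nonNeg p}} coef ⟩
    ℕtoℚ d Q.* ℕtoℚ p ≡⟨ sym (ℕtoℚ-* d p) ⟩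
    ℕtoℚ (d * p) ∎)
  where
  open QP.≤-Reasoning
  d = denominator ε
  f = (Z.+ p) / suc q
  x = (1ℚ Q.- ε) Q.* f
  b = floorℕ x
  f-cancel : ∀ p q → ((Z.+ p) / suc q) Q.* ℕtoℚ (suc q) ≡ ℕtoℚ p
  f-cancel p q = QP.toℚᵘ-injective (QUP.≃-trans (QP.toℚᵘ-homo-* ((Z.+ p) / suc q) (ℕtoℚ (suc q))) (QUP.≃-trans (QUP.*-cong (toℚᵘ-/ (Z.+ p) q) (toℚᵘ-ℕ (suc q)))
    (QUP.≃-trans (QU.*≡* (ZP.*-assoc (Z.+ p) (Z.+ suc q) (Z.+ 1) ⟨t⟩ cong (Z.+ p Z.*_) (ZP.*-comm (Z.+ suc q) (Z.+ 1) ⟨t⟩ trans (ZP.*-identityˡ (Z.+ suc q)) (sym (cong Z.+_ (*-identityʳ (suc q))))))) (QUP.≃-sym (toℚᵘ-ℕ p)))))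
    where
    _⟨t⟩_ : ∀ {a b c : ℤ} → a ≡ b → b ≡ c → a ≡ c
    _⟨t⟩_ = trans
  1-ε≥0 : 0ℚ Q.≤ 1ℚ Q.- ε
  1-ε≥0 = subst (Q._≤ 1ℚ Q.- ε) (QP.+-inverseʳ ε) (QP.+-monoˡ-≤ (Q.- ε) (QP.<⇒≤ ε<1))
  x≥0 : 0ℚ Q.≤ x
  x≥0 = subst (Q._≤ x) (QP.*-zeroˡ f) (QP.*-monoʳ-≤-nonNeg f {{Q.nonNegative (frac-nonneg p q)}} 1-ε≥0)
  coef : ℕtoℚ (suc d) Q.* (1ℚ Q.- ε) Q.≤ ℕtoℚ d
  coef = begin
    ℕtoℚ (suc d) Q.* (1ℚ Q.- ε) ≡⟨ lem (ℕtoℚ (suc d)) ε ⟩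
    ℕtoℚ (suc d) Q.+ Q.- (ε Q.* ℕtoℚ (suc d)) ≤⟨ QP.+-monoʳ-≤ (ℕtoℚ (suc d)) (QP.neg-antimono-≤ (subst (Q._≤ ε Q.* ℕtoℚ (suc d)) (f-cancel 1 d) (QP.*-monoʳ-≤-nonNeg (ℕtoℚ (suc d)) {{ℕtoℚ-nonNeg (suc d)}} (1/den≤ ε ε>0)))) ⟩
    ℕtoℚ (suc d) Q.+ Q.- 1ℚ ≡⟨ cong (Q._+ Q.- 1ℚ) (ℕtoℚ-+ 1 d) ⟩
    1ℚ Q.+ ℕtoℚ d Q.+ Q.- 1ℚ ≡⟨ lem′ (ℕtoℚ d) ⟩
    ℕtoℚ d ∎
    where
    lem : ∀ s e → s Q.* (1ℚ Q.+ Q.- e) ≡ s Q.+ Q.- (e Q.* s)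
    lem = solve 2 (λ s e → (s :* (con 1ℚ :+ :- e)) := (s :+ :- (e :* s))) refl
      where open +-*-Solver
    lem′ : ∀ s → 1ℚ Q.+ s Q.+ Q.- 1ℚ ≡ s
    lem′ = solve 1 (λ s → (con 1ℚ :+ s :+ :- con 1ℚ) := s) refl
      where open +-*-Solver

breaker-clever : ∀ {h} (H : Graph h) (b : ℕ → ℕ) N → (∀ n → N ≤ n → BreakerWins H (b n) n) → CleverTo0 H b
breaker-clever H b N w = N , λ n le → proj₁ (w n le)

breaker-random : ∀ {h} (H : Graph h) (b : ℕ → ℕ) N → (∀ n → N ≤ n → BreakerWins H (b n) n) → RandomTo0 H b
breaker-random H b N w ε ε>0 = N , λ n le → let (q , r) = Game.value H (b n) (board n) [] in q , r , QP.≤-trans (proj₂ (w n le) r) (QP.<⇒≤ ε>0)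

-- The initial potential is at most a fraction 1 / (d + 1) ≤ ε of the total `suc Zc`, d + 1 being
-- the denominator of ε.
error-bound : ∀ ε → 0ℚ Q.< ε → ∀ {q} Zc φ → φ * suc (denominator ε) ≤ suc Zc → ℕtoℚ (suc Zc) Q.≤ ℕtoℚ (suc Zc) Q.* q Q.+ ℕtoℚ φ → 1ℚ Q.- ε Q.≤ q
error-bound ε ε>0 {q} Zc φ le h = QP.*-cancelˡ-≤-pos Zq {{ℕtoℚ-pos Zc}} (begin
    Zq Q.* (1ℚ Q.- ε) ≡⟨ lem Zq ε ⟩
    Zq Q.+ Q.- (Zq Q.* ε) ≤⟨ QP.+-mono-≤ h (QP.neg-antimono-≤ φ≤) ⟩
    Zq Q.* q Q.+ ℕtoℚ φ Q.+ Q.- ℕtoℚ φ ≡⟨ lem′ (Zq Q.* q) (ℕtoℚ φ) ⟩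
    Zq Q.* q ∎)
  where
  open QP.≤-Reasoning
  Zq = ℕtoℚ (suc Zc)
  d = suc (denominator ε)
  φ≤ : ℕtoℚ φ Q.≤ Zq Q.* ε
  φ≤ = cancel-suc (denominator ε) (begin
    ℕtoℚ φ Q.* ℕtoℚ d ≡⟨ sym (ℕtoℚ-* φ d) ⟩
    ℕtoℚ (φ * d) ≤⟨ ℕtoℚ-mono le ⟩
    Zq ≡⟨ sym (QP.*-identityʳ Zq) ⟩
    Zq Q.* 1ℚ ≤⟨ QP.*-monoˡ-≤-nonNeg Zq {{ℕtoℚ-nonNeg (suc Zc)}} one ⟩
    Zq Q.* (ε Q.* ℕtoℚ d) ≡⟨ sym (QP.*-assoc Zq ε (ℕtoℚ d)) ⟩
    Zq Q.* ε Q.* ℕtoℚ d ∎)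
    where
    inv : ((Z.+ 1) / suc (denominator ε)) Q.* ℕtoℚ d ≡ 1ℚ
    inv = QP.toℚᵘ-injective (QUP.≃-trans (QP.toℚᵘ-homo-* ((Z.+ 1) / d) (ℕtoℚ d)) (QUP.≃-trans (QUP.*-cong (toℚᵘ-/ (Z.+ 1) (denominator ε)) (toℚᵘ-ℕ d)) (QU.*≡* (trans (ZP.*-identityʳ _) (trans (ZP.*-identityˡ (Z.+ d)) (sym (trans (ZP.*-identityˡ _) (cong Z.+_ (*-identityʳ d)))))))))
    one : 1ℚ Q.≤ ε Q.* ℕtoℚ d
    one = subst (Q._≤ ε Q.* ℕtoℚ d) inv (QP.*-monoʳ-≤-nonNeg (ℕtoℚ d) {{ℕtoℚ-nonNeg d}} (1/den≤ ε ε>0))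
  lem : ∀ s e → s Q.* (1ℚ Q.+ Q.- e) ≡ s Q.+ Q.- (s Q.* e)
  lem = solve 2 (λ s e → (s :* (con 1ℚ :+ :- e)) := (s :+ :- (s :* e))) refl
    where open +-*-Solver
  lem′ : ∀ a c → a Q.+ c Q.+ Q.- c ≡ a
  lem′ = solve 2 (λ a c → (a :+ c :+ :- c) := a) refl
    where open +-*-Solver

random⇒cleverTo1 : ∀ {h} (H : Graph h) (b : ℕ → ℕ) → RandomTo1 H b → CleverTo1 H b
random⇒cleverTo1 H b r with r Q.½ (QP.positive⁻¹ Q.½)
... | N , f = N , λ n le → let (q , v , l) = f n le in Game.random⇒clever H (b n) v (QP.<-≤-trans (QP.positive⁻¹ (1ℚ Q.- Q.½)) l)

-- Embedding graphs whose components have at most two edges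

embed : ∀ {h n} (H : Graph h) (G : Fin n → Fin n → Set) (f : Fin h → Fin n) → (∀ v w → f v ≡ f w → v ≡ w) →
  (∀ v w → T (adj H v w) → G (f v) (f w)) → HasMinor H G
embed H G f inj hom = (λ v x → does (f v FinP.≟ x)) ,
  (λ v w x p q → inj v w (trans (T→ (f v FinP.≟ x) p) (sym (T→ (f w FinP.≟ x) q)))) ,
  (λ v → f v , T← (f v FinP.≟ f v) refl) ,
  (λ v x y p q → subst₂ (WalkIn G _) (T→ (f v FinP.≟ x) p) (T→ (f v FinP.≟ y) q) here) ,
  (λ v w e → f v , f w , T← (f v FinP.≟ f v) refl , T← (f w FinP.≟ f w) refl , hom v w e)

lookup-injective : ∀ {A : Set} {xs : List A} → Unique xs → ∀ i j → lookup xs i ≡ lookup xs j → i ≡ j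
lookup-injective {xs = x ∷ xs} u Fin.zero Fin.zero _ = refl
lookup-injective {xs = x ∷ xs} u Fin.zero (Fin.suc j) eq = ⊥-elim (Unique-head u (subst (_∈ xs) (sym eq) (∈-lookup j)))
lookup-injective {xs = x ∷ xs} u (Fin.suc i) Fin.zero eq = ⊥-elim (Unique-head u (subst (_∈ xs) eq (∈-lookup i)))
lookup-injective {xs = x ∷ xs} u (Fin.suc i) (Fin.suc j) eq = cong Fin.suc (lookup-injective (Unique-tail u) i j eq)

cnt-complement : ∀ {A : Set} {P : A → Set} (P? : Decidable P) xs → cnt P? xs + cnt (¬? ∘ P?) xs ≡ length xs
cnt-complement P? xs = trans (cong₂ _+_ (sym (length-filter-cnt P? xs)) (sym (length-filter-cnt (¬? ∘ P?) xs))) (trans (sym (length-++ (filter P? xs))) (sym (PermP.↭-length (filter-split P? xs))))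

fresh-injection : ∀ {n} h (used : List (Fin n)) → length used + h ≤ n → ∃ λ (f : Fin h → Fin n) → (∀ v w → f v ≡ f w → v ≡ w) × (∀ v → f v ∉ used)
fresh-injection {n} h used le = (λ v → lookup free (Data.Fin.inject≤ v enough)) ,
    (λ v w eq → FinP.inject≤-injective enough enough v w (lookup-injective (UniqueP.filter⁺ _ (UniqueP.allFin⁺ n)) _ _ eq)) ,
    (λ v → proj₂ (∈-filter⁻ new? {xs = allFin n} (∈-lookup (Data.Fin.inject≤ v enough))))
  where
  import Data.Fin
  used? : Decidable (_∈ used)
  used? x = any? (x FinP.≟_) used
  new? : Decidable (_∉ used)
  new? x = ¬? (used? x)
  free = filter new? (allFin n)
  enough : h ≤ length free
  enough = +-cancelˡ-≤ (length used) _ _ (≤-trans le (≤-trans (≤-reflexive (sym (trans (cnt-complement used? (allFin n)) (length-tabulate {n = n} id))))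
    (+-mono-≤ (cnt-inj used? id (allFin n) used (UniqueP.allFin⁺ n) (λ _ _ m → m) (λ _ _ _ _ _ _ e → e)) (≤-reflexive (sym (length-filter-cnt new? (allFin n)))))))

module _ {k : ℕ} (H : Graph k) where

  T-∨ˡ : ∀ {a c} → T a → T (a ∨ c)
  T-∨ˡ {true} _ = tt
  T-∨ʳ : ∀ {a c} → T c → T (a ∨ c)
  T-∨ʳ {true} _ = tt
  T-∨ʳ {false} t = t

  -- The Boolean `reachB` computes away under `T`; the record keeps `m`, `v` and `w` visible.
  record Reach (m : ℕ) (v w : Fin k) : Set where
    constructor reach
    field get : T (reachB H m v w)

  reach-mono : ∀ {m m′ v w} → m ≤ m′ → Reach m v w → Reach m′ v w
  reach-mono {m} {m′} {v} {w} le (reach t) = reach (go′ m′ (m≤n⇒m<n∨m≡n le))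
    where
    go′ : ∀ m′ → m < m′ ⊎ m ≡ m′ → T (reachB H m′ v w)
    go′ m′ (inj₂ refl) = t
    go′ (suc m′) (inj₁ (s≤s l)) = T-∨ˡ {reachB H m′ v w} (go′ m′ (m≤n⇒m<n∨m≡n l))

  reach-refl : ∀ v → Reach 0 v v
  reach-refl v = reach (T← (v FinP.≟ v) refl)

  reach-suc : ∀ {m v u w} → Reach m v u → T (adj H u w) → Reach (suc m) v w
  reach-suc {m} {v} {u} {w} (reach r) a = reach (T-∨ʳ {reachB H m v w} (AnyP.any⁺ (λ u → reachB H m v u ∧ adj H u w) (lose (∈-allFin u) (∧-T r a))))

  orient : ∀ u w → T (adj H u w) → ∃[ e ] (Joins e u w × Ordered e)
  orient u w a with <-cmp (toℕ u) (toℕ w)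
  ... | tri< lt _ _ = _ , inj₁ refl , lt
  ... | tri≈ _ e _ = ⊥-elim (adj-≢ H a (FinP.toℕ-injective e))
  ... | tri> _ _ gt = _ , inj₂ refl , gt

  comp-edge : ∀ {m v e u w} → m ≤ k → Joins e u w → Ordered e → T (adj H u w) → Reach m v u → Reach m v w → CompEdge H v e
  comp-edge le (inj₁ refl) o a ru rw = ∧-T (<⇒<ᵇ o) (∧-T a (Reach.get (reach-mono le ru)))
  comp-edge le (inj₂ refl) o a ru rw = ∧-T (<⇒<ᵇ o) (∧-T (adj-sym H a) (Reach.get (reach-mono le rw)))

  compEdges≤τ : ∀ v → compEdges H v ≤ τ H
  compEdges≤τ v = below (allFin k) (∈-allFin v)
    where
    below : ∀ vs → v ∈ vs → compEdges H v ≤ foldr (λ v acc → compEdges H v ⊔ acc) 0 vs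
    below (_ ∷ vs) (here refl) = m≤m⊔n _ _
    below (w ∷ vs) (there m) = ≤-trans (below vs m) (m≤n⊔m (compEdges H w) _)

  τ-≥ : ∀ v {es} → Unique es → (∀ {e} → e ∈ es → CompEdge H v e) → length es ≤ τ H
  τ-≥ v u h = ≤-trans (≤-trans (cnt-≥ (compEdge? H v) (pairs k) u (λ m → pairs-complete _ _ , h m)) (≤-reflexive (sym (compEdges-cnt H v)))) (compEdges≤τ v)

  joins-≢ : ∀ {e f : Edge k} {u w u′ w′} → Joins e u w → Joins f u′ w′ → (u ≢ u′ × u ≢ w′) ⊎ (w ≢ u′ × w ≢ w′) → e ≢ f
  joins-≢ j j′ (inj₁ (a , c)) refl with touches-joins j′ (joins-touchesˡ j)
  ... | inj₁ e = a e
  ... | inj₂ e = c e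
  joins-≢ j j′ (inj₂ (a , c)) refl with touches-joins j′ (joins-touchesʳ j)
  ... | inj₁ e = a e
  ... | inj₂ e = c e

  three-vertices : ∀ {a c d : Fin k} → a ≢ c → a ≢ d → c ≢ d → 2 ≤ k
  three-vertices {a} {c} {d} ac ad cd = ≤-trans (s≤s (s≤s z≤n)) (unique-fin-length {xs = a ∷ c ∷ d ∷ []} ((ac ∷ ad ∷ []) ∷ (cd ∷ []) ∷ [] ∷ []))

  cherry⇒τ : Cherry H → 2 ≤ τ H
  cherry⇒τ (v , a , c , ne , va , vc) with orient v a va | orient v c vc
  ... | e , je , oe | f , jf , of = τ-≥ v {e ∷ f ∷ []} ((joins-≢ je jf (inj₂ ((λ q → adj-≢ H va (sym q)) , ne)) ∷ []) ∷ [] ∷ []) λ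
      { (here refl) → comp-edge 1≤k je oe va (reach-mono z≤n (reach-refl v)) (reach-suc (reach-refl v) va)
      ; (there (here refl)) → comp-edge 1≤k jf of vc (reach-mono z≤n (reach-refl v)) (reach-suc (reach-refl v) vc) }
    where
    1≤k : 1 ≤ k
    1≤k = ≤-trans (s≤s z≤n) (three-vertices (adj-≢ H va) (adj-≢ H vc) ne)

  claw⇒τ : Claw H → 3 ≤ τ H
  claw⇒τ (v , a , c , d , (ac , ad , cd) , va , vc , vd) with orient v a va | orient v c vc | orient v d vd
  ... | e , je , oe | f , jf , of | g , jg , og = τ-≥ v {e ∷ f ∷ g ∷ []}
      ((joins-≢ je jf (inj₂ ((λ q → adj-≢ H va (sym q)) , ac)) ∷ joins-≢ je jg (inj₂ ((λ q → adj-≢ H va (sym q)) , ad)) ∷ []) ∷ (joins-≢ jf jg (inj₂ ((λ q → adj-≢ H vc (sym q)) , cd)) ∷ []) ∷ [] ∷ []) λ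
      { (here refl) → comp-edge 1≤k je oe va (reach-mono z≤n (reach-refl v)) (reach-suc (reach-refl v) va)
      ; (there (here refl)) → comp-edge 1≤k jf of vc (reach-mono z≤n (reach-refl v)) (reach-suc (reach-refl v) vc)
      ; (there (there (here refl))) → comp-edge 1≤k jg og vd (reach-mono z≤n (reach-refl v)) (reach-suc (reach-refl v) vd) }
    where
    1≤k : 1 ≤ k
    1≤k = ≤-trans (s≤s z≤n) (three-vertices ac ad cd)

  -- a walk a-v-w-d with three distinct edges, covering both a path on four vertices and a triangle (a = d)
  walk3⇒τ : ∀ a v w d → a ≢ v → a ≢ w → v ≢ w → d ≢ v → d ≢ w → T (adj H a v) → T (adj H v w) → T (adj H w d) → 3 ≤ τ H
  walk3⇒τ a v w d a≢v a≢w v≢w d≢v d≢w av vw wd with orient a v av | orient v w vw | orient w d wd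
  ... | e , je , oe | f , jf , of | g , jg , og = τ-≥ v {e ∷ f ∷ g ∷ []}
      ((joins-≢ je jf (inj₁ (a≢v , a≢w)) ∷ joins-≢ je jg (inj₂ (v≢w , λ q → d≢v (sym q))) ∷ []) ∷ (joins-≢ jf jg (inj₁ (v≢w , λ q → d≢v (sym q))) ∷ []) ∷ [] ∷ []) λ
      { (here refl) → comp-edge 2≤k je oe av (reach-mono (s≤s z≤n) r₁a) (reach-mono z≤n (reach-refl v))
      ; (there (here refl)) → comp-edge 2≤k jf of vw (reach-mono z≤n (reach-refl v)) (reach-mono (s≤s z≤n) r₁w)
      ; (there (there (here refl))) → comp-edge 2≤k jg og wd (reach-mono (s≤s z≤n) r₁w) (reach-suc r₁w wd) }
    where
    2≤k = three-vertices a≢v a≢w v≢w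
    r₁a : Reach 1 v a
    r₁a = reach-suc (reach-refl v) (adj-sym H av)
    r₁w : Reach 1 v w
    r₁w = reach-suc (reach-refl v) vw

  neighbours : Fin k → List (Fin k)
  neighbours v = filter (λ w → T? (adj H v w)) (allFin k)

  neighbours-∈ : ∀ {v w} → T (adj H v w) → w ∈ neighbours v
  neighbours-∈ {v} {w} a = ∈-filter⁺ (λ w → T? (adj H v w)) (∈-allFin w) a

  ∈-neighbours : ∀ {v w} → w ∈ neighbours v → T (adj H v w)
  ∈-neighbours {v} {w} m = proj₂ (∈-filter⁻ (λ w → T? (adj H v w)) {xs = allFin k} m)

  neighbours-unique : ∀ v → Unique (neighbours v)
  neighbours-unique v = UniqueP.filter⁺ _ (UniqueP.allFin⁺ k)

  -- For τ H ≤ 2 every component fits into one cherry, numbered by a vertex of the component: its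
  -- vertex of degree 2, the smaller end of a single edge, or an isolated vertex itself. A slot is a
  -- position in one of these h cherries.
  data Slot : Set where
    centre left right : Fin k → Slot

  slotOf : Fin k → List (Fin k) → (Fin k → List (Fin k)) → Slot
  slotOf v [] N = centre v
  slotOf v (u ∷ _ ∷ _) N = centre v
  slotOf v (u ∷ []) N with N u
  ... | w ∷ _ ∷ _ = if does (w FinP.≟ v) then left u else right u
  ... | _ = if does (toℕ v <? toℕ u) then centre v else left u

  slot : Fin k → Slot
  slot v = slotOf v (neighbours v) neighbours

  data SlotView (v : Fin k) : Slot → Set where
    isCentre : SlotView v (centre v)
    isLeft1  : ∀ u → neighbours v ≡ u ∷ [] → neighbours u ≡ v ∷ [] → toℕ u ≤ toℕ v → SlotView v (left u)
    isLeft2  : ∀ u w → neighbours v ≡ u ∷ [] → neighbours u ≡ v ∷ w ∷ [] → SlotView v (left u)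
    isRight  : ∀ u w → neighbours v ≡ u ∷ [] → neighbours u ≡ w ∷ v ∷ [] → SlotView v (right u)

  module _ (τ≤2 : τ H ≤ 2) where

    two-neighbours : ∀ v {a c d ds} → neighbours v ≢ a ∷ c ∷ d ∷ ds
    two-neighbours v {a} {c} {d} eq with subst Unique eq (neighbours-unique v)
    ... | (ac ∷ ad ∷ _) ∷ (cd ∷ _) ∷ _ = <⇒≱ (claw⇒τ (v , a , c , d , (ac , ad , cd) ,
      ∈-neighbours (subst (a ∈_) (sym eq) (here refl)) , ∈-neighbours (subst (c ∈_) (sym eq) (there (here refl))) , ∈-neighbours (subst (d ∈_) (sym eq) (there (there (here refl)))))) τ≤2

    slot-view : ∀ v → SlotView v (slot v)
    slot-view v with neighbours v in eq
    ... | [] = isCentre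
    ... | _ ∷ _ ∷ _ = isCentre
    ... | u ∷ [] with neighbours u in eq′ | neighbours-∈ (adj-sym H (∈-neighbours (subst (u ∈_) (sym eq) (here refl))))
    ... | [] | ()
    ... | w ∷ [] | here refl = single (toℕ v <? toℕ u)
      where
      single : (d : Dec (toℕ v < toℕ u)) → SlotView v (if does d then centre v else left u)
      single (yes _) = isCentre
      single (no ge) = isLeft1 u eq eq′ (≮⇒≥ ge)
    slot-view v | u ∷ [] | w ∷ w′ ∷ _ ∷ _ | _ = ⊥-elim (two-neighbours u eq′)
    slot-view v | u ∷ [] | w ∷ w′ ∷ [] | m = pair (w FinP.≟ v) m
      where
      pair : (d : Dec (w ≡ v)) → v ∈ w ∷ w′ ∷ [] → SlotView v (if does d then left u else right u)
      pair (yes refl) _ = isLeft2 u w′ eq eq′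
      pair (no ne) (here e) = ⊥-elim (ne (sym e))
      pair (no ne) (there (here refl)) = isRight u w eq eq′

    slot-injective : ∀ v w → slot v ≡ slot w → v ≡ w
    slot-injective v w eq = go′ (slot-view v) (slot-view w) eq
      where
      hd : ∀ {A : Set} {a c : A} {as cs} → _≡_ {A = List A} (a ∷ as) (c ∷ cs) → a ≡ c
      hd refl = refl
      sd : ∀ {A : Set} {a c a′ c′ : A} {as cs} → _≡_ {A = List A} (a ∷ a′ ∷ as) (c ∷ c′ ∷ cs) → a′ ≡ c′
      sd refl = refl
      go′ : ∀ {s t} → SlotView v s → SlotView w t → s ≡ t → v ≡ w
      go′ isCentre isCentre refl = refl
      go′ (isLeft1 u _ e _) (isLeft1 .u _ e′ _) refl = hd (trans (sym e) e′)
      go′ (isLeft1 u _ e _) (isLeft2 .u _ _ e′) refl = hd (trans (sym e) e′)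
      go′ (isLeft2 u _ _ e) (isLeft1 .u _ e′ _) refl = hd (trans (sym e) e′)
      go′ (isLeft2 u _ _ e) (isLeft2 .u _ _ e′) refl = hd (trans (sym e) e′)
      go′ (isRight u _ _ e) (isRight .u _ _ e′) refl = sd (trans (sym e) e′)

    data SlotAdj : Slot → Slot → Set where
      cl : ∀ {u} → SlotAdj (centre u) (left u)
      cr : ∀ {u} → SlotAdj (centre u) (right u)
      lc : ∀ {u} → SlotAdj (left u) (centre u)
      rc : ∀ {u} → SlotAdj (right u) (centre u)

    slot-adj : ∀ v w → T (adj H v w) → SlotAdj (slot v) (slot w)
    slot-adj v w a with neighbours v in eqv | neighbours-∈ a | neighbours w in eqw | neighbours-∈ (adj-sym H a)
    ... | [] | () | _ | _
    ... | _ ∷ _ | _ | [] | ()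
    ... | _ ∷ [] | here refl | _ ∷ [] | here refl rewrite eqv | eqw = singles (toℕ v <? toℕ w) (toℕ w <? toℕ v)
      where
      singles : (d : Dec (toℕ v < toℕ w)) (d′ : Dec (toℕ w < toℕ v)) → SlotAdj (if does d then centre v else left w) (if does d′ then centre w else left v)
      singles (yes p) (yes q) = ⊥-elim (<-asym p q)
      singles (yes _) (no _) = cl
      singles (no _) (yes _) = lc
      singles (no p) (no q) = ⊥-elim (adj-≢ H a (FinP.toℕ-injective (≤-antisym (≮⇒≥ q) (≮⇒≥ p))))
    ... | _ ∷ [] | here refl | x ∷ y ∷ _ | _ rewrite eqw with does (x FinP.≟ v)
    ... | true = lc
    ... | false = rc
    slot-adj v w a | x ∷ y ∷ _ | _ | _ ∷ [] | here refl rewrite eqv with does (x FinP.≟ w)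
    ... | true = cl
    ... | false = cr
    -- Two adjacent vertices that each have a further neighbour span three edges, whether or not
    -- these neighbours coincide.
    slot-adj v w a | x ∷ y ∷ xs | _ | x′ ∷ y′ ∷ xs′ | _ = ⊥-elim (other-neighbour v w eqv λ p p≢w vp → other-neighbour w v eqw λ q q≢v wq →
        <⇒≱ (walk3⇒τ p v w q (λ e → adj-≢ H vp (sym e)) p≢w (adj-≢ H a) q≢v (λ e → adj-≢ H wq (sym e)) (adj-sym H vp) a wq) τ≤2)
      where
      other-neighbour : ∀ v w {x y xs} → neighbours v ≡ x ∷ y ∷ xs → (∀ p → p ≢ w → T (adj H v p) → ⊥) → ⊥
      other-neighbour v w {x} {y} eq f with x FinP.≟ w | y FinP.≟ w
      ... | no ne | _ = f x ne (∈-neighbours (subst (x ∈_) (sym eq) (here refl)))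
      ... | yes _ | no ne = f y ne (∈-neighbours (subst (y ∈_) (sym eq) (there (here refl))))
      ... | yes refl | yes refl = Unique-head (subst Unique eq (neighbours-unique v)) (here refl)

    embed-cherries : ∀ {n} (G : Fin n → Fin n → Set) → (∀ {x y} → G x y → G y x) → (place : Slot → Fin n) → (∀ s t → place s ≡ place t → s ≡ t) →
      (∀ u → G (place (centre u)) (place (left u))) → (∀ u → G (place (centre u)) (place (right u))) → HasMinor H G
    embed-cherries G gsym place inj gl gr = embed H G (place ∘ slot) (λ v w eq → slot-injective v w (inj _ _ eq)) (λ v w a → hom (slot-adj v w a))
      where
      hom : ∀ {s t} → SlotAdj s t → G (place s) (place t)
      hom (cl {u}) = gl u
      hom (cr {u}) = gr u
      hom (lc {u}) = gsym (gl u)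
      hom (rc {u}) = gsym (gr u)

ends : ∀ {n} → List (Edge n) → List (Fin n)
ends [] = []
ends ((x , y) ∷ M) = x ∷ y ∷ ends M

ends-length : ∀ {n} (M : List (Edge n)) → length (ends M) ≡ 2 * length M
ends-length [] = refl
ends-length (e ∷ M) = trans (cong (suc ∘ suc) (ends-length M)) (lem (length M))
  where
  lem : ∀ m → suc (suc (2 * m)) ≡ 2 * suc m
  lem = solve-∀

module _ {h n : ℕ} where

  -- The i-th edge of H goes to the i-th edge of the matching. Vertices on no edge get `nothing` and
  -- are placed later.
  assign : List (Edge h) → List (Edge n) → Fin h → Maybe (Fin n)
  assign [] _ v = nothing
  assign (_ ∷ _) [] v = nothing
  assign (e ∷ es) (m ∷ ms) v = if does (v FinP.≟ proj₁ e) then just (proj₁ m) else if does (v FinP.≟ proj₂ e) then just (proj₂ m) else assign es ms v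

  assign-∈ : ∀ es ms {v x} → assign es ms v ≡ just x → x ∈ ends ms
  assign-∈ (e ∷ es) (m ∷ ms) {v} eq with does (v FinP.≟ proj₁ e)
  assign-∈ (e ∷ es) (m ∷ ms) {v} refl | true = here refl
  ... | false with does (v FinP.≟ proj₂ e)
  assign-∈ (e ∷ es) (m ∷ ms) {v} refl | false | true = there (here refl)
  ... | false = there (there (assign-∈ es ms eq))

  assign-injective : ∀ es ms → Unique (ends ms) → ∀ {v w x} → assign es ms v ≡ just x → assign es ms w ≡ just x → v ≡ w
  assign-injective (e ∷ es) (m ∷ ms) u {v} {w} p q with v FinP.≟ proj₁ e | w FinP.≟ proj₁ e
  ... | yes a | yes c = trans a (sym c)
  assign-injective (e ∷ es) (m ∷ ms) u {v} {w} refl q | yes a | no _ with w FinP.≟ proj₂ e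
  ... | yes _ = ⊥-elim (Unique-head u (here (sym (just-inj q))))
    where
    just-inj : ∀ {a b : Fin n} → just a ≡ just b → a ≡ b
    just-inj refl = refl
  ... | no _ = ⊥-elim (Unique-head u (there (assign-∈ es ms q)))
  assign-injective (e ∷ es) (m ∷ ms) u {v} {w} p refl | no _ | yes c with v FinP.≟ proj₂ e
  ... | yes _ = ⊥-elim (Unique-head u (here (sym (just-inj p))))
    where
    just-inj : ∀ {a b : Fin n} → just a ≡ just b → a ≡ b
    just-inj refl = refl
  ... | no _ = ⊥-elim (Unique-head u (there (assign-∈ es ms p)))
  assign-injective (e ∷ es) (m ∷ ms) u {v} {w} p q | no _ | no _ with v FinP.≟ proj₂ e | w FinP.≟ proj₂ e
  ... | yes a | yes c = trans a (sym c)
  assign-injective (e ∷ es) (m ∷ ms) u {v} {w} refl q | no _ | no _ | yes _ | no _ = ⊥-elim (Unique-head (Unique-tail u) (assign-∈ es ms q))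
  assign-injective (e ∷ es) (m ∷ ms) u {v} {w} p refl | no _ | no _ | no _ | yes _ = ⊥-elim (Unique-head (Unique-tail u) (assign-∈ es ms p))
  assign-injective (e ∷ es) (m ∷ ms) u {v} {w} p q | no _ | no _ | no _ | no _ = assign-injective es ms (Unique-tail (Unique-tail u)) p q

  assign-edge : ∀ es ms → length es ≤ length ms → (∀ {e f v} → e ∈ es → f ∈ es → Touches v e → Touches v f → e ≡ f) → (∀ {e} → e ∈ es → proj₁ e ≢ proj₂ e) →
    ∀ {e} → e ∈ es → ∃[ m ] (m ∈ ms × assign es ms (proj₁ e) ≡ just (proj₁ m) × assign es ms (proj₂ e) ≡ just (proj₂ m))
  assign-edge (f ∷ es) (m ∷ ms) le dj lp (here refl) = m , here refl , if-yes (proj₁ f FinP.≟ proj₁ f) refl ,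
    trans (if-no (proj₂ f FinP.≟ proj₁ f) (λ e → lp (here refl) (sym e))) (if-yes (proj₂ f FinP.≟ proj₂ f) refl)
  assign-edge (f ∷ es) (m ∷ ms) (s≤s le) dj lp {e} (there k) with e ≟ᴱ f
  ... | yes refl = assign-edge (f ∷ es) (m ∷ ms) (s≤s le) dj lp (here refl)
  ... | no ne with assign-edge es ms le (λ a c → dj (there a) (there c)) (λ a → lp (there a)) k
  ... | m′ , k′ , p , q = m′ , there k′ , trans (miss (inj₁ refl)) p , trans (miss (inj₂ refl)) q
    where
    miss : ∀ {v} → Touches v e → assign (f ∷ es) (m ∷ ms) v ≡ assign es ms v
    miss {v} t = trans (if-no (v FinP.≟ proj₁ f) (λ c → ne (dj (there k) (here refl) t (inj₁ c)))) (if-no (v FinP.≟ proj₂ f) (λ c → ne (dj (there k) (here refl) t (inj₂ c))))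

hEdges : ∀ {h} → Graph h → List (Edge h)
hEdges {h} H = filter (hEdge? H) (pairs h)

hEdges-length : ∀ {h} (H : Graph h) → length (hEdges H) ≡ eH H
hEdges-length {h} H = trans (length-filter-cnt (hEdge? H) (pairs h)) (sym (countTrue-cnt _ (pairs h)))

hEdges-adj : ∀ {h} (H : Graph h) {e} → e ∈ hEdges H → T (adj H (proj₁ e) (proj₂ e)) × Ordered e
hEdges-adj {h} H {i , j} m = let t = proj₂ (∈-filter⁻ (hEdge? H) {xs = pairs h} m) in proj₂ (T-∧ {toℕ i <ᵇ toℕ j} t) , <ᵇ⇒< (toℕ i) (toℕ j) (proj₁ (T-∧ {toℕ i <ᵇ toℕ j} t))

hEdges-complete : ∀ {h} (H : Graph h) {e u w} → Joins e u w → Ordered e → T (adj H u w) → e ∈ hEdges H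
hEdges-complete H (inj₁ refl) o a = ∈-filter⁺ (hEdge? H) (pairs-complete _ _) (∧-T (<⇒<ᵇ o) a)
hEdges-complete H (inj₂ refl) o a = ∈-filter⁺ (hEdge? H) (pairs-complete _ _) (∧-T (<⇒<ᵇ o) (adj-sym H a))

-- Without a cherry, H is a matching with isolated vertices. The latter are sent to vertices off M,
-- for which the last hypothesis makes room.
matching-minor : ∀ {h n} (H : Graph h) → ¬ Cherry H → (M : List (Edge n)) → Unique (ends M) → eH H ≤ length M → length (ends M) + h ≤ n → HasMinor H (graphOf M)
matching-minor {h} {n} H ¬ch M u le room with fresh-injection h (ends M) room
... | g , ginj , gfresh = embed H (graphOf M) (λ v → place v (assign es M v)) (λ v w → inj v w (assign es M v) (assign es M w) refl refl) hom
  where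
  es = hEdges H
  place : Fin h → Maybe (Fin n) → Fin n
  place v (just x) = x
  place v nothing = g v
  inj : ∀ v w p q → assign es M v ≡ p → assign es M w ≡ q → place v p ≡ place w q → v ≡ w
  inj v w (just x) (just .x) pe qe refl = assign-injective es M u pe qe
  inj v w (just x) nothing pe qe eq = ⊥-elim (gfresh w (subst (_∈ ends M) eq (assign-∈ es M pe)))
  inj v w nothing (just y) pe qe eq = ⊥-elim (gfresh v (subst (_∈ ends M) (sym eq) (assign-∈ es M qe)))
  inj v w nothing nothing pe qe eq = ginj v w eq
  disj : ∀ {e f v} → e ∈ es → f ∈ es → Touches v e → Touches v f → e ≡ f
  disj {e} {f} {v} me mf te tf with other v e FinP.≟ other v f
  ... | yes eq = other-injective (proj₂ (hEdges-adj H me)) (proj₂ (hEdges-adj H mf)) te tf eq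
  ... | no ne = ⊥-elim (¬ch (v , other v e , other v f , ne , at me (joins-other te) , at mf (joins-other tf)))
    where
    at : ∀ {e w} → e ∈ es → Joins e v w → T (adj H v w)
    at m (inj₁ refl) = proj₁ (hEdges-adj H m)
    at m (inj₂ refl) = adj-sym H (proj₁ (hEdges-adj H m))
  hom : ∀ v w → T (adj H v w) → graphOf M (place v (assign es M v)) (place w (assign es M w))
  hom v w a with orient H v w a
  ... | e , j , o with assign-edge es M (≤-trans (≤-reflexive (hEdges-length H)) le) disj (λ m → adj-≢ H (proj₁ (hEdges-adj H m))) (hEdges-complete H j o a)
  hom v w a | .(v , w) , inj₁ refl , o | m , k , p , q rewrite p | q = inj₁ k
  hom v w a | .(w , v) , inj₂ refl , o | m , k , p , q rewrite p | q = inj₂ k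

-- Random Maker: matchings and cherries

TouchesAny : ∀ {n} → List (Fin n) → Edge n → Set
TouchesAny vs e = Any (λ v → Touches v e) vs

touchesAny? : ∀ {n} (vs : List (Fin n)) → Decidable (TouchesAny vs)
touchesAny? vs e = any? (λ v → touches? v e) vs

cnt-touchesAny : ∀ {n} {U : List (Edge n)} vs → Unique U → (∀ {e} → e ∈ U → Ordered e) → cnt (touchesAny? vs) U ≤ length vs * n
cnt-touchesAny {n} {U} [] u o = ≤-reflexive (cnt-none (touchesAny? []) U (λ _ _ ()))
cnt-touchesAny {n} {U} (v ∷ vs) u o = ≤-trans (cnt-⊎ (touchesAny? (v ∷ vs)) (touches? v) (touchesAny? vs) U (λ { _ _ (here t) → inj₁ t ; _ _ (there t) → inj₂ t }))
  (+-mono-≤ (≤-trans (m≤m+n _ 1) (deg<n v u o)) (cnt-touchesAny vs u o))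

WF-U⊆board : ∀ {n b} {U M : List (Edge n)} → WF b U M → 2 * length U ≤ n * n
WF-U⊆board {n} w = ≤-trans (*-monoʳ-≤ 2 (unique-⊆-length (uniqU w) (λ m → board-complete (ordU w m)))) (board-length-upper n)

budget-bound : ∀ {n b} {U M : List (Edge n)} t → WF b U M → length M ≤ t → n * n ≤ 2 * length U + 2 * (suc b * t) + n
budget-bound {n} {b} {U} {M} t w le = ≤-trans (board-length-lower n) (+-monoˡ-≤ n (≤-trans (*-monoʳ-≤ 2 (≤-trans (budget w) (+-monoʳ-≤ (length U) (*-monoʳ-≤ (suc b) le)))) (≤-reflexive (*-distribˡ-+ 2 (length U) (suc b * t)))))

random-To1 : ∀ {h} (H : Graph h) (b : ℕ → ℕ) →
  (∀ D → ∃[ N ] ∀ n → N ≤ n → ∃[ z ] ∃[ φ ] (φ * D ≤ suc z × (∀ {q} → RVal H (b n) (board n) [] q → ℕtoℚ (suc z) Q.≤ ℕtoℚ (suc z) Q.* q Q.+ ℕtoℚ φ))) → RandomTo1 H b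
random-To1 H b f ε ε>0 with f (suc (denominator ε))
... | N , g = N , λ n le → let (z , φ , le′ , bd) = g n le ; (q , r) = Game.value H (b n) (board n) [] in q , r , error-bound ε ε>0 z φ le′ (bd r)

module ≤R = ≤-Reasoning

-- With probability near 1 the first e(H) = r + 1 edges of Maker form a matching. In these rounds at
-- least n² / (4 (d + 1)) edges are free and at most 2 m n of them meet earlier Maker edges, so a
-- round fails with probability at most K / n. The potential is K times the number of rounds left,
-- against the total n.
random-matching : ∀ {h} (H : Graph h) → ¬ Cherry H → ∀ r → eH H ≡ suc r → ∀ d (b : ℕ → ℕ) → (∀ n → suc d * (b n * (2 * r)) ≤ d * (n * n)) → RandomTo1 H b
random-matching {h} H ¬ch r eq d b hyp = random-To1 H b λ D → N D , λ { zero () ; (suc n′) le → n′ , m * K , error D n′ le , λ rv → Main.P.Bound.get (Main.P.bound D n′ le rv (Main.start D n′ le)) }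
  where
  m = suc r
  K = 8 * m * suc d
  -- In this order, the summands absorb the lower-order terms of the count of free edges, bring the
  -- error below 1 / D, and leave room for the isolated vertices of H.
  N : ℕ → ℕ
  N D = 2 * suc d * (1 + 2 * r) + (m * K * D + (2 * m + h))
  error : ∀ D n′ → N D ≤ suc n′ → m * K * D ≤ suc n′
  error D n′ le = ≤-trans (≤-trans (m≤m+n (m * K * D) _) (m≤n+m _ (2 * suc d * (1 + 2 * r)))) le
  module Main (D n′ : ℕ) (le : N D ≤ suc n′) where
    n = suc n′
    open Game {h} {n} H (b n) using (Edges; Reply; module Potential)
    big : 2 * suc d * (n + 2 * r) ≤ n * n
    big = begin
      2 * suc d * (n + 2 * r) ≤⟨ *-monoʳ-≤ (2 * suc d) (+-monoʳ-≤ n (m≤n*m (2 * r) n)) ⟩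
      2 * suc d * (n + n * (2 * r)) ≡⟨ lem (suc d) n r ⟩
      2 * suc d * (1 + 2 * r) * n ≤⟨ *-monoˡ-≤ n (≤-trans (m≤m+n (2 * suc d * (1 + 2 * r)) _) le) ⟩
      n * n ∎
      where
      open ≤R
      lem : ∀ s n r → 2 * s * (n + n * (2 * r)) ≡ 2 * s * (1 + 2 * r) * n
      lem = solve-∀
    many : ∀ {U M} → WF (b n) U M → length M ≤ r → n * n ≤ 4 * suc d * length U
    many {U} {M} w l = +-cancelˡ-≤ (d * (n * n) + d * (n * n) + n * n) _ _ (begin
        d * (n * n) + d * (n * n) + n * n + n * n ≡⟨ e₁ d (n * n) ⟩
        2 * suc d * (n * n) ≤⟨ *-monoʳ-≤ (2 * suc d) (budget-bound r w l) ⟩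
        2 * suc d * (2 * u + 2 * (suc (b n) * r) + n) ≡⟨ e₂ (suc d) u (b n) r n ⟩
        suc d * (b n * (2 * r)) + suc d * (b n * (2 * r)) + 2 * suc d * (n + 2 * r) + 4 * suc d * u ≤⟨ +-monoˡ-≤ (4 * suc d * u) (+-mono-≤ (+-mono-≤ (hyp n) (hyp n)) big) ⟩
        d * (n * n) + d * (n * n) + n * n + 4 * suc d * u ∎)
      where
      open ≤R
      u = length U
      e₁ : ∀ d k → d * k + d * k + k + k ≡ 2 * suc d * k
      e₁ = solve-∀
      e₂ : ∀ s u b r n → 2 * s * (2 * u + 2 * (suc b * r) + n) ≡ s * (b * (2 * r)) + s * (b * (2 * r)) + 2 * s * (n + 2 * r) + 4 * s * u
      e₂ = solve-∀
    -- The first alternative is the absorbing state after a failure.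
    I : Edges → Edges → ℕ → Set
    I U M φ = (n ≤ φ) ⊎ (WF (b n) U M × Unique (ends M) × ∃[ s ] (s + length M ≡ m × φ ≡ s * K))
    start : I (board n) [] (m * K)
    start = inj₂ (wf-start , [] , m , +-identityʳ m , refl)
    progress : ∀ U M φ → I U M φ → HasMinor H (graphOf M) ⊎ (n ≤ φ) ⊎ (1 ≤ length U × ∃ λ (ψ : Edge n → ℕ) → sumf ψ U ≤ length U * φ ×
      (∀ e U′ B U″ → U ↭ e ∷ U′ → Reply U′ B U″ → I U″ (e ∷ M) (ψ e)))
    progress U M φ (inj₁ dead) = inj₂ (inj₁ dead)
    progress U M φ (inj₂ (w , um , zero , eqm , _)) = inj₁ (matching-minor H ¬ch M um (≤-reflexive (trans eq (sym eqm)))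
      (≤-trans (≤-reflexive (cong (_+ h) (trans (ends-length M) (cong (2 *_) eqm)))) (≤-trans (m≤n+m (2 * m + h) (m * K * D)) (≤-trans (m≤n+m _ (2 * suc d * (1 + 2 * r))) le))))
    progress U M φ (inj₂ (w , um , suc s , eqm , refl)) = inj₂ (inj₂ (positive , ψ , total , next))
      where
      u = length U
      M≤r : length M ≤ r
      M≤r = ≤-trans (m≤n+m _ s) (≤-reflexive (suc-injective eqm))
      positive : 1 ≤ u
      positive = nonzero u (many w M≤r)
        where
        nonzero : ∀ u → n * n ≤ 4 * suc d * u → 1 ≤ u
        nonzero zero q = ⊥-elim (<⇒≱ (s≤s z≤n) (subst (n * n ≤_) (*-zeroʳ (4 * suc d)) q))
        nonzero (suc _) _ = s≤s z≤n
      hit? = touchesAny? (ends M)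
      ψ : Edge n → ℕ
      ψ e = if does (hit? e) then n else s * K
      hits : cnt hit? U ≤ 2 * m * n
      hits = ≤-trans (cnt-touchesAny (ends M) (uniqU w) (ordU w)) (*-monoˡ-≤ n (≤-trans (≤-reflexive (ends-length M)) (*-monoʳ-≤ 2 (m≤n⇒m≤1+n M≤r))))
      total : sumf ψ U ≤ u * (suc s * K)
      total = begin
        sumf ψ U ≤⟨ sumf-mono U (λ e _ → split (hit? e)) ⟩
        sumf (λ e → n * ind (hit? e) + s * K) U ≡⟨ trans (sumf-+ _ _ U) (cong₂ _+_ (sumf-* n _ U) (sumf-const _ U)) ⟩
        n * cnt hit? U + u * (s * K) ≤⟨ +-monoˡ-≤ (u * (s * K)) (*-monoʳ-≤ n hits) ⟩
        n * (2 * m * n) + u * (s * K) ≡⟨ cong (_+ u * (s * K)) (e₁ n m) ⟩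
        2 * m * (n * n) + u * (s * K) ≤⟨ +-monoˡ-≤ (u * (s * K)) (*-monoʳ-≤ (2 * m) (many w M≤r)) ⟩
        2 * m * (4 * suc d * u) + u * (s * K) ≡⟨ e₂ m (suc d) u s ⟩
        u * (suc s * K) ∎
        where
        open ≤R
        split : ∀ {P : Set} (dc : Dec P) → (if does dc then n else s * K) ≤ n * ind dc + s * K
        split (yes _) = ≤-trans (≤-reflexive (sym (*-identityʳ n))) (m≤m+n _ _)
        split (no _) = m≤n+m _ (n * 0)
        e₁ : ∀ n m → n * (2 * m * n) ≡ 2 * m * (n * n)
        e₁ = solve-∀
        e₂ : ∀ m d u s → 2 * m * (4 * d * u) + u * (s * (8 * m * d)) ≡ u * (suc s * (8 * m * d))
        e₂ = solve-∀
      next : ∀ e U′ B U″ → U ↭ e ∷ U′ → Reply U′ B U″ → I U″ (e ∷ M) (ψ e)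
      next e@(x , y) U′ B U″ p (p′ , l) = step′ (hit? e)
        where
        step′ : (dc : Dec (TouchesAny (ends M) e)) → I U″ (e ∷ M) (if does dc then n else s * K)
        step′ (yes _) = inj₁ ≤-refl
        step′ (no ¬t) = inj₂ (wf-step w p p′ l ,
          Unique-∷ (λ { (here e) → ordered-≢ (ordU w (PermP.∈-resp-↭ (↭-sym p) (here refl))) (inj₁ refl) e ; (there k) → ¬t (lose k (inj₁ refl)) }) (Unique-∷ (λ k → ¬t (lose k (inj₂ refl))) um) ,
          s , trans (+-suc s _) eqm , refl)
    module P = Potential n I progress

data Role : Set where
  mid end₁ end₂ : Role

vertexAt : ∀ {n} → Fin n × Fin n × Fin n → Role → Fin n
vertexAt (c , l , r) mid = c
vertexAt (c , l , r) end₁ = l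
vertexAt (c , l , r) end₂ = r

cherryVertices : ∀ {n} → List (Fin n × Fin n × Fin n) → List (Fin n)
cherryVertices [] = []
cherryVertices ((c , l , r) ∷ ch) = c ∷ l ∷ r ∷ cherryVertices ch

cherryVertices-length : ∀ {n} (ch : List (Fin n × Fin n × Fin n)) → length (cherryVertices ch) ≡ 3 * length ch
cherryVertices-length [] = refl
cherryVertices-length (_ ∷ ch) = trans (cong (3 +_) (cherryVertices-length ch)) (sym (*-suc 3 (length ch)))

vertexAt-∈ : ∀ {n} (ch : List (Fin n × Fin n × Fin n)) i k → vertexAt (lookup ch i) k ∈ cherryVertices ch
vertexAt-∈ (t ∷ ch) Fin.zero mid = here refl
vertexAt-∈ (t ∷ ch) Fin.zero end₁ = there (here refl)
vertexAt-∈ (t ∷ ch) Fin.zero end₂ = there (there (here refl))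
vertexAt-∈ (t ∷ ch) (Fin.suc i) k = there (there (there (vertexAt-∈ ch i k)))

vertexAt-injective : ∀ {n} (ch : List (Fin n × Fin n × Fin n)) → Unique (cherryVertices ch) → ∀ i j k k′ →
  vertexAt (lookup ch i) k ≡ vertexAt (lookup ch j) k′ → i ≡ j × k ≡ k′
vertexAt-injective (t ∷ ch) u Fin.zero Fin.zero mid mid eq = refl , refl
vertexAt-injective (t ∷ ch) u Fin.zero Fin.zero end₁ end₁ eq = refl , refl
vertexAt-injective (t ∷ ch) u Fin.zero Fin.zero end₂ end₂ eq = refl , refl
vertexAt-injective (t ∷ ch) u Fin.zero Fin.zero mid end₁ eq = ⊥-elim (Unique-head u (here eq))
vertexAt-injective (t ∷ ch) u Fin.zero Fin.zero mid end₂ eq = ⊥-elim (Unique-head u (there (here eq)))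
vertexAt-injective (t ∷ ch) u Fin.zero Fin.zero end₁ mid eq = ⊥-elim (Unique-head u (here (sym eq)))
vertexAt-injective (t ∷ ch) u Fin.zero Fin.zero end₂ mid eq = ⊥-elim (Unique-head u (there (here (sym eq))))
vertexAt-injective (t ∷ ch) u Fin.zero Fin.zero end₁ end₂ eq = ⊥-elim (Unique-head (Unique-tail u) (here eq))
vertexAt-injective (t ∷ ch) u Fin.zero Fin.zero end₂ end₁ eq = ⊥-elim (Unique-head (Unique-tail u) (here (sym eq)))
vertexAt-injective (t ∷ ch) u (Fin.suc i) (Fin.suc j) k k′ eq = let (a , c) = vertexAt-injective ch (Unique-tail (Unique-tail (Unique-tail u))) i j k k′ eq in cong Fin.suc a , c
vertexAt-injective (t ∷ ch) u Fin.zero (Fin.suc j) k k′ eq = ⊥-elim (Unique-++-disj (vertexAt t mid ∷ vertexAt t end₁ ∷ vertexAt t end₂ ∷ []) u (first k) (subst (_∈ cherryVertices ch) (sym eq) (vertexAt-∈ ch j k′)))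
  where
  first : ∀ k → vertexAt t k ∈ vertexAt t mid ∷ vertexAt t end₁ ∷ vertexAt t end₂ ∷ []
  first mid = here refl
  first end₁ = there (here refl)
  first end₂ = there (there (here refl))
vertexAt-injective (t ∷ ch) u (Fin.suc i) Fin.zero k k′ eq = ⊥-elim (Unique-++-disj (vertexAt t mid ∷ vertexAt t end₁ ∷ vertexAt t end₂ ∷ []) u (first k′) (subst (_∈ cherryVertices ch) eq (vertexAt-∈ ch i k)))
  where
  first : ∀ k → vertexAt t k ∈ vertexAt t mid ∷ vertexAt t end₁ ∷ vertexAt t end₂ ∷ []
  first mid = here refl
  first end₁ = there (here refl)
  first end₂ = there (there (here refl))

cherries-minor : ∀ {h n} (H : Graph h) → τ H ≤ 2 → (G : Fin n → Fin n → Set) → (∀ {x y} → G x y → G y x) → (ch : List (Fin n × Fin n × Fin n)) → length ch ≡ h →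
  Unique (cherryVertices ch) → All (λ t → G (vertexAt t mid) (vertexAt t end₁) × G (vertexAt t mid) (vertexAt t end₂)) ch → HasMinor H G
cherries-minor {h} {n} H τ≤2 G gsym ch refl u g = embed-cherries H τ≤2 G gsym place inj (λ i → proj₁ (All.lookup g (∈-lookup i))) (λ i → proj₂ (All.lookup g (∈-lookup i)))
  where
  role : Slot H → Role
  role (centre _) = mid
  role (left _) = end₁
  role (right _) = end₂
  index : Slot H → Fin h
  index (centre i) = i
  index (left i) = i
  index (right i) = i
  place : Slot H → Fin n
  place s = vertexAt (lookup ch (index s)) (role s)
  role-index : ∀ s t → index s ≡ index t → role s ≡ role t → s ≡ t
  role-index (centre _) (centre _) refl _ = refl
  role-index (left _) (left _) refl _ = refl
  role-index (right _) (right _) refl _ = refl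
  role-index (centre _) (left _) _ ()
  role-index (centre _) (right _) _ ()
  role-index (left _) (centre _) _ ()
  role-index (left _) (right _) _ ()
  role-index (right _) (centre _) _ ()
  role-index (right _) (left _) _ ()
  inj : ∀ s t → place s ≡ place t → s ≡ t
  inj s t eq = let (a , c) = vertexAt-injective ch u (index s) (index t) (role s) (role t) eq in role-index s t a c

pull : ∀ {n} {M : List (Edge n)} {v} → v ∈ ends M → ∃[ f ] ∃[ w ] ∃[ M′ ] (M ↭ f ∷ M′ × Joins f v w × ends M ↭ v ∷ w ∷ ends M′)
pull {M = (x , y) ∷ M} (here refl) = (x , y) , y , M , ↭-refl , inj₁ refl , ↭-refl
pull {M = (x , y) ∷ M} (there (here refl)) = (x , y) , x , M , ↭-refl , inj₂ refl , swap x y ↭-refl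
pull {M = e@(x , y) ∷ M} (there (there m)) with pull m
... | f , w , M′ , p , j , q = f , w , e ∷ M′ , ↭-trans (prep e p) (swap e f ↭-refl) , j , ↭-trans (prep x (prep y q)) (PermP.shifts (x ∷ y ∷ []) (_ ∷ w ∷ []))

pairs-in : ∀ {n} {U : List (Edge n)} (X : List (Fin n)) → Unique U → (∀ {e} → e ∈ U → Ordered e) → (∀ {e} → e ∈ U → proj₁ e ∈ X × proj₂ e ∈ X) → 2 * length U ≤ length X * length X
pairs-in {n} {U} X u o inX = subst₂ _≤_ (trans (length-++ U) (cong (length U +_) (trans (length-map turn U) (sym (+-identityʳ _))))) (len X)
    (unique-⊆-length (UniqueP.++⁺ u (UniqueP.map⁺ (λ { refl → refl }) u) disj) sub)
  where
  turn : Edge n → Edge n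
  turn (x , y) = y , x
  disj : ∀ {e} → ¬ (e ∈ U × e ∈ map turn U)
  disj (m , k) with ∈-map⁻ turn k
  ... | f , f∈ , refl = <-asym (o f∈) (o m)
  sub : ∀ {e} → e ∈ U ++ map turn U → e ∈ cartesianProduct X X
  sub m with ∈-++⁻ U m
  ... | inj₁ k = let (a , c) = inX k in ∈-cartesianProduct⁺ a c
  ... | inj₂ k with ∈-map⁻ turn k
  ... | f , f∈ , refl = let (a , c) = inX f∈ in ∈-cartesianProduct⁺ c a
  len : ∀ Y → length (cartesianProduct Y X) ≡ length Y * length X
  len [] = refl
  len (y ∷ Y) = trans (length-++ (map (y ,_) X)) (cong₂ _+_ (length-map _ X) (len Y))

avoid-bound : ∀ {n} {U : List (Edge n)} (vs : List (Fin n)) → Unique vs → Unique U → (∀ {e} → e ∈ U → Ordered e) →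
  ∃[ x ] (x + length vs ≤ n × 2 * cnt (¬? ∘ touchesAny? vs) U ≤ x * x)
avoid-bound {n} {U} vs uv u o = length X , room ,
    ≤-trans (≤-reflexive (cong (2 *_) (sym (length-filter-cnt (¬? ∘ touchesAny? vs) U))))
      (pairs-in X (UniqueP.filter⁺ _ u) (λ m → o (proj₁ (∈-filter⁻ (¬? ∘ touchesAny? vs) {xs = U} m)))
        (λ m → let t = proj₂ (∈-filter⁻ (¬? ∘ touchesAny? vs) {xs = U} m) in
          ∈-filter⁺ out? (∈-allFin _) (λ k → t (lose k (inj₁ refl))) , ∈-filter⁺ out? (∈-allFin _) (λ k → t (lose k (inj₂ refl)))))
  where
  out? : Decidable (_∉ vs)
  out? x = ¬? (any? (x FinP.≟_) vs)
  X = filter out? (allFin n)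
  room : length X + length vs ≤ n
  room = ≤-trans (+-mono-≤ (≤-reflexive (length-filter-cnt out? (allFin n))) (cnt-≥ (λ x → any? (x FinP.≟_) vs) (allFin n) uv (λ m → ∈-allFin _ , m)))
    (≤-reflexive (trans (+-comm (cnt out? (allFin n)) _) (trans (cnt-complement (λ x → any? (x FinP.≟_) vs) (allFin n)) (length-tabulate {n = n} id))))

-- The numerical core: in the window, a positive proportion of the free edges touches the current matching.
good-edges : ∀ {n u x p t b s J t₀ k good w av N} a → n * n ≤ 2 * N + n → N ≤ u + suc b * t → u ≤ good + w + av → w ≤ 3 * k * n → 2 * av ≤ x * x → x + 2 * p ≤ n →
  a * b + 2 * n ≤ a * (2 * n) → t ≤ p + J + 3 * k → 4 * a * J ≤ t₀ → t₀ ≤ t → t ≤ 2 * t₀ → 16 * a * t₀ ≤ n → p ≤ t → t ≤ n → s ≡ 18 * k + 3 → s * a ≤ t₀ → t₀ * n ≤ 2 * a * good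
good-edges {n} {u} {x} {p} {t} {b} {s} {J} {t₀} {k} {good} {w} {av} {N} a h₁ h₂ h₃ h₄ h₅ h₆ h₇ h₈ h₉ h₁₀ h₁₁ h₁₂ h₁₃ h₁₄ refl h₁₆ =
    ≤-trans (*-monoˡ-≤ n h₁₀) (+-cancelʳ-≤ (3 * (t * n)) _ _ main)
  where
  open ≤R
  -- The inequality x² ≤ (n - 2p)², written without subtraction.
  square : x * x + 4 * p * n ≤ n * n + 4 * (p * p)
  square with m≤n⇒∃[o]m+o≡n h₆
  ... | z , refl = ≤-trans (m≤m+n _ (z * z + 2 * x * z)) (≤-reflexive (lem x p z))
    where
    lem : ∀ x p z → x * x + 4 * p * (x + 2 * p + z) + (z * z + 2 * x * z) ≡ (x + 2 * p + z) * (x + 2 * p + z) + 4 * (p * p)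
    lem = solve-∀
  -- A matching of p edges meets about 2 p n edges of the board, while Breaker has claimed at most b
  -- t ≤ (2 - 2/a) n t. With p close to t, about 2 n t / a of the edges it meets are still free; the
  -- terms carried along are lower-order losses.
  step₁ : n * n + 4 * p * n ≤ 2 * good + 6 * k * n + n * n + 4 * (p * p) + 2 * (suc b * t) + n
  step₁ = begin
    n * n + 4 * p * n ≤⟨ +-monoˡ-≤ (4 * p * n) (≤-trans h₁ (+-monoˡ-≤ n (*-monoʳ-≤ 2 (≤-trans h₂ (+-monoˡ-≤ (suc b * t) (≤-trans h₃ (+-monoˡ-≤ av (+-monoʳ-≤ good h₄)))))))) ⟩
    2 * (good + 3 * k * n + av + suc b * t) + n + 4 * p * n ≡⟨ lem good k n av (suc b * t) p ⟩
    2 * good + 6 * k * n + 2 * av + 4 * p * n + 2 * (suc b * t) + n ≤⟨ +-monoˡ-≤ n (+-monoˡ-≤ (2 * (suc b * t)) (≤-trans (≤-reflexive (+-assoc (2 * good + 6 * k * n) (2 * av) (4 * p * n))) (≤-trans (+-monoʳ-≤ (2 * good + 6 * k * n) (≤-trans (+-monoˡ-≤ (4 * p * n) h₅) square)) (≤-reflexive (sym (+-assoc (2 * good + 6 * k * n) (n * n) (4 * (p * p)))))))) ⟩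
    2 * good + 6 * k * n + n * n + 4 * (p * p) + 2 * (suc b * t) + n ∎
    where
    lem : ∀ g k n av bt p → 2 * (g + 3 * k * n + av + bt) + n + 4 * p * n ≡ 2 * g + 6 * k * n + 2 * av + 4 * p * n + 2 * bt + n
    lem = solve-∀
  step₂ : 4 * p * n ≤ 2 * good + 6 * k * n + 4 * (p * p) + 2 * (suc b * t) + n
  step₂ = +-cancelˡ-≤ (n * n) _ _ (≤-trans step₁ (≤-reflexive (lem (2 * good + 6 * k * n) (n * n) (4 * (p * p)) (2 * (suc b * t)) n)))
    where
    lem : ∀ a c d e f → a + c + d + e + f ≡ c + (a + d + e + f)
    lem = solve-∀
  -- times a, with a b t + 2 n t ≤ 2 a n t
  step₃ : a * (4 * p * n) + 4 * n * t ≤ 2 * a * good + a * (6 * k * n) + 4 * a * (p * p) + a * (4 * n * t) + 2 * a * t + a * n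
  step₃ = begin
    a * (4 * p * n) + 4 * n * t ≤⟨ +-monoˡ-≤ (4 * n * t) (*-monoʳ-≤ a step₂) ⟩
    a * (2 * good + 6 * k * n + 4 * (p * p) + 2 * (suc b * t) + n) + 4 * n * t ≡⟨ lem a good (6 * k * n) (p * p) b t n ⟩
    2 * a * good + a * (6 * k * n) + 4 * a * (p * p) + 2 * ((a * b + 2 * n) * t) + 2 * a * t + a * n ≤⟨ +-monoˡ-≤ (a * n) (+-monoˡ-≤ (2 * a * t) (+-monoʳ-≤ (2 * a * good + a * (6 * k * n) + 4 * a * (p * p)) (*-monoʳ-≤ 2 (*-monoˡ-≤ t h₇)))) ⟩
    2 * a * good + a * (6 * k * n) + 4 * a * (p * p) + 2 * (a * (2 * n) * t) + 2 * a * t + a * n ≡⟨ lem₂ a good (6 * k * n) (p * p) t n ⟩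
    2 * a * good + a * (6 * k * n) + 4 * a * (p * p) + a * (4 * n * t) + 2 * a * t + a * n ∎
    where
    lem : ∀ a g c d b t n → a * (2 * g + c + 4 * d + 2 * (suc b * t) + n) + 4 * n * t ≡ 2 * a * g + a * c + 4 * a * d + 2 * ((a * b + 2 * n) * t) + 2 * a * t + a * n
    lem = solve-∀
    lem₂ : ∀ a g c d t n → 2 * a * g + a * c + 4 * a * d + 2 * (a * (2 * n) * t) + 2 * a * t + a * n ≡ 2 * a * g + a * c + 4 * a * d + a * (4 * n * t) + 2 * a * t + a * n
    lem₂ = solve-∀
  pp : 4 * a * (p * p) ≤ t * n
  pp = begin
    4 * a * (p * p) ≤⟨ *-monoʳ-≤ (4 * a) (*-mono-≤ h₁₃ (≤-trans h₁₃ h₁₁)) ⟩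
    4 * a * (t * (2 * t₀)) ≡⟨ lem a t t₀ ⟩
    t * (8 * a * t₀) ≤⟨ *-monoʳ-≤ t (≤-trans (*-monoˡ-≤ t₀ (*-monoˡ-≤ a (m≤m+n 8 8))) h₁₂) ⟩
    t * n ∎
    where
    lem : ∀ a t t₀ → 4 * a * (t * (2 * t₀)) ≡ t * (8 * a * t₀)
    lem = solve-∀
  main : t * n + 3 * (t * n) ≤ 2 * a * good + 3 * (t * n)
  main = +-cancelˡ-≤ (a * (4 * p * n)) _ _ (begin
    a * (4 * p * n) + (t * n + 3 * (t * n)) ≡⟨ cong (a * (4 * p * n) +_) (e₀ t n) ⟩
    a * (4 * p * n) + 4 * n * t ≤⟨ step₃ ⟩
    2 * a * good + a * (6 * k * n) + 4 * a * (p * p) + a * (4 * n * t) + 2 * a * t + a * n ≤⟨ +-monoˡ-≤ (a * n) (+-mono-≤ (+-mono-≤ (+-monoʳ-≤ (2 * a * good + a * (6 * k * n)) pp) (*-monoʳ-≤ a (*-monoʳ-≤ (4 * n) h₈))) (*-monoʳ-≤ (2 * a) h₁₄)) ⟩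
    2 * a * good + a * (6 * k * n) + t * n + a * (4 * n * (p + J + 3 * k)) + 2 * a * n + a * n ≡⟨ e₁ a good k n t p J ⟩
    a * (4 * p * n) + (2 * a * good + (t * n + (4 * a * J * n + (18 * k + 3) * a * n))) ≤⟨ +-monoʳ-≤ (a * (4 * p * n)) (+-monoʳ-≤ (2 * a * good) (+-monoʳ-≤ (t * n) (+-mono-≤ (*-monoˡ-≤ n (≤-trans h₉ h₁₀)) (*-monoˡ-≤ n (≤-trans h₁₆ h₁₀))))) ⟩
    a * (4 * p * n) + (2 * a * good + (t * n + (t * n + t * n))) ≡⟨ cong (λ z → a * (4 * p * n) + (2 * a * good + z)) (e₂ (t * n)) ⟩
    a * (4 * p * n) + (2 * a * good + 3 * (t * n)) ∎)
    where
    e₀ : ∀ t n → t * n + 3 * (t * n) ≡ 4 * n * t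
    e₀ = solve-∀
    e₁ : ∀ a g k n t p J → 2 * a * g + a * (6 * k * n) + t * n + a * (4 * n * (p + J + 3 * k)) + 2 * a * n + a * n ≡ a * (4 * p * n) + (2 * a * g + (t * n + (4 * a * J * n + (18 * k + 3) * a * n)))
    e₁ = solve-∀
    e₂ : ∀ z → z + (z + z) ≡ 3 * z
    e₂ = solve-∀

divide : ∀ m n → ∃[ q ] (suc m * q ≤ n × n < suc m * suc q)
divide m n = n Nat./ suc m , ≤-trans (≤-reflexive (*-comm (suc m) _)) (m/n*n≤m n (suc m)) ,
  ≤-trans (s≤s (≤-reflexive (m≡m%n+[m/n]*n n (suc m)))) (≤-trans (+-monoˡ-≤ (n Nat./ suc m * suc m) (m%n<n n (suc m))) (≤-reflexive (*-comm (suc (n Nat./ suc m)) (suc m))))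
  where open import Data.Nat.DivMod using (m/n*n≤m; m≡m%n+[m/n]*n; m%n<n)

divide-≥ : ∀ m {n q k} → n < suc m * suc q → suc m * k ≤ n → k ≤ q
divide-≥ m {n} {q} {k} lt le with k ≤? q
... | yes l = l
... | no ¬l = ⊥-elim (<⇒≱ lt (≤-trans (*-monoʳ-≤ (suc m) (≰⇒> ¬l)) le))

Unique-drop : ∀ {A : Set} (xs : List A) {y ys} → Unique (xs ++ y ∷ ys) → Unique (xs ++ ys)
Unique-drop xs {y} {ys} u = Unique-tail (Unique-↭ (PermP.shift y xs ys) u)

factor-positive : ∀ {m} c u → 1 ≤ m → m ≤ c * u → 1 ≤ u
factor-positive c zero m≥1 le = ⊥-elim (<⇒≱ m≥1 (≤-trans le (≤-reflexive (*-zeroʳ c))))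
factor-positive c (suc u) _ _ = s≤s z≤n

-- The slack is 1/a and the admissible error 1/D. Maker first collects a matching for t₀ rounds, a
-- number linear in n, and is expected to complete all cherries during the next t₀ rounds. J bounds
-- the rounds wasted on edges that touch a finished cherry.
record CherrySetting (k : ℕ) : Set where
  constructor cherry-setting
  field
    a b D n t₀ J : ℕ
    a≥1 : 1 ≤ a
    1≤t₀ : 1 ≤ t₀
    16≤n : 16 ≤ n
    16t₀≤n : 16 * t₀ ≤ n
    16at₀≤n : 16 * a * t₀ ≤ n
    n≤32at₀ : n ≤ 32 * a * t₀
    4aJ≤t₀ : 4 * a * J ≤ t₀
    Jmin≤ : 96 * D * k + 1 ≤ J
    tmin₁ : (18 * k + 3) * a ≤ t₀
    tmin₂ : 2 * D * k * (32 * a * a) ≤ t₀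
    hyp′ : a * b + 2 * n ≤ a * (2 * n)

module CherryGame {k : ℕ} (H : Graph k) (τ≤2 : τ H ≤ 2) (setting : CherrySetting k) where
    open CherrySetting setting
    -- After round t₀ a random edge extends a matching edge to a cherry with probability at least 1
    -- / R.
    R = 32 * a * a
    open Game {k} {n} H b using (Edges; Reply; Reply-length; module Potential)
    t₀≤n : 2 * t₀ ≤ n
    t₀≤n = ≤-trans (*-monoˡ-≤ t₀ (m≤m+n 2 14)) 16t₀≤n
    b≤2n : b ≤ 2 * n
    b≤2n = *-cancelˡ-≤ a {{Nat.>-nonZero a≥1}} (≤-trans (m≤m+n _ (2 * n)) hyp′)
    -- The prices of a late round, `c₁`, and of a junk round, `c₂`, are such that t₀ late rounds or
    -- J junk rounds each amount to `Zc`.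
    c₁ = J * n
    c₂ = t₀ * n
    -- A junk edge appears with probability at most 3 k n / |U| ≤ 24 k / n and costs t₀ n; this is
    -- its expected cost in one round.
    hz = 24 * k * t₀
    Zc = t₀ * (J * n)
    many : ∀ {U M} → WF (b) U M → length M ≤ 2 * t₀ → n * n ≤ 8 * length U
    many {U} {M} w l = +-cancelʳ-≤ (n * n + 2 * (n * n)) _ _ (begin
        n * n + (n * n + 2 * (n * n)) ≡⟨ e₀ (n * n) ⟩
        4 * (n * n) ≤⟨ *-monoʳ-≤ 4 (≤-trans (budget-bound (2 * t₀) w l) (+-monoˡ-≤ n (+-monoʳ-≤ (2 * u) (*-monoʳ-≤ 2 (*-monoˡ-≤ (2 * t₀) (s≤s b≤2n)))))) ⟩
        4 * (2 * u + 2 * (suc (2 * n) * (2 * t₀)) + n) ≡⟨ e₁ u n t₀ ⟩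
        8 * u + (16 * t₀ * (2 * n + 1) + 4 * n) ≤⟨ +-monoʳ-≤ (8 * u) (+-monoˡ-≤ (4 * n) (*-monoˡ-≤ (2 * n + 1) 16t₀≤n)) ⟩
        8 * u + (n * (2 * n + 1) + 4 * n) ≡⟨ cong (8 * u +_) (e₂ n) ⟩
        8 * u + (5 * n + 2 * (n * n)) ≤⟨ +-monoʳ-≤ (8 * u) (+-monoˡ-≤ (2 * (n * n)) (*-monoˡ-≤ n (≤-trans (m≤m+n 5 11) 16≤n))) ⟩
        8 * u + (n * n + 2 * (n * n)) ∎)
      where
      open ≤R
      u = length U
      e₀ : ∀ z → z + (z + 2 * z) ≡ 4 * z
      e₀ = solve-∀
      e₁ : ∀ u n t → 4 * (2 * u + 2 * (suc (2 * n) * (2 * t)) + n) ≡ 8 * u + (16 * t * (2 * n + 1) + 4 * n)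
      e₁ = solve-∀
      e₂ : ∀ n → n * (2 * n + 1) + 4 * n ≡ 5 * n + 2 * (n * n)
      e₂ = solve-∀
    -- Each late round adds `c₁`, but completes a cherry with probability at least 1 / R and then
    -- releases R c₁. A junk round adds `c₂`, which is paid by the `hz` that every round releases.
    -- Thus the expected value does not increase, and either way of failing reaches `Zc`.
    pot : ℕ → ℕ → ℕ → ℕ → ℕ
    pot rem W j s = rem * (R * c₁) + W * c₁ + j * c₂ + s * hz
    record Live (U M : Edges) (φ : ℕ) : Set where
      no-eta-equality
      pattern
      constructor live
      field
        well : WF (b) U M
        ch : List (Fin n × Fin n × Fin n)
        mt : Edges
        j rem s : ℕ
        uv : Unique (cherryVertices ch ++ ends mt)
        gch : All (λ t → graphOf M (vertexAt t mid) (vertexAt t end₁) × graphOf M (vertexAt t mid) (vertexAt t end₂)) ch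
        mtM : ∀ {f} → f ∈ mt → f ∈ M
        rem-eq : rem + length ch ≡ k
        -- A new cherry adds one Maker edge and removes at most two edges from the matching, hence
        -- the factor 3.
        count : length M ≤ length mt + j + 3 * length ch
        mt≤ : length mt ≤ length M
        time : s + length M ≡ 2 * t₀
        pot-eq : φ ≡ pot rem (length M ∸ t₀) j s
    I : Edges → Edges → ℕ → Set
    I U M φ = (Zc ≤ φ) ⊎ Live U M φ
    φ₀ = pot k 0 0 (2 * t₀)
    start : I (board n) [] φ₀
    start = inj₂ (live wf-start [] [] 0 k (2 * t₀) [] [] (λ ()) (+-identityʳ k) z≤n z≤n (+-identityʳ _) (cong (λ z → pot k z 0 (2 * t₀)) (sym (0∸n≡0 t₀))))
    Outcome : Edges → Edges → ℕ → Set
    Outcome U M φ = HasMinor H (graphOf M) ⊎ (Zc ≤ φ) ⊎ (1 ≤ length U × ∃ λ (ψ : Edge n → ℕ) → sumf ψ U ≤ length U * φ ×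
      (∀ e U′ B U″ → U ↭ e ∷ U′ → Reply U′ B U″ → I U″ (e ∷ M) (ψ e)))
    module Step {U M : Edges} {rm s′ : ℕ} (w : WF (b) U M) (ch : List (Fin n × Fin n × Fin n)) (mt : Edges) (j : ℕ)
        (uv : Unique (cherryVertices ch ++ ends mt))
        (gch : All (λ t → graphOf M (vertexAt t mid) (vertexAt t end₁) × graphOf M (vertexAt t mid) (vertexAt t end₂)) ch)
        (mtM : ∀ {f} → f ∈ mt → f ∈ M) (rem-eq : suc rm + length ch ≡ k) (count : length M ≤ length mt + j + 3 * length ch)
        (mt≤ : length mt ≤ length M) (time : suc s′ + length M ≡ 2 * t₀) (j<J : j < J) where
      u = length U
      t = length M
      W = suc t ∸ t₀
      t≤2t₀ : t ≤ 2 * t₀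
      t≤2t₀ = ≤-trans (m≤n+m t (suc s′)) (≤-reflexive time)
      ch≤k : length ch ≤ k
      ch≤k = ≤-trans (m≤n+m _ (suc rm)) (≤-reflexive rem-eq)
      junk? = touchesAny? (cherryVertices ch)
      hit? = touchesAny? (ends mt)
      good? : Decidable (λ e → ¬ TouchesAny (cherryVertices ch) e × TouchesAny (ends mt) e)
      good? e = ¬? (junk? e) ×-dec hit? e
      ψ′ : ∀ {P Q : Set} → Dec P → Dec Q → ℕ
      ψ′ dj dh = if does dj then pot (suc rm) W (suc j) s′ else if does dh then pot rm W j s′ else pot (suc rm) W j s′
      ψ : Edge n → ℕ
      ψ e = ψ′ (junk? e) (hit? e)
      base = pot (suc rm) W j s′
      junks : cnt junk? U ≤ 3 * k * n
      junks = ≤-trans (cnt-touchesAny (cherryVertices ch) (uniqU w) (ordU w)) (*-monoˡ-≤ n (≤-trans (≤-reflexive (cherryVertices-length ch)) (*-monoʳ-≤ 3 ch≤k)))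
      junk-drift : c₂ * cnt junk? U ≤ u * hz
      junk-drift = begin
        t₀ * n * cnt junk? U ≤⟨ *-monoʳ-≤ (t₀ * n) junks ⟩
        t₀ * n * (3 * k * n) ≡⟨ e₁ t₀ n k ⟩
        3 * k * t₀ * (n * n) ≤⟨ *-monoʳ-≤ (3 * k * t₀) (many w t≤2t₀) ⟩
        3 * k * t₀ * (8 * u) ≡⟨ e₂ k t₀ u ⟩
        u * (24 * k * t₀) ∎
        where
        open ≤R
        e₁ : ∀ t n k → t * n * (3 * k * n) ≡ 3 * k * t * (n * n)
        e₁ = solve-∀
        e₂ : ∀ k t u → 3 * k * t * (8 * u) ≡ u * (24 * k * t)
        e₂ = solve-∀
      Uends : Unique (ends mt)
      Uends = Unique-++ʳ (cherryVertices ch) uv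
      goods : t₀ ≤ t → u ≤ R * cnt good? U
      goods t₀≤t with avoid-bound (ends mt) Uends (uniqU w) (ordU w)
      ... | x , room , av = *-cancelˡ-≤ 2 (begin
          2 * u ≤⟨ WF-U⊆board w ⟩
          n * n ≤⟨ *-monoˡ-≤ n n≤32at₀ ⟩
          32 * a * t₀ * n ≡⟨ *-assoc (32 * a) t₀ n ⟩
          32 * a * (t₀ * n) ≤⟨ *-monoʳ-≤ (32 * a) (good-edges {x = x} {p = length mt} {b = b} {J = J} {k = k} {w = cnt junk? U} {av = cnt (¬? ∘ hit?) U} a (board-length-lower n) (budget w) covers junks av
               (≤-trans (≤-reflexive (cong (x +_) (sym (ends-length mt)))) room) hyp′ count′ 4aJ≤t₀ t₀≤t t≤2t₀ 16at₀≤n mt≤ (≤-trans t≤2t₀ t₀≤n) refl tmin₁) ⟩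
          32 * a * (2 * a * cnt good? U) ≡⟨ e₁ a (cnt good? U) ⟩
          2 * (R * cnt good? U) ∎)
        where
        open ≤R
        e₁ : ∀ a g → 32 * a * (2 * a * g) ≡ 2 * (32 * a * a * g)
        e₁ = solve-∀
        count′ : t ≤ length mt + J + 3 * k
        count′ = ≤-trans count (+-mono-≤ (+-monoʳ-≤ (length mt) (<⇒≤ j<J)) (*-monoʳ-≤ 3 ch≤k))
        covers : u ≤ cnt good? U + cnt junk? U + cnt (¬? ∘ hit?) U
        covers = ≤-trans (≤-reflexive (sym (cnt-complement hit? U))) (+-monoˡ-≤ (cnt (¬? ∘ hit?) U) (cnt-⊎ hit? good? junk? U λ e _ q → case junk? e of λ { (yes y) → inj₂ y ; (no z) → inj₁ (z , q) }))
      window-drift : u * (W * c₁) ≤ u * ((t ∸ t₀) * c₁) + R * c₁ * cnt good? U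
      window-drift with t₀ ≤? t
      ... | yes t₀≤t = begin
          u * (W * c₁) ≡⟨ cong (λ z → u * (z * c₁)) (+-∸-assoc 1 t₀≤t) ⟩
          u * (suc (t ∸ t₀) * c₁) ≡⟨ e₁ u (t ∸ t₀) c₁ ⟩
          u * ((t ∸ t₀) * c₁) + u * c₁ ≤⟨ +-monoʳ-≤ (u * ((t ∸ t₀) * c₁)) (*-monoˡ-≤ c₁ (goods t₀≤t)) ⟩
          u * ((t ∸ t₀) * c₁) + R * cnt good? U * c₁ ≡⟨ cong (u * ((t ∸ t₀) * c₁) +_) (e₂ R (cnt good? U) c₁) ⟩
          u * ((t ∸ t₀) * c₁) + R * c₁ * cnt good? U ∎
        where
        open ≤R
        e₁ : ∀ u z c → u * (suc z * c) ≡ u * (z * c) + u * c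
        e₁ = solve-∀
        e₂ : ∀ r g c → r * g * c ≡ r * c * g
        e₂ = solve-∀
      ... | no t₀≰t = ≤-trans (≤-reflexive (trans (cong (λ z → u * (z * c₁)) (m≤n⇒m∸n≡0 (≰⇒> t₀≰t))) (*-zeroʳ u))) z≤n
      total : sumf ψ U ≤ u * pot (suc rm) (t ∸ t₀) j (suc s′)
      total = +-cancelʳ-≤ (R * c₁ * cnt good? U) _ _ (begin
          sumf ψ U + R * c₁ * cnt good? U ≡⟨ trans (cong (sumf ψ U +_) (sym (sumf-* (R * c₁) _ U))) (sym (sumf-+ ψ _ U)) ⟩
          sumf (λ e → ψ e + R * c₁ * ind (good? e)) U ≤⟨ sumf-mono U (λ e _ → pointwise (junk? e) (hit? e)) ⟩
          sumf (λ e → base + c₂ * ind (junk? e)) U ≡⟨ trans (sumf-+ _ _ U) (cong₂ _+_ (sumf-const base U) (sumf-* c₂ _ U)) ⟩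
          u * base + c₂ * cnt junk? U ≤⟨ +-monoʳ-≤ (u * base) junk-drift ⟩
          u * base + u * hz ≡⟨ e₁ u (suc rm * (R * c₁)) (W * c₁) (j * c₂) s′ hz ⟩
          u * (suc rm * (R * c₁)) + u * (W * c₁) + u * (j * c₂ + suc s′ * hz) ≤⟨ +-monoˡ-≤ (u * (j * c₂ + suc s′ * hz)) (+-monoʳ-≤ (u * (suc rm * (R * c₁))) window-drift) ⟩
          u * (suc rm * (R * c₁)) + (u * ((t ∸ t₀) * c₁) + R * c₁ * cnt good? U) + u * (j * c₂ + suc s′ * hz) ≡⟨ e₂ u (suc rm * (R * c₁)) ((t ∸ t₀) * c₁) (R * c₁ * cnt good? U) (j * c₂) (suc s′ * hz) ⟩
          u * pot (suc rm) (t ∸ t₀) j (suc s′) + R * c₁ * cnt good? U ∎)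
        where
        open ≤R
        e₁ : ∀ u x y z s h → u * (x + y + z + s * h) + u * h ≡ u * x + u * y + u * (z + suc s * h)
        e₁ = solve-∀
        e₂ : ∀ u x y g z v → u * x + (u * y + g) + u * (z + v) ≡ u * (x + y + z + v) + g
        e₂ = solve-∀
        pointwise : ∀ {P Q : Set} (dj : Dec P) (dh : Dec Q) → ψ′ dj dh + R * c₁ * ind (¬? dj ×-dec dh) ≤ base + c₂ * ind dj
        pointwise (yes _) _ = ≤-reflexive (e rm R c₁ W j c₂ (s′ * hz))
          where
          e : ∀ rm r c y j c₂ v → suc rm * (r * c) + y * c + suc j * c₂ + v + r * c * 0 ≡ suc rm * (r * c) + y * c + j * c₂ + v + c₂ * 1
          e = solve-∀
        pointwise (no _) (yes _) = ≤-reflexive (e rm R c₁ (W * c₁) (j * c₂) (s′ * hz) c₂)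
          where
          e : ∀ rm r c y z v c₂ → rm * (r * c) + y + z + v + r * c * 1 ≡ suc rm * (r * c) + y + z + v + c₂ * 0
          e = solve-∀
        pointwise (no _) (no _) = ≤-reflexive (cong (base +_) (trans (*-zeroʳ (R * c₁)) (sym (*-zeroʳ c₂))))
      time′ : s′ + suc t ≡ 2 * t₀
      time′ = trans (+-suc s′ t) time
      module _ (e : Edge n) (U′ B U″ : Edges) (p : U ↭ e ∷ U′) (r : Reply U′ B U″) where
        w″ : WF (b) U″ (e ∷ M)
        w″ = wf-step w p (proj₁ r) (proj₂ r)
        oe : Ordered e
        oe = ordU w (PermP.∈-resp-↭ (↭-sym p) (here refl))
        gch′ : All (λ t → graphOf (e ∷ M) (vertexAt t mid) (vertexAt t end₁) × graphOf (e ∷ M) (vertexAt t mid) (vertexAt t end₂)) ch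
        gch′ = All.map (λ { (x , y) → graphOf-∷ x , graphOf-∷ y }) gch
        e∉M : e ∉ M
        e∉M m = Unique-++-disj M (uniq w) m (PermP.∈-resp-↭ (↭-sym p) (here refl))
        junk-case : Live U″ (e ∷ M) (pot (suc rm) W (suc j) s′)
        junk-case = live w″ ch mt (suc j) (suc rm) s′ uv gch′ (there ∘ mtM) rem-eq (≤-trans (s≤s count) (≤-reflexive (sym (cong (_+ 3 * length ch) (+-suc (length mt) j))))) (m≤n⇒m≤1+n mt≤) time′ refl
        fresh-case : ¬ TouchesAny (cherryVertices ch) e → ¬ TouchesAny (ends mt) e → Live U″ (e ∷ M) (pot (suc rm) W j s′)
        fresh-case nj nh = live w″ ch (e ∷ mt) j (suc rm) s′ uv′ gch′ (λ { (here q) → here q ; (there m) → there (mtM m) }) rem-eq (s≤s count) (s≤s mt≤) time′ refl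
          where
          out : ∀ {v} → Touches v e → v ∉ cherryVertices ch ++ ends mt
          out tv m with ∈-++⁻ (cherryVertices ch) m
          ... | inj₁ q = nj (lose q tv)
          ... | inj₂ q = nh (lose q tv)
          uv′ : Unique (cherryVertices ch ++ proj₁ e ∷ proj₂ e ∷ ends mt)
          uv′ = Unique-↭ (↭-sym (PermP.shifts (cherryVertices ch) (proj₁ e ∷ proj₂ e ∷ [])))
            (Unique-∷ (λ { (here q) → ordered-≢ oe (inj₁ refl) q ; (there m) → out (inj₁ refl) m }) (Unique-∷ (out (inj₂ refl)) uv))
        -- e = vx and some matching edge f = vy form the new cherry with centre v
        good-case : ¬ TouchesAny (cherryVertices ch) e → ∀ v x → Joins e v x → v ∈ ends mt → Live U″ (e ∷ M) (pot rm W j s′)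
        good-case nj v x je vm with pull vm
        ... | f , y , mt₁ , pf , jf , pe = finish (any? (x FinP.≟_) (ends mt₁))
          where
          f∈M : f ∈ M
          f∈M = mtM (PermP.∈-resp-↭ (↭-sym pf) (here refl))
          V = cherryVertices ch
          uv₁ : Unique (v ∷ y ∷ V ++ ends mt₁)
          uv₁ = Unique-↭ (↭-trans (PermP.++⁺ˡ V pe) (PermP.shifts V (v ∷ y ∷ []))) uv
          x∉V : x ∉ V
          x∉V m = nj (lose m (joins-touchesʳ je))
          x≢v : x ≢ v
          x≢v q = ordered-≢ oe je (sym q)
          x≢y : x ≢ y
          x≢y refl = e∉M (subst (_∈ M) (sym (ordered-joins-unique oe (ordM w f∈M) je jf)) f∈M)
          gv : graphOf (e ∷ M) v y × graphOf (e ∷ M) v x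
          gv = graphOf-∷ (joins-graphOf f∈M jf) , joins-graphOf (here refl) je
          lmt : length mt ≡ suc (length mt₁)
          lmt = PermP.↭-length pf
          build : ∀ mt′ → Unique (x ∷ v ∷ y ∷ V ++ ends mt′) → (∀ {g} → g ∈ mt′ → g ∈ mt₁) → length mt₁ ≤ suc (length mt′) → length mt′ ≤ length mt₁ → Live U″ (e ∷ M) (pot rm W j s′)
          build mt′ u′ sub l₁ l₂ = live w″ ((v , y , x) ∷ ch) mt′ j rm s′
            (Unique-↭ (PermP.shifts (x ∷ []) (v ∷ y ∷ [])) u′) (gv ∷ gch′)
            (λ m → there (mtM (PermP.∈-resp-↭ (↭-sym pf) (there (sub m))))) (trans (+-suc rm _) rem-eq)
            (≤-trans (s≤s count) (≤-trans (s≤s (+-monoˡ-≤ (3 * length ch) (+-monoˡ-≤ j (≤-trans (≤-reflexive lmt) (s≤s l₁))))) (≤-reflexive (e₁ (length mt′) j (length ch)))))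
            (m≤n⇒m≤1+n (≤-trans l₂ (≤-trans (n≤1+n _) (≤-trans (≤-reflexive (sym lmt)) mt≤)))) time′ refl
            where
            e₁ : ∀ m j c → suc (suc (suc m) + j + 3 * c) ≡ m + j + 3 * suc c
            e₁ = solve-∀
          finish : Dec (x ∈ ends mt₁) → Live U″ (e ∷ M) (pot rm W j s′)
          finish (no x∉) = build mt₁ (Unique-∷ out uv₁) id (n≤1+n _) ≤-refl
            where
            out : x ∉ v ∷ y ∷ V ++ ends mt₁
            out (here q) = x≢v q
            out (there (here q)) = x≢y q
            out (there (there m)) with ∈-++⁻ V m
            ... | inj₁ q = x∉V q
            ... | inj₂ q = x∉ q
          finish (yes xm) with pull xm
          ... | g , z , mt₂ , pg , jg , pe₂ = build mt₂ (Unique-drop (x ∷ v ∷ y ∷ V) (Unique-↭ perm uv₁)) (λ m → PermP.∈-resp-↭ (↭-sym pg) (there m))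
                (≤-reflexive (PermP.↭-length pg)) (≤-trans (n≤1+n _) (≤-reflexive (sym (PermP.↭-length pg))))
            where
            perm : v ∷ y ∷ V ++ ends mt₁ ↭ x ∷ v ∷ y ∷ V ++ z ∷ ends mt₂
            perm = ↭-trans (PermP.++⁺ˡ (v ∷ y ∷ V) pe₂) (PermP.shift x (v ∷ y ∷ V) (z ∷ ends mt₂))
        next : I U″ (e ∷ M) (ψ e)
        next = go′ (junk? e) (hit? e)
          where
          go′ : (dj : Dec (TouchesAny (cherryVertices ch) e)) (dh : Dec (TouchesAny (ends mt) e)) → I U″ (e ∷ M) (ψ′ dj dh)
          go′ (yes _) _ = inj₂ junk-case
          go′ (no nj) (no nh) = inj₂ (fresh-case nj nh)
          go′ (no nj) (yes th) with find th
          ... | v , vm , tv = inj₂ (good-case nj v (other v e) (joins-other tv) vm)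
      outcome : Outcome U M (pot (suc rm) (length M ∸ t₀) j (suc s′))
      outcome = inj₂ (inj₂ (factor-positive 8 (length U) (*-mono-≤ {1} {n} {1} {n} n≥1 n≥1) (many w t≤2t₀) , ψ , total , next))
        where
        n≥1 : 1 ≤ n
        n≥1 = ≤-trans (s≤s z≤n) 16≤n
    progress : ∀ U M φ → I U M φ → Outcome U M φ
    progress U M φ (inj₁ dead) = inj₂ (inj₁ dead)
    progress U M φ (inj₂ (live w ch mt j zero s uv gch mtM rem-eq count mt≤ time _)) = inj₁ (cherries-minor H τ≤2 (graphOf M) (graphOf-sym {M = M}) ch rem-eq (Unique-++ˡ (cherryVertices ch) uv) gch)
    progress U M φ (inj₂ (live w ch mt j rem zero uv gch mtM rem-eq count mt≤ time refl)) = inj₂ (inj₁ (begin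
        t₀ * c₁ ≡⟨ cong (_* c₁) (sym (trans (cong (_∸ t₀) time) (trans (m+n∸m≡n t₀ (t₀ + 0)) (+-identityʳ t₀)))) ⟩
        (length M ∸ t₀) * c₁ ≤⟨ m≤n+m _ (rem * (R * c₁)) ⟩
        rem * (R * c₁) + (length M ∸ t₀) * c₁ ≤⟨ ≤-trans (m≤m+n _ (j * c₂)) (m≤m+n _ 0) ⟩
        pot rem (length M ∸ t₀) j zero ∎))
      where open ≤R
    progress U M φ (inj₂ (live w ch mt j (suc rm) (suc s′) uv gch mtM rem-eq count mt≤ time refl)) = decide (J ≤? j)
      where
      decide : Dec (J ≤ j) → Outcome U M (pot (suc rm) (length M ∸ t₀) j (suc s′))
      decide (yes J≤j) = inj₂ (inj₁ (junk-full J≤j))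
        where
        open ≤R
        e₁ : ∀ t j n → t * (j * n) ≡ j * (t * n)
        e₁ = solve-∀
        junk-full : J ≤ j → Zc ≤ pot (suc rm) (length M ∸ t₀) j (suc s′)
        junk-full J≤j = begin
          t₀ * (J * n) ≡⟨ e₁ t₀ J n ⟩
          J * c₂ ≤⟨ *-monoˡ-≤ c₂ J≤j ⟩
          j * c₂ ≤⟨ m≤n+m _ (suc rm * (R * c₁) + (length M ∸ t₀) * c₁) ⟩
          suc rm * (R * c₁) + (length M ∸ t₀) * c₁ + j * c₂ ≤⟨ m≤m+n _ _ ⟩
          pot (suc rm) (length M ∸ t₀) j (suc s′) ∎
      decide (no J≰j) = Step.outcome w ch mt j uv gch mtM rem-eq count mt≤ time (≰⇒> J≰j)
    module P = Potential Zc I progress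
    Z>0 : 1 ≤ Zc
    Z>0 = *-mono-≤ 1≤t₀ (*-mono-≤ (≤-trans (m≤n+m 1 (96 * D * k)) Jmin≤) (≤-trans (s≤s z≤n) 16≤n))
    error : φ₀ * D ≤ Zc
    error = *-cancelˡ-≤ 2 (begin
        2 * ((k * (R * c₁) + 0 * c₁ + 0 * c₂ + 2 * t₀ * hz) * D) ≡⟨ e₁ k R c₁ t₀ D ⟩
        2 * D * k * R * c₁ + 96 * D * k * t₀ * t₀ ≤⟨ +-mono-≤ (*-monoˡ-≤ c₁ tmin₂)
             (*-mono-≤ (*-monoˡ-≤ t₀ (≤-trans (m≤m+n _ 1) Jmin≤)) (≤-trans (m≤m+n t₀ (t₀ + 0)) t₀≤n)) ⟩
        t₀ * c₁ + J * t₀ * n ≡⟨ e₂ t₀ J n ⟩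
        2 * Zc ∎)
      where
      open ≤R
      e₁ : ∀ k r c t D → 2 * ((k * (r * c) + 0 * c + 0 * (t * n) + 2 * t * (24 * k * t)) * D) ≡ 2 * D * k * r * c + 96 * D * k * t * t
      e₁ = λ k r c t D → lem k r c t D n
        where
        lem : ∀ k r c t D n → 2 * ((k * (r * c) + 0 * c + 0 * (t * n) + 2 * t * (24 * k * t)) * D) ≡ 2 * D * k * r * c + 96 * D * k * t * t
        lem = solve-∀
      e₂ : ∀ t j n → t * (j * n) + j * t * n ≡ 2 * (t * (j * n))
      e₂ = solve-∀
    result : ∃[ z ] ∃[ φ ] (φ * D ≤ suc z × (∀ {q} → RVal H b (board n) [] q → ℕtoℚ (suc z) Q.≤ ℕtoℚ (suc z) Q.* q Q.+ ℕtoℚ φ))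
    result with Nat.pred Zc | suc-pred Zc {{Nat.>-nonZero Z>0}}
    ... | z | eq = z , φ₀ , ≤-trans error (≤-reflexive (sym eq)) , λ {q} rv → subst (λ y → ℕtoℚ y Q.≤ ℕtoℚ y Q.* q Q.+ ℕtoℚ φ₀) (sym eq) (P.Bound.get (P.bound rv start))

random-cherries : ∀ {h} (H : Graph h) → τ H ≤ 2 → ∀ d (b : ℕ → ℕ) → (∀ n → suc d * (b n * 1) ≤ d * (2 * n)) → RandomTo1 H b
-- The divisor suc (d + 15 * suc d) is 16 (d + 1) by computation; likewise the later divisor is 4 (d
-- + 1).
random-cherries {k} H τ≤2 d b hyp = random-To1 H b λ D → N D , λ n le → choose D n le (divide (d + 15 * suc d) n)
  where
  tmin : ℕ → ℕ
  tmin D = (18 * k + 3) * suc d + (4 * suc d * (96 * D * k + 1) + 2 * D * k * (32 * suc d * suc d))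
  N : ℕ → ℕ
  N D = suc (d + 15 * suc d) * tmin D
  module _ (D n : ℕ) (le : N D ≤ n) where
    Result : Set
    Result = ∃[ z ] ∃[ φ ] (φ * D ≤ suc z × (∀ {q} → RVal H (b n) (board n) [] q → ℕtoℚ (suc z) Q.≤ ℕtoℚ (suc z) Q.* q Q.+ ℕtoℚ φ))
    core : ∀ a t₀ J → a ≡ suc d → tmin D ≤ t₀ → 16 * a * t₀ ≤ n → n < 16 * a * suc t₀ → 4 * a * J ≤ t₀ → t₀ < 4 * a * suc J → Result
    core a t₀ J eq tm l₁ l₂ l₃ l₄ = CherryGame.result H τ≤2 (cherry-setting a (b n) D n t₀ J a≥1 1≤t₀ (≤-trans (≤-trans (≤-reflexive (sym (*-identityʳ 16))) (*-monoʳ-≤ 16 1≤t₀)) 16t₀≤n) 16t₀≤n l₁ n≤ l₃ Jm tm₁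
        (≤-trans (≤-reflexive (cong (λ z → 2 * D * k * (32 * z * z)) eq)) (≤-trans (m≤n+m _ ((18 * k + 3) * suc d + 4 * suc d * (96 * D * k + 1))) (≤-trans (≤-reflexive (+-assoc ((18 * k + 3) * suc d) _ _)) tm))) hyp′)
      where
      a≥1 : 1 ≤ a
      a≥1 = subst (1 ≤_) (sym eq) (s≤s z≤n)
      tm₁ : (18 * k + 3) * a ≤ t₀
      tm₁ = ≤-trans (≤-reflexive (cong ((18 * k + 3) *_) eq)) (≤-trans (m≤m+n _ _) tm)
      1≤t₀ : 1 ≤ t₀
      1≤t₀ = ≤-trans (*-mono-≤ {1} {18 * k + 3} {1} {a} (≤-trans (s≤s z≤n) (m≤n+m 3 (18 * k))) a≥1) tm₁
      16t₀≤n : 16 * t₀ ≤ n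
      16t₀≤n = ≤-trans (*-monoˡ-≤ t₀ (m≤m*n 16 a {{Nat.>-nonZero a≥1}})) l₁
      n≤ : n ≤ 32 * a * t₀
      n≤ = ≤-trans (<⇒≤ l₂) (≤-trans (*-monoʳ-≤ (16 * a) (+-monoˡ-≤ t₀ 1≤t₀)) (≤-reflexive (lem a t₀)))
        where
        lem : ∀ a t → 16 * a * (t + t) ≡ 32 * a * t
        lem = solve-∀
      Jm : 96 * D * k + 1 ≤ J
      Jm with 96 * D * k + 1 ≤? J
      ... | yes l = l
      ... | no ¬l = ⊥-elim (<⇒≱ l₄ (≤-trans (*-monoʳ-≤ (4 * a) (≰⇒> ¬l)) (≤-trans (≤-reflexive (cong (λ z → 4 * z * (96 * D * k + 1)) eq)) (≤-trans (≤-trans (m≤m+n _ (2 * D * k * (32 * suc d * suc d))) (m≤n+m _ ((18 * k + 3) * suc d))) tm))))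
      hyp′ : a * b n + 2 * n ≤ a * (2 * n)
      hyp′ = subst (λ a → a * b n + 2 * n ≤ a * (2 * n)) (sym eq) (≤-trans (+-monoˡ-≤ (2 * n) (≤-trans (≤-reflexive (cong (suc d *_) (sym (*-identityʳ (b n))))) (hyp n))) (≤-reflexive (+-comm (d * (2 * n)) _)))
    choose : ∃[ q ] (suc (d + 15 * suc d) * q ≤ n × n < suc (d + 15 * suc d) * suc q) → Result
    choose (t₀ , l₁ , l₂) with divide (d + 3 * suc d) t₀
    ... | J , l₃ , l₄ = core (suc d) t₀ J refl (divide-≥ (d + 15 * suc d) l₂ le) l₁ l₂ l₃ l₄

-- Minors of sparse graphs of large girth

concat-↭ : ∀ {A : Set} {L L′ : List (List A)} → L ↭ L′ → concat L ↭ concat L′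
concat-↭ Perm.refl = ↭-refl
concat-↭ (prep x p) = PermP.++⁺ˡ x (concat-↭ p)
concat-↭ (swap x y p) = ↭-trans (PermP.shifts x y) (PermP.++⁺ˡ y (PermP.++⁺ˡ x (concat-↭ p)))
concat-↭ (Perm.trans p q) = ↭-trans (concat-↭ p) (concat-↭ q)

concat-++ : ∀ {A : Set} (L L′ : List (List A)) → concat (L ++ L′) ≡ concat L ++ concat L′
concat-++ [] L′ = refl
concat-++ (X ∷ L) L′ = trans (cong (X ++_) (concat-++ L L′)) (sym (++-assoc X (concat L) (concat L′)))

∈-concat : ∀ {A : Set} {x : A} {X L} → x ∈ X → X ∈ L → x ∈ concat L
∈-concat m k = ∈-concat⁺′ m k

-- A blob is a list of vertices, to be contracted to a single vertex.
module Blobs {n : ℕ} (G : Fin n → Fin n → Set) (G? : ∀ x y → Dec (G x y)) (gsym : ∀ {x y} → G x y → G y x) where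

  Blob : Set
  Blob = List (Fin n)

  Adj : Blob → Blob → Set
  Adj X Y = Any (λ x → Any (G x) Y) X

  adj? : ∀ X → Decidable (Adj X)
  adj? X Y = any? (λ x → any? (G? x) Y) X

  adj-ends : ∀ {X Y} → Adj X Y → ∃₂ λ x y → x ∈ X × y ∈ Y × G x y
  adj-ends a with find a
  ... | x , mx , a′ with find a′
  ... | y , my , g = x , y , mx , my , g

  ends-adj : ∀ {X Y x y} → x ∈ X → y ∈ Y → G x y → Adj X Y
  ends-adj mx my g = lose mx (lose my g)

  Adj-sym : ∀ {X Y} → Adj X Y → Adj Y X
  Adj-sym a = let (x , y , mx , my , g) = adj-ends a in ends-adj my mx (gsym g)

  Joined : Blob → Fin n → Fin n → ℕ → Set
  Joined X x y k = ∃[ vs ] (Walk (λ a b → G a b × b ∈ X) x y vs × length vs ≤ k)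

  joined-mono : ∀ {X Y x y k l} → (∀ {z} → z ∈ X → z ∈ Y) → k ≤ l → Joined X x y k → Joined Y x y l
  joined-mono sub le (vs , w , l) = vs , walk-map (λ _ _ _ _ (g , m) → g , sub m) w , ≤-trans l le

  joined-trans : ∀ {X x y z w k l} → Joined X x y k → G y z → z ∈ X → Joined X z w l → Joined X x w (k + l)
  joined-trans (vs , v , l) g m (us , u , l′) = vs ++ us , walk-join v (g , m) u , ≤-trans (≤-reflexive (length-++ vs)) (+-mono-≤ l l′)

  walk-append : ∀ {X x y z vs us} → Walk (λ a b → G a b × b ∈ X) x y vs → Walk (λ a b → G a b × b ∈ X) y z us → ∃[ ws ] (Walk (λ a b → G a b × b ∈ X) x z ws × length ws ≤ length vs + length us)
  walk-append stop u = _ , u , n≤1+n _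
  walk-append (go g w) u with walk-append w u
  ... | ws , w′ , l = _ , go g w′ , s≤s l

  joined-append : ∀ {X x y z k l} → Joined X x y k → Joined X y z l → Joined X x z (k + l)
  joined-append (vs , v , l) (us , u , l′) = let (ws , w , l″) = walk-append v u in ws , w , ≤-trans l″ (+-mono-≤ l l′)

  joined-sym : ∀ {X x y k} → x ∈ X → Joined X x y k → Joined X y x k
  joined-sym {X} mx (vs , w , l) = let (us , u , e) = rev mx w in us , u , ≤-trans (≤-reflexive e) l
    where
    snoc : ∀ {x y z vs} → Walk (λ a b → G a b × b ∈ X) x y vs → G y z → z ∈ X → ∃[ us ] (Walk (λ a b → G a b × b ∈ X) x z us × length us ≡ suc (length vs))
    snoc stop g m = _ , go (g , m) stop , refl
    snoc (go h w) g m = let (us , u , e) = snoc w g m in _ , go h u , cong suc e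
    rev : ∀ {x y vs} → x ∈ X → Walk (λ a b → G a b × b ∈ X) x y vs → ∃[ us ] (Walk (λ a b → G a b × b ∈ X) y x us × length us ≡ length vs)
    rev m stop = _ , stop , refl
    rev m (go (g , mz) w) with rev mz w
    ... | us , u , e = let (ws , v , e′) = snoc u (gsym g) m in ws , v , trans e′ (cong suc e)

  Connected : Blob → Set
  Connected X = (∃[ x ] x ∈ X) × (∀ {x y} → x ∈ X → y ∈ X → ∃[ k ] Joined X x y k)

  merge-connected : ∀ {X Y} → Connected X → Connected Y → Adj X Y → Connected (X ++ Y)
  merge-connected {X} {Y} ((x , mx) , cx) (_ , cy) a with adj-ends a
  ... | x₀ , y₀ , m₀ , k₀ , g = (x , ∈-++⁺ˡ mx) , conn
    where
    inX : ∀ {x y k} → Joined X x y k → Joined (X ++ Y) x y k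
    inX = joined-mono ∈-++⁺ˡ ≤-refl
    inY : ∀ {x y k} → Joined Y x y k → Joined (X ++ Y) x y k
    inY = joined-mono (∈-++⁺ʳ X) ≤-refl
    conn : ∀ {x y} → x ∈ X ++ Y → y ∈ X ++ Y → ∃[ k ] Joined (X ++ Y) x y k
    conn m m′ with ∈-++⁻ X m | ∈-++⁻ X m′
    ... | inj₁ a | inj₁ c = let (k , j) = cx a c in k , inX j
    ... | inj₂ a | inj₂ c = let (k , j) = cy a c in k , inY j
    ... | inj₁ a | inj₂ c = _ , joined-trans (inX (proj₂ (cx a m₀))) g (∈-++⁺ʳ X k₀) (inY (proj₂ (cy k₀ c)))
    ... | inj₂ a | inj₁ c = _ , joined-trans (inY (proj₂ (cy a k₀))) (gsym g) (∈-++⁺ˡ m₀) (inX (proj₂ (cx m₀ c)))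

  -- The number of edges of the simple graph obtained by contracting the blobs: an adjacent pair
  -- counts once, however many edges join it.
  edges : List Blob → ℕ
  edges [] = 0
  edges (X ∷ L) = cnt (adj? X) L + edges L

  edges-↭ : ∀ {L L′} → L ↭ L′ → edges L ≡ edges L′
  edges-↭ Perm.refl = refl
  edges-↭ (prep X p) = cong₂ _+_ (sumf-↭ _ p) (edges-↭ p)
  edges-↭ {_} {_ ∷ _ ∷ L′} (swap X Y p) rewrite sumf-↭ (λ Z → ind (adj? X Z)) p | sumf-↭ (λ Z → ind (adj? Y Z)) p | edges-↭ p =
    trans (cong (λ i → i + cnt (adj? X) L′ + (cnt (adj? Y) L′ + edges L′)) (≤-antisym (ind-mono (adj? X Y) (adj? Y X) Adj-sym) (ind-mono (adj? Y X) (adj? X Y) Adj-sym)))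
      (lem (ind (adj? Y X)) (cnt (adj? X) L′) (cnt (adj? Y) L′) (edges L′))
    where
    lem : ∀ i a c d → i + a + (c + d) ≡ i + c + (a + d)
    lem = solve-∀
  edges-↭ (Perm.trans p q) = trans (edges-↭ p) (edges-↭ q)

  Common : Blob → Blob → Blob → Set
  Common X Y Z = Adj X Z × Adj Y Z

  common? : ∀ X Y → Decidable (Common X Y)
  common? X Y Z = adj? X Z ×-dec adj? Y Z

  -- Contracting an edge loses this edge and one more for every common neighbour of its ends.
  merge-edges : ∀ X Y L → edges (X ∷ Y ∷ L) ≤ edges ((X ++ Y) ∷ L) + suc (cnt (common? X Y) L)
  merge-edges X Y L = begin
      ind (adj? X Y) + cnt (adj? X) L + (cnt (adj? Y) L + edges L) ≤⟨ +-monoˡ-≤ _ (+-monoˡ-≤ (cnt (adj? X) L) (ind≤1 (adj? X Y))) ⟩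
      1 + cnt (adj? X) L + (cnt (adj? Y) L + edges L) ≡⟨ e₁ (cnt (adj? X) L) (cnt (adj? Y) L) (edges L) ⟩
      (cnt (adj? X) L + cnt (adj? Y) L) + suc (edges L) ≤⟨ +-monoˡ-≤ (suc (edges L)) inex ⟩
      (cnt (adj? (X ++ Y)) L + cnt (common? X Y) L) + suc (edges L) ≡⟨ e₂ (cnt (adj? (X ++ Y)) L) (cnt (common? X Y) L) (edges L) ⟩
      cnt (adj? (X ++ Y)) L + edges L + suc (cnt (common? X Y) L) ∎
    where
    open ≤R
    e₁ : ∀ a c d → 1 + a + (c + d) ≡ a + c + suc d
    e₁ = solve-∀
    e₂ : ∀ a c d → a + c + suc d ≡ a + d + suc c
    e₂ = solve-∀
    one : ∀ {P Q R : Set} (p : Dec P) (q : Dec Q) (r : Dec R) → (P → R) → (Q → R) → ind p + ind q ≤ ind r + ind (p ×-dec q)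
    one (yes p) (yes _) r f g = +-monoˡ-≤ 1 (≤-reflexive (sym (ind-yes r (f p))))
    one (yes p) (no _) r f g = +-monoˡ-≤ 0 (≤-reflexive (sym (ind-yes r (f p))))
    one (no _) (yes q) r f g = ≤-trans (≤-reflexive (sym (ind-yes r (g q)))) (m≤m+n _ 0)
    one (no _) (no _) r f g = z≤n
    inex : cnt (adj? X) L + cnt (adj? Y) L ≤ cnt (adj? (X ++ Y)) L + cnt (common? X Y) L
    inex = subst₂ _≤_ (sumf-+ _ _ L) (sumf-+ _ _ L) (sumf-mono L (λ Z _ → one (adj? X Z) (adj? Y Z) (adj? (X ++ Y) Z) (AnyP.++⁺ˡ) (AnyP.++⁺ʳ X)))

  picks-degrees : ∀ d L → (∀ {p} → p ∈ picks L → d ≤ cnt (adj? (proj₁ p)) (proj₂ p)) → d * length L ≤ 2 * edges L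
  picks-degrees d L h = ≤-trans (≤-reflexive (trans (*-comm d (length L)) (trans (cong (_* d) (sym (picks-length L))) (sym (sumf-const d (picks L))))))
      (≤-trans (sumf-mono (picks L) (λ p m → h m)) (≤-reflexive (total L)))
    where
    deg′ : Blob × List Blob → ℕ
    deg′ p = cnt (adj? (proj₁ p)) (proj₂ p)
    total : ∀ L → sumf deg′ (picks L) ≡ 2 * edges L
    total [] = refl
    total (X ∷ L) = begin
        cnt (adj? X) L + sumf deg′ (map (λ p → proj₁ p , X ∷ proj₂ p) (picks L)) ≡⟨ cong (cnt (adj? X) L +_) (trans (sumf-map _ deg′ (picks L)) (sumf-+ (λ p → ind (adj? (proj₁ p) X)) deg′ (picks L))) ⟩
        cnt (adj? X) L + (sumf (λ p → ind (adj? (proj₁ p) X)) (picks L) + sumf deg′ (picks L)) ≡⟨ cong₂ (λ a c → cnt (adj? X) L + (a + c)) (trans (sym (sumf-map proj₁ (λ Y → ind (adj? Y X)) (picks L))) (trans (cong (sumf (λ Y → ind (adj? Y X))) (picks-proj₁ L)) (sumf-cong L (λ Y _ → ≤-antisym (ind-mono (adj? Y X) (adj? X Y) Adj-sym) (ind-mono (adj? X Y) (adj? Y X) Adj-sym))))) (total L) ⟩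
        cnt (adj? X) L + (cnt (adj? X) L + 2 * edges L) ≡⟨ lem (cnt (adj? X) L) (edges L) ⟩
        2 * (cnt (adj? X) L + edges L) ∎
      where
      open ≡-Reasoning
      lem : ∀ a c → a + (a + 2 * c) ≡ 2 * (a + c)
      lem = solve-∀

  -- A complete minor of order h. By `contains` each of its blobs includes a given one, so a blob
  -- adjacent to all given ones is adjacent to the whole model; by `within` that blob stays disjoint
  -- from it.
  record Model (h : ℕ) (L : List Blob) : Set where
    field
      blobs : List Blob
      size : length blobs ≡ h
      connected : ∀ {K} → K ∈ blobs → Connected K
      pairwise : AllPairs Adj blobs
      disjoint : Unique (concat blobs)
      contains : ∀ {K} → K ∈ blobs → ∃[ X ] (X ∈ L × (∀ {x} → x ∈ X → x ∈ K))
      within : ∀ {x} → x ∈ concat blobs → x ∈ concat L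

  Forces : ℕ → Set
  Forces h = ∀ k L → length L ≤ k → 1 ≤ length L → (∀ {X} → X ∈ L → Connected X) → Unique (concat L) → 2 ^ h * length L ≤ edges L → Model h L

  mader-step : ∀ h → Forces h → Forces (suc h)
  mader-step h ih zero (X ∷ L) () _ _ _ _
  mader-step h ih (suc k) (X ∷ L) (s≤s le) _ conn uL dense with cnt (adj? X) L ≤? 2 ^ suc h
  ... | yes few = relabel (mader-step h ih k L le nonempty (conn ∘ there) (Unique-++ʳ X uL) dense′)
    where
    d = 2 ^ suc h
    dense′ : d * length L ≤ edges L
    dense′ = +-cancelˡ-≤ d _ _ (≤-trans (≤-reflexive (sym (*-suc d (length L)))) (≤-trans dense (+-monoˡ-≤ (edges L) few)))
    more : ∀ L → d * suc (length L) ≤ cnt (adj? X) L + edges L → 1 ≤ length L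
    more (_ ∷ _) _ = s≤s z≤n
    more [] q = ⊥-elim (<⇒≱ (m^n>0 2 (suc h)) (≤-trans (≤-reflexive (sym (*-identityʳ d))) q))
    nonempty : 1 ≤ length L
    nonempty = more L dense
    relabel : Model (suc h) L → Model (suc h) (X ∷ L)
    relabel m = record { blobs = blobs ; size = size ; connected = connected ; pairwise = pairwise ; disjoint = disjoint
      ; contains = λ k → let (Y , mY , sub) = contains k in Y , there mY , sub ; within = λ x → ∈-++⁺ʳ X (within x) }
      where open Model m
  ... | no many with any? (λ p → cnt (adj? (proj₁ p)) (proj₂ p) <? 2 ^ suc h) (picks (filter (adj? X) L))
  ... | yes found with find found
  ... | (Y , R) , pm , small = relabel (mader-step h ih k ((X ++ Y) ∷ R′) le′ (s≤s z≤n) conn′ unique′ dense′)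
    where
    d = 2 ^ suc h
    Nb = filter (adj? X) L
    R′ = R ++ filter (¬? ∘ adj? X) L
    NbY : Nb ↭ Y ∷ R
    NbY = picks-↭ Nb pm
    permL : L ↭ Y ∷ R′
    permL = ↭-trans (filter-split (adj? X) L) (PermP.++⁺ʳ _ NbY)
    adjXY : Adj X Y
    adjXY = proj₂ (∈-filter⁻ (adj? X) {xs = L} (PermP.∈-resp-↭ (↭-sym NbY) (here refl)))
    lenL : length L ≡ suc (length R′)
    lenL = PermP.↭-length permL
    le′ : length ((X ++ Y) ∷ R′) ≤ k
    le′ = ≤-trans (≤-reflexive (sym lenL)) le
    concat-perm : X ++ concat L ↭ (X ++ Y) ++ concat R′
    concat-perm = ↭-trans (PermP.++⁺ˡ X (concat-↭ permL)) (↭-reflexive (sym (++-assoc X Y (concat R′))))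
    unique′ : Unique ((X ++ Y) ++ concat R′)
    unique′ = Unique-↭ concat-perm uL
    conn′ : ∀ {Z} → Z ∈ (X ++ Y) ∷ R′ → Connected Z
    conn′ (here refl) = merge-connected (conn (here refl)) (conn (there (PermP.∈-resp-↭ (↭-sym permL) (here refl)))) adjXY
    conn′ (there m) = conn (there (PermP.∈-resp-↭ (↭-sym permL) (there m)))
    common≤ : cnt (common? X Y) R′ ≤ cnt (adj? Y) R
    common≤ = ≤-trans (≤-reflexive (sumf-++ _ R _)) (≤-trans (+-mono-≤ (cnt-mono (common? X Y) (adj? Y) R (λ _ _ → proj₂))
      (≤-reflexive (cnt-none (common? X Y) (filter (¬? ∘ adj? X) L) (λ Z m (a , _) → proj₂ (∈-filter⁻ (¬? ∘ adj? X) {xs = L} m) a)))) (≤-reflexive (+-identityʳ _)))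
    dense′ : d * length ((X ++ Y) ∷ R′) ≤ edges ((X ++ Y) ∷ R′)
    dense′ = +-cancelʳ-≤ d _ _ (begin
      d * suc (length R′) + d ≡⟨ lem d (length R′) ⟩
      d * suc (suc (length R′)) ≡⟨ cong (λ z → d * suc z) (sym lenL) ⟩
      d * length (X ∷ L) ≤⟨ dense ⟩
      edges (X ∷ L) ≡⟨ edges-↭ (prep X permL) ⟩
      edges (X ∷ Y ∷ R′) ≤⟨ merge-edges X Y R′ ⟩
      edges ((X ++ Y) ∷ R′) + suc (cnt (common? X Y) R′) ≤⟨ +-monoʳ-≤ (edges ((X ++ Y) ∷ R′)) (≤-trans (s≤s common≤) small) ⟩
      edges ((X ++ Y) ∷ R′) + d ∎)
      where
      open ≤R
      lem : ∀ d r → d * suc r + d ≡ d * suc (suc r)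
      lem = solve-∀
    relabel : Model (suc h) ((X ++ Y) ∷ R′) → Model (suc h) (X ∷ L)
    relabel m = record { blobs = blobs ; size = size ; connected = connected ; pairwise = pairwise ; disjoint = disjoint
      ; contains = λ k → cont (contains k) ; within = λ x → PermP.∈-resp-↭ (↭-sym concat-perm) (within x) }
      where
      open Model m
      cont : ∀ {K} → ∃[ Z ] (Z ∈ (X ++ Y) ∷ R′ × (∀ {x} → x ∈ Z → x ∈ K)) → ∃[ Z ] (Z ∈ X ∷ L × (∀ {x} → x ∈ Z → x ∈ K))
      cont (_ , here refl , sub) = X , here refl , λ x → sub (∈-++⁺ˡ x)
      cont (Z , there mZ , sub) = Z , there (PermP.∈-resp-↭ (↭-sym permL) (there mZ)) , sub
  mader-step h ih (suc k) (X ∷ L) (s≤s le) _ conn uL dense | no many | no none = extend (ih (length Nb) Nb ≤-refl nonempty (conn ∘ there ∘ inL) uN dense′)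
    where
    d = 2 ^ suc h
    Nb = filter (adj? X) L
    inL : ∀ {Z} → Z ∈ Nb → Z ∈ L
    inL m = proj₁ (∈-filter⁻ (adj? X) {xs = L} m)
    nonempty : 1 ≤ length Nb
    nonempty = ≤-trans (≤-trans (s≤s z≤n) (≰⇒> many)) (≤-reflexive (sym (length-filter-cnt (adj? X) L)))
    subN : ∀ {x} → x ∈ concat Nb → x ∈ concat L
    subN m with ∈-concat⁻′ Nb m
    ... | Z , mx , mZ = ∈-concat mx (inL mZ)
    uN : Unique (concat Nb)
    uN = Unique-++ˡ (concat Nb) (subst Unique (concat-++ Nb _) (Unique-↭ (concat-↭ (filter-split (adj? X) L)) (Unique-++ʳ X uL)))
    -- In the neighbourhood of X every blob now has at least 2^(h+1) neighbours, hence there are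
    -- half as many edges per blob.
    dense′ : 2 ^ h * length Nb ≤ edges Nb
    dense′ = *-cancelˡ-≤ 2 (≤-trans (≤-reflexive (sym (*-assoc 2 (2 ^ h) (length Nb)))) (picks-degrees d Nb (λ {p} m → ≮⇒≥ (λ lt → none (lose m lt)))))
    extend : Model h Nb → Model (suc h) (X ∷ L)
    extend m = record
      { blobs = X ∷ blobs ; size = cong suc size
      ; connected = λ { (here refl) → conn (here refl) ; (there k) → connected k }
      ; pairwise = All.tabulate (λ k → let (Z , mZ , sub) = contains k ; (x , z , mx , mz , g) = adj-ends (proj₂ (∈-filter⁻ (adj? X) {xs = L} mZ)) in ends-adj mx (sub mz) g) ∷ pairwise
      ; disjoint = UniqueP.++⁺ (Unique-++ˡ X uL) disjoint (λ { (a , c) → Unique-++-disj X uL a (subN (within c)) })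
      ; contains = λ { (here refl) → X , here refl , id ; (there k) → let (Z , mZ , sub) = contains k in Z , there (inL mZ) , sub }
      ; within = λ k → case ∈-++⁻ X k of λ { (inj₁ a) → ∈-++⁺ˡ a ; (inj₂ c) → ∈-++⁺ʳ X (subN (within c)) } }
      where open Model m

  -- Mader's induction: drop a blob of low degree, merge two adjacent blobs with few common
  -- neighbours, and otherwise recurse into a neighbourhood.
  mader : ∀ h → Forces h
  mader zero k L _ _ _ _ _ = record { blobs = [] ; size = refl ; connected = λ () ; pairwise = [] ; disjoint = [] ; contains = λ () ; within = λ () }
  mader (suc h) = mader-step h (mader h)

  model-minor : ∀ {h L} (H : Graph h) → Model h L → HasMinor H G
  model-minor {L = L} H m = build (Model.blobs m) (Model.size m) (Model.connected m) (Model.pairwise m) (Model.disjoint m)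
    where
    apart : ∀ Ks → Unique (concat Ks) → ∀ i j {x} → x ∈ lookup Ks i → x ∈ lookup Ks j → i ≡ j
    apart (K ∷ Ks) u Fin.zero Fin.zero _ _ = refl
    apart (K ∷ Ks) u Fin.zero (Fin.suc j) a c = ⊥-elim (Unique-++-disj K u a (∈-concat {L = Ks} c (∈-lookup j)))
    apart (K ∷ Ks) u (Fin.suc i) Fin.zero a c = ⊥-elim (Unique-++-disj K u c (∈-concat {L = Ks} a (∈-lookup i)))
    apart (K ∷ Ks) u (Fin.suc i) (Fin.suc j) a c = cong Fin.suc (apart Ks (Unique-++ʳ K u) i j a c)
    adjacent : ∀ Ks → AllPairs Adj Ks → ∀ i j → i ≢ j → Adj (lookup Ks i) (lookup Ks j)
    adjacent (K ∷ Ks) (a ∷ p) Fin.zero Fin.zero ne = ⊥-elim (ne refl)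
    adjacent (K ∷ Ks) (a ∷ p) Fin.zero (Fin.suc j) ne = All.lookup a (∈-lookup j)
    adjacent (K ∷ Ks) (a ∷ p) (Fin.suc i) Fin.zero ne = Adj-sym (All.lookup a (∈-lookup i))
    adjacent (K ∷ Ks) (a ∷ p) (Fin.suc i) (Fin.suc j) ne = adjacent Ks p i j (ne ∘ cong Fin.suc)
    build : ∀ Ks → length Ks ≡ _ → (∀ {K} → K ∈ Ks → Connected K) → AllPairs Adj Ks → Unique (concat Ks) → HasMinor H G
    build Ks refl conn pw u = (λ v x → does (any? (x FinP.≟_) (lookup Ks v))) ,
        (λ v w x p q → apart Ks u v w (mem v x p) (mem w x q)) ,
        (λ v → let ((x , m) , _) = conn (∈-lookup v) in x , T← (any? (x FinP.≟_) (lookup Ks v)) m) ,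
        (λ v x y p q → let (_ , c) = conn (∈-lookup v) ; (_ , _ , w , _) = c (mem v x p) (mem v y q) in
          WalkIn-map id (λ {z} k → T← (any? (z FinP.≟_) (lookup Ks v)) k) (toWalkIn w)) ,
        (λ v w e → let (x , y , mx , my , g) = adj-ends (adjacent Ks pw v w (adj-≢ H e)) in
          x , y , T← (any? (x FinP.≟_) (lookup Ks v)) mx , T← (any? (y FinP.≟_) (lookup Ks w)) my , g)
      where
      mem : ∀ v x → T (does (any? (x FinP.≟_) (lookup Ks v))) → x ∈ lookup Ks v
      mem v x = T→ (any? (x FinP.≟_) (lookup Ks v))

-- Large blobs of bounded diameter

module Clusters {n : ℕ} (G : Fin n → Fin n → Set) (G? : ∀ x y → Dec (G x y)) (gsym : ∀ {x y} → G x y → G y x) (g : ℕ) where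

  open Blobs G G? gsym

  Avoid : Fin n → Fin n → Fin n → Fin n → Set
  Avoid x y a b = G a b × ¬ (a ≡ x × b ≡ y) × ¬ (a ≡ y × b ≡ x)

  -- There is no cycle of length at most g: a cycle is an edge x y together with a walk from y back
  -- to x that avoids this edge, and the vertices of the walk count its length.
  NoShort : Set
  NoShort = ∀ {x y vs} → G x y → Walk (Avoid x y) y x vs → length vs ≤ g → ⊥

  Apart : Blob → Blob → Set
  Apart X Y = ∀ {x} → x ∈ X → x ∉ Y

  -- Three pairwise adjacent blobs of small diameter would close a short cycle.
  no-triangle : NoShort → ∀ {k X Y Z} → 3 * k ≤ g → Apart X Y → Apart X Z → Apart Y Z →
    (∀ {x y} → x ∈ X → y ∈ X → Joined X x y k) → (∀ {x y} → x ∈ Y → y ∈ Y → Joined Y x y k) → (∀ {x y} → x ∈ Z → y ∈ Z → Joined Z x y k) →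
    Adj X Y → Adj Y Z → Adj Z X → ⊥
  no-triangle ns {k} {X} {Y} {Z} le XY XZ YZ jX jY jZ aXY aYZ aZX with adj-ends aXY | adj-ends aYZ | adj-ends aZX
  ... | x₀ , y₀ , mx₀ , my₀ , g₀ | y₁ , z₀ , my₁ , mz₀ , g₁ | z₁ , x₁ , mz₁ , mx₁ , g₂ with jY my₀ my₁ | jZ mz₀ mz₁ | jX mx₁ mx₀
  ... | vs , wY , lY | us , wZ , lZ | ws , wX , lX = ns g₀ (walk-join (inside wY my₀ safeY) (cross (inj₁ (λ e → XY mx₀ (subst (_∈ Y) e my₁)) ) g₁ (λ { (_ , e) → XZ mx₀ (subst (_∈ Z) e mz₀) }))
        (walk-join (inside wZ mz₀ safeZ) (cross (inj₁ (λ e → XZ mx₀ (subst (_∈ Z) e mz₁))) g₂ (λ { (e , _) → YZ my₀ (subst (_∈ Z) e mz₁) })) (inside wX mx₁ safeX)))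
        (≤-trans (≤-reflexive (trans (length-++ vs) (cong (length vs +_) (length-++ us)))) (≤-trans (+-mono-≤ lY (+-mono-≤ lZ lX)) (≤-trans (≤-reflexive (lem k)) le)))
    where
    lem : ∀ k → k + (k + k) ≡ 3 * k
    lem = solve-∀
    cross : ∀ {a b} → (a ≢ x₀) ⊎ ⊥ → G a b → ¬ (a ≡ y₀ × b ≡ x₀) → Avoid x₀ y₀ a b
    cross (inj₁ ne) h nq = h , (λ { (e , _) → ne e }) , nq
    inside : ∀ {W a b vs} → Walk (λ a b → G a b × b ∈ W) a b vs → a ∈ W → (∀ {a b} → a ∈ W → b ∈ W → ¬ (a ≡ x₀ × b ≡ y₀) × ¬ (a ≡ y₀ × b ≡ x₀)) → Walk (Avoid x₀ y₀) a b vs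
    inside stop _ _ = stop
    inside (go (h , mb) w) ma safe = go (h , safe ma mb) (inside w mb safe)
    safeY : ∀ {a b} → a ∈ Y → b ∈ Y → ¬ (a ≡ x₀ × b ≡ y₀) × ¬ (a ≡ y₀ × b ≡ x₀)
    safeY ma mb = (λ { (refl , _) → XY mx₀ ma }) , (λ { (_ , refl) → XY mx₀ mb })
    safeX : ∀ {a b} → a ∈ X → b ∈ X → ¬ (a ≡ x₀ × b ≡ y₀) × ¬ (a ≡ y₀ × b ≡ x₀)
    safeX ma mb = (λ { (_ , refl) → XY mb my₀ }) , (λ { (refl , _) → XY ma my₀ })
    safeZ : ∀ {a b} → a ∈ Z → b ∈ Z → ¬ (a ≡ x₀ × b ≡ y₀) × ¬ (a ≡ y₀ × b ≡ x₀)
    safeZ ma mb = (λ { (refl , _) → XZ mx₀ ma }) , (λ { (_ , refl) → XZ mx₀ mb })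

  module Merge (ns : NoShort) (s : ℕ) (s≥1 : 1 ≤ s) (big : 3 * (6 * s + 2) ≤ g) (c : ℕ) where

    Small : Blob → Set
    Small X = length X < s

    small? : Decidable Small
    small? X = length X <? s

    -- Merging two adjacent blobs adds their numbers of vertices and the bounds on their diameters
    -- alike, so bounding the diameter by the size is preserved.
    Tight : Blob → Set
    Tight X = (∃[ x ] x ∈ X) × (∀ {x y} → x ∈ X → y ∈ X → Joined X x y (length X)) × length X ≤ 2 * s

    2s≤ : 2 * s ≤ 6 * s + 2
    2s≤ = ≤-trans (*-monoˡ-≤ s (m≤m+n 2 4)) (m≤m+n _ 2)

    apart-concat : ∀ {X Y L} → Unique (concat (X ∷ L)) → Y ∈ L → Apart X Y
    apart-concat {X} u m a b = Unique-++-disj X u a (∈-concat b m)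

    no-common : ∀ {X Y L} → Unique (concat (X ∷ Y ∷ L)) → Adj X Y → (∀ {x y} → x ∈ X → y ∈ X → Joined X x y (6 * s + 2)) → (∀ {x y} → x ∈ Y → y ∈ Y → Joined Y x y (6 * s + 2)) →
      (∀ Z → Z ∈ L → Common X Y Z → ∀ {x y} → x ∈ Z → y ∈ Z → Joined Z x y (6 * s + 2)) → cnt (common? X Y) L ≡ 0
    no-common {X} {Y} {L} u a jX jY jZ = cnt-none (common? X Y) L λ Z m (aX , aY) →
      no-triangle ns big (apart-concat {L = Y ∷ L} u (here refl)) (apart-concat {L = Y ∷ L} u (there m)) (apart-concat {L = L} (Unique-++ʳ X u) m) jX jY (jZ Z m (aX , aY)) a aY (Adj-sym aX)

    -- Without a common neighbour a merge loses one edge and one blob, so the surplus `c` of edges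
    -- over blobs stays.
    merge-excess : ∀ {X Y L} → cnt (common? X Y) L ≡ 0 → c + length (X ∷ Y ∷ L) ≤ edges (X ∷ Y ∷ L) → c + length ((X ++ Y) ∷ L) ≤ edges ((X ++ Y) ∷ L)
    merge-excess {X} {Y} {L} eq h = +-cancelʳ-≤ 1 _ _ (≤-trans (≤-reflexive (lem c (length L))) (≤-trans h (≤-trans (merge-edges X Y L) (≤-reflexive (cong (λ z → edges ((X ++ Y) ∷ L) + suc z) eq)))))
      where
      lem : ∀ c l → c + suc l + 1 ≡ c + suc (suc l)
      lem = solve-∀

    record Stage₁ (L : List Blob) : Set where
      constructor stage₁
      field
        tight : ∀ {X} → X ∈ L → Tight X
        unique : Unique (concat L)
        excess : c + length L ≤ edges L

    Separated : List Blob → Set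
    Separated L = ∀ {X R} → (X , R) ∈ picks L → Small X → ∀ {Y} → Y ∈ R → Small Y → ¬ Adj X Y

    stage₁-run : ∀ k L → length L ≤ k → Stage₁ L → ∃[ L′ ] (Stage₁ L′ × Separated L′)
    stage₁-run k L le st with any? (λ p → small? (proj₁ p) ×-dec any? (λ Y → small? Y ×-dec adj? (proj₁ p) Y) (proj₂ p)) (picks L)
    ... | no none = L , st , λ m sX mY sY a → none (lose m (sX , lose mY (sY , a)))
    ... | yes found with find found
    ... | (X , R) , pm , sX , inR with find inR
    ... | Y , mY , sY , a with ∈-split mY
    ... | R′ , permR = recurse k le
      where
      open Stage₁ st
      perm : L ↭ X ∷ Y ∷ R′
      perm = ↭-trans (picks-↭ L pm) (prep X permR)
      back : ∀ {Z} → Z ∈ X ∷ Y ∷ R′ → Z ∈ L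
      back = PermP.∈-resp-↭ (↭-sym perm)
      u′ : Unique (concat (X ∷ Y ∷ R′))
      u′ = Unique-↭ (concat-↭ perm) unique
      wide : ∀ {Z} → Tight Z → ∀ {x y} → x ∈ Z → y ∈ Z → Joined Z x y (6 * s + 2)
      wide (_ , j , l) mx my = joined-mono id (≤-trans l 2s≤) (j mx my)
      tX = tight (back (here refl))
      tY = tight (back (there (here refl)))
      join : ∀ {x y} → x ∈ X ++ Y → y ∈ X ++ Y → Joined (X ++ Y) x y (length (X ++ Y))
      join {x} {y} m m′ with adj-ends a
      ... | x₀ , y₀ , mx₀ , my₀ , h = subst (Joined (X ++ Y) x y) (sym (length-++ X)) (pick (∈-++⁻ X m) (∈-++⁻ X m′))
        where
        jX = proj₁ (proj₂ tX)
        jY = proj₁ (proj₂ tY)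
        pick : x ∈ X ⊎ x ∈ Y → y ∈ X ⊎ y ∈ Y → Joined (X ++ Y) x y (length X + length Y)
        pick (inj₁ p) (inj₁ q) = joined-mono ∈-++⁺ˡ (m≤m+n _ _) (jX p q)
        pick (inj₂ p) (inj₂ q) = joined-mono (∈-++⁺ʳ X) (m≤n+m _ (length X)) (jY p q)
        pick (inj₁ p) (inj₂ q) = joined-trans (joined-mono ∈-++⁺ˡ ≤-refl (jX p mx₀)) h (∈-++⁺ʳ X my₀) (joined-mono (∈-++⁺ʳ X) ≤-refl (jY my₀ q))
        pick (inj₂ p) (inj₁ q) = subst (Joined (X ++ Y) x y) (+-comm (length Y) (length X)) (joined-trans (joined-mono (∈-++⁺ʳ X) ≤-refl (jY p my₀)) (gsym h) (∈-++⁺ˡ mx₀) (joined-mono ∈-++⁺ˡ ≤-refl (jX mx₀ q)))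
      st′ : Stage₁ ((X ++ Y) ∷ R′)
      st′ = stage₁ (λ { (here refl) → ((_ , ∈-++⁺ˡ (proj₂ (proj₁ tX))) , join , ≤-trans (≤-reflexive (length-++ X)) (≤-trans (+-mono-≤ (<⇒≤ sX) (<⇒≤ sY)) (≤-reflexive (cong (s +_) (sym (+-identityʳ s)))))) ; (there m) → tight (back (there (there m))) })
        (subst Unique (sym (++-assoc X Y (concat R′))) u′)
        (merge-excess {X} {Y} {R′} (no-common u′ a (wide tX) (wide tY) (λ Z m _ → wide (tight (back (there (there m)))))) (subst₂ _≤_ (cong (c +_) (PermP.↭-length perm)) (edges-↭ perm) excess))
      recurse : ∀ k → length L ≤ k → ∃[ L′ ] (Stage₁ L′ × Separated L′)
      recurse zero le = case ≤-trans (≤-reflexive (sym (PermP.↭-length perm))) le of λ ()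
      recurse (suc k) le = stage₁-run k ((X ++ Y) ∷ R′) (≤-pred (≤-trans (≤-reflexive (sym (PermP.↭-length perm))) le)) st′

    -- The vertices in β are those of the blobs that were large at the start. Small blobs are
    -- pairwise non-adjacent, so they only touch β; each absorbed one hangs directly on the core of
    -- a blob. Hence every vertex stays near a core of diameter at most 2s, however many small blobs
    -- are absorbed.
    record Stage₂ (β : Fin n → Set) (Ss Bs : List Blob) : Set where
      constructor stage₂
      field
        tightS : ∀ {X} → X ∈ Ss → Tight X
        unique : Unique (concat (Ss ++ Bs))
        excess : c + length (Ss ++ Bs) ≤ edges (Ss ++ Bs)
        separated : AllPairs (λ X Y → ¬ Adj X Y) Ss
        notβ : ∀ {X x} → X ∈ Ss → x ∈ X → ¬ β x
        toβ : ∀ {X x Y y} → X ∈ Ss → x ∈ X → Y ∈ Bs → y ∈ Y → G x y → β y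
        core : ∀ {Y x y} → Y ∈ Bs → x ∈ Y → y ∈ Y → β x → β y → Joined Y x y (2 * s)
        near : ∀ {Y x} → Y ∈ Bs → x ∈ Y → ∃[ y ] (y ∈ Y × β y × Joined Y x y (2 * s + 1))
        large : ∀ {Y} → Y ∈ Bs → s ≤ length Y

    diameter : ∀ {β Ss Bs Y} → Stage₂ β Ss Bs → Y ∈ Bs → ∀ {x y} → x ∈ Y → y ∈ Y → Joined Y x y (6 * s + 2)
    diameter st mY mx my with Stage₂.near st mY mx | Stage₂.near st mY my
    ... | x′ , mx′ , βx , jx | y′ , my′ , βy , jy = joined-mono id (≤-reflexive (lem s)) (joined-append jx (joined-append (Stage₂.core st mY mx′ my′ βx βy) (joined-sym my jy)))
      where
      lem : ∀ s → 2 * s + 1 + (2 * s + (2 * s + 1)) ≡ 6 * s + 2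
      lem = solve-∀

    stage₂-run : ∀ {β} Ss Bs → Stage₂ β Ss Bs → ∃[ Bs′ ] Stage₂ β [] Bs′
    stage₂-run [] Bs st = Bs , st
    stage₂-run {β} (X ∷ Ss) Bs st with any? (adj? X) Bs
    -- A small blob without a large neighbour has no neighbour at all; dropping it loses a blob and
    -- no edge.
    ... | no none = stage₂-run Ss Bs record
          { tightS = tightS ∘ there ; unique = Unique-++ʳ X unique ; excess = excess′ ; separated = sepTail separated ; notβ = notβ ∘ there ; toβ = toβ ∘ there ; core = core ; near = near ; large = large }
      where
      open Stage₂ st
      sepTail : ∀ {R : Blob → Blob → Set} {X L} → AllPairs R (X ∷ L) → AllPairs R L
      sepTail (_ ∷ p) = p
      isolated : cnt (adj? X) (Ss ++ Bs) ≡ 0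
      isolated = cnt-none (adj? X) (Ss ++ Bs) λ Z m a → case ∈-++⁻ Ss m of λ { (inj₁ k) → iso separated k a ; (inj₂ k) → none (lose k a) }
        where
        iso : AllPairs (λ X Y → ¬ Adj X Y) (X ∷ Ss) → ∀ {Z} → Z ∈ Ss → ¬ Adj X Z
        iso (h ∷ _) k = All.lookup h k
      excess′ : c + length (Ss ++ Bs) ≤ edges (Ss ++ Bs)
      excess′ = ≤-trans (+-monoʳ-≤ c (n≤1+n _)) (≤-trans excess (≤-reflexive (cong (_+ edges (Ss ++ Bs)) isolated)))
    ... | yes found with find found
    ... | Y , mY , a with ∈-split mY
    ... | Bs′ , permB = stage₂-run Ss ((X ++ Y) ∷ Bs′) record
          { tightS = tightS ∘ there ; unique = unique′ ; excess = excess′ ; separated = sepTail separated ; notβ = notβ ∘ there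
          ; toβ = toβ′ ; core = core′ ; near = near′ ; large = λ { (here refl) → ≤-trans (large mY) (≤-trans (m≤n+m _ (length X)) (≤-reflexive (sym (length-++ X)))) ; (there m) → large (back m) } }
      where
      open Stage₂ st
      sepTail : ∀ {R : Blob → Blob → Set} {X L} → AllPairs R (X ∷ L) → AllPairs R L
      sepTail (_ ∷ p) = p
      sepHead : ∀ {R : Blob → Blob → Set} {X L} → AllPairs R (X ∷ L) → All (R X) L
      sepHead (h ∷ _) = h
      back : ∀ {Z} → Z ∈ Bs′ → Z ∈ Bs
      back m = PermP.∈-resp-↭ (↭-sym permB) (there m)
      perm : X ∷ Ss ++ Bs ↭ X ∷ Y ∷ Ss ++ Bs′
      perm = prep X (↭-trans (PermP.++⁺ˡ Ss permB) (PermP.shift Y Ss Bs′))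
      perm′ : (X ++ Y) ∷ Ss ++ Bs′ ↭ Ss ++ (X ++ Y) ∷ Bs′
      perm′ = ↭-sym (PermP.shift (X ++ Y) Ss Bs′)
      u₁ : Unique (concat (X ∷ Y ∷ Ss ++ Bs′))
      u₁ = Unique-↭ (concat-↭ perm) unique
      unique′ : Unique (concat (Ss ++ (X ++ Y) ∷ Bs′))
      unique′ = Unique-↭ (concat-↭ perm′) (subst Unique (sym (++-assoc X Y (concat (Ss ++ Bs′)))) u₁)
      wideX : ∀ {x y} → x ∈ X → y ∈ X → Joined X x y (6 * s + 2)
      wideX mx my = let (_ , j , l) = tightS (here refl) in joined-mono id (≤-trans l 2s≤) (j mx my)
      wideZ : ∀ Z → Z ∈ Ss ++ Bs′ → Common X Y Z → ∀ {x y} → x ∈ Z → y ∈ Z → Joined Z x y (6 * s + 2)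
      wideZ Z m (aX , _) with ∈-++⁻ Ss m
      ... | inj₁ k = ⊥-elim (All.lookup (sepHead separated) k aX)
      ... | inj₂ k = diameter st (back k)
      excess′ : c + length (Ss ++ (X ++ Y) ∷ Bs′) ≤ edges (Ss ++ (X ++ Y) ∷ Bs′)
      excess′ = subst₂ _≤_ (cong (c +_) (PermP.↭-length perm′)) (edges-↭ perm′)
        (merge-excess {X} {Y} {Ss ++ Bs′} (no-common u₁ a wideX (diameter st mY) wideZ) (subst₂ _≤_ (cong (c +_) (PermP.↭-length perm)) (edges-↭ perm) excess))
      toβ′ : ∀ {X′ x Z y} → X′ ∈ Ss → x ∈ X′ → Z ∈ (X ++ Y) ∷ Bs′ → y ∈ Z → G x y → β y
      toβ′ mX mx (there m) my h = toβ (there mX) mx (back m) my h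
      toβ′ mX mx (here refl) my h with ∈-++⁻ X my
      ... | inj₁ k = ⊥-elim (All.lookup (sepHead separated) mX (ends-adj k mx (gsym h)))
      ... | inj₂ k = toβ (there mX) mx mY k h
      core′ : ∀ {Z x y} → Z ∈ (X ++ Y) ∷ Bs′ → x ∈ Z → y ∈ Z → β x → β y → Joined Z x y (2 * s)
      core′ (there m) mx my bx by = core (back m) mx my bx by
      core′ (here refl) mx my bx by with ∈-++⁻ X mx | ∈-++⁻ X my
      ... | inj₁ k | _ = ⊥-elim (notβ (here refl) k bx)
      ... | _ | inj₁ k = ⊥-elim (notβ (here refl) k by)
      ... | inj₂ k | inj₂ l = joined-mono (∈-++⁺ʳ X) ≤-refl (core mY k l bx by)
      near′ : ∀ {Z x} → Z ∈ (X ++ Y) ∷ Bs′ → x ∈ Z → ∃[ y ] (y ∈ Z × β y × Joined Z x y (2 * s + 1))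
      near′ (there m) mx = near (back m) mx
      near′ (here refl) mx with ∈-++⁻ X mx
      ... | inj₂ k = let (y , my , by , j) = near mY k in y , ∈-++⁺ʳ X my , by , joined-mono (∈-++⁺ʳ X) ≤-refl j
      ... | inj₁ k with adj-ends a
      ... | x₀ , y₀ , mx₀ , my₀ , h = y₀ , ∈-++⁺ʳ X my₀ , toβ (here refl) mx₀ mY my₀ h ,
            joined-trans (joined-mono ∈-++⁺ˡ (proj₂ (proj₂ (tightS (here refl)))) (proj₁ (proj₂ (tightS (here refl))) k mx₀)) h (∈-++⁺ʳ X my₀) (_ , stop , ≤-refl)

    stage₂-start : ∀ L → Stage₁ L → Separated L → ∃₂ λ β Bs → Stage₂ β (filter small? L) Bs
    stage₂-start L st sep = (_∈ concat Bs) , Bs , record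
        { tightS = tight ∘ inS ; unique = u₁ ; excess = subst₂ _≤_ (cong (c +_) (PermP.↭-length perm)) (edges-↭ perm) excess
        ; separated = pairwise L sep ; notβ = λ mX mx mB → Unique-++-disj (concat Ss) u₂ (∈-concat mx mX) mB
        ; toβ = λ _ _ mY my _ → ∈-concat my mY ; core = λ mY mx my _ _ → joined-mono id (proj₂ (proj₂ (tight (inB mY)))) (proj₁ (proj₂ (tight (inB mY))) mx my)
        ; near = λ {Y} {x} mY mx → x , mx , ∈-concat mx mY , _ , stop , ≤-trans (s≤s z≤n) (m≤n+m 1 (2 * s))
        ; large = λ m → ≮⇒≥ (proj₂ (∈-filter⁻ (¬? ∘ small?) {xs = L} m)) }
      where
      open Stage₁ st
      Ss = filter small? L
      Bs = filter (¬? ∘ small?) L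
      perm : L ↭ Ss ++ Bs
      perm = filter-split small? L
      inS : ∀ {X} → X ∈ Ss → X ∈ L
      inS m = proj₁ (∈-filter⁻ small? {xs = L} m)
      inB : ∀ {X} → X ∈ Bs → X ∈ L
      inB m = proj₁ (∈-filter⁻ (¬? ∘ small?) {xs = L} m)
      u₁ : Unique (concat (Ss ++ Bs))
      u₁ = Unique-↭ (concat-↭ perm) unique
      u₂ : Unique (concat Ss ++ concat Bs)
      u₂ = subst Unique (concat-++ Ss Bs) u₁
      pairwise : ∀ L → Separated L → AllPairs (λ X Y → ¬ Adj X Y) (filter small? L)
      pairwise [] _ = []
      pairwise (X ∷ L) sep = extend (small? X)
        where
        rest : AllPairs (λ X Y → ¬ Adj X Y) (filter small? L)
        rest = pairwise L (λ {Y} {R} m sY mZ sZ → sep (there (∈-map⁺ (λ p → proj₁ p , X ∷ proj₂ p) m)) sY (there mZ) sZ)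
        extend : Dec (Small X) → AllPairs (λ X Y → ¬ Adj X Y) (filter small? (X ∷ L))
        extend (no ¬s) = subst (AllPairs (λ X Y → ¬ Adj X Y)) (sym (filter-reject small? ¬s)) rest
        extend (yes sX) = subst (AllPairs (λ X Y → ¬ Adj X Y)) (sym (filter-accept small? sX))
          (All.tabulate (λ m → let (mL , sZ) = ∈-filter⁻ small? {xs = L} m in sep (here refl) sX mL sZ) ∷ rest)

    clusters : ∀ L → Stage₁ L → ∃[ Bs ] ((∀ {Y} → Y ∈ Bs → Connected Y × s ≤ length Y) × Unique (concat Bs) × c + length Bs ≤ edges Bs)
    clusters L st with stage₁-run (length L) L ≤-refl st
    ... | L′ , st′ , sep with stage₂-start L′ st′ sep
    ... | β , Bs₀ , st₂ with stage₂-run (filter small? L′) Bs₀ st₂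
    ... | Bs , fin = Bs , (λ {Y} m → (nonempty Y (Stage₂.large fin m) , λ mx my → _ , diameter fin m mx my) , Stage₂.large fin m) , Stage₂.unique fin , Stage₂.excess fin
      where
      nonempty : ∀ Y → s ≤ length Y → ∃[ y ] y ∈ Y
      nonempty (y ∷ Y) _ = y , here refl
      nonempty [] l = ⊥-elim (<⇒≱ s≥1 l)

  -- Induction on the vertices: the edges of M at the first vertex lead to distinct later vertices.
  singleton-edges : ∀ vs (M : List (Edge n)) → Unique M → (∀ {e} → e ∈ M → Ordered e × G (proj₁ e) (proj₂ e) × proj₁ e ∈ vs × proj₂ e ∈ vs) → length M ≤ edges (map [_] vs)
  singleton-edges [] [] u h = z≤n
  singleton-edges [] (e ∷ M) u h = case proj₁ (proj₂ (proj₂ (h (here refl)))) of λ ()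
  singleton-edges (v ∷ vs) M u h = ≤-trans (≤-reflexive (sym (cnt-complement (touches? v) M)))
      (+-mono-≤ at-v (≤-trans (≤-reflexive (sym (length-filter-cnt (¬? ∘ touches? v) M))) (singleton-edges vs (filter (¬? ∘ touches? v) M) (UniqueP.filter⁺ _ u) rest)))
    where
    at-v : cnt (touches? v) M ≤ cnt (adj? [ v ]) (map [_] vs)
    at-v = ≤-trans (cnt-inj (touches? v) (λ e → [ other v e ]) M (filter (adj? [ v ]) (map [_] vs)) u
        (λ e m t → let (o , g , a , c) = h m in ∈-filter⁺ (adj? [ v ]) (∈-map⁺ [_] (strip (other-∈ e t a c) (other-≢ o t))) (here (here (toG e t g))))
        (λ e f m m′ t t′ eq → other-injective (proj₁ (h m)) (proj₁ (h m′)) t t′ (single-inj eq)))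
      (≤-reflexive (length-filter-cnt (adj? [ v ]) (map [_] vs)))
      where
      single-inj : ∀ {x y : Fin n} → _≡_ {A = List (Fin n)} (x ∷ []) (y ∷ []) → x ≡ y
      single-inj refl = refl
      strip : ∀ {x} → x ∈ v ∷ vs → x ≢ v → x ∈ vs
      strip (here e) ne = ⊥-elim (ne e)
      strip (there m) _ = m
      other-∈ : ∀ e → Touches v e → proj₁ e ∈ v ∷ vs → proj₂ e ∈ v ∷ vs → other v e ∈ v ∷ vs
      other-∈ e t a c with joins-other {v = v} {e} t
      ... | inj₁ q = subst (_∈ v ∷ vs) (cong proj₂ q) c
      ... | inj₂ q = subst (_∈ v ∷ vs) (cong proj₁ q) a
      toG : ∀ e → Touches v e → G (proj₁ e) (proj₂ e) → G v (other v e)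
      toG e t g with joins-other {v = v} {e} t
      ... | inj₁ q = subst₂ G (cong proj₁ q) (cong proj₂ q) g
      ... | inj₂ q = gsym (subst₂ G (cong proj₁ q) (cong proj₂ q) g)
    rest : ∀ {e} → e ∈ filter (¬? ∘ touches? v) M → Ordered e × G (proj₁ e) (proj₂ e) × proj₁ e ∈ vs × proj₂ e ∈ vs
    rest m with ∈-filter⁻ (¬? ∘ touches? v) {xs = M} m
    ... | mM , nt with h mM
    ... | o , g , a , c = o , g , strip a (λ e → nt (inj₁ (sym e))) , strip c (λ e → nt (inj₂ (sym e)))
      where
      strip : ∀ {x} → x ∈ v ∷ vs → x ≢ v → x ∈ vs
      strip (here e) ne = ⊥-elim (ne e)
      strip (there m) _ = m

  -- The surplus `c` survives all merges, while blobs of size at least q 2^h number at most n / (q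
  -- 2^h) ≤ c / 2^h. So the contracted graph has 2^h edges per blob, as `mader` requires.
  sparse-girth-minor : NoShort → ∀ {h} (H : Graph h) q c → 1 ≤ q → 1 ≤ c → 3 * (6 * (q * 2 ^ h) + 2) ≤ g → n ≤ c * q →
    (M : List (Edge n)) → Unique M → (∀ {e} → e ∈ M → Ordered e × G (proj₁ e) (proj₂ e)) → n + c ≤ length M → HasMinor H G
  sparse-girth-minor ns {h} H q c q≥1 c≥1 big n≤cq M uM hM dense = result (MG.clusters L₀ st₀)
    where
    s = q * 2 ^ h
    s≥1 : 1 ≤ s
    s≥1 = *-mono-≤ q≥1 (m^n>0 2 h)
    module MG = Merge ns s s≥1 big c
    L₀ = map [_] (allFin n)
    concat-singletons : ∀ {A : Set} (vs : List A) → concat (map [_] vs) ≡ vs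
    concat-singletons [] = refl
    concat-singletons (v ∷ vs) = cong (v ∷_) (concat-singletons vs)
    st₀ : MG.Stage₁ L₀
    st₀ = MG.stage₁ tight (subst Unique (sym (concat-singletons (allFin n))) (UniqueP.allFin⁺ n))
      (≤-trans (≤-reflexive (trans (cong (c +_) (trans (length-map [_] (allFin n)) (length-tabulate {n = n} id))) (+-comm c n)))
        (≤-trans dense (singleton-edges (allFin n) M uM (λ m → let (o , g) = hM m in o , g , ∈-allFin _ , ∈-allFin _))))
      where
      tight : ∀ {X} → X ∈ L₀ → MG.Tight X
      tight m with ∈-map⁻ [_] m
      ... | v , _ , refl = (v , here refl) , (λ { (here refl) (here refl) → _ , stop , ≤-refl }) , ≤-trans s≥1 (m≤m+n s _)
    result : ∃[ Bs ] ((∀ {Y} → Y ∈ Bs → Connected Y × s ≤ length Y) × Unique (concat Bs) × c + length Bs ≤ edges Bs) → HasMinor H G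
    result (Bs , good , u , excess) = model-minor H (mader h (length Bs) Bs ≤-refl nonempty (proj₁ ∘ good) u dense′)
      where
      some : ∀ Bs → c + length Bs ≤ edges Bs → 1 ≤ length Bs
      some (_ ∷ _) _ = s≤s z≤n
      some [] e = ⊥-elim (<⇒≱ c≥1 (≤-trans (m≤m+n c 0) e))
      nonempty : 1 ≤ length Bs
      nonempty = some Bs excess
      room : ∀ Bs → (∀ {Y} → Y ∈ Bs → s ≤ length Y) → s * length Bs ≤ length (concat Bs)
      room [] _ = ≤-reflexive (*-zeroʳ s)
      room (Y ∷ Bs) h = ≤-trans (≤-reflexive (*-suc s (length Bs))) (≤-trans (+-mono-≤ (h (here refl)) (room Bs (h ∘ there))) (≤-reflexive (sym (length-++ Y))))
      dense′ : 2 ^ h * length Bs ≤ edges Bs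
      dense′ = ≤-trans (*-cancelʳ-≤ (2 ^ h * length Bs) c q {{Nat.>-nonZero q≥1}} (≤-trans (≤-reflexive (lem (2 ^ h) (length Bs) q)) (≤-trans (room Bs (proj₂ ∘ good)) (≤-trans (unique-fin-length u) n≤cq))))
          (≤-trans (m≤m+n c _) excess)
        where
        lem : ∀ e l q → e * l * q ≡ q * e * l
        lem = solve-∀

-- Random Maker: short cycles

module _ {n : ℕ} where

  mk : Fin n → Fin n → Edge n
  mk x y = if does (toℕ x <? toℕ y) then (x , y) else (y , x)

  mk-joins : ∀ x y → Joins (mk x y) x y
  mk-joins x y = go′ (toℕ x <? toℕ y)
    where
    go′ : (d : Dec (toℕ x < toℕ y)) → Joins (if does d then (x , y) else (y , x)) x y
    go′ (yes _) = inj₁ refl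
    go′ (no _) = inj₂ refl

  mk-ordered : ∀ {x y} → x ≢ y → Ordered (mk x y)
  mk-ordered {x} {y} ne = go′ (toℕ x <? toℕ y)
    where
    go′ : (d : Dec (toℕ x < toℕ y)) → Ordered (if does d then (x , y) else (y , x))
    go′ (yes lt) = lt
    go′ (no ge) = ≤∧≢⇒< (≮⇒≥ ge) (λ e → ne (FinP.toℕ-injective (sym e)))

  pathEdges : Fin n → List (Fin n) → List (Edge n)
  pathEdges x [] = []
  pathEdges x (y ∷ vs) = mk x y ∷ pathEdges y vs

  lastOf : Fin n → List (Fin n) → Fin n
  lastOf x [] = x
  lastOf x (y ∷ vs) = lastOf y vs

  -- the closed walk through the given vertices, its closing edge first
  cycEdges : List (Fin n) → List (Edge n)
  cycEdges [] = []
  cycEdges (x ∷ vs) = mk x (lastOf x vs) ∷ pathEdges x vs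

  pathEdges-length : ∀ x vs → length (pathEdges x vs) ≡ length vs
  pathEdges-length x [] = refl
  pathEdges-length x (y ∷ vs) = cong suc (pathEdges-length y vs)

  cycEdges-length : ∀ p → length (cycEdges p) ≡ length p
  cycEdges-length [] = refl
  cycEdges-length (x ∷ vs) = cong suc (pathEdges-length x vs)

  pathEdges-touch : ∀ x vs {f v} → f ∈ pathEdges x vs → Touches v f → v ∈ x ∷ vs
  pathEdges-touch x (y ∷ vs) (here refl) t with touches-joins (mk-joins x y) t
  ... | inj₁ refl = here refl
  ... | inj₂ refl = there (here refl)
  pathEdges-touch x (y ∷ vs) (there m) t = there (pathEdges-touch y vs m t)

  pathEdges-unique : ∀ x vs → Unique (x ∷ vs) → Unique (pathEdges x vs)
  pathEdges-unique x [] u = []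
  pathEdges-unique x (y ∷ vs) u = Unique-∷ (λ m → Unique-head u (pathEdges-touch y vs m (joins-touchesˡ (mk-joins x y)))) (pathEdges-unique y vs (Unique-tail u))

  walk-lastOf : ∀ {G : Fin n → Fin n → Set} {x y vs} → Walk G x y (x ∷ vs) → lastOf x vs ≡ y
  walk-lastOf stop = refl
  walk-lastOf (go _ stop) = refl
  walk-lastOf (go _ w@(go _ _)) = walk-lastOf w

  walk-pathEdges : ∀ {G : Fin n → Fin n → Set} {x y vs f} → Walk G x y (x ∷ vs) → f ∈ pathEdges x vs → ∃₂ λ a c → G a c × f ≡ mk a c
  walk-pathEdges stop ()
  walk-pathEdges (go g stop) (here refl) = _ , _ , g , refl
  walk-pathEdges (go g (go _ _)) (here refl) = _ , _ , g , refl
  walk-pathEdges (go g w@(go _ _)) (there m) = walk-pathEdges w m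

  walk-head : ∀ {G : Fin n → Fin n → Set} {x y vs} → Walk G x y vs → ∃[ us ] vs ≡ x ∷ us
  walk-head stop = _ , refl
  walk-head (go _ _) = _ , refl

  tuples : ℕ → List (List (Fin n))
  tuples zero = [] ∷ []
  tuples (suc k) = concatMap (λ x → map (x ∷_) (tuples k)) (allFin n)

  tuples-complete : ∀ p → p ∈ tuples (length p)
  tuples-complete [] = here refl
  tuples-complete (x ∷ p) = ∈-concatMap⁺ (λ x → map (x ∷_) (tuples (length p))) (lose (∈-allFin x) (∈-map⁺ (x ∷_) (tuples-complete p)))

  tuples-length : ∀ k {p} → p ∈ tuples k → length p ≡ k
  tuples-length zero (here refl) = refl
  tuples-length (suc k) m with find (∈-concatMap⁻ (λ x → map (x ∷_) (tuples k)) {xs = allFin n} m)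
  ... | x , _ , m′ with ∈-map⁻ (x ∷_) m′
  ... | p , mp , refl = cong suc (tuples-length k mp)

  tuples-count : ∀ k → length (tuples k) ≡ n ^ k
  tuples-count zero = refl
  tuples-count (suc k) = trans (go′ (allFin n)) (cong₂ _*_ (length-tabulate {n = n} id) (tuples-count k))
    where
    go′ : ∀ xs → length (concatMap (λ x → map (x ∷_) (tuples k)) xs) ≡ length xs * length (tuples k)
    go′ [] = refl
    go′ (x ∷ xs) = trans (length-++ (map (x ∷_) (tuples k))) (cong₂ _+_ (length-map (x ∷_) (tuples k)) (go′ xs))

  tuplesUpTo : ℕ → List (List (Fin n))
  tuplesUpTo zero = []
  tuplesUpTo (suc k) = tuples (suc k) ++ tuplesUpTo k

  tuplesUpTo-complete : ∀ {k p} → 1 ≤ length p → length p ≤ k → p ∈ tuplesUpTo k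
  tuplesUpTo-complete {zero} {p} l le = ⊥-elim (<⇒≱ l le)
  tuplesUpTo-complete {suc k} {p} l le with m≤n⇒m<n∨m≡n le
  ... | inj₁ (s≤s lt) = ∈-++⁺ʳ (tuples (suc k)) (tuplesUpTo-complete l lt)
  ... | inj₂ eq = ∈-++⁺ˡ (subst (λ z → p ∈ tuples z) eq (tuples-complete p))

  tuplesUpTo-length : ∀ k {p} → p ∈ tuplesUpTo k → length p ≤ k
  tuplesUpTo-length (suc k) m with ∈-++⁻ (tuples (suc k)) m
  ... | inj₁ a = ≤-reflexive (tuples-length (suc k) a)
  ... | inj₂ c = m≤n⇒m≤1+n (tuplesUpTo-length k c)

  uniqueEdges? : (es : List (Edge n)) → Dec (Unique es)
  uniqueEdges? = allPairs? (λ e f → ¬? (e ≟ᴱ f))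
    where open import Data.List.Relation.Unary.AllPairs using (allPairs?)

  -- A cycle is listed once for every start and direction, which costs a constant factor only. Lists
  -- with a repeated edge are left out, so that a new Maker edge lowers `missing` by at most one.
  cycles : ℕ → List (List (Fin n))
  cycles g = filter (λ p → uniqueEdges? (cycEdges p)) (tuplesUpTo g)

  missing? : (M : List (Edge n)) → Decidable (λ (f : Edge n) → f ∉ M)
  missing? M f = ¬? (f ∈ᴱ? M)

  missing : List (Edge n) → List (Fin n) → ℕ
  missing M p = cnt (missing? M) (cycEdges p)

  missing-∷ : ∀ M e p → Unique (cycEdges p) → e ∉ M → missing M p ≡ missing (e ∷ M) p + ind (e ∈ᴱ? cycEdges p)
  missing-∷ M e p u e∉M = begin
      missing M p ≡⟨ sumf-cong (cycEdges p) (λ f _ → point f) ⟩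
      sumf (λ f → ind (missing? (e ∷ M) f) + ind (e ≟ᴱ f)) (cycEdges p) ≡⟨ sumf-+ _ _ (cycEdges p) ⟩
      missing (e ∷ M) p + cnt (e ≟ᴱ_) (cycEdges p) ≡⟨ cong (missing (e ∷ M) p +_) (occur (cycEdges p) u) ⟩
      missing (e ∷ M) p + ind (e ∈ᴱ? cycEdges p) ∎
    where
    open ≡-Reasoning
    point : ∀ f → ind (missing? M f) ≡ ind (missing? (e ∷ M) f) + ind (e ≟ᴱ f)
    point f with e ≟ᴱ f
    ... | yes refl = trans (ind-yes (missing? M f) e∉M) (cong (_+ 1) (sym (ind-no (missing? (e ∷ M) f) (λ h → h (here refl)))))
    ... | no ne = trans (≤-antisym (ind-mono (missing? M f) (missing? (e ∷ M) f) (λ { h (here q) → ne (sym q) ; h (there m) → h m }))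
                                   (ind-mono (missing? (e ∷ M) f) (missing? M f) (λ h m → h (there m)))) (sym (+-identityʳ _))
    occur : ∀ es → Unique es → cnt (e ≟ᴱ_) es ≡ ind (e ∈ᴱ? es)
    occur es u with e ∈ᴱ? es
    ... | no e∉ = cnt-none (e ≟ᴱ_) es (λ { x m refl → e∉ m })
    ... | yes m = ≤-antisym (cnt≤1 (e ≟ᴱ_) es u (λ { x y _ _ refl refl → refl })) (≤-trans (≤-reflexive (sym (ind-yes (e ≟ᴱ e) refl))) (sumf-∈ (λ f → ind (e ≟ᴱ f)) m))

-- The first two terms of the binomial expansion of (r + 1)^(i+1).
binom : ∀ r i → r ^ suc i + suc i * r ^ i ≤ suc r ^ suc i
binom r zero = ≤-reflexive (lem r)
  where
  lem : ∀ r → r * 1 + 1 * 1 ≡ suc r * 1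
  lem = solve-∀
binom r (suc i) = begin
    r * r ^ suc i + suc (suc i) * r ^ suc i ≤⟨ m≤m+n _ (suc i * r ^ i) ⟩
    r * r ^ suc i + suc (suc i) * r ^ suc i + suc i * r ^ i ≡⟨ lem r i (r ^ i) ⟩
    suc r * (r ^ suc i + suc i * r ^ i) ≤⟨ *-monoʳ-≤ (suc r) (binom r i) ⟩
    suc r * suc r ^ suc i ∎
  where
  open ≤R
  lem : ∀ r i x → r * (r * x) + suc (suc i) * (r * x) + suc i * x ≡ suc r * (r * x + suc i * x)
  lem = solve-∀

-- Of the 2c surplus edges, c are spent on cutting one edge of each short cycle; the other c are the
-- surplus that the contraction keeps.
few-cycles-minor : ∀ {h n} (H : Graph h) q c → 1 ≤ q → 1 ≤ c → n ≤ c * q → (M : List (Edge n)) → Unique M → (∀ {e} → e ∈ M → Ordered e) →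
  n + (c + c) ≤ length M → cnt (λ p → missing M p ≤? 0) (cycles (3 * (6 * (q * 2 ^ h) + 2))) ≤ c → HasMinor H (graphOf M)
few-cycles-minor {h} {n} H q c q≥1 c≥1 n≤cq M uM oM dense few = HasMinor-map {H = H} (λ {x} {y} → up {x} {y})
    (Clusters.sparse-girth-minor (graphOf M′) (graphOf? M′) (graphOf-sym {M = M′}) g noShort H q c q≥1 c≥1 ≤-refl n≤cq M′ (UniqueP.filter⁺ _ uM) (λ m → oM (sub m) , inj₁ m) dense′)
  where
  g = 3 * (6 * (q * 2 ^ h) + 2)
  Bad : Edge n → Set
  Bad e = Any (λ p → missing M p ≤ 0 × e ∈ take 1 (cycEdges p)) (cycles g)
  bad? : Decidable Bad
  bad? e = any? (λ p → (missing M p ≤? 0) ×-dec (e ∈ᴱ? take 1 (cycEdges p))) (cycles g)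
  M′ = filter (¬? ∘ bad?) M
  sub : ∀ {e} → e ∈ M′ → e ∈ M
  sub m = proj₁ (∈-filter⁻ (¬? ∘ bad?) {xs = M} m)
  up : ∀ {x y} → graphOf M′ x y → graphOf M x y
  up (inj₁ m) = inj₁ (sub m)
  up (inj₂ m) = inj₂ (sub m)
  closed? = λ p → missing M p ≤? 0
  bads : cnt bad? M ≤ c
  bads = ≤-trans (≤-reflexive (sym (length-filter-cnt bad? M))) (≤-trans (unique-⊆-length (UniqueP.filter⁺ _ uM) inImage)
      (≤-trans (heads (filter closed? (cycles g))) (≤-trans (≤-reflexive (length-filter-cnt closed? (cycles g))) few)))
    where
    inImage : ∀ {e} → e ∈ filter bad? M → e ∈ concatMap (take 1 ∘ cycEdges) (filter closed? (cycles g))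
    inImage m with find (proj₂ (∈-filter⁻ bad? {xs = M} m))
    ... | p , mp , shut , k = ∈-concatMap⁺ (take 1 ∘ cycEdges) (lose (∈-filter⁺ closed? mp shut) k)
    heads : ∀ ps → length (concatMap (take 1 ∘ cycEdges) ps) ≤ length ps
    heads [] = z≤n
    heads ([] ∷ ps) = m≤n⇒m≤1+n (heads ps)
    heads ((x ∷ p) ∷ ps) = s≤s (heads ps)
  dense′ : n + c ≤ length M′
  dense′ = +-cancelˡ-≤ c _ _ (≤-trans (≤-reflexive (lem c n)) (≤-trans dense (≤-trans (≤-reflexive (sym (cnt-complement bad? M))) (+-mono-≤ bads (≤-reflexive (sym (length-filter-cnt (¬? ∘ bad?) M)))))))
    where
    lem : ∀ c n → c + (n + c) ≡ n + (c + c)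
    lem = solve-∀
  open Clusters (graphOf M′) (graphOf? M′) (graphOf-sym {M = M′}) g using (NoShort; Avoid)
  to-mk : ∀ {a e} → graphOf M′ a e → mk a e ∈ M′
  to-mk {a} {e} ge with graphOf-joins {M = M′} ge
  ... | f , mf , jf = subst (_∈ M′) (ordered-joins-unique (oM (sub mf)) (mk-ordered (ordered-≢ (oM (sub mf)) jf)) jf (mk-joins a e)) mf
  mk-eq : ∀ {a e x y} → mk a e ≡ mk x y → (a ≡ x × e ≡ y) ⊎ (a ≡ y × e ≡ x)
  mk-eq {a} {e} {x} {y} eq with mk-joins a e | mk-joins x y
  ... | inj₁ p | inj₁ q with trans (sym p) (trans eq q)
  ... | refl = inj₁ (refl , refl)
  mk-eq {a} {e} {x} {y} eq | inj₁ p | inj₂ q with trans (sym p) (trans eq q)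
  ... | refl = inj₂ (refl , refl)
  mk-eq {a} {e} {x} {y} eq | inj₂ p | inj₁ q with trans (sym p) (trans eq q)
  ... | refl = inj₂ (refl , refl)
  mk-eq {a} {e} {x} {y} eq | inj₂ p | inj₂ q with trans (sym p) (trans eq q)
  ... | refl = inj₁ (refl , refl)
  noShort : NoShort
  -- With its loops erased the walk closes to a listed cycle. All edges of this cycle are in M, so
  -- its first edge, the closing one, has been deleted.
  noShort {x} {y} gxy w l with loop-erase w
  ... | vs , w′ , l′ , _ , u with walk-head w′
  ... | us , refl = proj₂ (∈-filter⁻ (¬? ∘ bad?) {xs = M} closing) (lose inCycles (≤-reflexive (cnt-none (missing? M) (cycEdges (y ∷ us)) (λ f m nm → nm (allM m))) , here (cong (mk y) (sym (walk-lastOf w′)))))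
    where
    closing : mk y x ∈ M′
    closing = to-mk (graphOf-sym {M = M′} gxy)
    allM : ∀ {f} → f ∈ cycEdges (y ∷ us) → f ∈ M
    allM (here refl) = sub (subst (λ z → mk y z ∈ M′) (sym (walk-lastOf w′)) closing)
    allM (there m) with walk-pathEdges w′ m
    ... | a , e , (ge , _) , refl = sub (to-mk ge)
    inCycles : y ∷ us ∈ cycles g
    inCycles = ∈-filter⁺ (λ p → uniqueEdges? (cycEdges p)) (tuplesUpTo-complete (s≤s z≤n) (≤-trans l′ l))
      (Unique-∷ notin (pathEdges-unique y us u))
      where
      notin : mk y (lastOf y us) ∉ pathEdges y us
      notin m with walk-pathEdges w′ m
      ... | a , e , (_ , n₁ , n₂) , eq with mk-eq (trans (cong (mk y) (sym (walk-lastOf w′))) eq)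
      ... | inj₁ (refl , refl) = n₂ (refl , refl)
      ... | inj₂ (refl , refl) = n₁ (refl , refl)

sumf-filter : ∀ {A : Set} {P : A → Set} (P? : Decidable P) (f : A → ℕ) xs → sumf f (filter P? xs) ≤ sumf f xs
sumf-filter P? f [] = z≤n
sumf-filter P? f (x ∷ xs) with P? x
... | yes _ = +-monoʳ-≤ (f x) (sumf-filter P? f xs)
... | no _ = ≤-trans (sumf-filter P? f xs) (m≤n+m _ (f x))

-- D bounds the number of free edges from below as long as Maker has at most t edges.
module CycleGame {h : ℕ} (H : Graph h) (b n c t D g K : ℕ) (D≥1 : 1 ≤ D) (K≥1 : 1 ≤ K) (nt≤KD : n * t ≤ K * D)
    (enough : ∀ {U M : List (Edge n)} → WF b U M → length M ≤ t → D ≤ length U)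
    (few : ∀ {U M : List (Edge n)} → WF b U M → length M ≡ t → cnt (λ p → missing M p ≤? 0) (cycles g) ≤ c → HasMinor H (graphOf M)) where

  open Game {h} {n} H b using (Edges; Reply; Reply-length; module Potential)

  -- Up to the factor D^g this is (r / D)^j, a bound for the probability that j given edges are all
  -- claimed by Maker within r rounds when at least D edges are free.
  weight : ℕ → ℕ → ℕ
  weight r j = r ^ j * D ^ (g ∸ j)

  Φ : ℕ → Edges → ℕ
  Φ r M = sumf (λ p → weight r (missing M p)) (cycles g)

  Zc : ℕ
  Zc = c * D ^ g

  I : Edges → Edges → ℕ → Set
  I U M φ = WF b U M × ∃[ r ] (r + length M ≡ t × φ ≡ Φ r M)

  Outcome : Edges → Edges → ℕ → Set
  Outcome U M φ = HasMinor H (graphOf M) ⊎ (Zc ≤ φ) ⊎ (1 ≤ length U × ∃ λ (ψ : Edge n → ℕ) → sumf ψ U ≤ length U * φ ×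
      (∀ e U′ B U″ → U ↭ e ∷ U′ → Reply U′ B U″ → I U″ (e ∷ M) (ψ e)))

  cycle-size : ∀ {p : List (Fin n)} → p ∈ cycles g → length p ≤ g
  cycle-size m = tuplesUpTo-length g (proj₁ (∈-filter⁻ (λ p → uniqueEdges? (cycEdges p)) {xs = tuplesUpTo g} m))

  cycle-unique : ∀ {p : List (Fin n)} → p ∈ cycles g → Unique (cycEdges p)
  cycle-unique m = proj₂ (∈-filter⁻ (λ p → uniqueEdges? (cycEdges p)) {xs = tuplesUpTo g} m)

  -- One of i + 1 missing edges is hit with probability at most (i + 1) / D; the gain this brings is
  -- the second term of `binom`.
  weight-step : ∀ r i u → suc i ≤ g → D ≤ u → u * weight r (suc i) + suc i * weight r i ≤ u * weight (suc r) (suc i)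
  weight-step r i u i<g D≤u = begin
      u * (r ^ suc i * E) + suc i * (r ^ i * D ^ (g ∸ i)) ≡⟨ cong (λ z → u * (r ^ suc i * E) + suc i * (r ^ i * D ^ z)) (+-∸-assoc 1 i<g) ⟩
      u * (r ^ suc i * E) + suc i * (r ^ i * (D * E)) ≡⟨ e₁ u (r ^ suc i) E (suc i) (r ^ i) D ⟩
      u * (r ^ suc i * E) + D * (suc i * r ^ i * E) ≤⟨ +-monoʳ-≤ (u * (r ^ suc i * E)) (*-monoˡ-≤ (suc i * r ^ i * E) D≤u) ⟩
      u * (r ^ suc i * E) + u * (suc i * r ^ i * E) ≡⟨ e₂ u (r ^ suc i) E (suc i * r ^ i) ⟩
      u * ((r ^ suc i + suc i * r ^ i) * E) ≤⟨ *-monoʳ-≤ u (*-monoˡ-≤ E (binom r i)) ⟩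
      u * (suc r ^ suc i * E) ∎
    where
    open ≤R
    E = D ^ (g ∸ suc i)
    e₁ : ∀ u x e i y d → u * (x * e) + i * (y * (d * e)) ≡ u * (x * e) + d * (i * y * e)
    e₁ = solve-∀
    e₂ : ∀ u x e y → u * (x * e) + u * (y * e) ≡ u * ((x + y) * e)
    e₂ = solve-∀

  cycle-step : ∀ {U M : Edges} r p → WF b U M → Unique (cycEdges p) → length p ≤ g → D ≤ length U →
    sumf (λ e → weight r (missing (e ∷ M) p)) U ≤ length U * weight (suc r) (missing M p)
  cycle-step {U} {M} r p w u p≤g D≤U = by (missing M p) refl
    where
    e∉M : ∀ {e} → e ∈ U → e ∉ M
    e∉M m k = Unique-++-disj M (uniq w) k m
    hit? = λ (e : Edge n) → e ∈ᴱ? cycEdges p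
    hits : cnt hit? U ≤ missing M p
    hits = ≤-trans (cnt-inj hit? id U (filter (missing? M) (cycEdges p)) (uniqU w) (λ e m k → ∈-filter⁺ (missing? M) k (e∉M m)) (λ _ _ _ _ _ _ q → q))
      (≤-reflexive (length-filter-cnt (missing? M) (cycEdges p)))
    by : ∀ j → missing M p ≡ j → sumf (λ e → weight r (missing (e ∷ M) p)) U ≤ length U * weight (suc r) (missing M p)
    by zero eq = ≤-trans (sumf-bound U (λ e m → ≤-reflexive (cong (weight r) (n≤0⇒n≡0 (≤-trans (m≤m+n (missing (e ∷ M) p) (ind (hit? e))) (≤-reflexive (trans (sym (missing-∷ M e p u (e∉M m))) eq)))))))
      (≤-reflexive (cong (λ z → length U * weight (suc r) z) (sym eq)))
    by (suc i) eq = begin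
        sumf (λ e → weight r (missing (e ∷ M) p)) U ≤⟨ sumf-mono U (λ e m → point e m (hit? e) (missing-∷ M e p u (e∉M m))) ⟩
        sumf (λ e → weight r (suc i) + weight r i * ind (hit? e)) U ≡⟨ trans (sumf-+ _ _ U) (cong₂ _+_ (sumf-const _ U) (sumf-* (weight r i) _ U)) ⟩
        length U * weight r (suc i) + weight r i * cnt hit? U ≤⟨ +-monoʳ-≤ (length U * weight r (suc i)) (≤-trans (*-monoʳ-≤ (weight r i) (≤-trans hits (≤-reflexive eq))) (≤-reflexive (*-comm (weight r i) (suc i)))) ⟩
        length U * weight r (suc i) + suc i * weight r i ≤⟨ weight-step r i (length U) i<g D≤U ⟩
        length U * weight (suc r) (suc i) ≡⟨ cong (λ z → length U * weight (suc r) z) (sym eq) ⟩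
        length U * weight (suc r) (missing M p) ∎
      where
      open ≤R
      i<g : suc i ≤ g
      i<g = ≤-trans (≤-reflexive (sym eq)) (≤-trans (cnt≤length (missing? M) (cycEdges p)) (≤-trans (≤-reflexive (cycEdges-length p)) p≤g))
      point : ∀ e → e ∈ U → (d : Dec (e ∈ cycEdges p)) → missing M p ≡ missing (e ∷ M) p + ind d → weight r (missing (e ∷ M) p) ≤ weight r (suc i) + weight r i * ind d
      point e m (yes _) q = ≤-trans (≤-reflexive (trans (cong (weight r) (suc-injective (trans (+-comm 1 _) (trans (sym q) eq)))) (sym (*-identityʳ (weight r i))))) (m≤n+m _ (weight r (suc i)))
      point e m (no _) q = ≤-trans (≤-reflexive (cong (weight r) (trans (sym (+-identityʳ _)) (trans (sym q) eq)))) (m≤m+n _ _)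

  progress : ∀ U M φ → I U M φ → Outcome U M φ
  progress U M φ (w , zero , time , refl) = finish (cnt closed? (cycles g) ≤? c)
    where
    closed? = λ p → missing M p ≤? 0
    point : ∀ j → D ^ g * ind (j ≤? 0) ≤ weight 0 j
    point zero = ≤-reflexive (*-comm (D ^ g) 1)
    point (suc j) = ≤-reflexive (*-zeroʳ (D ^ g))
    finish : Dec (cnt closed? (cycles g) ≤ c) → Outcome U M (Φ 0 M)
    finish (yes l) = inj₁ (few w time l)
    finish (no ¬l) = inj₂ (inj₁ (begin
      c * D ^ g ≤⟨ *-monoˡ-≤ (D ^ g) (<⇒≤ (≰⇒> ¬l)) ⟩
      cnt closed? (cycles g) * D ^ g ≡⟨ trans (*-comm _ (D ^ g)) (sym (sumf-* (D ^ g) _ (cycles g))) ⟩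
      sumf (λ p → D ^ g * ind (closed? p)) (cycles g) ≤⟨ sumf-mono (cycles g) (λ p _ → point (missing M p)) ⟩
      Φ 0 M ∎))
      where open ≤R
  progress U M φ (w , suc r , time , refl) = inj₂ (inj₂ (≤-trans D≥1 D≤U , (λ e → Φ r (e ∷ M)) , total , λ e U′ B U″ p (p′ , l) → wf-step w p p′ l , r , trans (+-suc r _) time , refl))
    where
    D≤U : D ≤ length U
    D≤U = enough w (≤-trans (m≤n+m _ (suc r)) (≤-reflexive time))
    total : sumf (λ e → Φ r (e ∷ M)) U ≤ length U * Φ (suc r) M
    total = ≤-trans (≤-reflexive (sumf-swap (λ e p → weight r (missing (e ∷ M) p)) U (cycles g)))
      (≤-trans (sumf-mono (cycles g) (λ p m → cycle-step r p w (cycle-unique m) (cycle-size m) D≤U)) (≤-reflexive (sumf-* (length U) _ (cycles g))))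

  module P = Potential Zc I progress

  start : I (board n) [] (Φ t [])
  start = wf-start , t , +-identityʳ t , refl

  pow-mono : ∀ {x y} k → x ≤ y → x ^ k ≤ y ^ k
  pow-mono zero _ = ≤-refl
  pow-mono (suc k) le = *-mono-≤ le (pow-mono k le)

  pow-mul : ∀ x y k → x ^ k * y ^ k ≡ (x * y) ^ k
  pow-mul x y zero = refl
  pow-mul x y (suc k) = trans (lem x y (x ^ k) (y ^ k)) (cong (x * y *_) (pow-mul x y k))
    where
    lem : ∀ x y a e → x * a * (y * e) ≡ x * y * (a * e)
    lem = solve-∀

  -- There are n^k lists of length k, each of weight (t / D)^k up to scaling, and n t ≤ K D. So the
  -- expected number of short cycles is bounded by a constant.
  start-bound : Φ t [] ≤ g * (K ^ g * D ^ g)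
  start-bound = ≤-trans (sumf-filter (λ p → uniqueEdges? (cycEdges p)) f (tuplesUpTo g)) (layers g ≤-refl)
    where
    open ≤R
    f : List (Fin n) → ℕ
    f p = weight t (missing [] p)
    miss : ∀ (p : List (Fin n)) → missing [] p ≡ length p
    miss p = trans (all-missing (cycEdges p)) (cycEdges-length p)
      where
      all-missing : ∀ (es : Edges) → cnt (missing? []) es ≡ length es
      all-missing [] = refl
      all-missing (e ∷ es) = cong suc (all-missing es)
    layer : ∀ k → k ≤ g → n ^ k * weight t k ≤ K ^ g * D ^ g
    layer k k≤g = begin
      n ^ k * (t ^ k * D ^ (g ∸ k)) ≡⟨ trans (sym (*-assoc (n ^ k) (t ^ k) _)) (cong (_* D ^ (g ∸ k)) (pow-mul n t k)) ⟩
      (n * t) ^ k * D ^ (g ∸ k) ≤⟨ *-monoˡ-≤ (D ^ (g ∸ k)) (pow-mono k nt≤KD) ⟩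
      (K * D) ^ k * D ^ (g ∸ k) ≡⟨ trans (cong (_* D ^ (g ∸ k)) (sym (pow-mul K D k))) (*-assoc (K ^ k) (D ^ k) _) ⟩
      K ^ k * (D ^ k * D ^ (g ∸ k)) ≡⟨ cong (K ^ k *_) (trans (sym (^-distribˡ-+-* D k (g ∸ k))) (cong (D ^_) (m+[n∸m]≡n k≤g))) ⟩
      K ^ k * D ^ g ≤⟨ *-monoˡ-≤ (D ^ g) (^-monoʳ-≤ K {{Nat.>-nonZero K≥1}} k≤g) ⟩
      K ^ g * D ^ g ∎
    layers : ∀ k → k ≤ g → sumf f (tuplesUpTo {n} k) ≤ k * (K ^ g * D ^ g)
    layers zero _ = z≤n
    layers (suc k) le = begin
      sumf f (tuples {n} (suc k) ++ tuplesUpTo k) ≡⟨ sumf-++ f (tuples {n} (suc k)) (tuplesUpTo {n} k) ⟩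
      sumf f (tuples {n} (suc k)) + sumf f (tuplesUpTo {n} k)
        ≤⟨ +-mono-≤ (≤-trans (sumf-bound (tuples {n} (suc k)) (λ p m → ≤-reflexive (cong (weight t) (trans (miss p) (tuples-length (suc k) m))))) (≤-trans (≤-reflexive (cong (_* weight t (suc k)) (tuples-count {n} (suc k)))) (layer (suc k) le))) (layers k (≤-trans (n≤1+n k) le)) ⟩
      suc k * (K ^ g * D ^ g) ∎

  result : ∀ Den → g * K ^ g * Den ≤ c → 1 ≤ c → ∃[ z ] ∃[ φ ] (φ * Den ≤ suc z × (∀ {q} → RVal H b (board n) [] q → ℕtoℚ (suc z) Q.≤ ℕtoℚ (suc z) Q.* q Q.+ ℕtoℚ φ))
  result Den le c≥1 = pack Zc refl (*-mono-≤ c≥1 (m^n>0 D {{Nat.>-nonZero D≥1}} g))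
    where
    error : Φ t [] * Den ≤ Zc
    error = ≤-trans (*-monoˡ-≤ Den start-bound) (≤-trans (≤-reflexive (lem g (K ^ g) (D ^ g) Den)) (*-monoˡ-≤ (D ^ g) le))
      where
      lem : ∀ g k d e → g * (k * d) * e ≡ g * k * e * d
      lem = solve-∀
    pack : ∀ z → z ≡ Zc → 1 ≤ z → ∃[ z ] ∃[ φ ] (φ * Den ≤ suc z × (∀ {q} → RVal H b (board n) [] q → ℕtoℚ (suc z) Q.≤ ℕtoℚ (suc z) Q.* q Q.+ ℕtoℚ φ))
    pack (suc z) eq _ = z , Φ t [] , ≤-trans error (≤-reflexive (sym eq)) , λ {q} rv → subst (λ y → ℕtoℚ y Q.≤ ℕtoℚ y Q.* q Q.+ ℕtoℚ (Φ t [])) (sym eq) (P.Bound.get (P.bound rv start))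

-- As 2 b ≤ (1 - 1/a) n, about n² / (2a) edges are free after n rounds. The condition 4 a c ≤ n lets
-- the 2c further rounds take at most half of them, and 20 a ≤ n takes care of the lower-order
-- terms.
free-edges : ∀ {n u b c t} a → n * n ≤ 2 * u + 2 * (suc b * t) + n → a * (b * 2) + n ≤ a * n → t ≡ n + (c + c) → 4 * a * c ≤ n → t ≤ 2 * n → 20 * a ≤ n → n * n ≤ 8 * a * u
free-edges {n} {u} {b} {c} {t} a h₁ h₂ h₃ h₄ h₅ h₆ = +-cancelʳ-≤ (n * n) _ _ (begin
    n * n + n * n ≡⟨ e₀ (n * n) ⟩
    2 * (n * n) ≤⟨ *-monoʳ-≤ 2 main ⟩
    2 * (4 * a * u + 10 * a * n) ≡⟨ e₁ a u n ⟩
    8 * a * u + 20 * a * n ≤⟨ +-monoʳ-≤ (8 * a * u) (*-monoˡ-≤ n h₆) ⟩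
    8 * a * u + n * n ∎)
  where
  open ≤R
  e₀ : ∀ z → z + z ≡ 2 * z
  e₀ = solve-∀
  e₁ : ∀ a u n → 2 * (4 * a * u + 10 * a * n) ≡ 8 * a * u + 20 * a * n
  e₁ = solve-∀
  step₁ : a * (n * n) + n * t ≤ 2 * a * u + a * n * t + 2 * a * t + a * n
  step₁ = begin
    a * (n * n) + n * t ≤⟨ +-monoˡ-≤ (n * t) (*-monoʳ-≤ a h₁) ⟩
    a * (2 * u + 2 * (suc b * t) + n) + n * t ≡⟨ e a u b t n ⟩
    2 * a * u + (a * (b * 2) + n) * t + 2 * a * t + a * n ≤⟨ +-monoˡ-≤ (a * n) (+-monoˡ-≤ (2 * a * t) (+-monoʳ-≤ (2 * a * u) (*-monoˡ-≤ t h₂))) ⟩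
    2 * a * u + a * n * t + 2 * a * t + a * n ∎
    where
    e : ∀ a u b t n → a * (2 * u + 2 * (suc b * t) + n) + n * t ≡ 2 * a * u + (a * (b * 2) + n) * t + 2 * a * t + a * n
    e = solve-∀
  main : n * n ≤ 4 * a * u + 10 * a * n
  main = +-cancelˡ-≤ (2 * (a * (n * n)) + n * n) _ _ (begin
    2 * (a * (n * n)) + n * n + n * n ≡⟨ e₂ (a * (n * n)) (n * n) ⟩
    2 * (a * (n * n) + n * n) ≤⟨ *-monoʳ-≤ 2 (+-monoʳ-≤ (a * (n * n)) (*-monoʳ-≤ n (≤-trans (m≤m+n n (c + c)) (≤-reflexive (sym h₃))))) ⟩
    2 * (a * (n * n) + n * t) ≤⟨ *-monoʳ-≤ 2 step₁ ⟩
    2 * (2 * a * u + a * n * t + 2 * a * t + a * n) ≡⟨ cong (λ z → 2 * (2 * a * u + a * n * z + 2 * a * t + a * n)) h₃ ⟩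
    2 * (2 * a * u + a * n * (n + (c + c)) + 2 * a * t + a * n) ≤⟨ *-monoʳ-≤ 2 (+-monoˡ-≤ (a * n) (+-monoʳ-≤ (2 * a * u + a * n * (n + (c + c))) (*-monoʳ-≤ (2 * a) h₅))) ⟩
    2 * (2 * a * u + a * n * (n + (c + c)) + 2 * a * (2 * n) + a * n) ≡⟨ e₃ a u n c ⟩
    2 * (a * (n * n)) + 4 * a * c * n + (4 * a * u + 10 * a * n) ≤⟨ +-monoˡ-≤ (4 * a * u + 10 * a * n) (+-monoʳ-≤ (2 * (a * (n * n))) (*-monoˡ-≤ n h₄)) ⟩
    2 * (a * (n * n)) + n * n + (4 * a * u + 10 * a * n) ∎)
    where
    e₂ : ∀ x y → 2 * x + y + y ≡ 2 * (x + y)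
    e₂ = solve-∀
    e₃ : ∀ a u n c → 2 * (2 * a * u + a * n * (n + (c + c)) + 2 * a * (2 * n) + a * n) ≡ 2 * (a * (n * n)) + 4 * a * c * n + (4 * a * u + 10 * a * n)
    e₃ = solve-∀

divide′ : ∀ m → 1 ≤ m → ∀ n → ∃[ q ] (m * q ≤ n × n < m * suc q)
divide′ (suc m) _ n = divide m n

module DenseMaker {h : ℕ} (H : Graph h) (a : ℕ) (a≥1 : 1 ≤ a) (b : ℕ → ℕ) (hyp : ∀ n → a * (b n * 2) + n ≤ a * n) where

  -- Here c = ⌊n / (4a)⌋ and D = ⌊n² / (8a)⌋ come from `free-edges`, K = 32 a from n t ≤ 2 n² and D
  -- + 1 ≤ 2 D, and the 8 a in g from n ≤ 8 a c, which is the bound n ≤ c q of the contraction.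
  minor-from : ∀ n c t D g K Den → g ≡ 3 * (6 * (8 * a * 2 ^ h) + 2) → K ≡ 32 * a → t ≡ n + (c + c) → 4 * a * c ≤ n → n < 4 * a * suc c → 8 * a * D ≤ n * n → n * n < 8 * a * suc D →
    20 * a ≤ n → g * K ^ g * Den + 1 ≤ c → ∃[ z ] ∃[ φ ] (φ * Den ≤ suc z × (∀ {q} → RVal H (b n) (board n) [] q → ℕtoℚ (suc z) Q.≤ ℕtoℚ (suc z) Q.* q Q.+ ℕtoℚ φ))
  minor-from n c t D g K Den gq Kq tq c₁ c₂ D₁ D₂ n₁ cD = CycleGame.result H (b n) n c t D g K D≥1 (subst (1 ≤_) (sym Kq) (≤-trans a≥1 (m≤m+n a (31 * a)))) nt enough few Den (≤-trans (m≤m+n _ 1) cD) c≥1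
    where
    open ≤R
    c≥1 : 1 ≤ c
    c≥1 = ≤-trans (m≤n+m 1 (g * K ^ g * Den)) cD
    n≥1 : 1 ≤ n
    n≥1 = ≤-trans (≤-trans a≥1 (m≤m+n a (19 * a))) n₁
    8a≤ : 8 * a ≤ n
    8a≤ = ≤-trans (*-monoˡ-≤ a (m≤m+n 8 12)) n₁
    D≥1 : 1 ≤ D
    D≥1 with 1 ≤? D
    ... | yes l = l
    ... | no ¬l = ⊥-elim (<⇒≱ D₂ (≤-trans (*-monoʳ-≤ (8 * a) (≰⇒> ¬l)) (≤-trans (≤-reflexive (*-identityʳ (8 * a))) (≤-trans 8a≤ (≤-trans (≤-reflexive (sym (*-identityʳ n))) (*-monoʳ-≤ n n≥1))))))
    2c≤n : c + c ≤ n
    2c≤n = ≤-trans (≤-reflexive (cong (c +_) (sym (+-identityʳ c)))) (≤-trans (*-monoˡ-≤ c (≤-trans (s≤s (s≤s z≤n)) (*-monoʳ-≤ 4 a≥1))) c₁)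
    t≤2n : t ≤ 2 * n
    t≤2n = ≤-trans (≤-reflexive tq) (+-monoʳ-≤ n (≤-trans 2c≤n (≤-reflexive (sym (+-identityʳ n)))))
    nt : n * t ≤ K * D
    nt = begin
      n * t ≤⟨ *-monoʳ-≤ n t≤2n ⟩
      n * (2 * n) ≡⟨ e₁ n ⟩
      2 * (n * n) ≤⟨ *-monoʳ-≤ 2 (<⇒≤ D₂) ⟩
      2 * (8 * a * suc D) ≤⟨ *-monoʳ-≤ 2 (*-monoʳ-≤ (8 * a) (+-monoˡ-≤ D D≥1)) ⟩
      2 * (8 * a * (D + D)) ≡⟨ e₂ a D ⟩
      32 * a * D ≡⟨ cong (_* D) (sym Kq) ⟩
      K * D ∎
      where
      e₁ : ∀ n → n * (2 * n) ≡ 2 * (n * n)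
      e₁ = solve-∀
      e₂ : ∀ a d → 2 * (8 * a * (d + d)) ≡ 32 * a * d
      e₂ = solve-∀
    8a≥1 : 1 ≤ 8 * a
    8a≥1 = ≤-trans a≥1 (m≤m+n a (7 * a))
    enough : ∀ {U M : List (Edge n)} → WF (b n) U M → length M ≤ t → D ≤ length U
    enough w l = *-cancelˡ-≤ (8 * a) {{Nat.>-nonZero 8a≥1}} (≤-trans D₁ (free-edges {b = b n} {c = c} a (budget-bound t w l) (hyp n) tq c₁ t≤2n n₁))
    few : ∀ {U M : List (Edge n)} → WF (b n) U M → length M ≡ t → cnt (λ p → missing M p ≤? 0) (cycles g) ≤ c → HasMinor H (graphOf M)
    few {M = M} w eq l = few-cycles-minor H (8 * a) c 8a≥1 c≥1 n≤ M (uniqM w) (ordM w) (≤-reflexive (sym (trans eq tq))) (subst (λ g → cnt (λ p → missing M p ≤? 0) (cycles g) ≤ c) gq l)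
      where
      n≤ : n ≤ c * (8 * a)
      n≤ = ≤-trans (<⇒≤ c₂) (≤-trans (*-monoʳ-≤ (4 * a) (+-monoˡ-≤ c c≥1)) (≤-reflexive (e a c)))
        where
        e : ∀ a c → 4 * a * (c + c) ≡ c * (8 * a)
        e = solve-∀

  random-wins : RandomTo1 H b
  random-wins = random-To1 H b λ Den → N Den , λ n le → choose Den n le (divide′ (4 * a) (≤-trans a≥1 (m≤m+n a (3 * a))) n) (divide′ (8 * a) (≤-trans a≥1 (m≤m+n a (7 * a))) (n * n))
    where
    g = 3 * (6 * (8 * a * 2 ^ h) + 2)
    K = 32 * a
    N : ℕ → ℕ
    N Den = 4 * a * (g * K ^ g * Den + 1) + 20 * a
    choose : ∀ Den n → N Den ≤ n → ∃[ q ] (4 * a * q ≤ n × n < 4 * a * suc q) → ∃[ q ] (8 * a * q ≤ n * n × n * n < 8 * a * suc q) → _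
    choose Den n le (c , c₁ , c₂) (D , D₁ , D₂) = minor-from n c (n + (c + c)) D g K Den refl refl refl c₁ c₂ D₁ D₂ (≤-trans (m≤n+m (20 * a) (4 * a * (g * K ^ g * Den + 1))) le) cD
      where
      cD : g * K ^ g * Den + 1 ≤ c
      cD with g * K ^ g * Den + 1 ≤? c
      ... | yes l = l
      ... | no ¬l = ⊥-elim (<⇒≱ c₂ (≤-trans (*-monoʳ-≤ (4 * a) (≰⇒> ¬l)) (≤-trans (m≤m+n (4 * a * (g * K ^ g * Den + 1)) (20 * a)) le)))

-- Clever Maker: trees of blobs

-- the number of free edges at the vertices of A, those inside A counted twice
freeSum : ∀ {n} → List (Fin n) → List (Edge n) → ℕ
freeSum A U = sumf (λ z → deg z U) A

module _ {n : ℕ} where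

  touch-count : ∀ {A : List (Fin n)} → Unique A → ∀ f → cnt (λ z → touches? z f) A ≤ 1 + ind (any? (proj₁ f FinP.≟_) A ×-dec any? (proj₂ f FinP.≟_) A)
  touch-count {A} u (x , y) = ≤-trans (cnt-⊎ (λ z → touches? z (x , y)) (FinP._≟ x) (FinP._≟ y) A (λ _ _ t → t))
      (≤-trans (+-mono-≤ (once x) (once y)) (both (any? (x FinP.≟_) A) (any? (y FinP.≟_) A)))
    where
    once : ∀ x → cnt (FinP._≟ x) A ≤ ind (any? (x FinP.≟_) A)
    once x with any? (x FinP.≟_) A
    ... | yes _ = cnt≤1 (FinP._≟ x) A u (λ { _ _ _ _ refl refl → refl })
    ... | no x∉ = ≤-reflexive (cnt-none (FinP._≟ x) A (λ { z m refl → x∉ m }))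
    both : ∀ {P Q : Set} (p : Dec P) (q : Dec Q) → ind p + ind q ≤ 1 + ind (p ×-dec q)
    both (yes _) (yes _) = ≤-refl
    both (yes _) (no _) = ≤-refl
    both (no _) (yes _) = ≤-refl
    both (no _) (no _) = z≤n

  -- A claimed edge lowers the sum by at most one, apart from edges inside A, of which there are at
  -- most |A|².
  freeSum-loss : ∀ {A : List (Fin n)} B → Unique A → Unique B → (∀ {e} → e ∈ B → Ordered e) → freeSum A B ≤ length B + length A * length A
  freeSum-loss {A} B uA uB oB = begin
      freeSum A B ≡⟨ sumf-swap (λ z f → ind (touches? z f)) A B ⟩
      sumf (λ f → cnt (λ z → touches? z f) A) B ≤⟨ sumf-mono B (λ f _ → touch-count uA f) ⟩
      sumf (λ f → 1 + ind (in? f)) B ≡⟨ trans (sumf-+ (λ _ → 1) _ B) (cong (_+ cnt in? B) (trans (sumf-const 1 B) (*-identityʳ _))) ⟩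
      length B + cnt in? B ≤⟨ +-monoʳ-≤ (length B) inside ⟩
      length B + length A * length A ∎
    where
    open ≤R
    in? : Decidable (λ (f : Edge n) → proj₁ f ∈ A × proj₂ f ∈ A)
    in? f = any? (proj₁ f FinP.≟_) A ×-dec any? (proj₂ f FinP.≟_) A
    inside : cnt in? B ≤ length A * length A
    inside = ≤-trans (≤-reflexive (sym (length-filter-cnt in? B))) (≤-trans (m≤m+n _ _) (pairs-in A (UniqueP.filter⁺ in? uB) (λ m → oB (proj₁ (∈-filter⁻ in? {xs = B} m))) (λ m → proj₂ (∈-filter⁻ in? {xs = B} m))))

  freeSum-++ : ∀ (A : List (Fin n)) U V → freeSum A (U ++ V) ≡ freeSum A U + freeSum A V
  freeSum-++ A U V = trans (sumf-cong A (λ z _ → sumf-++ _ U V)) (sumf-+ _ _ A)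

  freeSum-↭ : ∀ (A : List (Fin n)) {U V} → U ↭ V → freeSum A U ≡ freeSum A V
  freeSum-↭ A p = sumf-cong A (λ z _ → sumf-↭ _ p)

  deg≤n : ∀ {b} {U M : List (Edge n)} v → WF b U M → deg v U ≤ n
  deg≤n v w = ≤-trans (m≤m+n _ 1) (deg<n v (uniqU w) (ordU w))

data Grown {n} (M : List (Edge n)) (r : Fin n) : List (Fin n) → Set where
  seed   : Grown M r []
  attach : ∀ {z w N} → z ∈ r ∷ N → graphOf M z w → Grown M r N → Grown M r (w ∷ N)

Grown-mono : ∀ {n} {M M′ : List (Edge n)} {r N} → (∀ {f} → f ∈ M → f ∈ M′) → Grown M r N → Grown M′ r N
Grown-mono s seed = seed
Grown-mono s (attach m (inj₁ g) t) = attach m (inj₁ (s g)) (Grown-mono s t)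
Grown-mono s (attach m (inj₂ g) t) = attach m (inj₂ (s g)) (Grown-mono s t)

record CleverSetting : Set where
  field
    n b γ Z Q αm α₀ : ℕ
    n≥1 : 1 ≤ n
    b<n : suc b ≤ n
    ρ≤n : b + γ + 2 + Z * Z ≤ n
    few-poor : n * (2 * Z + 1) + suc Q * (b + γ + 2 + Z * Z) < suc Q * n
    wide : αm * (Z + Q) < n
    γ-large : n ≤ α₀ * γ

module CleverGame {h : ℕ} (H : Graph h) (setting : CleverSetting) where

  open CleverSetting setting
  open Game {h} {n} H b using (Edges; Reply; Reply-length) public

  -- Maker can enforce R. Intermediate goals can be chained, which the winning predicate itself does
  -- not allow.
  data Force (R : Edges → Edges → Set) : Edges → Edges → Set where
    now  : ∀ {U M} → R U M → Force R U M
    play : ∀ {U M} e U′ → U ↭ e ∷ U′ → (∀ B U″ → Reply U′ B U″ → Force R U″ (e ∷ M)) → Force R U M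

  force-bind : ∀ {R S : Edges → Edges → Set} {U M} → Force R U M → (∀ {U M} → R U M → Force S U M) → Force S U M
  force-bind (now r) f = f r
  force-bind (play e U′ p k) f = play e U′ p (λ B U″ r → force-bind (k B U″ r) f)

  keep-won : ∀ k {U M : Edges} → length U ≤ k → HasMinor H (graphOf M) → MakerWins H b U M
  keep-won k {[]} _ m = done m
  keep-won (suc k) {e ∷ U} (s≤s le) m = move e U ↭-refl (λ B U″ p l → keep-won k (≤-trans (Reply-length {U} {B} {U″} (p , l)) le) (HasMinor-map {H = H} (λ {x} {y} → graphOf-∷ {e = e} {x} {y}) m))

  force-win : ∀ {R : Edges → Edges → Set} {U M} → (∀ {U M} → R U M → HasMinor H (graphOf M)) → Force R U M → MakerWins H b U M
  force-win {U = U} f (now r) = keep-won (length U) ≤-refl (f r)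
  force-win f (play e U′ p k) = move e U′ p (λ B U″ q l → force-win f (k B U″ (q , l)))

  ρ : ℕ
  ρ = b + γ + 2 + Z * Z

  poor? : (U : Edges) → Decidable (λ w → deg w U < ρ)
  poor? U w = deg w U <? ρ

  -- The free degrees sum to 2 |U|, so the deficits n - deg v sum to at most n (2Z + 1), while a
  -- poor vertex contributes at least n - ρ; compare `few-poor`.
  poor-bound : ∀ {U M} → WF b U M → length M ≤ Z → cnt (poor? U) (allFin n) ≤ Q
  poor-bound {U} {M} w M≤Z = by (cnt (poor? U) (allFin n)) count
    where
    open ≤R
    u = length U
    handshake : u * 2 ≤ sumf (λ v → deg v U) (allFin n)
    handshake = begin
      u * 2 ≡⟨ sym (sumf-const 2 U) ⟩
      sumf (λ _ → 2) U ≤⟨ sumf-mono U (λ { (x , y) m → cnt-≥ (λ z → touches? z (x , y)) (allFin n) {x ∷ y ∷ []} ((ordered-≢ (ordU w m) (inj₁ refl) ∷ []) ∷ [] ∷ []) (λ { (here refl) → ∈-allFin _ , inj₁ refl ; (there (here refl)) → ∈-allFin _ , inj₂ refl }) }) ⟩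
      sumf (λ f → cnt (λ z → touches? z f) (allFin n)) U ≡⟨ sym (sumf-swap (λ z f → ind (touches? z f)) (allFin n) U) ⟩
      sumf (λ v → deg v U) (allFin n) ∎
    point : ∀ v → deg v U + n * ind (poor? U v) ≤ ρ * ind (poor? U v) + n
    point v = by′ (poor? U v)
      where
      by′ : (d : Dec (deg v U < ρ)) → deg v U + n * ind d ≤ ρ * ind d + n
      by′ (yes lt) = +-mono-≤ (≤-trans (<⇒≤ lt) (≤-reflexive (sym (*-identityʳ ρ)))) (≤-reflexive (*-identityʳ n))
      by′ (no _) = ≤-trans (≤-reflexive (trans (cong (deg v U +_) (*-zeroʳ n)) (+-identityʳ _))) (≤-trans (deg≤n v w) (m≤n+m n (ρ * 0)))
    count : u * 2 + n * cnt (poor? U) (allFin n) ≤ ρ * cnt (poor? U) (allFin n) + n * n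
    count = begin
      u * 2 + n * cnt (poor? U) (allFin n) ≤⟨ +-monoˡ-≤ _ handshake ⟩
      sumf (λ v → deg v U) (allFin n) + n * cnt (poor? U) (allFin n) ≡⟨ trans (cong (sumf (λ v → deg v U) (allFin n) +_) (sym (sumf-* n _ (allFin n)))) (sym (sumf-+ _ _ (allFin n))) ⟩
      sumf (λ v → deg v U + n * ind (poor? U v)) (allFin n) ≤⟨ sumf-mono (allFin n) (λ v _ → point v) ⟩
      sumf (λ v → ρ * ind (poor? U v) + n) (allFin n) ≡⟨ trans (sumf-+ _ _ (allFin n)) (cong₂ _+_ (sumf-* ρ _ (allFin n)) (trans (sumf-const n (allFin n)) (cong (_* n) (length-tabulate {n = n} id)))) ⟩
      ρ * cnt (poor? U) (allFin n) + n * n ∎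
    spent : n * n ≤ u * 2 + n * (2 * Z + 1)
    spent = ≤-trans (budget-bound Z w M≤Z) (≤-trans (+-monoˡ-≤ n (+-monoʳ-≤ (2 * u) (*-monoʳ-≤ 2 (*-monoˡ-≤ Z b<n)))) (≤-reflexive (lem u n Z)))
      where
      lem : ∀ u n z → 2 * u + 2 * (n * z) + n ≡ u * 2 + n * (2 * z + 1)
      lem = solve-∀
    by : ∀ y → u * 2 + n * y ≤ ρ * y + n * n → y ≤ Q
    by y le with y ≤? Q
    ... | yes l = l
    ... | no ¬l with m≤n⇒∃[o]m+o≡n (≰⇒> ¬l)
    ... | z , refl = ⊥-elim (<⇒≱ few-poor (+-cancelʳ-≤ (u * 2 + z * n) _ _ (begin
        suc Q * n + (u * 2 + z * n) ≡⟨ e₁ Q n u z ⟩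
        u * 2 + n * (suc Q + z) ≤⟨ le ⟩
        ρ * (suc Q + z) + n * n ≤⟨ +-monoʳ-≤ (ρ * (suc Q + z)) spent ⟩
        ρ * (suc Q + z) + (u * 2 + n * (2 * Z + 1)) ≡⟨ e₂ ρ Q z u (n * (2 * Z + 1)) ⟩
        n * (2 * Z + 1) + suc Q * ρ + (u * 2 + z * ρ) ≤⟨ +-monoʳ-≤ (n * (2 * Z + 1) + suc Q * ρ) (+-monoʳ-≤ (u * 2) (*-monoʳ-≤ z ρ≤n)) ⟩
        n * (2 * Z + 1) + suc Q * ρ + (u * 2 + z * n) ∎)))
      where
      e₁ : ∀ q n u z → suc q * n + (u * 2 + z * n) ≡ u * 2 + n * (suc q + z)
      e₁ = solve-∀
      e₂ : ∀ r q z u x → r * (suc q + z) + (u * 2 + x) ≡ x + suc q * r + (u * 2 + z * r)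
      e₂ = solve-∀

  Live : ℕ → Edges → Fin n → Set
  Live α U v = n ≤ α * deg v U

  live? : ∀ α U → Decidable (Live α U)
  live? α U v = n ≤? α * deg v U

  -- A live vertex has more than Z + Q free edges, and at most Z + Q of them lead into F or to a
  -- poor vertex.
  extension : ∀ {U M F v α} → WF b U M → length M ≤ Z → length F ≤ Z → α ≤ αm → Live α U v →
    ∃₂ λ e w → e ∈ U × Joins e v w × w ∉ F × ρ ≤ deg w U
  extension {U} {M} {F} {v} {α} wf′ M≤Z F≤Z α≤ lv with any? good? U
    where
    good? : Decidable (λ e → Touches v e × other v e ∉ F × ρ ≤ deg (other v e) U)
    good? e = touches? v e ×-dec ¬? (any? (other v e FinP.≟_) F) ×-dec (ρ ≤? deg (other v e) U)
  ... | yes found = let (e , m , t , nF , r) = find found in e , other v e , m , joins-other t , nF , r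
  ... | no none = ⊥-elim (<⇒≱ wide (≤-trans (≤-trans lv (*-monoˡ-≤ (deg v U) α≤)) (*-monoʳ-≤ αm bound)))
    where
    poors = filter (poor? U) (allFin n)
    bound : deg v U ≤ Z + Q
    bound = ≤-trans (cnt-inj (touches? v) (other v) U (F ++ poors) (uniqU wf′) into (λ e f me mf te tf → other-injective (ordU wf′ me) (ordU wf′ mf) te tf))
      (≤-trans (≤-reflexive (length-++ F)) (+-mono-≤ F≤Z (≤-trans (≤-reflexive (length-filter-cnt (poor? U) (allFin n))) (poor-bound wf′ M≤Z))))
      where
      into : ∀ e → e ∈ U → Touches v e → other v e ∈ F ++ poors
      into e m t with any? (other v e FinP.≟_) F | poor? U (other v e)
      ... | yes k | _ = ∈-++⁺ˡ k
      ... | no _ | yes p = ∈-++⁺ʳ F (∈-filter⁺ (poor? U) (∈-allFin _) p)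
      ... | no nF | no np = ⊥-elim (none (lose m (t , nF , ≮⇒≥ np)))

  -- The new vertex brings at least ρ = b + γ + 2 + Z² free edges; the at most b + 1 edges of the
  -- round take away at most b + 1 + Z².
  potential-step : ∀ {U M e U′ B U″ w A} → WF b U M → U ↭ e ∷ U′ → Reply U′ B U″ → Unique (w ∷ A) → length (w ∷ A) ≤ Z → ρ ≤ deg w U → freeSum A U + γ ≤ freeSum (w ∷ A) U″
  potential-step {U} {M} {e} {U′} {B} {U″} {w} {A} wf′ p (q , l) uA A≤Z rich = +-cancelʳ-≤ (b + 2 + Z * Z) _ _ (begin
      freeSum A U + γ + (b + 2 + Z * Z) ≡⟨ e₁ (freeSum A U) γ b (Z * Z) ⟩
      ρ + freeSum A U ≤⟨ +-monoˡ-≤ (freeSum A U) rich ⟩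
      freeSum (w ∷ A) U ≡⟨ trans (freeSum-↭ (w ∷ A) perm) (freeSum-++ (w ∷ A) (e ∷ B) U″) ⟩
      freeSum (w ∷ A) (e ∷ B) + freeSum (w ∷ A) U″ ≤⟨ +-monoˡ-≤ (freeSum (w ∷ A) U″) loss ⟩
      b + 2 + Z * Z + freeSum (w ∷ A) U″ ≡⟨ +-comm (b + 2 + Z * Z) _ ⟩
      freeSum (w ∷ A) U″ + (b + 2 + Z * Z) ∎)
    where
    open ≤R
    perm : U ↭ (e ∷ B) ++ U″
    perm = ↭-trans p (prep e q)
    loss : freeSum (w ∷ A) (e ∷ B) ≤ b + 2 + Z * Z
    loss = ≤-trans (freeSum-loss (e ∷ B) uA (Unique-++ˡ (e ∷ B) (Unique-↭ perm (uniqU wf′))) (λ m → ordU wf′ (PermP.∈-resp-↭ (↭-sym perm) (∈-++⁺ˡ m))))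
      (+-mono-≤ (≤-trans (s≤s (≤-trans (≤-reflexive l) (m⊓n≤m b _))) (≤-trans (n≤1+n (suc b)) (≤-reflexive (+-comm 2 b)))) (*-mono-≤ A≤Z A≤Z))
    e₁ : ∀ s g b z → s + g + (b + 2 + z) ≡ (b + g + 2 + z) + s
    e₁ = solve-∀

  Unit : Set
  Unit = Fin n × List (Fin n)

  news : List Unit → List (Fin n)
  news = concatMap proj₂

  tree : Unit → List (Fin n)
  tree (r , N) = r ∷ N

  -- F holds the vertices used before. The bound `potAll` shows that many vertices among roots and
  -- new ones are live; `potNew` shows it for the new ones alone, which is needed when they are to
  -- become roots of subtrees.
  record Growth (vs F : List (Fin n)) (T S₀ : ℕ) (M₀ U M : Edges) (us : List Unit) : Set where
    constructor growth
    field
      well : WF b U M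
      roots : map proj₁ us ↭ vs
      unique : Unique (news us ++ F)
      grown : ∀ {u} → u ∈ us → Grown M (proj₁ u) (proj₂ u)
      cap : ∀ {u} → u ∈ us → length (proj₂ u) ≤ T
      size : length M ≤ length F + length (news us)
      potAll : S₀ + length (news us) * γ ≤ freeSum (news us ++ vs) U
      potNew : length (news us) * γ ≤ freeSum (news us) U
      history : ∀ {f} → f ∈ M₀ → f ∈ M

  Stuck : ℕ → ℕ → Edges → List Unit → Set
  Stuck α T U us = ∀ {u v} → u ∈ us → length (proj₂ u) < T → v ∈ tree u → ¬ Live α U v

  news-cap : ∀ T us → (∀ {u} → u ∈ us → length (proj₂ u) ≤ T) → length (news us) ≤ length us * T
  news-cap T [] h = z≤n
  news-cap T (u ∷ us) h = ≤-trans (≤-reflexive (length-++ (proj₂ u))) (+-mono-≤ (h (here refl)) (news-cap T us (h ∘ there)))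

  concatMap-↭ : ∀ {A : Set} (f : A → List (Fin n)) {xs ys} → xs ↭ ys → concatMap f xs ↭ concatMap f ys
  concatMap-↭ f p = concat-↭ (PermP.map⁺ f p)

  -- As long as a unit below its cap has a live vertex, a new vertex is attached there. The caps
  -- bound the number of such rounds.
  grow-run : ∀ k {vs F T S₀ M₀ α U M} us → Unique vs → (∀ {v} → v ∈ vs → v ∈ F) → length F + length vs * T ≤ Z → α ≤ αm → length vs * T ≤ k + length (news us) →
    Growth vs F T S₀ M₀ U M us → Force (λ U′ M′ → ∃[ us′ ] (Growth vs F T S₀ M₀ U′ M′ us′ × Stuck α T U′ us′)) U M
  grow-run k {vs} {F} {T} {S₀} {M₀} {α} {U} {M} us uv v⊆F room α≤ fuel st = search (any? (λ u → (length (proj₂ u) <? T) ×-dec any? (live? α U) (tree u)) us)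
    where
    open Growth st
    lenus : length us ≡ length vs
    lenus = trans (sym (length-map proj₁ us)) (PermP.↭-length roots)
    search : Dec _ → Force (λ U′ M′ → ∃[ us′ ] (Growth vs F T S₀ M₀ U′ M′ us′ × Stuck α T U′ us′)) U M
    search (no none) = now (us , st , λ mu lt mv lv → none (lose mu (lt , lose mv lv)))
    search (yes found) with find found
    ... | (r , N) , mu , lt , lives with find lives | ∈-split mu
    ... | v , mv , lv | rest , perm = extend (extension well (≤-trans size (≤-trans (≤-reflexive (+-comm (length F) _)) used)) (≤-trans (≤-reflexive (length-++ (news us))) used) α≤ lv)
      where
      strict : suc (length (news us)) ≤ length vs * T
      strict = ≤-trans (≤-reflexive (cong suc (trans (PermP.↭-length (concatMap-↭ proj₂ perm)) (length-++ N))))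
        (≤-trans (+-mono-≤ lt (news-cap T rest (λ m → cap (PermP.∈-resp-↭ (↭-sym perm) (there m))))) (≤-reflexive (cong (_* T) (trans (sym (PermP.↭-length perm)) lenus))))
      used : length (news us) + length F ≤ Z
      used = ≤-trans (+-monoˡ-≤ (length F) (≤-trans (n≤1+n _) strict)) (≤-trans (≤-reflexive (+-comm _ (length F))) room)
      used′ : suc (length (news us)) + length F ≤ Z
      used′ = ≤-trans (+-monoˡ-≤ (length F) strict) (≤-trans (≤-reflexive (+-comm _ (length F))) room)
      extend : (∃₂ λ e w → e ∈ U × Joins e v w × w ∉ news us ++ F × ρ ≤ deg w U) → Force (λ U′ M′ → ∃[ us′ ] (Growth vs F T S₀ M₀ U′ M′ us′ × Stuck α T U′ us′)) U M
      extend (e , w , me , je , w∉ , rich) with ∈-split me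
      ... | U′ , permU = play e U′ permU (λ B U″ r → next k fuel B U″ r)
        where
        us′ : List Unit
        us′ = (r , w ∷ N) ∷ rest
        news-perm : w ∷ news us ↭ news us′
        news-perm = prep w (concatMap-↭ proj₂ perm)
        len-news : length (news us′) ≡ suc (length (news us))
        len-news = sym (PermP.↭-length news-perm)
        u₁ : Unique (w ∷ news us ++ F)
        u₁ = Unique-∷ w∉ unique
        uAll : Unique (w ∷ news us ++ vs)
        uAll = UniqueP.++⁺ (Unique-++ˡ (w ∷ news us) u₁) uv (λ { (a , c) → Unique-++-disj (w ∷ news us) u₁ a (v⊆F c) })
        vs≤F : length vs ≤ length F
        vs≤F = unique-⊆-length uv v⊆F
        lenAll : length (w ∷ news us ++ vs) ≤ Z
        lenAll = ≤-trans (≤-reflexive (cong suc (length-++ (news us)))) (≤-trans (+-monoʳ-≤ (suc (length (news us))) vs≤F) used′)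
        lenNew : length (w ∷ news us) ≤ Z
        lenNew = ≤-trans (m≤m+n _ (length F)) used′
        st′ : ∀ B U″ → Reply U′ B U″ → Growth vs F T S₀ M₀ U″ (e ∷ M) us′
        st′ B U″ rp@(p , l) = growth (wf-step well permU p l) (↭-trans (PermP.map⁺ proj₁ (↭-sym perm)) roots) (Unique-↭ (PermP.++⁺ʳ F news-perm) u₁)
          (λ { (here refl) → attach mv (joins-graphOf (here refl) je) (Grown-mono there (grown mu)) ; (there m) → Grown-mono there (grown (PermP.∈-resp-↭ (↭-sym perm) (there m))) })
          (λ { (here refl) → lt ; (there m) → cap (PermP.∈-resp-↭ (↭-sym perm) (there m)) })
          (≤-trans (s≤s size) (≤-reflexive (sym (trans (cong (length F +_) len-news) (+-suc (length F) _)))))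
          (≤-trans (≤-reflexive (trans (cong (λ z → S₀ + z * γ) len-news) (lem S₀ (length (news us)) γ))) (≤-trans (+-monoˡ-≤ γ potAll)
            (≤-trans (potential-step {B = B} {U″ = U″} well permU rp uAll lenAll rich) (≤-reflexive (sumf-↭ (λ z → deg z U″) (PermP.++⁺ʳ vs news-perm))))))
          (≤-trans (≤-reflexive (trans (cong (_* γ) len-news) (+-comm γ _))) (≤-trans (+-monoˡ-≤ γ potNew)
            (≤-trans (potential-step {B = B} {U″ = U″} well permU rp (Unique-++ˡ (w ∷ news us) u₁) lenNew rich) (≤-reflexive (sumf-↭ (λ z → deg z U″) news-perm)))))
          (there ∘ history)
          where
          lem : ∀ s l g → s + suc l * g ≡ s + l * g + g
          lem = solve-∀
        next : ∀ k → length vs * T ≤ k + length (news us) → ∀ B U″ → Reply U′ B U″ → Force (λ U′ M′ → ∃[ us′ ] (Growth vs F T S₀ M₀ U′ M′ us′ × Stuck α T U′ us′)) U″ (e ∷ M)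
        next zero fuel B U″ rp = ⊥-elim (<⇒≱ strict fuel)
        next (suc k) fuel B U″ rp = grow-run k us′ uv v⊆F room α≤ (≤-trans fuel (≤-reflexive (trans (sym (+-suc k _)) (cong (k +_) (sym len-news))))) (st′ B U″ rp)

  -- A live vertex contributes at most n free edges, any other one less than n / α.
  live-count : ∀ {U M} α → WF b U M → ∀ A → α * freeSum A U ≤ α * n * cnt (live? α U) A + length A * n
  live-count {U} α w A = begin
      α * freeSum A U ≡⟨ sym (sumf-* α _ A) ⟩
      sumf (λ z → α * deg z U) A ≤⟨ sumf-mono A (λ z _ → point z (live? α U z)) ⟩
      sumf (λ z → α * n * ind (live? α U z) + n) A ≡⟨ trans (sumf-+ _ _ A) (cong₂ _+_ (sumf-* (α * n) _ A) (sumf-const n A)) ⟩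
      α * n * cnt (live? α U) A + length A * n ∎
    where
    open ≤R
    point : ∀ z (d : Dec (Live α U z)) → α * deg z U ≤ α * n * ind d + n
    point z (yes _) = ≤-trans (≤-trans (*-monoʳ-≤ α (deg≤n z w)) (≤-reflexive (sym (*-identityʳ (α * n))))) (m≤m+n _ n)
    point z (no nl) = ≤-trans (<⇒≤ (≰⇒> nl)) (m≤n+m n (α * n * 0))

  liveIn : ℕ → Edges → Unit → ℕ
  liveIn α U u = cnt (live? α U) (tree u)

  module _ {vs F T S₀ M₀ U M us} (st : Growth vs F T S₀ M₀ U M us) (α : ℕ) (live₀ : n * length vs ≤ α * S₀) (n≤αγ : n ≤ α * γ) where
    open Growth st

    private
      r = length (news us)

    trees-live : ∀ us → cnt (live? (2 * α) U) (news us) + cnt (live? (2 * α) U) (map proj₁ us) ≡ sumf (liveIn (2 * α) U) us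
    trees-live [] = refl
    trees-live ((x , N) ∷ us) = trans (cong (_+ (ind (live? (2 * α) U x) + cnt (live? (2 * α) U) (map proj₁ us))) (sumf-++ _ N (news us)))
      (trans (lem (cnt (live? (2 * α) U) N) (cnt (live? (2 * α) U) (news us)) (ind (live? (2 * α) U x)) (cnt (live? (2 * α) U) (map proj₁ us))) (cong (liveIn (2 * α) U (x , N) +_) (trees-live us)))
      where
      lem : ∀ a c d e → a + c + (d + e) ≡ d + a + (c + e)
      lem = solve-∀

    -- The vertices have on average at least n / α free edges, and those that are not live for 2α
    -- account for at most half of this sum.
    many-live : length vs + r ≤ 2 * α * sumf (liveIn (2 * α) U) us
    many-live = *-cancelˡ-≤ n {{Nat.>-nonZero n≥1}} (+-cancelʳ-≤ (n * (length vs + r)) _ _ (begin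
        n * (m + r) + n * (m + r) ≡⟨ e₁ n m r ⟩
        2 * (n * m) + 2 * (r * n) ≤⟨ +-mono-≤ (*-monoʳ-≤ 2 live₀) (*-monoʳ-≤ 2 (*-monoʳ-≤ r n≤αγ)) ⟩
        2 * (α * S₀) + 2 * (r * (α * γ)) ≡⟨ e₂ α S₀ r γ ⟩
        2 * α * (S₀ + r * γ) ≤⟨ *-monoʳ-≤ (2 * α) potAll ⟩
        2 * α * freeSum (news us ++ vs) U ≤⟨ live-count (2 * α) well (news us ++ vs) ⟩
        2 * α * n * cnt (live? (2 * α) U) (news us ++ vs) + length (news us ++ vs) * n ≡⟨ cong₂ (λ x y → 2 * α * n * x + y * n) cnt-eq (length-++ (news us)) ⟩
        2 * α * n * sumf (liveIn (2 * α) U) us + (r + m) * n ≡⟨ e₃ α n (sumf (liveIn (2 * α) U) us) r m ⟩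
        n * (2 * α * sumf (liveIn (2 * α) U) us) + n * (m + r) ∎))
      where
      open ≤R
      m = length vs
      cnt-eq : cnt (live? (2 * α) U) (news us ++ vs) ≡ sumf (liveIn (2 * α) U) us
      cnt-eq = trans (sumf-++ _ (news us) vs) (trans (cong (cnt (live? (2 * α) U) (news us) +_) (sym (sumf-↭ _ roots))) (trees-live us))
      e₁ : ∀ n m r → n * (m + r) + n * (m + r) ≡ 2 * (n * m) + 2 * (r * n)
      e₁ = solve-∀
      e₂ : ∀ a s r g → 2 * (a * s) + 2 * (r * (a * g)) ≡ 2 * a * (s + r * g)
      e₂ = solve-∀
      e₃ : ∀ a n l r m → 2 * a * n * l + (r + m) * n ≡ n * (2 * a * l) + n * (m + r)
      e₃ = solve-∀

    sum-news : ∀ us → length (news us) ≡ sumf (λ u → length (proj₂ u)) us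
    sum-news [] = refl
    sum-news (u ∷ us) = trans (length-++ (proj₂ u)) (cong (length (proj₂ u) +_) (sum-news us))

    stuck-dead : Stuck (2 * α) T U us → ∀ {u} → u ∈ us → length (proj₂ u) < T → liveIn (2 * α) U u ≡ 0
    stuck-dead sk {u} mu lt = cnt-none (live? (2 * α) U) (tree u) (λ v mv → sk mu lt mv)

    good? : ∀ K → Decidable (λ u → K ≤ liveIn (2 * α) U u)
    good? K u = K ≤? liveIn (2 * α) U u

    -- each unit that is not stuck early has T new vertices, which pay for K live ones
    good-units : ∀ K → T ≡ 2 * α * K → Stuck (2 * α) T U us → length vs ≤ 2 * α * suc T * cnt (good? K) us
    good-units K eq sk = +-cancelʳ-≤ r _ _ (begin
        length vs + r ≤⟨ many-live ⟩
        2 * α * sumf (liveIn (2 * α) U) us ≤⟨ *-monoʳ-≤ (2 * α) (≤-trans (sumf-mono us (λ u mu → point u mu (good? K u) (full? u))) (≤-reflexive (trans (sumf-+ _ _ us) (cong₂ _+_ (sumf-* (suc T) _ us) (sumf-* K _ us))))) ⟩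
        2 * α * (suc T * cnt (good? K) us + K * cnt full? us) ≡⟨ e₁ α (suc T) (cnt (good? K) us) K (cnt full? us) ⟩
        2 * α * suc T * cnt (good? K) us + 2 * α * K * cnt full? us ≡⟨ cong (λ z → 2 * α * suc T * cnt (good? K) us + z * cnt full? us) (sym eq) ⟩
        2 * α * suc T * cnt (good? K) us + T * cnt full? us ≤⟨ +-monoʳ-≤ (2 * α * suc T * cnt (good? K) us) paid ⟩
        2 * α * suc T * cnt (good? K) us + r ∎)
      where
      open ≤R
      full? : Decidable (λ (u : Unit) → T ≤ length (proj₂ u))
      full? u = T ≤? length (proj₂ u)
      e₁ : ∀ a t g k f → 2 * a * (t * g + k * f) ≡ 2 * a * t * g + 2 * a * k * f
      e₁ = solve-∀
      paid : T * cnt full? us ≤ r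
      paid = ≤-trans (≤-reflexive (sym (sumf-* T _ us))) (≤-trans (sumf-mono us (λ u _ → pay u (full? u))) (≤-reflexive (sym (sum-news us))))
        where
        pay : ∀ u (d : Dec (T ≤ length (proj₂ u))) → T * ind d ≤ length (proj₂ u)
        pay u (yes l) = ≤-trans (≤-reflexive (*-identityʳ T)) l
        pay u (no _) = ≤-trans (≤-reflexive (*-zeroʳ T)) z≤n
      point : ∀ u → u ∈ us → (g : Dec (K ≤ liveIn (2 * α) U u)) (f : Dec (T ≤ length (proj₂ u))) → liveIn (2 * α) U u ≤ suc T * ind g + K * ind f
      point u mu (yes _) _ = ≤-trans (≤-trans (cnt≤length (live? (2 * α) U) (tree u)) (≤-trans (s≤s (cap mu)) (≤-reflexive (sym (*-identityʳ (suc T)))))) (m≤m+n _ _)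
      point u mu (no ng) (yes _) = ≤-trans (<⇒≤ (≰⇒> ng)) (≤-trans (≤-reflexive (sym (*-identityʳ K))) (m≤n+m _ _))
      point u mu (no ng) (no nf) = ≤-trans (≤-reflexive (stuck-dead sk mu (≰⇒> nf))) z≤n

    -- A unit without a new vertex has no live vertex either, and the others have at most two. So
    -- the number of new vertices is at least a constant fraction of |vs|, and by `potNew` a
    -- constant fraction of these is live.
    new-leaves : T ≡ 1 → Stuck (2 * α) T U us → length vs ≤ 8 * α * α * cnt (live? (2 * α) U) (news us)
    new-leaves refl sk = begin
        length vs ≤⟨ ≤-trans (m≤m+n _ r) many-live ⟩
        2 * α * sumf (liveIn (2 * α) U) us ≤⟨ *-monoʳ-≤ (2 * α) (≤-trans (sumf-mono us (λ u mu → point u mu (proj₂ u) refl)) (≤-reflexive (trans (sumf-* 2 _ us) (cong (2 *_) (sym (sum-news us)))))) ⟩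
        2 * α * (2 * r) ≤⟨ *-monoʳ-≤ (2 * α) (*-monoʳ-≤ 2 half) ⟩
        2 * α * (2 * (2 * α * L)) ≡⟨ e₁ α L ⟩
        8 * α * α * L ∎
      where
      open ≤R
      L = cnt (live? (2 * α) U) (news us)
      e₁ : ∀ a l → 2 * a * (2 * (2 * a * l)) ≡ 8 * a * a * l
      e₁ = solve-∀
      point : ∀ u → u ∈ us → ∀ N → proj₂ u ≡ N → liveIn (2 * α) U u ≤ 2 * length (proj₂ u)
      point u mu [] refl = ≤-reflexive (stuck-dead sk mu (s≤s z≤n))
      point u mu (x ∷ N) refl = ≤-trans (cnt≤length (live? (2 * α) U) (tree u)) (≤-trans (≤-reflexive (+-comm 1 _)) (≤-trans (+-monoʳ-≤ (suc (length N)) (s≤s (z≤n {length N}))) (≤-reflexive (cong (suc (length N) +_) (sym (+-identityʳ _))))))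
      half : r ≤ 2 * α * L
      half = *-cancelˡ-≤ n {{Nat.>-nonZero n≥1}} (+-cancelʳ-≤ (r * n) _ _ (begin
        n * r + r * n ≡⟨ e₂ n r ⟩
        2 * (r * n) ≤⟨ *-monoʳ-≤ 2 (*-monoʳ-≤ r n≤αγ) ⟩
        2 * (r * (α * γ)) ≡⟨ e₃ r α γ ⟩
        2 * α * (r * γ) ≤⟨ *-monoʳ-≤ (2 * α) potNew ⟩
        2 * α * freeSum (news us) U ≤⟨ live-count (2 * α) well (news us) ⟩
        2 * α * n * L + r * n ≡⟨ cong (_+ r * n) (e₄ α n L) ⟩
        n * (2 * α * L) + r * n ∎))
        where
        e₂ : ∀ n r → n * r + r * n ≡ 2 * (r * n)
        e₂ = solve-∀
        e₃ : ∀ r a g → 2 * (r * (a * g)) ≡ 2 * a * (r * g)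
        e₃ = solve-∀
        e₄ : ∀ a n l → 2 * a * n * l ≡ n * (2 * a * l)
        e₄ = solve-∀

  growth-start : ∀ {vs F T U M} → WF b U M → Unique F → length M ≤ length F → Growth vs F T (freeSum vs U) M U M (map (λ v → v , []) vs)
  growth-start {vs} {F} {T} {U} {M} w uF M≤F = growth w (↭-reflexive (trans (sym (map-∘ vs)) (map-id vs))) (subst (λ z → Unique (z ++ F)) (sym (none vs)) uF)
      (λ m → let (v , _ , eq) = ∈-map⁻ (λ v → v , []) m in subst (λ u → Grown M (proj₁ u) (proj₂ u)) (sym eq) seed)
      (λ m → let (v , _ , eq) = ∈-map⁻ (λ v → v , []) m in subst (λ u → length (proj₂ u) ≤ T) (sym eq) z≤n)
      (≤-trans M≤F (m≤m+n _ _)) (≤-reflexive (trans (cong (λ z → freeSum vs U + length z * γ) (none vs)) (trans (+-identityʳ _) (cong (λ z → freeSum (z ++ vs) U) (sym (none vs))))))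
      (≤-trans (≤-reflexive (cong (λ z → length z * γ) (none vs))) z≤n) id
    where
    open import Data.List.Properties using (map-∘; map-id)
    none : ∀ vs → news (map (λ v → v , []) vs) ≡ []
    none [] = refl
    none (_ ∷ vs) = none vs

  live-sum : ∀ {α U} vs → (∀ {v} → v ∈ vs → Live α U v) → n * length vs ≤ α * freeSum vs U
  live-sum {α} {U} vs h = ≤-trans (≤-reflexive (trans (*-comm n (length vs)) (sym (sumf-const n vs)))) (≤-trans (sumf-mono vs (λ v m → h m)) (≤-reflexive (sumf-* α _ vs)))

concatMap-sep : ∀ {A B : Set} (f : A → List B) us → Unique (concatMap f us) → ∀ {u u′ x} → u ∈ us → u′ ∈ us → x ∈ f u → x ∈ f u′ → u ≡ u′
concatMap-sep f (u ∷ us) uq (here refl) (here refl) _ _ = refl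
concatMap-sep f (u ∷ us) uq (here refl) (there m) a c = ⊥-elim (Unique-++-disj (f u) uq a (∈-concatMap⁺ f (lose m c)))
concatMap-sep f (u ∷ us) uq (there m) (here refl) a c = ⊥-elim (Unique-++-disj (f u) uq c (∈-concatMap⁺ f (lose m a)))
concatMap-sep f (u ∷ us) uq (there m) (there m′) a c = concatMap-sep f us (Unique-++ʳ (f u) uq) m m′ a c

concatMap-unique : ∀ {A B : Set} (f : A → List B) us → Unique us → (∀ {u} → u ∈ us → Unique (f u)) →
  (∀ {u u′ x} → u ∈ us → u′ ∈ us → x ∈ f u → x ∈ f u′ → u ≡ u′) → Unique (concatMap f us)
concatMap-unique f [] _ _ _ = []
concatMap-unique f (u ∷ us) uq each sep = UniqueP.++⁺ (each (here refl)) (concatMap-unique f us (Unique-tail uq) (each ∘ there) (λ a c → sep (there a) (there c)))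
  (λ { (a , c) → let (v , mv , xv) = find (∈-concatMap⁻ f {xs = us} c) in Unique-head uq (subst (_∈ us) (sym (sep (here refl) (there mv) a xv)) mv) })

concatMap-∈ : ∀ {A B : Set} (f : A → List B) {us x} → x ∈ concatMap f us → ∃[ u ] (u ∈ us × x ∈ f u)
concatMap-∈ f {us} m = find (∈-concatMap⁻ f {xs = us} m)

∈-concatMap : ∀ {A B : Set} (f : A → List B) {us u x} → u ∈ us → x ∈ f u → x ∈ concatMap f us
∈-concatMap f m k = ∈-concatMap⁺ f (lose m k)

∈-map-elim : ∀ {A B : Set} (g : A → B) {P : B → Set} {xs} → (∀ {x} → x ∈ xs → P (g x)) → ∀ {y} → y ∈ map g xs → P y
∈-map-elim g {P} f m = let (x , mx , eq) = ∈-map⁻ g m in subst P (sym eq) (f mx)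

concatMap-length : ∀ {A B : Set} (f : A → List B) c us → (∀ {u} → u ∈ us → length (f u) ≡ c) → length (concatMap f us) ≡ length us * c
concatMap-length f c [] _ = refl
concatMap-length f c (u ∷ us) h = trans (length-++ (f u)) (cong₂ _+_ (h (here refl)) (concatMap-length f c us (h ∘ there)))

-- Tree M k j r V: in the graph M, the vertices V carry a k-ary tree of depth j whose nodes are
-- connected blobs, the root blob containing r.
data Tree {n} (M : List (Edge n)) (k : ℕ) : ℕ → Fin n → List (Fin n) → Set where
  leaf : ∀ {r} → Tree M k 0 r (r ∷ [])
  node : ∀ {j r N} (kids : List (Fin n × Fin n × List (Fin n))) → Grown M r N → k ≤ length kids →
    (∀ {s w V} → (s , w , V) ∈ kids → s ∈ r ∷ N × graphOf M s w × Tree M k j w V) →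
    Tree M k (suc j) r ((r ∷ N) ++ concatMap (λ kid → proj₂ (proj₂ kid)) kids)

graphOf-mono : ∀ {n} {M M′ : List (Edge n)} → (∀ {f} → f ∈ M → f ∈ M′) → ∀ {x y} → graphOf M x y → graphOf M′ x y
graphOf-mono s (inj₁ m) = inj₁ (s m)
graphOf-mono s (inj₂ m) = inj₂ (s m)

Tree-root : ∀ {n} {M : List (Edge n)} {k j r V} → Tree M k j r V → r ∈ V
Tree-root leaf = here refl
Tree-root (node _ _ _ _) = here refl

module Costs (k : ℕ) where

  -- depth j at liveness α: one tree per count j α units, at a price of cost j α vertices per unit
  count kidsFor : ℕ → ℕ → ℕ
  count zero α = 1
  count (suc j) α = 2 * α * suc (2 * α * (2 * k * kidsFor j α)) * (2 * kidsFor j α)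
  kidsFor j α = suc (8 * (2 * α) * (2 * α) * count j (2 * (2 * α)))

  -- A good unit offers 2 k · kidsFor live vertices, so that at least 2k of them on average come to
  -- carry a subtree. By `good-units` this takes 2α new vertices per mark.
  marksFor growFor : ℕ → ℕ → ℕ
  marksFor j α = 2 * k * kidsFor j α
  growFor j α = 2 * α * marksFor j α

  cost : ℕ → ℕ → ℕ
  cost zero α = 0
  cost (suc j) α = growFor j α + (marksFor j α + marksFor j α * cost j (2 * (2 * α)))

module CleverTrees {h : ℕ} (H : Graph h) (setting : CleverSetting) (k : ℕ) (k≥1 : 1 ≤ k) where

  open CleverSetting setting
  open CleverGame H setting public
  open Costs k public

  -- By `avoids` a tree keeps off all vertices used before, apart from its root. This is what makes
  -- the assembled trees of the next level disjoint.
  record Trees (j : ℕ) (vs F : List (Fin n)) (c : ℕ) (M₀ U M : Edges) : Set where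
    constructor trees
    field
      out : List (Fin n × List (Fin n))
      rooted : ∀ {o} → o ∈ out → proj₁ o ∈ vs
      isTree : ∀ {o} → o ∈ out → Tree M k j (proj₁ o) (proj₂ o)
      avoids : ∀ {o x} → o ∈ out → x ∈ proj₂ o → x ≡ proj₁ o ⊎ x ∉ F
      disjoint : Unique (concatMap proj₂ out)
      enough : length vs ≤ c * length out
      history : ∀ {f} → f ∈ M₀ → f ∈ M

  UnitIn : Fin n → List (Fin n) → List Unit → Set
  UnitIn s N us = _∈_ {A = Unit} (s , N) us

  -- The root of the unit to which `w` was attached; for a vertex of no unit the value is a mere
  -- default.
  parent : List Unit → Fin n → Fin n
  parent [] w = w
  parent ((s , N) ∷ us) w = if does (any? (w FinP.≟_) N) then s else parent us w

  parent-unit : ∀ us {w} → w ∈ news us → ∃[ N ] (UnitIn (parent us w) N us × w ∈ N)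
  parent-unit ((s , N) ∷ us) {w} m = pick (any? (w FinP.≟_) N)
    where
    pick : (d : Dec (w ∈ N)) → ∃[ N′ ] (UnitIn (if does d then s else parent us w) N′ ((s , N) ∷ us) × w ∈ N′)
    pick (yes k) = N , here refl , k
    pick (no nk) with ∈-++⁻ N m
    ... | inj₁ k = ⊥-elim (nk k)
    ... | inj₂ k = let (N′ , mu , mw) = parent-unit us k in N′ , there mu , mw

  growth-trees-unique : ∀ {vs F T S₀ M₀ U M us} → Growth vs F T S₀ M₀ U M us → Unique vs → (∀ {v} → v ∈ vs → v ∈ F) → Unique (concatMap tree us)
  growth-trees-unique {us = us} g uvs vs⊆F = Unique-↭ (↭-sym (rearrange us)) (UniqueP.++⁺ (Unique-++ˡ (news us) unique) (Unique-↭ (↭-sym roots) uvs)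
      (λ { (a , c) → Unique-++-disj (news us) unique a (vs⊆F (PermP.∈-resp-↭ roots c)) }))
    where
    open Growth g
    rearrange : ∀ us → concatMap tree us ↭ news us ++ map proj₁ us
    rearrange [] = ↭-refl
    rearrange ((r , N) ∷ us) = ↭-trans (prep r (PermP.++⁺ˡ N (rearrange us))) (↭-trans (↭-reflexive (cong (r ∷_) (sym (++-assoc N (news us) (map proj₁ us))))) (↭-sym (PermP.shift r (N ++ news us) (map proj₁ us))))

  concatMap-each : ∀ {A : Set} (f : A → List (Fin n)) us → Unique (concatMap f us) → ∀ {u} → u ∈ us → Unique (f u)
  concatMap-each f (u ∷ us) uq (here refl) = Unique-++ˡ (f u) uq
  concatMap-each f (u ∷ us) uq (there m) = concatMap-each f us (Unique-++ʳ (f u) uq) m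

  out-unique : ∀ {M : Edges} {j} os → Unique (concatMap proj₂ os) → (∀ {o} → o ∈ os → Tree M k j (proj₁ o) (proj₂ o)) → Unique os
  out-unique [] _ _ = []
  out-unique (o ∷ os) uq tr = Unique-∷ (λ m → Unique-++-disj (proj₂ o) uq (Tree-root (tr (here refl))) (∈-concatMap proj₂ m (Tree-root (tr (here refl))))) (out-unique os (Unique-++ʳ (proj₂ o) uq) (tr ∘ there))

  same-unit : ∀ us → Unique (map proj₁ us) → ∀ {s N N′} → UnitIn s N us → UnitIn s N′ us → N ≡ N′
  same-unit (_ ∷ us) u (here refl) (here refl) = refl
  same-unit (_ ∷ us) u (here refl) (there m) = ⊥-elim (Unique-head u (∈-map⁺ proj₁ m))
  same-unit (_ ∷ us) u (there m) (here refl) = ⊥-elim (Unique-head u (∈-map⁺ proj₁ m))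
  same-unit (_ ∷ us) u (there m) (there m′) = same-unit us (Unique-tail u) m m′

  single : ∀ {N : List (Fin n)} {x y} → length N ≤ 1 → x ∈ N → y ∈ N → x ≡ y
  single {_ ∷ []} _ (here refl) (here refl) = refl
  single {_ ∷ _ ∷ _} (s≤s ()) _ _

  single-edge : ∀ {M : Edges} {s w} N → length N ≤ 1 → w ∈ N → Grown M s N → graphOf M s w
  single-edge (w ∷ []) _ (here refl) (attach (here refl) g seed) = g
  single-edge (_ ∷ _ ∷ _) (s≤s ()) _ _

  kids-concat : ∀ (f : Fin n × List (Fin n) → Fin n) os → concatMap (λ kid → proj₂ (proj₂ kid)) (map (λ o → f o , o) os) ≡ concatMap proj₂ os
  kids-concat f [] = refl
  kids-concat f (o ∷ os) = cong (proj₂ o ++_) (kids-concat f os)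

  concatMap-pair : ∀ (f : Unit → List (Fin n)) us → concatMap proj₂ (map (λ u → proj₁ u , f u) us) ≡ concatMap f us
  concatMap-pair f [] = refl
  concatMap-pair f (u ∷ us) = cong (f u ++_) (concatMap-pair f us)

  -- grow the units, attach a leaf to each marked vertex, recurse on the leaves
  record Phases (vs F : List (Fin n)) (j : ℕ) (M₀ U M : Edges) : Set where
    constructor phases
    field
      {ms} : List (Fin n)
      {M₁ M₂ U₁ U₂} : Edges
      {C T₁ S₁ S₂} : ℕ
      {us₁ us₂} : List Unit
      g₁ : Growth vs F T₁ S₁ M₀ U₁ M₁ us₁
      uvs : Unique vs
      vs⊆F : ∀ {v} → v ∈ vs → v ∈ F
      goods : List Unit
      goods⊆ : ∀ {u} → u ∈ goods → u ∈ us₁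
      ugoods : Unique goods
      marks : Unit → List (Fin n)
      marks⊆ : ∀ {u x} → x ∈ marks u → x ∈ tree u
      ms-def : ms ≡ concatMap marks goods
      g₂ : Growth ms (news us₁ ++ F) 1 S₂ M₁ U₂ M₂ us₂
      ums : Unique ms
      lf : List (Fin n)
      lf⊆ : ∀ {w} → w ∈ lf → w ∈ news us₂
      t₃ : Trees j lf (news us₂ ++ news us₁ ++ F) C M₂ U M

  module Assemble {vs F : List (Fin n)} {j : ℕ} {M₀ U M : Edges} (P : Phases vs F j M₀ U M) where

    open Phases P
    private
      module G₁ = Growth g₁
      module G₂ = Growth g₂
      module T₃ = Trees t₃

    par : Fin n × List (Fin n) → Fin n
    par o = parent us₂ (proj₁ o)

    kid? : ∀ u → Decidable (λ o → par o ∈ marks u)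
    kid? u o = any? (par o FinP.≟_) (marks u)

    out-unit : ∀ {o} → o ∈ T₃.out → ∃[ N ] (UnitIn (par o) N us₂ × proj₁ o ∈ N)
    out-unit m = parent-unit us₂ (lf⊆ (T₃.rooted m))

    unit-in : ∀ {s N} → UnitIn s N us₂ → s ∈ ms
    unit-in m = PermP.∈-resp-↭ G₂.roots (∈-map⁺ proj₁ m)

    roots-unique : Unique (map proj₁ us₂)
    roots-unique = Unique-↭ (↭-sym G₂.roots) ums

    out-same : ∀ {o o′ x} → o ∈ T₃.out → o′ ∈ T₃.out → x ∈ proj₂ o → x ∈ proj₂ o′ → o ≡ o′
    out-same = concatMap-sep proj₂ T₃.out T₃.disjoint

    -- In the leaf phase a unit receives at most one new vertex, so subtrees below the same mark
    -- have the same root and are equal.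
    par-injective : ∀ {o o′} → o ∈ T₃.out → o′ ∈ T₃.out → par o ≡ par o′ → o ≡ o′
    par-injective {o} {o′} m m′ eq with out-unit m | out-unit m′
    ... | N , mu , w | N′ , mu′ , w′ with same-unit us₂ roots-unique mu (subst (λ s → UnitIn s N′ us₂) (sym eq) mu′)
    ... | refl = out-same m m′ (Tree-root (T₃.isTree m)) (subst (_∈ proj₂ o′) (sym (single (G₂.cap mu) w w′)) (Tree-root (T₃.isTree m′)))

    par-edge : ∀ {o} → o ∈ T₃.out → graphOf M (par o) (proj₁ o)
    par-edge {o} m with out-unit m
    ... | N , mu , w = graphOf-mono T₃.history (single-edge N (G₂.cap mu) w (G₂.grown mu))

    kids : Unit → List (Fin n × List (Fin n))
    kids u = filter (kid? u) T₃.out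

    kids⊆ : ∀ {u o} → o ∈ kids u → o ∈ T₃.out × par o ∈ marks u
    kids⊆ {u} m = ∈-filter⁻ (kid? u) {xs = T₃.out} m

    vertices : Unit → List (Fin n)
    vertices u = tree u ++ concatMap (λ kid → proj₂ (proj₂ kid)) (map (λ o → par o , o) (kids u))

    old-tree : ∀ {u x} → u ∈ us₁ → x ∈ tree u → x ∈ news us₁ ++ F
    old-tree mu (here refl) = ∈-++⁺ʳ (news us₁) (vs⊆F (PermP.∈-resp-↭ G₁.roots (∈-map⁺ proj₁ mu)))
    old-tree mu (there m) = ∈-++⁺ˡ (∈-concatMap proj₂ mu m)

    new-vertex : ∀ {o x} → o ∈ T₃.out → x ∈ proj₂ o → x ∉ news us₁ ++ F
    new-vertex m mx k with T₃.avoids m mx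
    ... | inj₂ nF = nF (∈-++⁺ʳ (news us₂) k)
    ... | inj₁ refl = Unique-++-disj (news us₂) G₂.unique (lf⊆ (T₃.rooted m)) k

    trees-unique : Unique (concatMap tree us₁)
    trees-unique = growth-trees-unique g₁ uvs vs⊆F

    tree-same : ∀ {u u′ x} → u ∈ us₁ → u′ ∈ us₁ → x ∈ tree u → x ∈ tree u′ → u ≡ u′
    tree-same = concatMap-sep tree us₁ trees-unique

    in-vertices : ∀ u {x} → x ∈ vertices u → x ∈ tree u ⊎ ∃[ o ] (o ∈ kids u × x ∈ proj₂ o)
    in-vertices u {x} m with ∈-++⁻ (tree u) m
    ... | inj₁ a = inj₁ a
    ... | inj₂ c = inj₂ (concatMap-∈ proj₂ (subst (x ∈_) (kids-concat par (kids u)) c))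

    vertices-same : ∀ {u u′ x} → u ∈ us₁ → u′ ∈ us₁ → x ∈ vertices u → x ∈ vertices u′ → u ≡ u′
    vertices-same {u} {u′} mu mu′ a c with in-vertices u a | in-vertices u′ c
    ... | inj₁ p | inj₁ q = tree-same mu mu′ p q
    ... | inj₁ p | inj₂ (o , mo , xo) = ⊥-elim (new-vertex (proj₁ (kids⊆ {u′} mo)) xo (old-tree mu p))
    ... | inj₂ (o , mo , xo) | inj₁ q = ⊥-elim (new-vertex (proj₁ (kids⊆ {u} mo)) xo (old-tree mu′ q))
    ... | inj₂ (o , mo , xo) | inj₂ (o′ , mo′ , xo′) with out-same (proj₁ (kids⊆ {u} mo)) (proj₁ (kids⊆ {u′} mo′)) xo xo′
    ... | refl = tree-same mu mu′ (marks⊆ (proj₂ (kids⊆ {u} mo))) (marks⊆ (proj₂ (kids⊆ {u′} mo′)))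

    vertices-unique : ∀ {u} → u ∈ us₁ → Unique (vertices u)
    vertices-unique {u} mu = UniqueP.++⁺ (concatMap-each tree us₁ trees-unique mu)
        (subst Unique (sym (kids-concat par (kids u))) (concatMap-unique proj₂ (kids u) (UniqueP.filter⁺ (kid? u) (out-unique {M} {j} T₃.out T₃.disjoint T₃.isTree)) (λ m → concatMap-each proj₂ T₃.out T₃.disjoint (proj₁ (kids⊆ {u} m)))
          (λ m m′ a c → out-same (proj₁ (kids⊆ {u} m)) (proj₁ (kids⊆ {u} m′)) a c)))
        (λ { {x} (a , c) → let (o , mo , xo) = concatMap-∈ proj₂ (subst (x ∈_) (kids-concat par (kids u)) c) in new-vertex (proj₁ (kids⊆ {u} mo)) xo (old-tree mu a) })

    rich? : Decidable (λ u → k ≤ length (kids u))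
    rich? u = k ≤? length (kids u)

    winners : List Unit
    winners = filter rich? goods

    winner⊆ : ∀ {u} → u ∈ winners → u ∈ us₁ × k ≤ length (kids u)
    winner⊆ m = let (a , c) = ∈-filter⁻ rich? {xs = goods} m in goods⊆ a , c

    is-tree : ∀ {u} → u ∈ winners → Tree M k (suc j) (proj₁ u) (vertices u)
    is-tree {u} m = node (map (λ o → par o , o) (kids u)) (Grown-mono (T₃.history ∘ G₂.history) (G₁.grown (proj₁ (winner⊆ m))))
      (≤-trans (proj₂ (winner⊆ m)) (≤-reflexive (sym (length-map _ (kids u))))) kid
      where
      kid : ∀ {s w V} → (s , w , V) ∈ map (λ o → par o , o) (kids u) → s ∈ tree u × graphOf M s w × Tree M k j w V
      kid = ∈-map-elim (λ o → par o , o) {P = λ c → proj₁ c ∈ tree u × graphOf M (proj₁ c) (proj₁ (proj₂ c)) × Tree M k j (proj₁ (proj₂ c)) (proj₂ (proj₂ c))}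
        (λ mo → let (m′ , p) = kids⊆ {u} mo in marks⊆ p , par-edge m′ , T₃.isTree m′)

    covered : length T₃.out ≤ sumf (λ u → length (kids u)) goods
    covered = ≤-trans (≤-trans (≤-reflexive (sym (*-identityʳ _))) (≤-trans (≤-reflexive (sym (sumf-const 1 T₃.out))) (sumf-mono T₃.out one)))
        (≤-reflexive (trans (sym (sumf-swap (λ u o → ind (kid? u o)) goods T₃.out)) (sumf-cong goods (λ u _ → sym (length-filter-cnt (kid? u) T₃.out)))))
      where
      one : ∀ o → o ∈ T₃.out → 1 ≤ cnt (λ u → kid? u o) goods
      one o m with out-unit m
      ... | N , mu , _ with concatMap-∈ marks {us = goods} (subst (par o ∈_) ms-def (unit-in mu))
      ... | u , mgu , mo = ≤-trans (≤-reflexive (sym (ind-yes (kid? u o) mo))) (sumf-∈ (λ u → ind (kid? u o)) mgu)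

    kids-bound : ∀ {u K} → length (marks u) ≤ K → length (kids u) ≤ K
    kids-bound {u} le = ≤-trans (≤-reflexive (length-filter-cnt (kid? u) T₃.out)) (≤-trans (cnt-inj (kid? u) par T₃.out (marks u) (out-unique {M} {j} T₃.out T₃.disjoint T₃.isTree) (λ _ _ m → m) (λ o o′ m m′ _ _ eq → par-injective m m′ eq)) le)

    -- A winner carries at most K subtrees, every other good unit fewer than k.
    winners-count : ∀ {K} → (∀ {u} → u ∈ goods → length (marks u) ≤ K) → length T₃.out ≤ K * length winners + k * length goods
    winners-count {K} mk≤ = ≤-trans covered (≤-trans (sumf-mono goods (λ u m → point u m (rich? u)))
        (≤-reflexive (trans (sumf-+ _ _ goods) (cong₂ _+_ (trans (sumf-* K _ goods) (cong (K *_) (sym (length-filter-cnt rich? goods)))) (trans (sumf-const k goods) (*-comm _ k))))))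
      where
      point : ∀ u → u ∈ goods → (d : Dec (k ≤ length (kids u))) → length (kids u) ≤ K * ind d + k
      point u m (yes _) = ≤-trans (kids-bound {u} (mk≤ m)) (≤-trans (≤-reflexive (sym (*-identityʳ K))) (m≤m+n _ k))
      point u m (no nk) = ≤-trans (<⇒≤ (≰⇒> nk)) (m≤n+m k (K * 0))

    result : ∀ {c} → length vs ≤ c * length winners → Trees (suc j) vs F c M₀ U M
    result {c} le = trees (map pack winners) rooted′ tree′ avoids′ disjoint′ (≤-trans le (≤-reflexive (cong (c *_) (sym (length-map _ winners))))) (T₃.history ∘ G₂.history ∘ G₁.history)
      where
      pack : Unit → Fin n × List (Fin n)
      pack u = proj₁ u , vertices u
      rooted′ : ∀ {o} → o ∈ map pack winners → proj₁ o ∈ vs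
      rooted′ = ∈-map-elim pack {P = λ o → proj₁ o ∈ vs} (λ mu → PermP.∈-resp-↭ G₁.roots (∈-map⁺ proj₁ (proj₁ (winner⊆ mu))))
      tree′ : ∀ {o} → o ∈ map pack winners → Tree M k (suc j) (proj₁ o) (proj₂ o)
      tree′ = ∈-map-elim pack {P = λ o → Tree M k (suc j) (proj₁ o) (proj₂ o)} is-tree
      fresh : ∀ {u x} → u ∈ winners → x ∈ tree u ⊎ ∃[ o ] (o ∈ kids u × x ∈ proj₂ o) → x ≡ proj₁ u ⊎ x ∉ F
      fresh mu (inj₁ (here e)) = inj₁ e
      fresh mu (inj₁ (there mN)) = inj₂ (Unique-++-disj (news us₁) G₁.unique (∈-concatMap proj₂ (proj₁ (winner⊆ mu)) mN))
      fresh {u} mu (inj₂ (o , mo , xo)) = inj₂ (λ k → new-vertex (proj₁ (kids⊆ {u} mo)) xo (∈-++⁺ʳ (news us₁) k))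
      avoids′ : ∀ {o x} → o ∈ map pack winners → x ∈ proj₂ o → x ≡ proj₁ o ⊎ x ∉ F
      avoids′ {x = x} = ∈-map-elim pack {P = λ o → x ∈ proj₂ o → x ≡ proj₁ o ⊎ x ∉ F} (λ {u} mu mx → fresh mu (in-vertices u mx))
      disjoint′ : Unique (concatMap proj₂ (map pack winners))
      disjoint′ = subst Unique (sym (concatMap-pair vertices winners)) (concatMap-unique vertices winners (UniqueP.filter⁺ rich? ugoods) (λ m → vertices-unique (proj₁ (winner⊆ m))) (λ m m′ a c → vertices-same (proj₁ (winner⊆ m)) (proj₁ (winner⊆ m′)) a c))

  take-⊆ : ∀ {A : Set} m (xs : List A) {x} → x ∈ take m xs → x ∈ xs
  take-⊆ (suc m) (x ∷ xs) (here e) = here e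
  take-⊆ (suc m) (x ∷ xs) (there k) = there (take-⊆ m xs k)

  -- The g good units carry o ≥ 2 k g subtrees. Those with fewer than k account for at most k g, so
  -- the w winners carry at least k g between them, each at most 2 k (c′ + 1).
  tree-ratio : ∀ α t c′ v g w o → v ≤ 2 * α * suc t * g → g * (2 * k * suc c′) ≤ suc c′ * o → o ≤ 2 * k * suc c′ * w + k * g → v ≤ 2 * α * suc t * (2 * suc c′) * w
  tree-ratio α t c′ v g w o h₁ h₂ h₃ = ≤-trans h₁ (≤-trans (*-monoʳ-≤ (2 * α * suc t) g≤) (≤-reflexive (sym (*-assoc (2 * α * suc t) (2 * suc c′) w))))
    where
    open ≤R
    twice : 2 * k * g ≤ o
    twice = *-cancelˡ-≤ (suc c′) (≤-trans (≤-reflexive (lem g k (suc c′))) h₂)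
      where
      lem : ∀ g k c → c * (2 * k * g) ≡ g * (2 * k * c)
      lem = solve-∀
    g≤ : g ≤ 2 * suc c′ * w
    g≤ = *-cancelˡ-≤ k {{Nat.>-nonZero k≥1}} (+-cancelʳ-≤ (k * g) _ _ (≤-trans (≤-reflexive (lem k g)) (≤-trans twice (≤-trans h₃ (≤-reflexive (cong (_+ k * g) (lem′ k (suc c′) w)))))))
      where
      lem : ∀ k g → k * g + k * g ≡ 2 * k * g
      lem = solve-∀
      lem′ : ∀ k c w → 2 * k * c * w ≡ k * (2 * c * w)
      lem′ = solve-∀

  -- Each level halves the guaranteed free degree twice, once by averaging over the grown units and
  -- once over the attached leaves. Hence α becomes 4α, and depth j needs α 4^j ≤ αm.
  build : ∀ j α vs F {U M} → α₀ ≤ α → α * 4 ^ j ≤ αm → Unique F → Unique vs → (∀ {v} → v ∈ vs → v ∈ F) → length F + length vs * cost j α ≤ Z →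
    WF b U M → length M ≤ length F → (∀ {v} → v ∈ vs → Live α U v) → Force (Trees j vs F (count j α) M) U M
  build zero α vs F {U} {M} α≥ α≤ uF uv sub room w M≤F lv = now (trees (map (λ v → v , v ∷ []) vs)
      (λ m → let (v , mv , eq) = ∈-map⁻ (λ v → v , v ∷ []) m in subst (λ o → proj₁ o ∈ vs) (sym eq) mv)
      (λ m → let (v , mv , eq) = ∈-map⁻ (λ v → v , v ∷ []) m in subst (λ o → Tree M k 0 (proj₁ o) (proj₂ o)) (sym eq) leaf)
      (λ {o} {x} m mx → let (v , mv , eq) = ∈-map⁻ (λ v → v , v ∷ []) m in inj₁ (only (subst (λ o → x ∈ proj₂ o) eq mx) (cong proj₁ eq)))
      (subst Unique (sym (flat vs)) uv) (≤-reflexive (sym (trans (+-identityʳ _) (length-map _ vs)))) id)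
    where
    only : ∀ {x v y : Fin n} → x ∈ v ∷ [] → y ≡ v → x ≡ y
    only (here refl) refl = refl
    flat : ∀ vs → concatMap proj₂ (map (λ v → v , v ∷ []) vs) ≡ vs
    flat [] = refl
    flat (v ∷ vs) = cong (v ∷_) (flat vs)
  build (suc j) α vs F {U} {M} α≥ α≤ uF uv sub room w M≤F lv =
      force-bind (grow-run (length vs * Tn) {T = Tn} {S₀ = freeSum vs U} {M₀ = M} {α = 2 * α} (map (λ v → v , []) vs) uv sub room₁ 2α≤ (m≤m+n _ _) (growth-start w uF M≤F)) phase₂
    where
    c′ = 8 * (2 * α) * (2 * α) * count j (2 * (2 * α))
    K = marksFor j α
    Tn = growFor j α
    4^≥1 : 1 ≤ 4 ^ j
    4^≥1 = m^n>0 4 j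
    4α≤ : 2 * (2 * α) ≤ αm
    4α≤ = ≤-trans (≤-trans (≤-reflexive (sym (*-identityʳ _))) (*-monoʳ-≤ (2 * (2 * α)) 4^≥1)) (≤-trans (≤-reflexive (lem α (4 ^ j))) α≤)
      where
      lem : ∀ a p → 2 * (2 * a) * p ≡ a * (4 * p)
      lem = solve-∀
    2α≤ : 2 * α ≤ αm
    2α≤ = ≤-trans (m≤m+n (2 * α) (2 * α + 0)) 4α≤
    n≤αγ : n ≤ α * γ
    n≤αγ = ≤-trans γ-large (*-monoˡ-≤ γ α≥)
    n≤2αγ : n ≤ 2 * α * γ
    n≤2αγ = ≤-trans n≤αγ (*-monoˡ-≤ γ (m≤m+n α (α + 0)))
    X = cost j (2 * (2 * α))
    room₁ : length F + length vs * Tn ≤ Z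
    room₁ = ≤-trans (+-monoʳ-≤ (length F) (*-monoʳ-≤ (length vs) (m≤m+n Tn _))) room
    phase₂ : ∀ {U₁ M₁} → ∃[ us₁ ] (Growth vs F Tn (freeSum vs U) M U₁ M₁ us₁ × Stuck (2 * α) Tn U₁ us₁) → Force (Trees (suc j) vs F (count (suc j) α) M) U₁ M₁
    phase₂ {U₁} {M₁} (us₁ , g₁ , sk₁) =
        force-bind (grow-run (length ms * 1) {T = 1} {S₀ = freeSum ms U₁} {M₀ = M₁} {α = 2 * (2 * α)} (map (λ v → v , []) ms) ums ms⊆F₁ room₂ 4α≤ (m≤m+n _ _) (growth-start (Growth.well g₁) (Growth.unique g₁) M₁≤)) phase₃
      where
      live₀ = live-sum {α} {U} vs lv
      goods? = good? g₁ α live₀ n≤αγ K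
      goods = filter goods? us₁
      marks : Unit → List (Fin n)
      marks u = take K (filter (live? (2 * α) U₁) (tree u))
      ms = concatMap marks goods
      goods⊆ : ∀ {u} → u ∈ goods → u ∈ us₁
      goods⊆ m = proj₁ (∈-filter⁻ goods? {xs = us₁} m)
      marks⊆ : ∀ {u x} → x ∈ marks u → x ∈ tree u
      marks⊆ {u} m = proj₁ (∈-filter⁻ (live? (2 * α) U₁) {xs = tree u} (take-⊆ K _ m))
      tu = growth-trees-unique g₁ uv sub
      uus : Unique us₁
      uus = UniqueP.map⁻ (Unique-↭ (↭-sym (Growth.roots g₁)) uv)
      ums : Unique ms
      ums = concatMap-unique marks goods (UniqueP.filter⁺ goods? uus) (λ m → UniqueP.take⁺ K (UniqueP.filter⁺ (live? (2 * α) U₁) (concatMap-each tree us₁ tu (goods⊆ m))))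
        (λ {u} {u′} m m′ a c → concatMap-sep tree us₁ tu (goods⊆ m) (goods⊆ m′) (marks⊆ {u} a) (marks⊆ {u′} c))
      ms⊆F₁ : ∀ {x} → x ∈ ms → x ∈ news us₁ ++ F
      ms⊆F₁ m with concatMap-∈ marks {us = goods} m
      ... | u , mu , mx = old (goods⊆ mu) (marks⊆ {u} mx)
        where
        old : ∀ {u x} → u ∈ us₁ → x ∈ tree u → x ∈ news us₁ ++ F
        old mu (here refl) = ∈-++⁺ʳ (news us₁) (sub (PermP.∈-resp-↭ (Growth.roots g₁) (∈-map⁺ proj₁ mu)))
        old mu (there m) = ∈-++⁺ˡ (∈-concatMap proj₂ mu m)
      ms-live : ∀ {x} → x ∈ ms → Live (2 * α) U₁ x
      ms-live m with concatMap-∈ marks {us = goods} m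
      ... | u , mu , mx = proj₂ (∈-filter⁻ (live? (2 * α) U₁) {xs = tree u} (take-⊆ K _ mx))
      marks-length : ∀ {u} → u ∈ goods → length (marks u) ≡ K
      marks-length {u} m = trans (length-take K (filter (live? (2 * α) U₁) (tree u))) (m≤n⇒m⊓n≡m (≤-trans (proj₂ (∈-filter⁻ goods? {xs = us₁} m)) (≤-reflexive (sym (length-filter-cnt (live? (2 * α) U₁) (tree u))))))
        where open import Data.List.Properties using (length-take)
      ms-length : length ms ≡ length goods * K
      ms-length = concatMap-length marks K goods marks-length
      us≡vs : length us₁ ≡ length vs
      us≡vs = trans (sym (length-map proj₁ us₁)) (PermP.↭-length (Growth.roots g₁))
      news≤ : length (news us₁) ≤ length vs * Tn
      news≤ = ≤-trans (news-cap Tn us₁ (Growth.cap g₁)) (≤-reflexive (cong (_* Tn) us≡vs))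
      ms≤ : length ms ≤ length vs * K
      ms≤ = ≤-trans (≤-reflexive ms-length) (*-monoˡ-≤ K (≤-trans (≤-trans (≤-reflexive (length-filter-cnt goods? us₁)) (cnt≤length goods? us₁)) (≤-reflexive us≡vs)))
      F₁≤ : length (news us₁ ++ F) ≤ length vs * Tn + length F
      F₁≤ = ≤-trans (≤-reflexive (length-++ (news us₁))) (+-monoˡ-≤ (length F) news≤)
      M₁≤ : length M₁ ≤ length (news us₁ ++ F)
      M₁≤ = ≤-trans (Growth.size g₁) (≤-reflexive (trans (+-comm (length F) _) (sym (length-++ (news us₁)))))
      total-room : length vs * Tn + length F + (length vs * K + length vs * K * X) ≤ Z
      total-room = ≤-trans (≤-reflexive (lem (length vs) Tn (length F) K X)) room
        where
        lem : ∀ v t f k x → v * t + f + (v * k + v * k * x) ≡ f + v * (t + (k + k * x))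
        lem = solve-∀
      room₂ : length (news us₁ ++ F) + length ms * 1 ≤ Z
      room₂ = ≤-trans (+-mono-≤ F₁≤ (≤-trans (≤-reflexive (*-identityʳ _)) (≤-trans ms≤ (m≤m+n _ (length vs * K * X))))) total-room
      goods-count : length vs ≤ 2 * α * suc Tn * length goods
      goods-count = ≤-trans (good-units g₁ α live₀ n≤αγ K refl sk₁) (≤-reflexive (cong (2 * α * suc Tn *_) (sym (length-filter-cnt goods? us₁))))
      phase₃ : ∀ {U₂ M₂} → ∃[ us₂ ] (Growth ms (news us₁ ++ F) 1 (freeSum ms U₁) M₁ U₂ M₂ us₂ × Stuck (2 * (2 * α)) 1 U₂ us₂) → Force (Trees (suc j) vs F (count (suc j) α) M) U₂ M₂
      phase₃ {U₂} {M₂} (us₂ , g₂ , sk₂) = force-bind (build j (2 * (2 * α)) lf F₂ (≤-trans α≥ (m≤m+n α _ ⟨≤⟩ m≤m+n (2 * α) _)) (≤-trans (≤-reflexive (lem α (4 ^ j))) α≤)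
            (Growth.unique g₂) ulf lf⊆F₂ room₃ (Growth.well g₂) M₂≤ (λ m → proj₂ (∈-filter⁻ leaf? {xs = news us₂} m))) finish
        where
        _⟨≤⟩_ : ∀ {x y z : ℕ} → x ≤ y → y ≤ z → x ≤ z
        _⟨≤⟩_ = ≤-trans
        lem : ∀ a p → 2 * (2 * a) * p ≡ a * (4 * p)
        lem = solve-∀
        leaf? = live? (2 * (2 * α)) U₂
        lf = filter leaf? (news us₂)
        F₂ = news us₂ ++ news us₁ ++ F
        lf⊆ : ∀ {x} → x ∈ lf → x ∈ news us₂
        lf⊆ m = proj₁ (∈-filter⁻ leaf? {xs = news us₂} m)
        lf⊆F₂ : ∀ {x} → x ∈ lf → x ∈ F₂
        lf⊆F₂ m = ∈-++⁺ˡ (lf⊆ m)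
        ulf : Unique lf
        ulf = UniqueP.filter⁺ leaf? (Unique-++ˡ (news us₂) (Growth.unique g₂))
        news₂≤ : length (news us₂) ≤ length vs * K
        news₂≤ = ≤-trans (news-cap 1 us₂ (Growth.cap g₂)) (≤-trans (≤-reflexive (trans (*-identityʳ _) (trans (sym (length-map proj₁ us₂)) (PermP.↭-length (Growth.roots g₂))))) ms≤)
        lf≤ : length lf ≤ length vs * K
        lf≤ = ≤-trans (≤-reflexive (length-filter-cnt leaf? (news us₂))) (≤-trans (cnt≤length leaf? (news us₂)) news₂≤)
        room₃ : length F₂ + length lf * X ≤ Z
        room₃ = ≤-trans (+-mono-≤ (≤-trans (≤-reflexive (length-++ (news us₂))) (+-mono-≤ news₂≤ F₁≤)) (*-monoˡ-≤ X lf≤)) (≤-trans (≤-reflexive (lem₂ (length vs * K) (length vs * Tn + length F) (length vs * K * X))) total-room)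
          where
          lem₂ : ∀ x y z → x + y + z ≡ y + (x + z)
          lem₂ = solve-∀
        M₂≤ : length M₂ ≤ length F₂
        M₂≤ = ≤-trans (Growth.size g₂) (≤-reflexive (trans (+-comm (length (news us₁ ++ F)) _) (sym (length-++ (news us₂)))))
        leaves : length ms ≤ 8 * (2 * α) * (2 * α) * length lf
        leaves = ≤-trans (new-leaves g₂ (2 * α) (live-sum {2 * α} {U₁} ms ms-live) n≤2αγ refl sk₂) (≤-reflexive (cong (8 * (2 * α) * (2 * α) *_) (sym (length-filter-cnt leaf? (news us₂)))))
        done₃ : ∀ {U M₃} → Trees j lf F₂ (count j (2 * (2 * α))) M₂ U M₃ → Phases vs F j M U M₃
        done₃ = phases g₁ uv sub goods goods⊆ (UniqueP.filter⁺ goods? uus) marks (λ {u} → marks⊆ {u}) refl g₂ ums lf lf⊆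
        finish : ∀ {U M₃} → Trees j lf F₂ (count j (2 * (2 * α))) M₂ U M₃ → Force (Trees (suc j) vs F (count (suc j) α) M) U M₃
        finish t₃ = now (Assemble.result (done₃ t₃) (tree-ratio α Tn c′ (length vs) (length goods) (length (Assemble.winners (done₃ t₃))) (length (Trees.out t₃)) goods-count
            (≤-trans (≤-reflexive (sym ms-length)) (≤-trans leaves (≤-trans (*-monoʳ-≤ (8 * (2 * α) * (2 * α)) (Trees.enough t₃)) (≤-trans (≤-reflexive (sym (*-assoc (8 * (2 * α) * (2 * α)) _ _))) (*-monoˡ-≤ (length (Trees.out t₃)) (n≤1+n c′))))))
            (Assemble.winners-count (done₃ t₃) (λ m → ≤-reflexive (marks-length m)))))

-- Forests as minors of trees of blobs

WalkIn-append : ∀ {n} {G : Fin n → Fin n → Set} {P : Fin n → Set} {x y z} → WalkIn G P x y → WalkIn G P y z → WalkIn G P x z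
WalkIn-append here w = w
WalkIn-append (step g p v) w = step g p (WalkIn-append v w)

grown-connected : ∀ {n} {M : List (Edge n)} {r N} → Grown M r N → ∀ {x y} → x ∈ r ∷ N → y ∈ r ∷ N → WalkIn (graphOf M) (_∈ r ∷ N) x y
grown-connected {n} {M} {r} t mx my = WalkIn-append (proj₁ (both t mx)) (proj₂ (both t my))
  where
  both : ∀ {N x} → Grown M r N → x ∈ r ∷ N → WalkIn (graphOf M) (_∈ r ∷ N) x r × WalkIn (graphOf M) (_∈ r ∷ N) r x
  both _ (here refl) = here , here
  both (attach {z} {w} {N} mz g t) (there m) = new m
    where
    wider : ∀ {a} → a ∈ r ∷ N → a ∈ r ∷ w ∷ N
    wider (here e) = here e
    wider (there k) = there (there k)
    new : ∀ {x} → x ∈ w ∷ N → WalkIn (graphOf M) (_∈ r ∷ w ∷ N) x r × WalkIn (graphOf M) (_∈ r ∷ w ∷ N) r x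
    new (there k) = let (a , c) = both t (there k) in WalkIn-map id wider a , WalkIn-map id wider c
    new (here refl) = let (a , c) = both t mz in step (graphOf-sym {M = M} g) (wider mz) (WalkIn-map id wider a) , WalkIn-append (WalkIn-map id wider c) (step g (there (here refl)) here)

concatMap-index : ∀ {A B : Set} (f : A → List B) us → Unique (concatMap f us) → ∀ i j {x} → x ∈ f (lookup us i) → x ∈ f (lookup us j) → i ≡ j
concatMap-index f (u ∷ us) uq Fin.zero Fin.zero _ _ = refl
concatMap-index f (u ∷ us) uq Fin.zero (Fin.suc j) a c = ⊥-elim (Unique-++-disj (f u) uq a (∈-concatMap f {us = us} (∈-lookup j) c))
concatMap-index f (u ∷ us) uq (Fin.suc i) Fin.zero a c = ⊥-elim (Unique-++-disj (f u) uq c (∈-concatMap f {us = us} (∈-lookup i) a))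
concatMap-index f (u ∷ us) uq (Fin.suc i) (Fin.suc j) a c = cong Fin.suc (concatMap-index f us (Unique-++ʳ (f u) uq) i j a c)

module _ {n : ℕ} {M : List (Edge n)} {k : ℕ} where

  private
    vertexSet : Fin n × Fin n × List (Fin n) → List (Fin n)
    vertexSet kid = proj₂ (proj₂ kid)

    unique-part : ∀ (kids : List (Fin n × Fin n × List (Fin n))) → Unique (concatMap vertexSet kids) → ∀ i → Unique (vertexSet (lookup kids i))
    unique-part (kid ∷ kids) u Fin.zero = Unique-++ˡ (vertexSet kid) u
    unique-part (kid ∷ kids) u (Fin.suc i) = unique-part kids (Unique-++ʳ (vertexSet kid) u) i

  -- the blob reached from the root along a word of child indices
  blob : ∀ {j r V} → Tree M k j r V → List (Fin k) → List (Fin n)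
  blob {r = r} leaf [] = r ∷ []
  blob leaf (_ ∷ _) = []
  blob (node {r = r} {N} kids _ _ _) [] = r ∷ N
  blob (node kids _ le h) (i ∷ is) = blob (proj₂ (proj₂ (h (∈-lookup {xs = kids} (inject≤ i le))))) is

  blob-root : ∀ {j r V} (t : Tree M k j r V) → r ∈ blob t []
  blob-root leaf = here refl
  blob-root (node _ _ _ _) = here refl

  blob-⊆ : ∀ {j r V} (t : Tree M k j r V) is {x} → x ∈ blob t is → x ∈ V
  blob-⊆ leaf [] m = m
  blob-⊆ (node kids _ _ _) [] m = ∈-++⁺ˡ m
  blob-⊆ (node {r = r} {N} kids _ le h) (i ∷ is) m = ∈-++⁺ʳ (r ∷ N) (∈-concatMap vertexSet {us = kids} (∈-lookup (inject≤ i le)) (blob-⊆ (proj₂ (proj₂ (h (∈-lookup {xs = kids} (inject≤ i le))))) is m))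

  blob-nonempty : ∀ {j r V} (t : Tree M k j r V) is → length is ≤ j → ∃[ x ] x ∈ blob t is
  blob-nonempty t [] _ = _ , blob-root t
  blob-nonempty (node kids _ le h) (i ∷ is) (s≤s l) = blob-nonempty (proj₂ (proj₂ (h (∈-lookup {xs = kids} (inject≤ i le))))) is l

  blob-connected : ∀ {j r V} (t : Tree M k j r V) is {x y} → x ∈ blob t is → y ∈ blob t is → WalkIn (graphOf M) (_∈ blob t is) x y
  blob-connected leaf [] (here refl) (here refl) = here
  blob-connected (node kids g _ _) [] mx my = grown-connected g mx my
  blob-connected (node kids _ le h) (i ∷ is) mx my = blob-connected (proj₂ (proj₂ (h (∈-lookup {xs = kids} (inject≤ i le))))) is mx my

  blob-disjoint : ∀ {j r V} (t : Tree M k j r V) → Unique V → ∀ is js {x} → x ∈ blob t is → x ∈ blob t js → is ≡ js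
  blob-disjoint t u [] [] _ _ = refl
  blob-disjoint (node {r = r} {N} kids g le h) u [] (i ∷ js) a c = ⊥-elim (Unique-++-disj (r ∷ N) u a
      (∈-concatMap vertexSet {us = kids} (∈-lookup (inject≤ i le)) (blob-⊆ (proj₂ (proj₂ (h (∈-lookup {xs = kids} (inject≤ i le))))) js c)))
  blob-disjoint (node {r = r} {N} kids g le h) u (i ∷ is) [] a c = ⊥-elim (Unique-++-disj (r ∷ N) u c
      (∈-concatMap vertexSet {us = kids} (∈-lookup (inject≤ i le)) (blob-⊆ (proj₂ (proj₂ (h (∈-lookup {xs = kids} (inject≤ i le))))) is a)))
  blob-disjoint (node {r = r} {N} kids g le h) u (i ∷ is) (i′ ∷ js) a c with FinP.inject≤-injective le le i i′ (concatMap-index vertexSet kids (Unique-++ʳ (r ∷ N) u) _ _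
      (blob-⊆ (proj₂ (proj₂ (h (∈-lookup {xs = kids} (inject≤ i le))))) is a) (blob-⊆ (proj₂ (proj₂ (h (∈-lookup {xs = kids} (inject≤ i′ le))))) js c))
  ... | refl = cong (i ∷_) (blob-disjoint (proj₂ (proj₂ (h (∈-lookup {xs = kids} (inject≤ i le))))) (unique-part kids (Unique-++ʳ (r ∷ N) u) (inject≤ i le)) is js a c)

  blob-edge : ∀ {j r V} (t : Tree M k j r V) is i → length is < j → ∃₂ λ x y → x ∈ blob t is × y ∈ blob t (is ++ [ i ]) × graphOf M x y
  blob-edge (node kids _ le h) [] i _ = let (ms , g , t) = h (∈-lookup {xs = kids} (inject≤ i le)) in _ , _ , ms , blob-root t , g
  blob-edge (node kids _ le h) (i′ ∷ is) i (s≤s l) = blob-edge (proj₂ (proj₂ (h (∈-lookup {xs = kids} (inject≤ i′ le))))) is i l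

-- Words for the vertices of a forest such that adjacent vertices get words differing by one last letter.
module ForestWords {h : ℕ} (H : Graph h) (forest : IsForest H) where

  private
    Link : List (Fin h) → Set
    Link = Linked (λ a c → T (adj H a c))

    close : ∀ {x y} a rest → Link (a ∷ rest) → y ∈ rest → T (adj H y x) → ∃₂ λ ys zs → Link (a ∷ ys ++ [ x ]) × 1 ≤ length ys × rest ≡ ys ++ zs
    close a (y ∷ rest) (l ∷ _) (here refl) e = y ∷ [] , rest , l ∷ e ∷ [-] , s≤s z≤n , refl
    close a (y ∷ rest) (l ∷ ls) (there m) e with close y rest ls m e
    ... | ys , zs , ls′ , _ , refl = y ∷ ys , zs , l ∷ ls′ , s≤s z≤n , refl

    TwoIn : List (Fin h) → Fin h → Set
    TwoIn L v = Any (λ a → Any (λ c → a ≢ c × T (adj H v a) × T (adj H v c)) L) L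

    twoIn? : ∀ L → Decidable (TwoIn L)
    twoIn? L v = any? (λ a → any? (λ c → ¬? (a FinP.≟ c) ×-dec T? (adj H v a) ×-dec T? (adj H v c)) L) L

    other-than : ∀ {L v} p → TwoIn L v → ∃[ y ] (y ∈ L × y ≢ p × T (adj H v y))
    other-than p two with find two
    ... | a , ma , two′ with find two′
    ... | c , mc , ne , va , vc with a FinP.≟ p
    ... | no a≢p = a , ma , a≢p , va
    ... | yes refl = c , mc , (λ e → ne (sym e)) , vc

    -- without a vertex of degree at most 1, a path can be prolonged for ever
    prolong : ∀ L → (∀ {v} → v ∈ L → TwoIn L v) → ∀ m x rest → x ∈ L → Unique (x ∷ rest) → Link (x ∷ rest) → h < length (x ∷ rest) + m → ⊥
    prolong L two zero x rest mx u l lt = <⇒≱ lt (≤-trans (≤-reflexive (+-identityʳ _)) (unique-fin-length u))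
    prolong L two (suc m) x [] mx u l lt with other-than x (two mx)
    ... | y , my , ne , e = prolong L two m y (x ∷ []) my ((ne ∷ []) ∷ u) (adj-sym H e ∷ l) lt
    prolong L two (suc m) x (p ∷ rest) mx u (l ∷ ls) lt with other-than p (two mx)
    ... | y , my , ne , e with any? (y FinP.≟_) rest
    ... | no y∉ = prolong L two m y (x ∷ p ∷ rest) my (Unique-∷ (λ { (here q) → adj-≢ H e (sym q) ; (there (here q)) → ne q ; (there (there k)) → y∉ k }) u) (adj-sym H e ∷ l ∷ ls)
            (≤-trans lt (≤-reflexive (+-suc (length (x ∷ p ∷ rest)) m)))
    -- The further neighbour lies on the path already, so the segment up to it closes to a cycle.
    ... | yes y∈ with close p rest ls y∈ (adj-sym H e)
    ... | ys , zs , ls′ , l1 , refl = forest (x , p ∷ ys , s≤s l1 , Unique-++ˡ (x ∷ p ∷ ys) u , l ∷ ls′)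

    leaf-vertex : ∀ v₀ L → ∃[ v ] (v ∈ v₀ ∷ L × ¬ TwoIn (v₀ ∷ L) v)
    leaf-vertex v₀ L with any? (λ v → ¬? (twoIn? (v₀ ∷ L) v)) (v₀ ∷ L)
    ... | yes found = find found
    ... | no none = ⊥-elim (prolong (v₀ ∷ L) (λ {v} m → decidable-stable (twoIn? (v₀ ∷ L) v) (λ n → none (lose m n))) h v₀ [] (here refl) ([] ∷ []) [-] ≤-refl)

  Words : List (Fin h) → Set
  Words L = ∃ λ (φ : Fin h → List (Fin h)) → (∀ {v} → v ∈ L → (∃[ xs ] φ v ≡ xs ++ [ v ]) × length (φ v) ≤ length L) ×
    (∀ {v w} → v ∈ L → w ∈ L → T (adj H v w) → φ w ≡ φ v ++ [ w ] ⊎ φ v ≡ φ w ++ [ v ])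

  -- Remove a vertex of degree at most 1 and give it the word of its neighbour, if any, with itself
  -- appended. A word ends in its own vertex, so words are distinct, and different components need
  -- no separate trees.
  words : ∀ m L → length L ≤ m → Unique L → Words L
  words m [] _ _ = (λ _ → []) , (λ ()) , (λ ())
  words (suc m) L@(v₀ ∷ L₀) (s≤s le) uL with leaf-vertex v₀ L₀
  ... | v , mv , ¬two with ∈-split mv
  ... | L′ , perm with words m L′ (≤-trans (≤-reflexive (suc-injective (sym (PermP.↭-length perm)))) le) (Unique-tail (Unique-↭ perm uL))
  ... | φ , shape , join = extend (any? (λ p → T? (adj H v p)) L′)
    where
    v∉ : v ∉ L′
    v∉ = Unique-head (Unique-↭ perm uL)
    back : ∀ {x} → x ∈ v ∷ L′ → x ∈ L
    back = PermP.∈-resp-↭ (↭-sym perm)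
    lenL : length L ≡ suc (length L′)
    lenL = PermP.↭-length perm
    with-word : ∀ ws → (∃[ xs ] ws ≡ xs ++ [ v ]) → length ws ≤ suc (length L′) → (∀ {w} → w ∈ L′ → T (adj H v w) → ws ≡ φ w ++ [ v ]) → Words L
    with-word ws sh lw jn = φ′ , shape′ , join′
      where
      φ′ : Fin h → List (Fin h)
      φ′ u = if does (u FinP.≟ v) then ws else φ u
      at-v : φ′ v ≡ ws
      at-v = if-yes (v FinP.≟ v) refl
      at-L′ : ∀ {u} → u ∈ L′ → φ′ u ≡ φ u
      at-L′ {u} m = if-no (u FinP.≟ v) (λ { refl → v∉ m })
      shape′ : ∀ {u} → u ∈ L → (∃[ xs ] φ′ u ≡ xs ++ [ u ]) × length (φ′ u) ≤ length L
      shape′ m with PermP.∈-resp-↭ perm m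
      ... | here refl = (proj₁ sh , trans at-v (proj₂ sh)) , ≤-trans (≤-reflexive (cong length at-v)) (≤-trans lw (≤-reflexive (sym lenL)))
      ... | there k = let ((xs , e) , l) = shape k in (xs , trans (at-L′ k) e) , ≤-trans (≤-reflexive (cong length (at-L′ k))) (≤-trans l (≤-trans (n≤1+n _) (≤-reflexive (sym lenL))))
      join′ : ∀ {u w} → u ∈ L → w ∈ L → T (adj H u w) → φ′ w ≡ φ′ u ++ [ w ] ⊎ φ′ u ≡ φ′ w ++ [ u ]
      join′ mu mw e with PermP.∈-resp-↭ perm mu | PermP.∈-resp-↭ perm mw
      ... | here refl | here refl = ⊥-elim (adj-≢ H e refl)
      ... | here refl | there k = inj₂ (trans at-v (trans (jn k e) (cong (_++ [ v ]) (sym (at-L′ k)))))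
      ... | there k | here refl = inj₁ (trans at-v (trans (jn k (adj-sym H e)) (cong (_++ [ v ]) (sym (at-L′ k)))))
      join′ {u} {w} mu mw e | there k | there k′ with join k k′ e
      ... | inj₁ q = inj₁ (trans (at-L′ k′) (trans q (cong (_++ [ w ]) (sym (at-L′ k)))))
      ... | inj₂ q = inj₂ (trans (at-L′ k) (trans q (cong (_++ [ u ]) (sym (at-L′ k′)))))
    extend : Dec (Any (λ p → T (adj H v p)) L′) → Words L
    extend (no none) = with-word [ v ] ([] , refl) (s≤s z≤n) (λ m e → ⊥-elim (none (lose m e)))
    extend (yes found) with find found
    ... | p , mp , vp = with-word (φ p ++ [ v ]) (φ p , refl) (≤-trans (≤-reflexive (trans (length-++ (φ p)) (+-comm _ 1))) (s≤s (proj₂ (shape mp)))) only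
      where
      only : ∀ {w} → w ∈ L′ → T (adj H v w) → φ p ++ [ v ] ≡ φ w ++ [ v ]
      only {w} m e with p FinP.≟ w
      ... | yes refl = refl
      ... | no ne = ⊥-elim (¬two (lose (back (there mp)) (lose (back (there m)) (ne , vp , e))))

  -- Letters are vertices of H and words have length at most h, so arity h and depth h suffice.
  -- Adjacent vertices of H go to a blob and one of its children.
  tree-minor : ∀ {n} {M : List (Edge n)} {r V} → Tree M h h r V → Unique V → HasMinor H (graphOf M)
  tree-minor {n} {M} {r} {V} t uV with words h (allFin h) (≤-reflexive (length-tabulate {n = h} id)) (UniqueP.allFin⁺ h)
  ... | φ , shape , join = (λ v x → does (any? (x FinP.≟_) (B v))) ,
      (λ v w x p q → φ-injective v w (blob-disjoint t uV (φ v) (φ w) (mem v x p) (mem w x q))) ,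
      (λ v → let (x , m) = blob-nonempty t (φ v) (short v) in x , T← (any? (x FinP.≟_) (B v)) m) ,
      (λ v x y p q → WalkIn-map id (λ {z} m → T← (any? (z FinP.≟_) (B v)) m) (blob-connected t (φ v) (mem v x p) (mem v y q))) ,
      (λ v w e → edge v w (join (∈-allFin v) (∈-allFin w) e))
    where
    B : Fin h → List (Fin n)
    B v = blob t (φ v)
    mem : ∀ v x → T (does (any? (x FinP.≟_) (B v))) → x ∈ B v
    mem v x = T→ (any? (x FinP.≟_) (B v))
    short : ∀ v → length (φ v) ≤ h
    short v = ≤-trans (proj₂ (shape (∈-allFin v))) (≤-reflexive (length-tabulate {n = h} id))
    last-inj : ∀ (xs ys : List (Fin h)) {v w} → xs ++ [ v ] ≡ ys ++ [ w ] → v ≡ w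
    last-inj xs ys eq = ∷ʳ-injectiveʳ xs ys eq
      where open import Data.List.Properties using (∷ʳ-injectiveʳ)
    φ-injective : ∀ v w → φ v ≡ φ w → v ≡ w
    φ-injective v w eq = let ((xs , p) , _) = shape (∈-allFin v) ; ((ys , q) , _) = shape (∈-allFin w) in last-inj xs ys (trans (sym p) (trans eq q))
    longer : ∀ v w → φ w ≡ φ v ++ [ w ] → length (φ v) < h
    longer v w eq = ≤-trans (≤-reflexive (trans (+-comm 1 _) (trans (sym (length-++ (φ v))) (cong length (sym eq))))) (short w)
    edge : ∀ v w → φ w ≡ φ v ++ [ w ] ⊎ φ v ≡ φ w ++ [ v ] → ∃[ x ] ∃[ y ] (T (does (any? (x FinP.≟_) (B v))) × T (does (any? (y FinP.≟_) (B w))) × graphOf M x y)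
    edge v w (inj₁ eq) = let (x , y , mx , my , g) = blob-edge t (φ v) w (longer v w eq) in
      x , y , T← (any? (x FinP.≟_) (B v)) mx , T← (any? (y FinP.≟_) (B w)) (subst (λ is → y ∈ blob t is) (sym eq) my) , g
    edge v w (inj₂ eq) = let (y , x , my , mx , g) = blob-edge t (φ w) v (longer w v eq) in
      x , y , T← (any? (x FinP.≟_) (B v)) (subst (λ is → x ∈ blob t is) (sym eq) mx) , T← (any? (y FinP.≟_) (B w)) my , graphOf-sym {M = M} g

-- Constants of the clever Maker

board-deg : ∀ {n} (v : Fin n) → n ≤ deg v (board n) + 1
board-deg {n} v = begin
    n ≡⟨ sym (length-tabulate {n = n} id) ⟩
    length (allFin n) ≡⟨ sym (cnt-complement (FinP._≟ v) (allFin n)) ⟩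
    cnt (FinP._≟ v) (allFin n) + cnt (¬? ∘ (FinP._≟ v)) (allFin n) ≤⟨ +-mono-≤ (cnt≤1 (FinP._≟ v) (allFin n) (UniqueP.allFin⁺ n) (λ { _ _ _ _ refl refl → refl })) others ⟩
    1 + deg v (board n) ≡⟨ +-comm 1 _ ⟩
    deg v (board n) + 1 ∎
  where
  open ≤R
  rest = filter (¬? ∘ (FinP._≟ v)) (allFin n)
  ≢v : ∀ {w} → w ∈ rest → w ≢ v
  ≢v m = proj₂ (∈-filter⁻ (¬? ∘ (FinP._≟ v)) {xs = allFin n} m)
  mk-injective : ∀ {w w′} → mk v w ≡ mk v w′ → w ≡ w′
  mk-injective {w} {w′} eq with touches-joins (mk-joins v w′) (subst (Touches w) eq (joins-touchesʳ (mk-joins v w)))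
  ... | inj₂ e = e
  ... | inj₁ refl with touches-joins (mk-joins v v) (subst (Touches w′) (sym eq) (joins-touchesʳ (mk-joins v w′)))
  ... | inj₁ e = sym e
  ... | inj₂ e = sym e
  others : cnt (¬? ∘ (FinP._≟ v)) (allFin n) ≤ deg v (board n)
  others = ≤-trans (≤-reflexive (trans (sym (length-filter-cnt (¬? ∘ (FinP._≟ v)) (allFin n))) (sym (length-map (mk v) rest))))
    (cnt-≥ (touches? v) (board n) (UniqueP.map⁺ mk-injective (UniqueP.filter⁺ (¬? ∘ (FinP._≟ v)) (UniqueP.allFin⁺ n)))
      (λ m → let (w , mw , eq) = ∈-map⁻ (mk v) m in subst (λ e → e ∈ board n × Touches v e) (sym eq) (board-complete (mk-ordered (λ e → ≢v mw (sym e))) , joins-touchesˡ (mk-joins v w))))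

module CleverForest {h : ℕ} (H : Graph h) (forest : IsForest H) (h≥1 : 1 ≤ h) (a : ℕ) (a≥1 : 1 ≤ a) where

  private
    Z S X : ℕ
    -- The room that `build` asks for when started from a single vertex.
    Z = 1 + 1 * Costs.cost h h (4 * a)
    S = Z * Z
    -- This is Q + 1. Poor vertices miss at least n - ρ ≥ n / (2a) free edges, so X of them would
    -- miss (2Z + 2) n in total, more than the n (2Z + 1) available.
    X = 2 * a * (2 * Z + 2)

  module Constants (n b q : ℕ) (n≥2 : 2 ≤ n) (q≤ : 4 * a * q ≤ n) (S≤ : 4 * a * (3 + S) ≤ n) (hyp : a * b + n ≤ a * n) where

    open ≤R

    ρ : ℕ
    ρ = b + suc q + 2 + S

    -- Of the n / a by which b falls short of n, the gain γ and the constants in ρ take about n /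
    -- (4a) each; so ρ stays n / (2a) below n.
    gap : 2 * a * ρ + n ≤ 2 * a * n
    gap = *-cancelˡ-≤ 2 (begin
        2 * (2 * a * ρ + n) ≡⟨ e₁ a b q S n ⟩
        4 * (a * b) + 2 * n + (4 * a * q + 4 * a * (3 + S)) ≤⟨ +-monoʳ-≤ (4 * (a * b) + 2 * n) (+-mono-≤ q≤ S≤) ⟩
        4 * (a * b) + 2 * n + (n + n) ≡⟨ e₂ (a * b) n ⟩
        4 * (a * b + n) ≤⟨ *-monoʳ-≤ 4 hyp ⟩
        4 * (a * n) ≡⟨ e₃ a n ⟩
        2 * (2 * a * n) ∎)
      where
      e₁ : ∀ a b q s n → 2 * (2 * a * (b + suc q + 2 + s) + n) ≡ 4 * (a * b) + 2 * n + (4 * a * q + 4 * a * (3 + s))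
      e₁ = solve-∀
      e₂ : ∀ x n → 4 * x + 2 * n + (n + n) ≡ 4 * (x + n)
      e₂ = solve-∀
      e₃ : ∀ a n → 4 * (a * n) ≡ 2 * (2 * a * n)
      e₃ = solve-∀

    ρ≤n : ρ ≤ n
    ρ≤n = *-cancelˡ-≤ (2 * a) {{Nat.>-nonZero (≤-trans a≥1 (m≤m+n a (1 * a)))}} (≤-trans (m≤m+n _ n) gap)

    b<n : b < n
    b<n = *-cancelˡ-< a b n (≤-trans (≤-trans (≤-reflexive (+-comm 1 (a * b))) (+-monoʳ-≤ (a * b) (≤-trans (n≤1+n 1) n≥2))) hyp)

    few-poor : n * (2 * Z + 1) + X * ρ < X * n
    few-poor = begin-strict
        n * (2 * Z + 1) + X * ρ <⟨ m<m+n _ (≤-trans (n≤1+n 1) n≥2) ⟩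
        n * (2 * Z + 1) + X * ρ + n ≡⟨ e₁ n Z a ρ ⟩
        (2 * Z + 2) * (2 * a * ρ + n) ≤⟨ *-monoʳ-≤ (2 * Z + 2) gap ⟩
        (2 * Z + 2) * (2 * a * n) ≡⟨ e₂ Z a n ⟩
        X * n ∎
      where
      e₁ : ∀ n z a r → n * (2 * z + 1) + 2 * a * (2 * z + 2) * r + n ≡ (2 * z + 2) * (2 * a * r + n)
      e₁ = solve-∀
      e₂ : ∀ z a n → (2 * z + 2) * (2 * a * n) ≡ 2 * a * (2 * z + 2) * n
      e₂ = solve-∀

  win : ∀ n b q Q → suc Q ≡ X → 4 * a * q ≤ n → n < 4 * a * suc q → 4 * a * (3 + S) ≤ n → 4 * a * 4 ^ h * (Z + Q) < n → 2 ≤ n → a * b + n ≤ a * n → MakerWins H b (board n) []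
  win n@(suc _) b q Q X-eq q≤ <q S≤ wide n≥2 hyp =
      force-win finish (build h (4 * a) vs vs ≤-refl ≤-refl ([] ∷ []) ([] ∷ []) id ≤-refl wf-start z≤n λ { (here refl) → live })
    where
    module C = Constants n b q n≥2 q≤ S≤ hyp
    setting : CleverSetting
    setting = record { n = n ; b = b ; γ = suc q ; Z = Z ; Q = Q ; αm = 4 * a * 4 ^ h ; α₀ = 4 * a ; n≥1 = s≤s z≤n ; b<n = C.b<n ; ρ≤n = C.ρ≤n ;
      few-poor = subst (λ X → n * (2 * Z + 1) + X * C.ρ < X * n) (sym X-eq) C.few-poor ; wide = wide ; γ-large = <⇒≤ <q }
    open CleverTrees H setting h h≥1 using (Trees; trees; build; count; force-win)
    vs : List (Fin n)
    vs = Fin.zero ∷ []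
    live : n ≤ 4 * a * deg Fin.zero (board n)
    live = ≤-trans (board-deg Fin.zero) (≤-trans (+-monoʳ-≤ _ deg≥1) (≤-trans (≤-reflexive (sym (cong (deg Fin.zero (board n) +_) (+-identityʳ _))))
        (*-monoˡ-≤ (deg Fin.zero (board n)) (≤-trans (s≤s (s≤s z≤n)) (*-monoʳ-≤ 4 a≥1)))))
      where
      deg≥1 : 1 ≤ deg Fin.zero (board n)
      deg≥1 = +-cancelʳ-≤ 1 _ _ (≤-trans n≥2 (board-deg Fin.zero))
    finish : ∀ {U M} → Trees h vs vs (count h (4 * a)) [] U M → HasMinor H (graphOf M)
    finish {M = M} (trees out _ isTree _ disjoint enough _) = pick out isTree disjoint enough
      where
      pick : ∀ out → (∀ {o} → o ∈ out → Tree M h h (proj₁ o) (proj₂ o)) → Unique (concatMap proj₂ out) → 1 ≤ count h (4 * a) * length out → HasMinor H (graphOf M)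
      pick [] _ _ l = ⊥-elim (<⇒≱ l (≤-reflexive (*-zeroʳ (count h (4 * a)))))
      pick (o ∷ _) t u _ = ForestWords.tree-minor H forest (t (here refl)) (Unique-++ˡ (proj₂ o) u)

  clever-wins : ∀ b → (∀ n → a * b n + n ≤ a * n) → CleverTo1 H b
  clever-wins b hyp = N , λ n le → choose n le (divide′ (4 * a) (≤-trans a≥1 (m≤m+n a (3 * a))) n)
    where
    Q = Nat.pred X
    N = suc (suc (4 * a * (3 + S) + 4 * a * 4 ^ h * (Z + Q)))
    X-eq : suc Q ≡ X
    X-eq = suc-pred X {{Nat.>-nonZero (≤-trans (*-mono-≤ {1} {2 * a} {1} {2 * Z + 2} (≤-trans a≥1 (m≤m+n a (1 * a))) (≤-trans (s≤s z≤n) (m≤n+m 2 (2 * Z)))) ≤-refl)}}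
    choose : ∀ n → N ≤ n → ∃[ q ] (4 * a * q ≤ n × n < 4 * a * suc q) → MakerWins H (b n) (board n) []
    choose n le (q , q≤ , <q) = win n (b n) q Q X-eq q≤ <q
      (≤-trans (m≤m+n _ _) (≤-trans (≤-trans (n≤1+n _) (n≤1+n _)) le))
      (≤-trans (s≤s (m≤n+m _ (4 * a * (3 + S)))) (≤-trans (n≤1+n _) le))
      (≤-trans (s≤s (s≤s z≤n)) le) (hyp n)

-- Thresholds

bothSharp : ∀ {h} (H : Graph h) (f : ℕ → ℚ) → (∀ ε → 0ℚ Q.< ε → ε Q.< 1ℚ → RandomTo1 H (λ n → floorℕ ((1ℚ Q.- ε) Q.* f n))) →
  (∀ ε → 0ℚ Q.< ε → ∀ n → BreakerWins H (floorℕ ((1ℚ Q.+ ε) Q.* f n)) n) → BothSharp H f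
bothSharp H f maker breaker =
  ((λ ε ε>0 ε<1 → random⇒cleverTo1 H _ (maker ε ε>0 ε<1)) , (λ ε ε>0 → breaker-clever H _ 0 (λ n _ → breaker ε ε>0 n))) ,
  (maker , (λ ε ε>0 → breaker-random H _ 0 (λ n _ → breaker ε ε>0 n)))

few-edges : ∀ n r b → n * n < suc b * (2 * r) → length (board n) ≤ r * suc b
few-edges n r b lt = *-cancelˡ-≤ 2 (≤-trans (board-length-upper n) (≤-trans (<⇒≤ lt) (≤-reflexive (e r b))))
  where
  e : ∀ r b → suc b * (2 * r) ≡ 2 * (r * suc b)
  e = solve-∀

with-slack : ∀ d x n → suc d * x ≤ d * n → suc d * x + n ≤ suc d * n
with-slack d x n le = ≤-trans (+-monoˡ-≤ n le) (≤-reflexive (+-comm (d * n) n))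

below : ∀ {n m} → n < suc m * 1 → n ≤ m
below {m = m} lt = ≤-pred (≤-trans lt (≤-reflexive (*-identityʳ (suc m))))

τ-nonempty : ∀ {h} (H : Graph h) → 1 ≤ τ H → 1 ≤ h
τ-nonempty {zero} H ()
τ-nonempty {suc h} H _ = s≤s z≤n

forest-breaker : ∀ {h n b} (H : Graph h) → IsForest H → 3 ≤ τ H → n ≤ b → BreakerWins H b n
forest-breaker H f τ≥3 le with τ≥3⇒claw⊎p₄ H f τ≥3
... | inj₁ claw = breaker-paths H le claw
... | inj₂ p₄ = breaker-stars H le p₄

-- The hypothesis of DenseMaker is wanted for every n, so b is replaced by 0 where it is still large.
random-forest : ∀ {h} (H : Graph h) b → LittleO b (λ n → Z.+ n / 1) → RandomTo1 H b
random-forest H b small ε ε>0 = transfer (small ¼ (QP.positive⁻¹ ¼)) (DenseMaker.random-wins H 2 (s≤s z≤n) b′ hyp ε ε>0)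
  where
  -- For a = 2 the hypothesis of `DenseMaker` reads 4 b ≤ n, and its conclusion gives every H, in
  -- particular a forest.
  ¼ = Z.+ 1 / 4
  b′ : ℕ → ℕ
  b′ n = if does (4 * b n ≤? n) then b n else 0
  b′-small : ∀ n → 4 * b′ n ≤ n
  b′-small n = cases (4 * b n ≤? n)
    where
    cases : (d : Dec (4 * b n ≤ n)) → 4 * (if does d then b n else 0) ≤ n
    cases (yes l) = l
    cases (no _) = z≤n
  hyp : ∀ n → 2 * (b′ n * 2) + n ≤ 2 * n
  hyp n = ≤-trans (≤-reflexive (e (b′ n) n)) (+-monoʳ-≤ n (≤-trans (b′-small n) (≤-reflexive (sym (+-identityʳ n)))))
    where
    e : ∀ b n → 2 * (b * 2) + n ≡ n + 4 * b
    e = solve-∀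
  b′≡b : ∀ n → ℕtoℚ (b n) Q.≤ ¼ Q.* (Z.+ n / 1) → b′ n ≡ b n
  b′≡b n le = if-yes (4 * b n ≤? n) (ℕtoℚ-cancel (QP.≤-trans (QP.≤-reflexive (ℕtoℚ-* 4 (b n)))
      (QP.≤-trans (QP.*-monoˡ-≤-nonNeg (ℕtoℚ 4) le) (QP.≤-reflexive (trans (sym (QP.*-assoc (ℕtoℚ 4) ¼ (ℕtoℚ n))) (QP.*-identityˡ (ℕtoℚ n)))))))
  transfer : (∃[ N ] ∀ n → N ≤ n → ℕtoℚ (b n) Q.≤ ¼ Q.* (Z.+ n / 1)) → (∃[ N ] ∀ n → N ≤ n → ∃[ q ] (RVal H (b′ n) (board n) [] q × (1ℚ Q.- ε) Q.≤ q)) →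
    ∃[ N ] ∀ n → N ≤ n → ∃[ q ] (RVal H (b n) (board n) [] q × (1ℚ Q.- ε) Q.≤ q)
  transfer (N , f) (N′ , g) = N ⊔ N′ , λ n le → let (q , v , l) = g n (≤-trans (m≤n⊔m N N′) le) in
    q , subst (λ b → RVal H b (board n) [] q) (b′≡b n (f n (≤-trans (m≤m⊔n N N′) le))) v , l

open import Data.Integer using (+_)

theorem1 : ∀ {h} (H : Graph h) →
    (τ H ≡ 1 → 2 ≤ eH H → BothSharp H (λ n → + (n * n) / (2 * suc (eH H ∸ 2)))) ×
    (τ H ≡ 2 → BothSharp H (λ n → + (2 * n) / 1)) ×
    (IsForest H → 3 ≤ τ H →
      SharpThreshold CleverTo1 CleverTo0 H (λ n → + n / 1) ×
      Threshold RandomTo1 RandomTo0 H (λ n → + n / 1)) ×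
    (¬ IsForest H → BothSharp H (λ n → + n / 2))
theorem1 H = matching , cherries , forest , cyclic
  where
  matching : τ H ≡ 1 → 2 ≤ eH H → BothSharp H (λ n → + (n * n) / (2 * suc (eH H ∸ 2)))
  matching τ≡1 e≥2 = bothSharp H _
      (λ ε ε>0 ε<1 → random-matching H ¬cherry r r-eq (denominator ε) _ (λ n → floor-below ε ε>0 ε<1 (n * n) _))
      (λ ε ε>0 n → breaker-exhausts {r = r} H (few-edges n r _ (floor-above ε ε>0 (n * n) _)) (≤-reflexive (sym r-eq)))
    where
    -- As e(H) ≥ 2, this is e(H) - 1, and 2 r is the denominator of the threshold.
    r = suc (eH H ∸ 2)
    r-eq : eH H ≡ suc r
    r-eq = sym (m+[n∸m]≡n e≥2)
    ¬cherry : ¬ Cherry H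
    ¬cherry c = <⇒≱ ≤-refl (≤-trans (cherry⇒τ H c) (≤-reflexive τ≡1))
  cherries : τ H ≡ 2 → BothSharp H (λ n → + (2 * n) / 1)
  cherries τ≡2 = bothSharp H _
    (λ ε ε>0 ε<1 → random-cherries H (≤-reflexive τ≡2) (denominator ε) _ (λ n → floor-below ε ε>0 ε<1 (2 * n) 0))
    (λ ε ε>0 n → breaker-matching H (below (floor-above ε ε>0 (2 * n) 0)) (τ≥2⇒cherry H (≤-reflexive (sym τ≡2))))
  forest : IsForest H → 3 ≤ τ H → SharpThreshold CleverTo1 CleverTo0 H (λ n → + n / 1) × Threshold RandomTo1 RandomTo0 H (λ n → + n / 1)
  forest f τ≥3 =
    ((λ ε ε>0 ε<1 → CleverForest.clever-wins H f (τ-nonempty H (≤-trans (s≤s z≤n) τ≥3)) (suc (denominator ε)) (s≤s z≤n) _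
        (λ n → with-slack (denominator ε) _ n (≤-trans (≤-reflexive (cong (suc (denominator ε) *_) (sym (*-identityʳ _)))) (floor-below ε ε>0 ε<1 n 0)))) ,
     (λ ε ε>0 → breaker-clever H _ 0 (λ n _ → forest-breaker H f τ≥3 (below (floor-above ε ε>0 n 0))))) ,
    random-forest H ,
    (λ b large → let (N , l) = large 1ℚ in
      breaker-random H b N (λ n le → forest-breaker H f τ≥3 (ℕtoℚ-cancel (QP.≤-trans (QP.≤-reflexive (sym (QP.*-identityˡ (ℕtoℚ n)))) (l n le)))))
  cyclic : ¬ IsForest H → BothSharp H (λ n → + n / 2)
  cyclic ¬f = bothSharp H _
    (λ ε ε>0 ε<1 → DenseMaker.random-wins H (suc (denominator ε)) (s≤s z≤n) _ (λ n → with-slack (denominator ε) _ n (floor-below ε ε>0 ε<1 n 1)))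
    (λ ε ε>0 n → breaker-forest H (≤-trans (<⇒≤ (floor-above ε ε>0 n 1)) (≤-reflexive (*-comm _ 2))) ¬f)
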